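{- Let $\Sigma$ be an $n$-vertex signed bipartite graph that is controllable or almost controllable. Assume that the coefficient of the constant term (if $n$ is even) or of the linear term (if $n$ is odd) of $\chi(\Sigma;x)$ is $\pm 1$. If $2^{ -\lfloor n/2\rfloor}\sqrt{\Delta_{\Sigma}}$ is a squarefree integer, then $\Sigma$ is determined by its generalized spectrum (DGS).
   Context: A signed graph $\Sigma=(G,\sigma)$ is a simple graph $G$ with a map $\sigma:E(G)\to\{+1,-1\}$; its adjacency matrix $A(\Sigma)=(a_{ij})$ has $a_{ij}=\sigma(ij)$ if $i,j$ are adjacent and $0$ otherwise. $\chi(\Sigma;x)=\det(xI-A(\Sigma))$ is the characteristic polynomial and $\Delta_\Sigma$ is its discriminant, i.e. $\prod_{i<j}(\alpha_j-\alpha_i)^2$ over the roots $\alpha_i$ of $\chi(\Sigma;x)$. The walk matrix is $W(\Sigma)=[e,Ae,\dots,A^{n-1}e]$ with $e$ the all-ones vector and $A=A(\Sigma)$; $\Sigma$ is controllable if $\operatorname{rank}W(\Sigma)=n$ and almost controllable if $\operatorname{rank}W(\Sigma)=n-1$. Two signed graphs $\Sigma_1,\Sigma_2$ on $n$ vertices are generalized cospectral if $\det(xI-A(\Sigma_1))=\det(xI-A(\Sigma_2))$ and $\det(xI-(J-I-A(\Sigma_1)))=\det(xI-(J-I-A(\Sigma_2)))$, where $J$ is the all-ones matrix. $\Sigma$ is DGS if every signed graph generalized cospectral with $\Sigma$ is isomorphic to $\Sigma$. -}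

module Defs where

open import Data.Nat as ℕ using (ℕ; zero; suc; _≤ᵇ_; _∸_; _/_)
open import Data.Integer as ℤ using (ℤ; +_; -_; 0ℤ; 1ℤ; -1ℤ)
open import Data.Fin using (Fin; zero; suc; toℕ; punchIn)
open import Data.List using (List; []; _∷_; map)
open import Data.Bool using (Bool; true; false; if_then_else_)
open import Data.Product using (Σ; ∃; _×_; _,_)
open import Data.Sum using (_⊎_)
open import Relation.Binary.PropositionalEquality using (_≡_)
open import Relation.Nullary using (¬_)
open import Function.Bundles using (_↔_; Inverse)

data Adj : Set where
  none pos neg : Adj

record SignedGraph (n : ℕ) : Set where
  field
    adj   : Fin n → Fin n → Adj
    sym   : ∀ i j → adj i j ≡ adj j i
    irref : ∀ i → adj i i ≡ none
open SignedGraph public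

adjℤ : Adj → ℤ
adjℤ none = 0ℤ
adjℤ pos  = 1ℤ
adjℤ neg  = -1ℤ

A : ∀ {n} → SignedGraph n → Fin n → Fin n → ℤ
A Σ' i j = adjℤ (adj Σ' i j)

Acomp : ∀ {n} → SignedGraph n → Fin n → Fin n → ℤ
Acomp Σ' i j with toℕ i ℕ.≟ toℕ j
... | Relation.Nullary.yes _ = 0ℤ
... | Relation.Nullary.no _  = 1ℤ ℤ.- A Σ' i j
  where import Relation.Nullary

Bipartite : ∀ {n} → SignedGraph n → Set
Bipartite {n} Σ' = Σ (Fin n → Bool) λ c →
  ∀ i j → ¬ (adj Σ' i j ≡ none) → ¬ (c i ≡ c j)

Isomorphic : ∀ {n} → SignedGraph n → SignedGraph n → Set
Isomorphic {n} Σ₁ Σ₂ = Σ (Fin n ↔ Fin n) λ π →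
  ∀ i j → adj Σ₂ (Inverse.to π i) (Inverse.to π j) ≡ adj Σ₁ i j

record RingOps (R : Set) : Set where
  field
    r0 r1 : R
    radd rmul : R → R → R
    rneg : R → R

module Det {R : Set} (ops : RingOps R) where
  open RingOps ops

  sumFin : ∀ n → (Fin n → R) → R
  sumFin zero    f = r0
  sumFin (suc n) f = radd (f zero) (sumFin n (λ k → f (suc k)))

  sgn : ℕ → R → R
  sgn zero    x = x
  sgn (suc k) x = rneg (sgn k x)

  det : ∀ n → (Fin n → Fin n → R) → R
  det zero    M = r1
  det (suc n) M = sumFin (suc n) λ j →
    sgn (toℕ j) (rmul (M zero j) (det n (λ r c → M (suc r) (punchIn j c))))

ℤops : RingOps ℤ
ℤops = record { r0 = 0ℤ ; r1 = 1ℤ ; radd = ℤ._+_ ; rmul = ℤ._*_ ; rneg = -_ }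

detℤ : ∀ n → (Fin n → Fin n → ℤ) → ℤ
detℤ = Det.det ℤops

-- Polynomials over ℤ as coefficient lists (coefficient of x^i at index i)

Poly : Set
Poly = List ℤ

_+p_ : Poly → Poly → Poly
[]      +p q       = q
(a ∷ p) +p []      = a ∷ p
(a ∷ p) +p (b ∷ q) = (a ℤ.+ b) ∷ (p +p q)

scaleP : ℤ → Poly → Poly
scaleP a = map (a ℤ.*_)

_*p_ : Poly → Poly → Poly
[]      *p q = []
(a ∷ p) *p q = scaleP a q +p (0ℤ ∷ (p *p q))

negP : Poly → Poly
negP = map -_

coeff : Poly → ℕ → ℤ
coeff []      k       = 0ℤ
coeff (a ∷ p) zero    = a
coeff (a ∷ p) (suc k) = coeff p k

Polyops : RingOps Poly
Polyops = record { r0 = [] ; r1 = 1ℤ ∷ [] ; radd = _+p_ ; rmul = _*p_ ; rneg = negP }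

charPoly : ∀ n → (Fin n → Fin n → ℤ) → Poly
charPoly n M = Det.det Polyops n λ i j →
  if toℕ i ℕ.≡ᵇ toℕ j then (- M i j) ∷ 1ℤ ∷ [] else (- M i j) ∷ []

_≈p_ : Poly → Poly → Set
p ≈p q = ∀ k → coeff p k ≡ coeff q k

χ : ∀ {n} → SignedGraph n → Poly
χ {n} Σ' = charPoly n (A Σ')

-- Discriminant of a monic polynomial f of degree n:
--   Δ(f) = (-1)^{n(n-1)/2} Res(f, f'),
-- with Res given by the determinant of the Sylvester matrix.
-- (For monic f this equals ∏_{i<j} (α_j - α_i)^2 over the roots α_i.)

sylvester : (f : Poly) (d : ℕ) (g : Poly) (m : ℕ) →
            Fin (m ℕ.+ d) → Fin (m ℕ.+ d) → ℤ
sylvester f d g m r c =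
  if toℕ r ℕ.<ᵇ m
  then band f d (toℕ r) (toℕ c)
  else band g m (toℕ r ∸ m) (toℕ c)
  where
    -- row i carries coefficients p_deg, ..., p_0 starting at column i
    band : Poly → ℕ → ℕ → ℕ → ℤ
    band p deg i j =
      if (i ≤ᵇ j) Data.Bool.∧ (j ≤ᵇ i ℕ.+ deg)
      then coeff p (deg ∸ (j ∸ i)) else 0ℤ

derivP : Poly → Poly
derivP p = go 1 (dropHead p)
  where
    dropHead : Poly → Poly
    dropHead []      = []
    dropHead (_ ∷ q) = q
    go : ℕ → Poly → Poly
    go k []      = []
    go k (a ∷ q) = ((+ k) ℤ.* a) ∷ go (suc k) q

signPow : ℕ → ℤ
signPow zero    = 1ℤ
signPow (suc k) = - signPow k

discriminant : (f : Poly) (n : ℕ) → ℤ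
discriminant f n =
  signPow ((n ℕ.* (n ∸ 1)) / 2) ℤ.*
  detℤ ((n ∸ 1) ℕ.+ n) (sylvester f n (derivP f) (n ∸ 1))

Δ : ∀ {n} → SignedGraph n → ℤ
Δ {n} Σ' = discriminant (χ Σ') n

mulMV : ∀ {n} → (Fin n → Fin n → ℤ) → (Fin n → ℤ) → Fin n → ℤ
mulMV {n} M v i = Det.sumFin ℤops n λ j → M i j ℤ.* v j

powApply : ∀ {n} → ℕ → (Fin n → Fin n → ℤ) → (Fin n → ℤ) → Fin n → ℤ
powApply zero    M v = v
powApply (suc k) M v = mulMV M (powApply k M v)

W : ∀ {n} → SignedGraph n → Fin n → Fin n → ℤ
W Σ' i k = powApply (toℕ k) (A Σ') (λ _ → 1ℤ) i

-- rank via determinantal rank (the matrix is square n × n)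
-- rank W = n
Controllable : ∀ {n} → SignedGraph n → Set
Controllable {n} Σ' = ¬ (detℤ n (W Σ') ≡ 0ℤ)

-- rank W = n - 1 : det W = 0 and some (n-1)×(n-1) minor is nonzero
AlmostControllable : ∀ {n} → SignedGraph n → Set
AlmostControllable {zero}  Σ' = Data.Empty.⊥
  where import Data.Empty
AlmostControllable {suc m} Σ' =
  (detℤ (suc m) (W Σ') ≡ 0ℤ) ×
  Σ (Fin (suc m)) λ i → Σ (Fin (suc m)) λ j →
    ¬ (detℤ m (λ r c → W Σ' (punchIn i r) (punchIn j c)) ≡ 0ℤ)

GenCospectral : ∀ {n} → SignedGraph n → SignedGraph n → Set
GenCospectral {n} Σ₁ Σ₂ =
  (charPoly n (A Σ₁) ≈p charPoly n (A Σ₂)) ×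
  (charPoly n (Acomp Σ₁) ≈p charPoly n (Acomp Σ₂))

DGS : ∀ {n} → SignedGraph n → Set
DGS {n} Σ₁ = ∀ (Σ₂ : SignedGraph n) → GenCospectral Σ₁ Σ₂ → Isomorphic Σ₁ Σ₂

-- squarefree natural number (excludes 0, since 2·2 ∣ 0)
Squarefree : ℕ → Set
Squarefree m = ∀ d → d ℕ.* d Data.Nat.Divisibility.∣ m → d ≡ 1
  where import Data.Nat.Divisibility

-- 2^{-⌊n/2⌋} √Δ is a squarefree integer:
-- Δ = (2^{⌊n/2⌋} m)^2 for some squarefree m (√Δ ≥ 0, so m ≥ 0)
ScaledSqrtDiscSquarefree : ∀ {n} → SignedGraph n → Set
ScaledSqrtDiscSquarefree {n} Σ' = Σ ℕ λ m →
  Squarefree m × (Δ Σ' ≡ + ((2 ℕ.^ (n / 2) ℕ.* m) ℕ.^ 2))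

lowCoeff : ∀ {n} → SignedGraph n → ℤ
lowCoeff {n} Σ' = coeff (χ Σ') (n ℕ.% 2)

IsUnit : ℤ → Set
IsUnit a = (a ≡ 1ℤ) ⊎ (a ≡ -1ℤ)

{-# OPTIONS --safe #-}
-- Walk counts are generalized spectral invariants, so a graph Σ₂ generalized cospectral with Σ yields an integer
-- matrix Q and a level ℓ with QᵀQ = ℓ²I, QᵀAQ = ℓ²A₂ and Q𝟙 = ℓ𝟙; for ℓ = 1 this is a permutation matrix.  In the
-- almost controllable case the walk matrix is completed by the vector of its cofactors.  The level can be divided
-- by a prime q as soon as every column u of Q vanishes modulo q, and uᵀAᵏu ≡ 0 modulo q² for all k.
--
-- If n is odd, the hypothesis on the linear term forces an isolated vertex, which is deleted; so let A be bipartite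
-- and unimodular, χ(x) = P(x²), χ′(A) = 2K with K = A P′(A²).  Then Δ = ± det χ′(A) = ± 2ⁿ det K, hence |det K| is the
-- square of a squarefree number and it suffices that a u which does not vanish modulo q makes q⁴ divide det K.
-- Isotropy of u modulo q gives χ′(A)u ≡ 0: as χ(A + q u uᵀ) ≡ 0 modulo q², the derivative Σ Aᵏu (χₖ₊₁(A)u)ᵀ of χ in the
-- direction u uᵀ vanishes modulo q, and a generalised inverse of the Krylov matrix contracts it to χ′(A)u.
-- For odd q the two parts of u under the bipartition, on which the form K vanishes modulo q², give the factor q⁴.
-- For q = 2 one first finds in one part an isotropic vector for A², and then uses that P′ is a square modulo 2.
module Submission where

open import Defs hiding (sym)
open import Data.Nat as ℕ using (ℕ; zero; suc; s≤s; z≤n)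
import Data.Nat.Properties as ℕₚ
open import Data.Integer as ℤ using (ℤ; -_; _+_; _*_; _-_; 0ℤ; 1ℤ; -1ℤ; ∣_∣; -[1+_]) renaming (+_ to int)
import Data.Integer.Properties as ℤₚ
open import Data.Integer.Tactic.RingSolver using (solve-∀)
open import Data.Fin as Fin using (Fin; zero; suc; toℕ; punchIn; punchOut; inject₁; fromℕ; splitAt; _↑ˡ_; _↑ʳ_; _≟_)
import Data.Fin.Properties as Finₚ
open import Data.Vec.Functional using (updateAt; insertAt) renaming (_∷_ to _◂_)
open import Data.Vec.Functional.Properties using (updateAt-updates; updateAt-minimal; insertAt-lookup; insertAt-punchIn)
open import Data.List using ([]; _∷_; length; drop)
open import Data.Bool using (Bool; true; false; not; if_then_else_; _∧_)
open import Data.Product using (Σ; _×_; _,_; proj₁; proj₂)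
open import Data.Sum using (_⊎_; inj₁; inj₂)
open import Data.Empty using (⊥; ⊥-elim)
open import Function using (_∘_; const; id)
open import Relation.Nullary using (¬_; Dec; yes; no)
open import Relation.Nullary.Negation using (contradiction)
open import Relation.Binary.PropositionalEquality using (_≡_; _≢_; refl; sym; trans; cong; cong₂; subst; subst₂; _≗_; module ≡-Reasoning)
open import Relation.Binary.Definitions using (tri<; tri≈; tri>)
open import Data.Nat.Divisibility as ℕᵈ using (divides)
open import Data.Integer.Divisibility.Signed as ℤᵈ using (divides)
open import Data.Nat.Primality using (Prime; prime⇒irreducible; prime⇒nonZero; prime⇒nonTrivial; euclidsLemma; prime[2])
open import Data.Nat.Coprimality using (Coprime; coprime-Bézout)
open import Data.Nat.GCD using (module Bézout)
import Data.Bool.Properties as Boolₚ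
open import Data.Nat.DivMod using (m≡m%n+[m/n]*n; m%n<n)
open import Data.Nat.ListAction using () renaming (product to productℕ)
open import Data.List.Relation.Unary.All using (All; []; _∷_)
open import Data.Nat.Primality.Factorisation using (PrimeFactorisation; factorise)
open import Function.Bundles using (mk↔ₛ′)

-- Finite sums and congruences

-- The square shapes the whole argument. As |det K| = m² with m squarefree, q² may well divide det
-- K, and a single kernel vector of K modulo q contradicts nothing; a second, independent one is
-- needed. The bipartition supplies it: K exchanges the two parts, so both halves of u lie in its
-- kernel modulo q, each half is orthogonal to its own image, and only the mixed value has to be
-- controlled. That is why isotropy is required modulo q² and not just modulo q. The argument
-- cancels the factors 2 in χ′ = 2K and 4 in uᵀχ′u = 4 tᵀKf. At q = 2 the congruence χ′(A)u ≡ 0 is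
-- empty, so there the derivative is taken of P at A², with both new vectors generated from one part
-- of u. Everything stays in ℤ. Kernels modulo q are congruences, inverses are adjugates, polynomial
-- identities are checked by evaluation at positive integers, and identities that are easy only for
-- generic matrices are carried over to all matrices by congruences modulo every k. Eigenvalues
-- never appear; the discriminant enters only as a Sylvester determinant.

Vect : ℕ → Set
Vect n = Fin n → ℤ

Mat : ℕ → Set
Mat n = Fin n → Fin n → ℤ

-- Opaque so that sums, and likewise determinants below, stay closed terms during conversion; they
-- are accessed only through the equations given here.
opaque
  ∑ : ∀ {n} → Vect n → ℤ
  ∑ {n} = Det.sumFin ℤops n

  ∑-sumFin : ∀ {n} {f : Vect n} → ∑ f ≡ Det.sumFin ℤops n f
  ∑-sumFin = refl

  ∑-nil : ∀ {f : Vect 0} → ∑ f ≡ 0ℤ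
  ∑-nil = refl

  ∑-suc : ∀ {n} {f : Vect (suc n)} → ∑ f ≡ f zero + ∑ (f ∘ suc)
  ∑-suc = refl

∑-cong : ∀ {n} {f g : Vect n} → f ≗ g → ∑ f ≡ ∑ g
∑-cong {zero}  h = trans ∑-nil (sym ∑-nil)
∑-cong {suc n} h = trans ∑-suc (trans (cong₂ _+_ (h zero) (∑-cong (h ∘ suc))) (sym ∑-suc))

∑-0 : ∀ {n} {f : Vect n} → (∀ i → f i ≡ 0ℤ) → ∑ f ≡ 0ℤ
∑-0 {zero}  h = ∑-nil
∑-0 {suc n} h = trans ∑-suc (cong₂ _+_ (h zero) (∑-0 (h ∘ suc)))

interchange : ∀ a b c d → (a + b) + (c + d) ≡ (a + c) + (b + d)
interchange = solve-∀

∑-+ : ∀ {n} (f g : Vect n) → ∑ (λ i → f i + g i) ≡ ∑ f + ∑ g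
∑-+ {zero}  f g rewrite ∑-nil {f} | ∑-nil {g} = ∑-nil
∑-+ {suc n} f g rewrite ∑-suc {f = f} | ∑-suc {f = g} =
  trans ∑-suc (trans (cong (f zero + g zero +_) (∑-+ (f ∘ suc) (g ∘ suc))) (interchange (f zero) (g zero) (∑ (f ∘ suc)) (∑ (g ∘ suc))))

∑-*ˡ : ∀ {n} c (f : Vect n) → ∑ (λ i → c * f i) ≡ c * ∑ f
∑-*ˡ {zero}  c f rewrite ∑-nil {f} = trans ∑-nil (sym (ℤₚ.*-zeroʳ c))
∑-*ˡ {suc n} c f rewrite ∑-suc {f = f} =
  trans ∑-suc (trans (cong (c * f zero +_) (∑-*ˡ c (f ∘ suc))) (sym (ℤₚ.*-distribˡ-+ c (f zero) (∑ (f ∘ suc)))))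

∑-*ʳ : ∀ {n} c (f : Vect n) → ∑ (λ i → f i * c) ≡ ∑ f * c
∑-*ʳ c f = trans (∑-cong (λ i → ℤₚ.*-comm (f i) c)) (trans (∑-*ˡ c f) (ℤₚ.*-comm c (∑ f)))

∑-lin : ∀ {n} x y (f g : Vect n) → ∑ (λ i → x * f i + y * g i) ≡ x * ∑ f + y * ∑ g
∑-lin x y f g = trans (∑-+ (λ i → x * f i) (λ i → y * g i)) (cong₂ _+_ (∑-*ˡ x f) (∑-*ˡ y g))

∑-swap : ∀ {m n} (f : Fin m → Fin n → ℤ) → ∑ (λ i → ∑ (f i)) ≡ ∑ (λ j → ∑ (λ i → f i j))
∑-swap {zero}  f = trans ∑-nil (sym (∑-0 (λ _ → ∑-nil)))
∑-swap {suc m} f =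
  trans ∑-suc (trans (cong (∑ (f zero) +_) (∑-swap (λ i → f (suc i))))
    (trans (sym (∑-+ (f zero) (λ j → ∑ (λ i → f (suc i) j)))) (∑-cong (λ j → sym ∑-suc))))

δ : ∀ {m n} → Fin m → Fin n → ℤ
δ zero    zero    = 1ℤ
δ zero    (suc j) = 0ℤ
δ (suc i) zero    = 0ℤ
δ (suc i) (suc j) = δ i j

δ-refl : ∀ {n} (i : Fin n) → δ i i ≡ 1ℤ
δ-refl zero    = refl
δ-refl (suc i) = δ-refl i

δ-≢ : ∀ {n} {i j : Fin n} → i ≢ j → δ i j ≡ 0ℤ
δ-≢ {i = zero}  {zero}  h = contradiction refl h
δ-≢ {i = zero}  {suc j} h = refl
δ-≢ {i = suc i} {zero}  h = refl
δ-≢ {i = suc i} {suc j} h = δ-≢ (h ∘ cong suc)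

δ-sym : ∀ {m n} (i : Fin m) (j : Fin n) → δ i j ≡ δ j i
δ-sym zero    zero    = refl
δ-sym zero    (suc j) = refl
δ-sym (suc i) zero    = refl
δ-sym (suc i) (suc j) = δ-sym i j

∑-δˡ : ∀ {n} (j : Fin n) (f : Vect n) → ∑ (λ i → δ j i * f i) ≡ f j
∑-δˡ zero f = trans ∑-suc (trans (cong₂ _+_ (ℤₚ.*-identityˡ (f zero)) (∑-0 (λ i → ℤₚ.*-zeroˡ (f (suc i))))) (ℤₚ.+-identityʳ (f zero)))
∑-δˡ (suc j) f = trans ∑-suc (trans (cong₂ _+_ (ℤₚ.*-zeroˡ (f zero)) (∑-δˡ j (f ∘ suc))) (ℤₚ.+-identityˡ (f (suc j))))

∑-δʳ : ∀ {n} (j : Fin n) (f : Vect n) → ∑ (λ i → f i * δ i j) ≡ f j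
∑-δʳ j f = trans (∑-cong (λ i → trans (ℤₚ.*-comm (f i) (δ i j)) (cong (_* f i) (δ-sym i j)))) (∑-δˡ j f)

∑-single : ∀ {n} (j : Fin n) (f : Vect n) → (∀ i → i ≢ j → f i ≡ 0ℤ) → ∑ f ≡ f j
∑-single j f h = trans (∑-cong (λ i → eq i)) (∑-δˡ j f)
  where
  eq : ∀ i → f i ≡ δ j i * f i
  eq i with i ≟ j
  ... | yes refl rewrite δ-refl i = sym (ℤₚ.*-identityˡ (f j))
  ... | no i≢j rewrite h i i≢j = sym (ℤₚ.*-zeroʳ (δ j i))

signPow-+ : ∀ m n → signPow (m ℕ.+ n) ≡ signPow m * signPow n
signPow-+ zero    n = sym (ℤₚ.*-identityˡ (signPow n))
signPow-+ (suc m) n = trans (cong -_ (signPow-+ m n)) (ℤₚ.neg-distribˡ-* (signPow m) (signPow n))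

signPow-sq : ∀ n → signPow n * signPow n ≡ 1ℤ
signPow-sq zero    = refl
signPow-sq (suc n) = trans (h (signPow n)) (signPow-sq n)
  where
  h : ∀ a → - a * - a ≡ a * a
  h = solve-∀

sgn≡ : ∀ k x → Det.sgn ℤops k x ≡ signPow k * x
sgn≡ zero    x = sym (ℤₚ.*-identityˡ x)
sgn≡ (suc k) x = trans (cong -_ (sgn≡ k x)) (ℤₚ.neg-distribˡ-* (signPow k) x)

minor : ∀ {n} → Mat (suc n) → Fin (suc n) → Fin (suc n) → Mat n
minor M i j r c = M (punchIn i r) (punchIn j c)


infix 4 _≡_[mod_]
-- The quotient is kept as data because it later serves as a matrix entry (`L` in `det-divisible`,
-- `Q'` in `divide`). The modulus is any integer; modulus 0 is equality, so congruence lemmas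
-- specialise to identities by `mod0⇒≡`.
record _≡_[mod_] (a b N : ℤ) : Set where
  constructor wit
  field
    quot : ℤ
    rel  : a ≡ b + quot * N

≡⇒mod : ∀ {N a b} → a ≡ b → a ≡ b [mod N ]
≡⇒mod {N} {a} refl = wit 0ℤ (h a N)
  where
  h : ∀ a N → a ≡ a + 0ℤ * N
  h = solve-∀

mod-refl : ∀ {N a} → a ≡ a [mod N ]
mod-refl = ≡⇒mod refl

mod-sym : ∀ {N a b} → a ≡ b [mod N ] → b ≡ a [mod N ]
mod-sym {N} {b = b} (wit k refl) = wit (- k) (h b k N)
  where
  h : ∀ b k N → b ≡ (b + k * N) + - k * N
  h = solve-∀

mod-trans : ∀ {N a b c} → a ≡ b [mod N ] → b ≡ c [mod N ] → a ≡ c [mod N ]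
mod-trans {N} {c = c} (wit k refl) (wit l refl) = wit (k + l) (h c k l N)
  where
  h : ∀ c k l N → (c + l * N) + k * N ≡ c + (k + l) * N
  h = solve-∀

mod-+ : ∀ {N a b c d} → a ≡ b [mod N ] → c ≡ d [mod N ] → a + c ≡ b + d [mod N ]
mod-+ {N} {b = b} {d = d} (wit k refl) (wit l refl) = wit (k + l) (h b d k l N)
  where
  h : ∀ b d k l N → (b + k * N) + (d + l * N) ≡ (b + d) + (k + l) * N
  h = solve-∀

mod-* : ∀ {N a b c d} → a ≡ b [mod N ] → c ≡ d [mod N ] → a * c ≡ b * d [mod N ]
mod-* {N} {b = b} {d = d} (wit k refl) (wit l refl) = wit (k * d + b * l + k * l * N) (h b d k l N)
  where
  h : ∀ b d k l N → (b + k * N) * (d + l * N) ≡ b * d + (k * d + b * l + k * l * N) * N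
  h = solve-∀

mod-neg : ∀ {N a b} → a ≡ b [mod N ] → - a ≡ - b [mod N ]
mod-neg {N} {b = b} (wit k refl) = wit (- k) (h b k N)
  where
  h : ∀ b k N → - (b + k * N) ≡ - b + - k * N
  h = solve-∀

mod-- : ∀ {N a b c d} → a ≡ b [mod N ] → c ≡ d [mod N ] → a - c ≡ b - d [mod N ]
mod-- p q = mod-+ p (mod-neg q)

mod-*ˡ : ∀ {N b d} c → b ≡ d [mod N ] → c * b ≡ c * d [mod N ]
mod-*ˡ c = mod-* (mod-refl {a = c})

mod-*0 : ∀ {N b} c → b ≡ 0ℤ [mod N ] → c * b ≡ 0ℤ [mod N ]
mod-*0 {N} {b} c h = subst (λ z → c * b ≡ z [mod N ]) (ℤₚ.*-zeroʳ c) (mod-*ˡ c h)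

mod-+0 : ∀ {N a b} → a ≡ 0ℤ [mod N ] → b ≡ 0ℤ [mod N ] → a + b ≡ 0ℤ [mod N ]
mod-+0 p q = mod-+ p q

mod-cong₂ : ∀ {N a b c d} → a ≡ b → c ≡ d → b ≡ d [mod N ] → a ≡ c [mod N ]
mod-cong₂ refl refl h = h

mod-weaken : ∀ {N a b} c → a ≡ b [mod c * N ] → a ≡ b [mod N ]
mod-weaken {N} {b = b} c (wit k refl) = wit (k * c) (h b k c N)
  where
  h : ∀ b k c N → b + k * (c * N) ≡ b + k * c * N
  h = solve-∀

∑-mod : ∀ {N n} {f g : Vect n} → (∀ i → f i ≡ g i [mod N ]) → ∑ f ≡ ∑ g [mod N ]
∑-mod {n = zero}  h = mod-cong₂ ∑-nil ∑-nil mod-refl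
∑-mod {n = suc n} h = mod-cong₂ ∑-suc ∑-suc (mod-+ (h zero) (∑-mod (h ∘ suc)))

∑-mod0 : ∀ {N n} {f : Vect n} → (∀ i → f i ≡ 0ℤ [mod N ]) → ∑ f ≡ 0ℤ [mod N ]
∑-mod0 h = mod-trans (∑-mod h) (≡⇒mod (∑-0 {f = λ _ → 0ℤ} (λ _ → refl)))

-- Alternating multilinear forms

Rows : ℕ → ℕ → Set
Rows n m = Fin n → Vect m

infix 4 _≈_ _≈[_]_
_≈_ : ∀ {n m} → Rows n m → Rows n m → Set
M ≈ N = ∀ i j → M i j ≡ N i j

_≈[_]_ : ∀ {n m} → Rows n m → Fin n → Rows n m → Set
M ≈[ i ] N = ∀ a → a ≢ i → M a ≗ N a

infixl 9 _[_≔_]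
_[_≔_] : ∀ {n m} → Rows n m → Fin n → Vect m → Rows n m
M [ i ≔ v ] = updateAt M i (const v)

upd-at : ∀ {n m} (M : Rows n m) i v k → (M [ i ≔ v ]) i k ≡ v k
upd-at M i v k = cong (λ x → x k) (updateAt-updates i M)

upd-off : ∀ {n m} (M : Rows n m) i v → M [ i ≔ v ] ≈[ i ] M
upd-off M i v a a≢i k = cong (λ x → x k) (updateAt-minimal a i M a≢i)

upd-id : ∀ {n m} (M : Rows n m) i {v} → M i ≗ v → M [ i ≔ v ] ≈ M
upd-id M i h a k with a ≟ i
... | yes refl = trans (upd-at M i _ k) (sym (h k))
... | no a≢i = upd-off M i _ a a≢i k

-- Matrices are functions without extensionality, hence the field `congruent`, and hence `linear`
-- relates three matrices agreeing away from row i instead of speaking of one matrix with a row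
-- overwritten.
record Multilinear {n m} (D : Rows n m → ℤ) : Set where
  field
    congruent : ∀ {M N} → M ≈ N → D M ≡ D N
    linear    : ∀ i x y {M N P} → N ≈[ i ] M → P ≈[ i ] M →
                (∀ k → M i k ≡ x * N i k + y * P i k) → D M ≡ x * D N + y * D P

record Alternating {n m} (D : Rows n m → ℤ) : Set where
  field
    multilinear : Multilinear D
    alternate   : ∀ {i j} M → i ≢ j → M i ≗ M j → D M ≡ 0ℤ
  open Multilinear multilinear public

module _ {n m} {D : Rows n m → ℤ} (ml : Multilinear D) where
  open Multilinear ml

  linear-≔ : ∀ i x y u v M → D (M [ i ≔ (λ k → x * u k + y * v k) ]) ≡ x * D (M [ i ≔ u ]) + y * D (M [ i ≔ v ])
  linear-≔ i x y u v M = linear i x y (off u) (off v)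
    (λ k → trans (upd-at M i _ k) (sym (cong₂ (λ a b → x * a + y * b) (upd-at M i u k) (upd-at M i v k))))
    where
    off : ∀ w → M [ i ≔ w ] ≈[ i ] M [ i ≔ (λ k → x * u k + y * v k) ]
    off w a a≢i k = trans (upd-off M i w a a≢i k) (sym (upd-off M i _ a a≢i k))

  add-≔ : ∀ i u v M → D (M [ i ≔ (λ k → u k + v k) ]) ≡ D (M [ i ≔ u ]) + D (M [ i ≔ v ])
  add-≔ i u v M = trans (congruent eq) (trans (linear-≔ i 1ℤ 1ℤ u v M) (cong₂ _+_ (ℤₚ.*-identityˡ (D (M [ i ≔ u ]))) (ℤₚ.*-identityˡ (D (M [ i ≔ v ])))))
    where
    eq : M [ i ≔ (λ k → u k + v k) ] ≈ M [ i ≔ (λ k → 1ℤ * u k + 1ℤ * v k) ]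
    eq a k with a ≟ i
    ... | yes refl = trans (upd-at M i _ k) (trans (sym (cong₂ _+_ (ℤₚ.*-identityˡ (u k)) (ℤₚ.*-identityˡ (v k)))) (sym (upd-at M i _ k)))
    ... | no a≢i = trans (upd-off M i _ a a≢i k) (sym (upd-off M i _ a a≢i k))

  cong-≔ : ∀ i {u v} M → u ≗ v → D (M [ i ≔ u ]) ≡ D (M [ i ≔ v ])
  cong-≔ i {u} {v} M h = congruent eq
    where
    eq : M [ i ≔ u ] ≈ M [ i ≔ v ]
    eq a k with a ≟ i
    ... | yes refl = trans (upd-at M i _ k) (trans (h k) (sym (upd-at M i _ k)))
    ... | no a≢i = trans (upd-off M i _ a a≢i k) (sym (upd-off M i _ a a≢i k))

  zero-≔ : ∀ i M → D (M [ i ≔ (λ _ → 0ℤ) ]) ≡ 0ℤ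
  zero-≔ i M = trans (linear-≔ i 0ℤ 0ℤ (λ _ → 0ℤ) (λ _ → 0ℤ) M) (h (D (M [ i ≔ (λ _ → 0ℤ) ])) (D (M [ i ≔ (λ _ → 0ℤ) ])))
    where
    h : ∀ a b → 0ℤ * a + 0ℤ * b ≡ 0ℤ
    h = solve-∀

  scale-≔ : ∀ i x u M → D (M [ i ≔ (λ k → x * u k) ]) ≡ x * D (M [ i ≔ u ])
  scale-≔ i x u M = trans (cong-≔ i M (λ k → h x (u k))) (trans (linear-≔ i x 0ℤ u u M) (g x (D (M [ i ≔ u ]))))
    where
    h : ∀ x a → x * a ≡ x * a + 0ℤ * a
    h = solve-∀
    g : ∀ x a → x * a + 0ℤ * a ≡ x * a
    g = solve-∀

  sum-≔ : ∀ {l} i (x : Vect l) (u : Rows l m) M →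
          D (M [ i ≔ (λ k → ∑ (λ j → x j * u j k)) ]) ≡ ∑ (λ j → x j * D (M [ i ≔ u j ]))
  sum-≔ {zero}  i x u M = trans (trans (cong-≔ i M (λ k → ∑-nil)) (zero-≔ i M)) (sym ∑-nil)
  sum-≔ {suc l} i x u M =
    trans (cong-≔ i M (λ k → trans ∑-suc (cong (x zero * u zero k +_) (sym (ℤₚ.*-identityˡ (tl k))))))
      (trans (linear-≔ i (x zero) 1ℤ (u zero) tl M)
        (trans (cong (x zero * D (M [ i ≔ u zero ]) +_) (trans (ℤₚ.*-identityˡ (D (M [ i ≔ tl ]))) (sum-≔ i (x ∘ suc) (u ∘ suc) M))) (sym ∑-suc)))
    where
    tl : Vect m
    tl k = ∑ (λ j → x (suc j) * u (suc j) k)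

head-cong : ∀ {n m} (v : Vect m) {R S : Rows n m} → R ≈ S → (v ◂ R) ≈ (v ◂ S)
head-cong v h zero    k = refl
head-cong v h (suc i) k = h i k

head-off : ∀ {n m} (v : Vect m) {R S : Rows n m} i → R ≈[ i ] S → (v ◂ R) ≈[ suc i ] (v ◂ S)
head-off v i h zero    a≢i k = refl
head-off v i h (suc a) a≢i k = h a (λ e → a≢i (cong suc e)) k

fixHead-multi : ∀ {n m} {D : Rows (suc n) m → ℤ} (v : Vect m) → Multilinear D → Multilinear (λ R → D (v ◂ R))
fixHead-multi v ml = record
  { congruent = λ h → congruent (head-cong v h)
  ; linear = λ i x y p q h → linear (suc i) x y (head-off v i p) (head-off v i q) h }
  where open Multilinear ml

fixHead : ∀ {n m} {D : Rows (suc n) m → ℤ} (v : Vect m) → Alternating D → Alternating (λ R → D (v ◂ R))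
fixHead v alt = record
  { multilinear = fixHead-multi v multilinear
  ; alternate = λ {i} {j} R i≢j h → alternate (v ◂ R) (λ e → i≢j (Finₚ.suc-injective e)) h }
  where open Alternating alt

module _ {n m} {D : Rows (suc n) m → ℤ} (ml : Multilinear D) where
  open Multilinear ml

  head≔ : ∀ (M : Rows (suc n) m) v → D (M [ zero ≔ v ]) ≡ D (v ◂ (M ∘ suc))
  head≔ M v = congruent (λ { zero k → refl ; (suc i) k → refl })

  head-η : ∀ (M : Rows (suc n) m) → D M ≡ D (M zero ◂ (M ∘ suc))
  head-η M = congruent (λ { zero k → refl ; (suc i) k → refl })

  head-add : ∀ u v (R : Rows n m) → D ((λ k → u k + v k) ◂ R) ≡ D (u ◂ R) + D (v ◂ R)
  head-add u v R = trans (sym (head≔ (u ◂ R) _)) (trans (add-≔ ml zero u v (u ◂ R)) (cong₂ _+_ (head≔ (u ◂ R) u) (head≔ (u ◂ R) v)))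

  head-scale : ∀ x u (R : Rows n m) → D ((λ k → x * u k) ◂ R) ≡ x * D (u ◂ R)
  head-scale x u R = trans (sym (head≔ (u ◂ R) _)) (trans (scale-≔ ml zero x u (u ◂ R)) (cong (x *_) (head≔ (u ◂ R) u)))

  head-sum : ∀ {l} (x : Vect l) (u : Rows l m) (R : Rows n m) →
             D ((λ k → ∑ (λ j → x j * u j k)) ◂ R) ≡ ∑ (λ j → x j * D (u j ◂ R))
  head-sum x u R = trans (sym (head≔ ((λ _ → 0ℤ) ◂ R) _)) (trans (sum-≔ ml zero x u ((λ _ → 0ℤ) ◂ R)) (∑-cong (λ j → cong (x j *_) (head≔ ((λ _ → 0ℤ) ◂ R) (u j)))))

-- One row at a time: linearity splits off b₀ F(v, ...), which vanishes, and the form with its head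
-- row fixed inherits the vanishing property.
absorb : ∀ {n m} {F : Rows n m → ℤ} → Multilinear F → ∀ v → (∀ M i → M i ≗ v → F M ≡ 0ℤ) →
         ∀ (M N : Rows n m) (b : Vect n) → (∀ a k → N a k ≡ M a k + b a * v k) → F N ≡ F M
absorb {zero} ml v vanish M N b h = Multilinear.congruent ml (λ ())
absorb {suc n} {F = F} ml v vanish M N b h = begin
  F N                                                       ≡⟨ head-η ml N ⟩
  F (N zero ◂ (N ∘ suc))                                    ≡⟨ Multilinear.congruent ml (λ { zero k → h zero k ; (suc i) k → refl }) ⟩
  F ((λ k → M zero k + b zero * v k) ◂ (N ∘ suc))           ≡⟨ head-add ml (M zero) (λ k → b zero * v k) (N ∘ suc) ⟩
  F (M zero ◂ (N ∘ suc)) + F ((λ k → b zero * v k) ◂ (N ∘ suc)) ≡⟨ cong (F (M zero ◂ (N ∘ suc)) +_) (head-scale ml (b zero) v (N ∘ suc)) ⟩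
  F (M zero ◂ (N ∘ suc)) + b zero * F (v ◂ (N ∘ suc))       ≡⟨ cong (λ z → F (M zero ◂ (N ∘ suc)) + b zero * z) (vanish _ zero (λ _ → refl)) ⟩
  F (M zero ◂ (N ∘ suc)) + b zero * 0ℤ                      ≡⟨ g (F (M zero ◂ (N ∘ suc))) (b zero) ⟩
  F (M zero ◂ (N ∘ suc))                                    ≡⟨ absorb (fixHead-multi (M zero) ml) v (λ R i e → vanish _ (suc i) e) (M ∘ suc) (N ∘ suc) (b ∘ suc) (λ a → h (suc a)) ⟩
  F (M zero ◂ (M ∘ suc))                                    ≡⟨ sym (head-η ml M) ⟩
  F M ∎
  where
  open ≡-Reasoning
  g : ∀ a b → a + b * 0ℤ ≡ a
  g = solve-∀

absorb-head : ∀ {n m} {D : Rows (suc n) m → ℤ} → Alternating D → ∀ v (R S : Rows n m) (b : Vect n) →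
              (∀ a k → S a k ≡ R a k + b a * v k) → D (v ◂ S) ≡ D (v ◂ R)
absorb-head alt v R S b h =
  absorb (fixHead-multi v multilinear) v (λ M i e → alternate {zero} {suc i} (v ◂ M) (λ ()) (λ k → sym (e k))) R S b h
  where open Alternating alt

module _ {n m} {D : Rows n m → ℤ} (ml : Multilinear D) where
  open Multilinear ml

  ≔≔-self : ∀ i j M {u v} → M i ≗ u → M j ≗ v → D M ≡ D (M [ i ≔ u ] [ j ≔ v ])
  ≔≔-self i j M {u} {v} hu hv = sym (congruent eq)
    where
    eq : (M [ i ≔ u ] [ j ≔ v ]) ≈ M
    eq a k with a ≟ j
    ... | yes refl = trans (upd-at (M [ i ≔ u ]) a v k) (sym (hv k))
    ... | no a≢j = trans (upd-off (M [ i ≔ u ]) j v a a≢j k) (upd-id M i hu a k)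

  -- Bilinear expansion of D(…,u+v,…,u+v,…) = 0.
  swap-rows : ∀ {i j} → i ≢ j → (∀ M → M i ≗ M j → D M ≡ 0ℤ) →
              ∀ M N → N i ≗ M j → N j ≗ M i → (∀ a → a ≢ i → a ≢ j → N a ≗ M a) → D N ≡ - D M
  swap-rows {i} {j} i≢j alt M N hi hj hoff = solveFor (begin
    D M + D N                                            ≡⟨ cong₂ _+_ (≔≔-self i j M (λ _ → refl) (λ _ → refl)) eqN ⟩
    E u v + E v u                                        ≡⟨ h (E u u) (E u v) (E v u) (E v v) (e≡ u) (e≡ v) ⟩
    (E u u + E u v) + (E v u + E v v)                    ≡⟨ sym (cong₂ _+_ (add-≔ ml j u v (M [ i ≔ u ])) (add-≔ ml j u v (M [ i ≔ v ]))) ⟩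
    E u w + E v w                                        ≡⟨ cong₂ _+_ (comm u w) (comm v w) ⟩
    D (M [ j ≔ w ] [ i ≔ u ]) + D (M [ j ≔ w ] [ i ≔ v ]) ≡⟨ sym (add-≔ ml i u v (M [ j ≔ w ])) ⟩
    D (M [ j ≔ w ] [ i ≔ w ])                            ≡⟨ sym (comm w w) ⟩
    E w w                                                ≡⟨ e≡ w ⟩
    0ℤ ∎)
    where
    open ≡-Reasoning
    u = M i
    v = M j
    w : Vect m
    w k = u k + v k
    E : Vect m → Vect m → ℤ
    E x y = D (M [ i ≔ x ] [ j ≔ y ])
    at-i : ∀ x y k → (M [ i ≔ x ] [ j ≔ y ]) i k ≡ x k
    at-i x y k = trans (upd-off (M [ i ≔ x ]) j y i i≢j k) (upd-at M i x k)
    at-j : ∀ x y k → (M [ i ≔ x ] [ j ≔ y ]) j k ≡ y k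
    at-j x y k = upd-at (M [ i ≔ x ]) j y k
    off : ∀ x y a → a ≢ i → a ≢ j → (M [ i ≔ x ] [ j ≔ y ]) a ≗ M a
    off x y a p q k = trans (upd-off (M [ i ≔ x ]) j y a q k) (upd-off M i x a p k)
    e≡ : ∀ x → E x x ≡ 0ℤ
    e≡ x = alt _ (λ k → trans (at-i x x k) (sym (at-j x x k)))
    eqN : D N ≡ E v u
    eqN = congruent pt
      where
      pt : N ≈ (M [ i ≔ v ] [ j ≔ u ])
      pt a k with a ≟ i | a ≟ j
      ... | yes refl | _ = trans (hi k) (sym (at-i v u k))
      ... | no _ | yes refl = trans (hj k) (sym (at-j v u k))
      ... | no p | no q = trans (hoff a p q k) (sym (off v u a p q k))
    comm : ∀ x y → E x y ≡ D (M [ j ≔ y ] [ i ≔ x ])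
    comm x y = congruent pt
      where
      pt : (M [ i ≔ x ] [ j ≔ y ]) ≈ (M [ j ≔ y ] [ i ≔ x ])
      pt a k with a ≟ i | a ≟ j
      ... | yes refl | _ = trans (at-i x y k) (sym (upd-at (M [ j ≔ y ]) i x k))
      ... | no p | yes refl = trans (at-j x y k) (sym (trans (upd-off (M [ j ≔ y ]) i x a p k) (upd-at M j y k)))
      ... | no p | no q = trans (off x y a p q k) (sym (trans (upd-off (M [ j ≔ y ]) i x a p k) (upd-off M j y a q k)))
    h : ∀ a b c d → a ≡ 0ℤ → d ≡ 0ℤ → b + c ≡ (a + b) + (c + d)
    h a b c d refl refl = g b c
      where
      g : ∀ b c → b + c ≡ (0ℤ + b) + (c + 0ℤ)
      g = solve-∀
    solveFor : ∀ {a b} → a + b ≡ 0ℤ → b ≡ - a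
    solveFor {a} {b} e = trans (g a b) (trans (cong (_- a) e) (ℤₚ.+-identityˡ (- a)))
      where
      g : ∀ a b → b ≡ (a + b) - a
      g = solve-∀

inject₁≢suc : ∀ {n} (c : Fin n) → inject₁ c ≢ suc c
inject₁≢suc (suc c) e = inject₁≢suc c (Finₚ.suc-injective e)

-- Moving row j towards row i by adjacent transpositions.
adjacent⇒alternating : ∀ {n m} {D : Rows (suc n) m → ℤ} → Multilinear D →
  (∀ (c : Fin n) M → M (inject₁ c) ≗ M (suc c) → D M ≡ 0ℤ) → Alternating D
adjacent⇒alternating {n} {m} {D} ml adj = record { multilinear = ml ; alternate = general }
  where
  open Multilinear ml
  swapped : Fin n → Rows (suc n) m → Rows (suc n) m
  swapped c M = M [ inject₁ c ≔ M (suc c) ] [ suc c ≔ M (inject₁ c) ]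
  neg0 : ∀ {a b} → a ≡ - b → a ≡ 0ℤ → b ≡ 0ℤ
  neg0 {a} {b} p q = trans (sym (ℤₚ.neg-involutive b)) (cong -_ (trans (sym p) q))
  less : ∀ t (i j : Fin (suc n)) → toℕ j ≡ t → i Fin.< j → ∀ M → M i ≗ M j → D M ≡ 0ℤ
  less zero i zero e () M h
  less (suc t) i (suc c) e i<j M h with i ≟ inject₁ c
  ... | yes refl = adj c M h
  ... | no i≢ = neg0 (swap-rows ml (inject₁≢suc c) (adj c) M M' at-i at-j (λ a p q k → trans (upd-off _ (suc c) _ a q k) (upd-off M (inject₁ c) _ a p k)))
                  (less t i (inject₁ c) (trans (Finₚ.toℕ-inject₁ c) (ℕₚ.suc-injective e)) i<c M'
                    (λ k → trans (trans (upd-off _ (suc c) _ i i≢j k) (upd-off M (inject₁ c) _ i i≢ k)) (trans (h k) (sym (at-i k)))))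
    where
    M' = swapped c M
    i≢j : i ≢ suc c
    i≢j refl = ℕₚ.<-irrefl refl i<j
    at-i : M' (inject₁ c) ≗ M (suc c)
    at-i k = trans (upd-off (M [ inject₁ c ≔ M (suc c) ]) (suc c) _ (inject₁ c) (inject₁≢suc c) k) (upd-at M (inject₁ c) _ k)
    at-j : M' (suc c) ≗ M (inject₁ c)
    at-j k = upd-at (M [ inject₁ c ≔ M (suc c) ]) (suc c) _ k
    i<c : i Fin.< inject₁ c
    i<c = ℕₚ.≤∧≢⇒< (subst (toℕ i ℕ.≤_) (sym (Finₚ.toℕ-inject₁ c)) (ℕₚ.≤-pred i<j)) (λ e' → i≢ (Finₚ.toℕ-injective e'))
  general : ∀ {i j} M → i ≢ j → M i ≗ M j → D M ≡ 0ℤ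
  general {i} {j} M i≢j h with ℕₚ.<-cmp (toℕ i) (toℕ j)
  ... | tri< i<j _ _ = less (toℕ j) i j refl i<j M h
  ... | tri≈ _ e _ = contradiction (Finₚ.toℕ-injective e) i≢j
  ... | tri> _ _ j<i = less (toℕ i) j i refl j<i M (λ k → sym (h k))

-- Determinants

opaque
  det : ∀ {n} → Mat n → ℤ
  det {n} = detℤ n

  det-detℤ : ∀ {n} {M : Mat n} → det M ≡ detℤ n M
  det-detℤ = refl

  det-nil : ∀ {M : Mat 0} → det M ≡ 1ℤ
  det-nil = refl

  det-laplace : ∀ n (M : Mat (suc n)) → det M ≡ ∑ (λ j → signPow (toℕ j) * (M zero j * det (minor M zero j)))
  det-laplace n M = trans (sym ∑-sumFin) (∑-cong (λ j → sgn≡ (toℕ j) (M zero j * det (minor M zero j))))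

det-cong : ∀ n {M N : Mat n} → M ≈ N → det M ≡ det N
det-cong zero    h = trans det-nil (sym det-nil)
det-cong (suc n) {M} {N} h =
  trans (det-laplace n M) (trans (∑-cong (λ j → cong₂ (λ a b → signPow (toℕ j) * (a * b)) (h zero j)
    (det-cong n (λ r c → h (suc r) (punchIn j c))))) (sym (det-laplace n N)))

infix 30 _ᵗ
_ᵗ : ∀ {n} → Mat n → Mat n
(M ᵗ) i j = M j i

detᵗ-laplace : ∀ n (M : Mat (suc n)) →
  det (M ᵗ) ≡ ∑ (λ j → signPow (toℕ j) * (M j zero * det ((minor M j zero) ᵗ)))
detᵗ-laplace n M = det-laplace n (M ᵗ)

-- The Laplace rule expands along the first row. For the transpose this is the first column of M,
-- and then each term of the expansion involves row i exactly once: through its entry, or inside the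
-- minor. This also makes alternation easy, which is why the transpose is treated before `det`
-- itself.
detᵗ-multilinear : ∀ n → Multilinear (λ (M : Mat n) → det (M ᵗ))
detᵗ-multilinear n = record { congruent = λ h → det-cong n (λ r c → h c r) ; linear = lin n }
  where
  lin : ∀ n (i : Fin n) x y {M N P : Mat n} → N ≈[ i ] M → P ≈[ i ] M → (∀ k → M i k ≡ x * N i k + y * P i k) →
        det (M ᵗ) ≡ x * det (N ᵗ) + y * det (P ᵗ)
  lin (suc n) i x y {M} {N} {P} hN hP e =
    trans (detᵗ-laplace n M) (trans (∑-cong term) (trans (∑-lin x y (T N) (T P))
      (sym (cong₂ (λ a b → x * a + y * b) (detᵗ-laplace n N) (detᵗ-laplace n P)))))
    where
    T : Mat (suc n) → Vect (suc n)
    T M j = signPow (toℕ j) * (M j zero * det ((minor M j zero) ᵗ))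
    g₁ : ∀ s x y a b d → s * ((x * a + y * b) * d) ≡ x * (s * (a * d)) + y * (s * (b * d))
    g₁ = solve-∀
    g₂ : ∀ s x y a b d → s * (d * (x * a + y * b)) ≡ x * (s * (d * a)) + y * (s * (d * b))
    g₂ = solve-∀
    term : ∀ j → T M j ≡ x * T N j + y * T P j
    term j with j ≟ i
    ... | yes refl = begin
      signPow (toℕ j) * (M j zero * d M)  ≡⟨ cong (λ z → signPow (toℕ j) * (z * d M)) (e zero) ⟩
      signPow (toℕ j) * ((x * N j zero + y * P j zero) * d M)  ≡⟨ g₁ (signPow (toℕ j)) x y (N j zero) (P j zero) (d M) ⟩
      x * (signPow (toℕ j) * (N j zero * d M)) + y * (signPow (toℕ j) * (P j zero * d M))
        ≡⟨ cong₂ (λ a b → x * (signPow (toℕ j) * (N j zero * a)) + y * (signPow (toℕ j) * (P j zero * b))) (same hN) (same hP) ⟩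
      x * T N j + y * T P j ∎
      where
      open ≡-Reasoning
      d : Mat (suc n) → ℤ
      d M = det ((minor M j zero) ᵗ)
      same : ∀ {Q} → Q ≈[ j ] M → d M ≡ d Q
      same h = det-cong n (λ r c → sym (h (punchIn j c) (Finₚ.punchInᵢ≢i j c) (suc r)))
    ... | no j≢i = begin
      signPow (toℕ j) * (M j zero * d M)  ≡⟨ cong (λ z → signPow (toℕ j) * (M j zero * z)) (lin n (punchOut j≢i) x y (off hN) (off hP) at) ⟩
      signPow (toℕ j) * (M j zero * (x * d N + y * d P))  ≡⟨ g₂ (signPow (toℕ j)) x y (d N) (d P) (M j zero) ⟩
      x * (signPow (toℕ j) * (M j zero * d N)) + y * (signPow (toℕ j) * (M j zero * d P))
        ≡⟨ cong₂ (λ a b → x * (signPow (toℕ j) * (a * d N)) + y * (signPow (toℕ j) * (b * d P))) (sym (hN j j≢i zero)) (sym (hP j j≢i zero)) ⟩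
      x * T N j + y * T P j ∎
      where
      open ≡-Reasoning
      d : Mat (suc n) → ℤ
      d M = det ((minor M j zero) ᵗ)
      off : ∀ {Q} → Q ≈[ i ] M → minor Q j zero ≈[ punchOut j≢i ] minor M j zero
      off h a a≢ k = h (punchIn j a) (λ q → a≢ (Finₚ.punchIn-injective j a _ (trans q (sym (Finₚ.punchIn-punchOut j≢i))))) (suc k)
      at : ∀ k → minor M j zero (punchOut j≢i) k ≡ x * minor N j zero (punchOut j≢i) k + y * minor P j zero (punchOut j≢i) k
      at k rewrite Finₚ.punchIn-punchOut j≢i = e (suc k)

punchIn-adjacent : ∀ {n} (j : Fin (suc (suc n))) (c : Fin (suc n)) → j ≢ inject₁ c → j ≢ suc c →
                   Σ (Fin n) λ c' → (punchIn j (inject₁ c') ≡ inject₁ c) × (punchIn j (suc c') ≡ suc c)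
punchIn-adjacent zero zero p q = contradiction refl p
punchIn-adjacent zero (suc c) p q = c , refl , refl
punchIn-adjacent (suc zero) zero p q = contradiction refl q
punchIn-adjacent {suc n} (suc (suc j)) zero p q = zero , refl , refl
punchIn-adjacent {suc n} (suc j) (suc c) p q with punchIn-adjacent j c (p ∘ cong suc) (q ∘ cong suc)
... | c' , e₁ , e₂ = suc c' , cong suc e₁ , cong suc e₂

punchIn-neighbours : ∀ {n} (c a : Fin n) → (punchIn (inject₁ c) a ≡ punchIn (suc c) a) ⊎
                     ((punchIn (inject₁ c) a ≡ suc c) × (punchIn (suc c) a ≡ inject₁ c))
punchIn-neighbours zero zero = inj₂ (refl , refl)
punchIn-neighbours zero (suc a) = inj₁ refl
punchIn-neighbours (suc c) zero = inj₁ refl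
punchIn-neighbours (suc c) (suc a) with punchIn-neighbours c a
... | inj₁ e = inj₁ (cong suc e)
... | inj₂ (e₁ , e₂) = inj₂ (cong suc e₁ , cong suc e₂)

∑-adjacent : ∀ {n} (c : Fin n) (f : Vect (suc n)) → (∀ j → j ≢ inject₁ c → j ≢ suc c → f j ≡ 0ℤ) →
             f (inject₁ c) + f (suc c) ≡ 0ℤ → ∑ f ≡ 0ℤ
∑-adjacent zero f h e =
  trans ∑-suc (trans (cong (f zero +_) (trans ∑-suc (trans (cong (f (suc zero) +_) (∑-0 (λ j → h (suc (suc j)) (λ ()) (λ ())))) (ℤₚ.+-identityʳ (f (suc zero)))))) e)
∑-adjacent (suc c) f h e =
  trans ∑-suc (trans (cong₂ _+_ (h zero (λ ()) (λ ())) (∑-adjacent c (f ∘ suc) (λ j p q → h (suc j) (p ∘ Finₚ.suc-injective) (q ∘ Finₚ.suc-injective)) e)) refl)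

-- Two equal neighbouring rows survive in every minor except the two that delete one of them; these
-- two minors coincide and carry opposite signs.
detᵗ-adjacent : ∀ n (c : Fin n) (M : Mat (suc n)) → M (inject₁ c) ≗ M (suc c) → det (M ᵗ) ≡ 0ℤ
detᵗ-adjacent (suc n) c M h = trans (detᵗ-laplace (suc n) M) (∑-adjacent c T other pair)
  where
  open ≡-Reasoning
  d : Fin (suc (suc n)) → ℤ
  d j = det ((minor M j zero) ᵗ)
  T : Vect (suc (suc n))
  T j = signPow (toℕ j) * (M j zero * d j)
  other : ∀ j → j ≢ inject₁ c → j ≢ suc c → T j ≡ 0ℤ
  other j p q with punchIn-adjacent j c p q
  ... | c' , e₁ , e₂ = trans (cong (λ z → signPow (toℕ j) * (M j zero * z)) (detᵗ-adjacent n c' (minor M j zero) eq)) (g (signPow (toℕ j)) (M j zero))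
    where
    eq : minor M j zero (inject₁ c') ≗ minor M j zero (suc c')
    eq k rewrite e₁ | e₂ = h (suc k)
    g : ∀ s a → s * (a * 0ℤ) ≡ 0ℤ
    g = solve-∀
  same : d (inject₁ c) ≡ d (suc c)
  same = det-cong (suc n) pt
    where
    pt : ∀ r a → M (punchIn (inject₁ c) a) (suc r) ≡ M (punchIn (suc c) a) (suc r)
    pt r a with punchIn-neighbours c a
    ... | inj₁ e = cong (λ z → M z (suc r)) e
    ... | inj₂ (e₁ , e₂) = trans (cong (λ z → M z (suc r)) e₁) (trans (sym (h (suc r))) (cong (λ z → M z (suc r)) (sym e₂)))
  pair : T (inject₁ c) + T (suc c) ≡ 0ℤ
  pair = begin
    T (inject₁ c) + T (suc c)
      ≡⟨ cong (_+ T (suc c)) (cong₂ _*_ (cong signPow (Finₚ.toℕ-inject₁ c)) (cong₂ _*_ (h zero) same)) ⟩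
    signPow (toℕ c) * (M (suc c) zero * d (suc c)) + T (suc c)
      ≡⟨ g (signPow (toℕ c)) (M (suc c) zero * d (suc c)) ⟩
    0ℤ ∎
    where
    g : ∀ s a → s * a + - s * a ≡ 0ℤ
    g = solve-∀

detᵗ-alternating : ∀ n → Alternating (λ (M : Mat n) → det (M ᵗ))
detᵗ-alternating zero = record { multilinear = detᵗ-multilinear zero ; alternate = λ { {()} } }
detᵗ-alternating (suc n) = adjacent⇒alternating (detᵗ-multilinear (suc n)) (detᵗ-adjacent n)

record Linear {m n} (L : Vect m → Vect n) : Set where
  field
    l-cong : ∀ {u v} → u ≗ v → L u ≗ L v
    l-comb : ∀ x y u v → L (λ k → x * u k + y * v k) ≗ (λ k → x * L u k + y * L v k)

precompose : ∀ {n m l} {D : Rows n m → ℤ} {L : Vect l → Vect m} → Linear L → Alternating D →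
             Alternating (λ (R : Rows n l) → D (λ a → L (R a)))
precompose {D = D} {L} lin alt = record
  { multilinear = record
    { congruent = λ h → congruent (λ i → l-cong (h i))
    ; linear = λ i x y {M} {N} {P} p q h → linear i x y (λ a a≢i → l-cong (p a a≢i)) (λ a a≢i → l-cong (q a a≢i))
        (λ k → trans (l-cong h k) (l-comb x y (N i) (P i) k)) }
  ; alternate = λ M i≢j h → alternate _ i≢j (l-cong h) }
  where
  open Linear lin
  open Alternating alt

data View {n} (i : Fin (suc n)) : Fin (suc n) → Set where
  here  : View i i
  there : ∀ a → View i (punchIn i a)

view : ∀ {n} (i k : Fin (suc n)) → View i k
view i k with i ≟ k
... | yes refl = here
... | no i≢k = subst (View i) (Finₚ.punchIn-punchOut i≢k) (there (punchOut i≢k))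

pad : ∀ {n} → Fin (suc n) → Vect n → Vect (suc n)
pad i x = insertAt x i 0ℤ

pad-at : ∀ {n} i (x : Vect n) → pad i x i ≡ 0ℤ
pad-at i x = insertAt-lookup x i 0ℤ

pad-in : ∀ {n} i (x : Vect n) a → pad i x (punchIn i a) ≡ x a
pad-in i x a = insertAt-punchIn x i 0ℤ a

pad-linear : ∀ {n} (i : Fin (suc n)) → Linear (pad i)
pad-linear i = record { l-cong = λ h k → c h k (view i k) ; l-comb = λ x y u v k → l x y u v k (view i k) }
  where
  c : ∀ {u v} → u ≗ v → ∀ k → View i k → pad i u k ≡ pad i v k
  c {u} {v} h _ here = trans (pad-at i u) (sym (pad-at i v))
  c {u} {v} h _ (there a) = trans (pad-in i u a) (trans (h a) (sym (pad-in i v a)))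
  g : ∀ x y → 0ℤ ≡ x * 0ℤ + y * 0ℤ
  g = solve-∀
  l : ∀ x y u v k → View i k → pad i (λ k → x * u k + y * v k) k ≡ x * pad i u k + y * pad i v k
  l x y u v _ here = trans (pad-at i _) (trans (g x y) (sym (cong₂ (λ a b → x * a + y * b) (pad-at i u) (pad-at i v))))
  l x y u v _ (there a) = trans (pad-in i _ a) (sym (cong₂ (λ a b → x * a + y * b) (pad-in i u a) (pad-in i v a)))

δ-punchIn : ∀ {n} (j : Fin (suc n)) (a b : Fin n) → δ (punchIn j a) (punchIn j b) ≡ δ a b
δ-punchIn zero    a b = refl
δ-punchIn (suc j) zero zero = refl
δ-punchIn (suc j) zero (suc b) = refl
δ-punchIn (suc j) (suc a) zero = refl
δ-punchIn (suc j) (suc a) (suc b) = δ-punchIn j a b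

pad-δ : ∀ {n} (j : Fin (suc n)) a → pad j (δ a) ≗ δ (punchIn j a)
pad-δ j a k = go k (view j k)
  where
  go : ∀ k → View j k → pad j (δ a) k ≡ δ (punchIn j a) k
  go _ here = trans (pad-at j (δ a)) (sym (δ-≢ (Finₚ.punchInᵢ≢i j a)))
  go _ (there b) = trans (pad-in j (δ a) b) (sym (δ-punchIn j a b))

-- Row j travels to the front by j transpositions: by induction to second place with the head row
-- fixed, then one more swap.
cycle : ∀ {n m} {D : Rows (suc n) m → ℤ} → Alternating D → ∀ V j → D (V j ◂ (V ∘ punchIn j)) ≡ signPow (toℕ j) * D V
cycle {D = D} alt V zero = trans (sym (head-η multilinear V)) (sym (ℤₚ.*-identityˡ (D V)))
  where open Alternating alt
cycle {suc n} {D = D} alt V (suc j) = begin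
  D (V (suc j) ◂ (V ∘ punchIn (suc j)))  ≡⟨ swap-rows multilinear {zero} {suc zero} (λ ()) (λ M → alternate M (λ ())) M _ (λ _ → refl) (λ _ → refl) off ⟩
  - D M  ≡⟨ cong -_ (cycle (fixHead (V zero) alt) (V ∘ suc) j) ⟩
  - (signPow (toℕ j) * D (V zero ◂ (V ∘ suc)))  ≡⟨ ℤₚ.neg-distribˡ-* (signPow (toℕ j)) (D (V zero ◂ (V ∘ suc))) ⟩
  - signPow (toℕ j) * D (V zero ◂ (V ∘ suc))  ≡⟨ cong (- signPow (toℕ j) *_) (sym (head-η multilinear V)) ⟩
  - signPow (toℕ j) * D V ∎
  where
  open ≡-Reasoning
  open Alternating alt
  M : Rows (suc (suc n)) _
  M = V zero ◂ (V (suc j) ◂ (V ∘ suc ∘ punchIn j))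
  off : ∀ a → a ≢ zero → a ≢ suc zero → (V (suc j) ◂ (V ∘ punchIn (suc j))) a ≗ M a
  off zero p q = contradiction refl p
  off (suc zero) p q = contradiction refl q
  off (suc (suc a)) p q k = refl

-- Expanding the head row in unit vectors leaves the values D(δⱼ, ...). There δⱼ clears column j of
-- the other rows, so what remains is an alternating form of the minor, padded by a zero column, and
-- induction applies. Transposes, products and block matrices all reduce to this.
det-unique : ∀ n {D : Mat n → ℤ} → Alternating D → ∀ M → D M ≡ det M * D δ
det-unique zero {D} alt M = trans (Alternating.congruent alt (λ ())) (sym (trans (cong (_* D δ) det-nil) (ℤₚ.*-identityˡ (D δ))))
det-unique (suc n) {D} alt M = begin
  D M ≡⟨ head-η multilinear M ⟩
  D (M zero ◂ (M ∘ suc)) ≡⟨ congruent (λ { zero k → sym (∑-δʳ k (M zero)) ; (suc i) k → refl }) ⟩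
  D ((λ k → ∑ (λ j → M zero j * δ j k)) ◂ (M ∘ suc)) ≡⟨ head-sum multilinear (M zero) δ (M ∘ suc) ⟩
  ∑ (λ j → M zero j * D (δ j ◂ (M ∘ suc))) ≡⟨ ∑-cong term ⟩
  ∑ (λ j → (signPow (toℕ j) * (M zero j * det (minor M zero j))) * D δ) ≡⟨ ∑-*ʳ (D δ) (λ j → signPow (toℕ j) * (M zero j * det (minor M zero j))) ⟩
  ∑ (λ j → signPow (toℕ j) * (M zero j * det (minor M zero j))) * D δ ≡⟨ cong (_* D δ) (sym (det-laplace n M)) ⟩
  det M * D δ ∎
  where
  open ≡-Reasoning
  open Alternating alt
  E : Fin (suc n) → Mat n → ℤ
  E j N = D (δ j ◂ (λ a → pad j (N a)))
  g : ∀ m d s x → m * (d * (s * x)) ≡ (s * (m * d)) * x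
  g = solve-∀
  split : ∀ j a k → View j k → M (suc a) k ≡ pad j (minor M zero j a) k + M (suc a) j * δ j k
  split j a _ here = trans (h (M (suc a) j)) (sym (cong₂ (λ x y → x + M (suc a) j * y) (pad-at j (minor M zero j a)) (δ-refl j)))
    where
    h : ∀ x → x ≡ 0ℤ + x * 1ℤ
    h = solve-∀
  split j a _ (there b) = trans (h (M (suc a) (punchIn j b)) (M (suc a) j))
    (sym (cong₂ (λ x y → x + M (suc a) j * y) (pad-in j (minor M zero j a) b) (δ-≢ (λ e → Finₚ.punchInᵢ≢i j b (sym e)))))
    where
    h : ∀ x y → x ≡ x + y * 0ℤ
    h = solve-∀
  Eδ : ∀ j → E j δ ≡ signPow (toℕ j) * D δ
  Eδ j = trans (congruent (λ { zero k → refl ; (suc a) k → pad-δ j a k })) (cycle alt δ j)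
  term : ∀ j → M zero j * D (δ j ◂ (M ∘ suc)) ≡ (signPow (toℕ j) * (M zero j * det (minor M zero j))) * D δ
  term j = begin
    M zero j * D (δ j ◂ (M ∘ suc))
      ≡⟨ cong (M zero j *_) (absorb-head alt (δ j) (λ a → pad j (minor M zero j a)) (M ∘ suc) (λ a → M (suc a) j) (λ a k → split j a k (view j k))) ⟩
    M zero j * E j (minor M zero j)
      ≡⟨ cong (M zero j *_) (det-unique n (precompose (pad-linear j) (fixHead (δ j) alt)) (minor M zero j)) ⟩
    M zero j * (det (minor M zero j) * E j δ)
      ≡⟨ cong (λ z → M zero j * (det (minor M zero j) * z)) (Eδ j) ⟩
    M zero j * (det (minor M zero j) * (signPow (toℕ j) * D δ))
      ≡⟨ g (M zero j) (det (minor M zero j)) (signPow (toℕ j)) (D δ) ⟩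
    (signPow (toℕ j) * (M zero j * det (minor M zero j))) * D δ ∎

det-δ : ∀ n → det {n} δ ≡ 1ℤ
det-δ zero = det-nil
det-δ (suc n) = trans (det-laplace n δ) (trans (∑-single zero _ off) (trans (h (det δ)) (det-δ n)))
  where
  off : ∀ j → j ≢ zero → signPow (toℕ j) * (δ {suc n} zero j * det (minor δ zero j)) ≡ 0ℤ
  off zero p = contradiction refl p
  off (suc j) p = g (signPow (toℕ (suc j))) (det (minor δ zero (suc j)))
    where
    g : ∀ s d → s * (0ℤ * d) ≡ 0ℤ
    g = solve-∀
  h : ∀ d → 1ℤ * (1ℤ * d) ≡ d
  h = solve-∀

det-ᵗ : ∀ n (M : Mat n) → det (M ᵗ) ≡ det M
det-ᵗ n M = trans (det-unique n (detᵗ-alternating n) M)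
  (trans (cong (det M *_) (trans (det-cong n (λ i j → δ-sym j i)) (det-δ n))) (ℤₚ.*-identityʳ (det M)))

alternating-≗ : ∀ {n m} {D E : Rows n m → ℤ} → (∀ M → E M ≡ D M) → Alternating D → Alternating E
alternating-≗ e alt = record
  { multilinear = record
    { congruent = λ {M} {N} h → trans (e M) (trans (congruent h) (sym (e N)))
    ; linear = λ i x y {M} {N} {P} p q h → trans (e M) (trans (linear i x y p q h) (sym (cong₂ (λ a b → x * a + y * b) (e N) (e P)))) }
  ; alternate = λ M i≢j h → trans (e M) (alternate M i≢j h) }
  where open Alternating alt

det-alternating : ∀ n → Alternating (det {n})
det-alternating n = alternating-≗ (λ M → sym (det-ᵗ n M)) (detᵗ-alternating n)

infixl 7 _⊗_
_⊗_ : ∀ {n} → Mat n → Mat n → Mat n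
(M ⊗ N) i k = ∑ (λ j → M i j * N j k)

rowMul-linear : ∀ {n} (N : Mat n) → Linear (λ x k → ∑ (λ j → x j * N j k))
rowMul-linear N = record
  { l-cong = λ h k → ∑-cong (λ j → cong (_* N j k) (h j))
  ; l-comb = λ x y u v k → trans (∑-cong (λ j → g x y (u j) (v j) (N j k))) (∑-lin x y (λ j → u j * N j k) (λ j → v j * N j k)) }
  where
  g : ∀ x y u v n → (x * u + y * v) * n ≡ x * (u * n) + y * (v * n)
  g = solve-∀

det-⊗ : ∀ n (M N : Mat n) → det (M ⊗ N) ≡ det M * det N
det-⊗ n M N = trans (det-unique n (precompose (rowMul-linear N) (det-alternating n)) M)
  (cong (det M *_) (det-cong n (λ i k → ∑-δˡ i (λ j → N j k))))

-- Bordered determinants and adjugates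

-- The bordered matrix with corner a, top row w and left column u. The entries are generic because
-- it is also formed over polynomials, to obtain adj(xI - M).
bd : ∀ {R : Set} {n} → R → (Fin n → R) → (Fin n → R) → (Fin n → Fin n → R) → Fin (suc n) → Fin (suc n) → R
bd a w u M zero    zero    = a
bd a w u M zero    (suc j) = w j
bd a w u M (suc i) zero    = u i
bd a w u M (suc i) (suc j) = M i j

0ᵛ : ∀ {n} → Vect n
0ᵛ _ = 0ℤ

module _ {n : ℕ} where
  open Alternating (det-alternating (suc n))

  det-bd-0 : ∀ a (u : Vect n) M → det (bd a 0ᵛ u M) ≡ a * det M
  det-bd-0 a u M = trans (det-laplace n B) (trans (∑-single zero _ off) (h a (det M)))
    where
    B = bd a 0ᵛ u M
    h : ∀ a d → 1ℤ * (a * d) ≡ a * d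
    h = solve-∀
    off : ∀ j → j ≢ zero → signPow (toℕ j) * (B zero j * det (minor B zero j)) ≡ 0ℤ
    off zero p = contradiction refl p
    off (suc j) p = g (signPow (toℕ (suc j))) (det (minor B zero (suc j)))
      where
      g : ∀ s d → s * (0ℤ * d) ≡ 0ℤ
      g = solve-∀

  det-bd-row : ∀ a b w v (u : Vect n) M →
               det (bd (a + b) (λ k → w k + v k) u M) ≡ det (bd a w u M) + det (bd b v u M)
  det-bd-row a b w v u M = trans (congruent (λ { zero zero → refl ; zero (suc k) → refl ; (suc i) zero → refl ; (suc i) (suc k) → refl }))
    (trans (head-add multilinear (B₁ zero) (B₂ zero) (B₁ ∘ suc))
      (cong₂ _+_ (congruent (λ { zero zero → refl ; zero (suc k) → refl ; (suc i) zero → refl ; (suc i) (suc k) → refl })) (congruent (λ { zero zero → refl ; zero (suc k) → refl ; (suc i) zero → refl ; (suc i) (suc k) → refl }))))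
    where
    B₁ = bd a w u M
    B₂ = bd b v u M

  -- wᵀ adjugate(M) u, as a bordered determinant.
  β : Mat n → Vect n → Vect n → ℤ
  β M w u = - det (bd 0ℤ w u M)

  β-cong : ∀ {M N w v u t} → M ≈ N → w ≗ v → u ≗ t → β M w u ≡ β N v t
  β-cong h p q = cong -_ (congruent (λ { zero zero → refl ; zero (suc k) → p k ; (suc i) zero → q i ; (suc i) (suc k) → h i k }))

  β-ᵗ : ∀ M w u → β (M ᵗ) w u ≡ β M u w
  β-ᵗ M w u = cong -_ (trans (congruent (λ { zero zero → refl ; zero (suc k) → refl ; (suc i) zero → refl ; (suc i) (suc k) → refl }))
    (det-ᵗ (suc n) (bd 0ℤ u w M)))

  -- With corner u i instead of 0 the top row would repeat row i of the bordered matrix and the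
  -- determinant would vanish; the correction -u i stands in an otherwise zero top row. This is the
  -- identity M adj(M) = det M.
  β-row : ∀ M i u → β M (M i) u ≡ det M * u i
  β-row M i u = begin
    - det' (bd 0ℤ (M i) u M)
      ≡⟨ cong -_ (congruent (λ { zero zero → sym (ℤₚ.+-inverseˡ (u i)) ; zero (suc k) → sym (ℤₚ.+-identityˡ (M i k)) ; (suc i) zero → refl ; (suc i) (suc k) → refl })) ⟩
    - det' (bd (- u i + u i) (λ k → 0ℤ + M i k) u M)
      ≡⟨ cong -_ (det-bd-row (- u i) (u i) 0ᵛ (M i) u M) ⟩
    - (det' (bd (- u i) 0ᵛ u M) + det' (bd (u i) (M i) u M))
      ≡⟨ cong -_ (cong₂ _+_ (det-bd-0 (- u i) u M) (alternate {zero} {suc i} (bd (u i) (M i) u M) (λ ()) (λ { zero → refl ; (suc k) → refl }))) ⟩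
    - (- u i * det M + 0ℤ) ≡⟨ h (u i) (det M) ⟩
    det M * u i ∎
    where
    open ≡-Reasoning
    det' = det {suc n}
    h : ∀ u d → - (- u * d + 0ℤ) ≡ d * u
    h = solve-∀

  β-sum : ∀ {l} M (x : Vect l) (W : Rows l n) u → β M (λ k → ∑ (λ j → x j * W j k)) u ≡ ∑ (λ j → x j * β M (W j) u)
  β-sum M x W u = begin
    - det' (bd 0ℤ (λ k → ∑ (λ j → x j * W j k)) u M)
      ≡⟨ cong -_ (congruent (λ { zero zero → sym (∑-0 (λ j → ℤₚ.*-zeroʳ (x j))) ; zero (suc k) → refl ; (suc i) zero → refl ; (suc i) (suc k) → refl })) ⟩
    - det' ((λ k → ∑ (λ j → x j * R j k)) ◂ T) ≡⟨ cong -_ (head-sum multilinear x R T) ⟩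
    - ∑ (λ j → x j * det' (R j ◂ T)) ≡⟨ neg-out _ ⟩
    ∑ (λ j → - (x j * det' (R j ◂ T)))
      ≡⟨ ∑-cong (λ j → trans (ℤₚ.neg-distribʳ-* (x j) (det' (R j ◂ T))) (cong (λ z → x j * - z) (congruent (λ { zero zero → refl ; zero (suc k) → refl ; (suc i) zero → refl ; (suc i) (suc k) → refl })))) ⟩
    ∑ (λ j → x j * β M (W j) u) ∎
    where
    open ≡-Reasoning
    det' = det {suc n}
    T : Rows n (suc n)
    T i = bd 0ℤ 0ᵛ u M (suc i)
    R : Rows _ (suc n)
    R j = bd 0ℤ (W j) u M zero
    neg-out : ∀ {l} (f : Vect l) → - ∑ f ≡ ∑ (λ j → - f j)
    neg-out f = trans (h (∑ f)) (trans (sym (∑-*ˡ -1ℤ f)) (∑-cong (λ j → sym (h (f j)))))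
      where
      h : ∀ a → - a ≡ -1ℤ * a
      h a = sym (ℤₚ.-1*i≡-i a)

  adjugate : Mat n → Mat n
  adjugate M j k = β M (δ j) (δ k)

  β-δ : ∀ M w k → β M w (δ k) ≡ ∑ (λ j → w j * adjugate M j k)
  β-δ M w k = trans (β-cong {u = δ k} (λ _ _ → refl) (λ j → sym (∑-δʳ j w)) (λ _ → refl)) (β-sum M w δ (δ k))

  adj-ᵗ : ∀ M j k → adjugate (M ᵗ) j k ≡ adjugate M k j
  adj-ᵗ M j k = β-ᵗ M (δ j) (δ k)

  β-adj : ∀ M w u → β M w u ≡ ∑ (λ k → u k * ∑ (λ j → w j * adjugate M j k))
  β-adj M w u = begin
    β M w u                     ≡⟨ sym (β-ᵗ M u w) ⟩
    β (M ᵗ) u w                 ≡⟨ β-cong (λ _ _ → refl) (λ j → sym (∑-δʳ j u)) (λ _ → refl) ⟩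
    β (M ᵗ) (λ j → ∑ (λ k → u k * δ k j)) w ≡⟨ β-sum (M ᵗ) u δ w ⟩
    ∑ (λ k → u k * β (M ᵗ) (δ k) w) ≡⟨ ∑-cong (λ k → cong (u k *_) (trans (β-ᵗ M (δ k) w) (β-δ M w k))) ⟩
    ∑ (λ k → u k * ∑ (λ j → w j * adjugate M j k)) ∎
    where open ≡-Reasoning

  ⊗-adj : ∀ M i k → (M ⊗ adjugate M) i k ≡ det M * δ k i
  ⊗-adj M i k = trans (sym (β-δ M (M i) k)) (β-row M i (δ k))

  adj-⊗ : ∀ M i k → (adjugate M ⊗ M) i k ≡ det M * δ i k
  adj-⊗ M i k = trans (∑-cong (λ j → trans (ℤₚ.*-comm (adjugate M i j) (M j k)) (cong (M j k *_) (sym (adj-ᵗ M j i)))))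
    (trans (⊗-adj (M ᵗ) k i) (cong (_* δ i k) (det-ᵗ n M)))

  -- Rank-one update, by clearing the first column of the bordered matrix.
  det-rank1 : ∀ M u w → det (λ i j → M i j - u i * w j) ≡ det M - β M w u
  det-rank1 M u w = trans (sym left) right
    where
    open ≡-Reasoning
    det' = det {suc n}
    M' : Mat n
    M' i j = M i j - u i * w j
    B = bd 1ℤ w u M
    split : ∀ a k → B (suc a) k ≡ bd 1ℤ w 0ᵛ M' (suc a) k + u a * B zero k
    split a zero = h (u a)
      where
      h : ∀ u → u ≡ 0ℤ + u * 1ℤ
      h = solve-∀
    split a (suc k) = h (M a k) (u a) (w k)
      where
      h : ∀ m u w → m ≡ (m - u * w) + u * w
      h = solve-∀
    left : det' B ≡ det M'
    left = begin
      det' B ≡⟨ congruent (λ { zero k → refl ; (suc i) zero → refl ; (suc i) (suc k) → refl }) ⟩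
      det' (B zero ◂ (B ∘ suc)) ≡⟨ absorb-head (det-alternating (suc n)) (B zero) (bd 1ℤ w 0ᵛ M' ∘ suc) (B ∘ suc) u split ⟩
      det' (B zero ◂ (bd 1ℤ w 0ᵛ M' ∘ suc)) ≡⟨ congruent (λ { zero zero → refl ; zero (suc k) → refl ; (suc i) zero → refl ; (suc i) (suc k) → refl }) ⟩
      det' ((bd 1ℤ 0ᵛ w (M' ᵗ)) ᵗ) ≡⟨ det-ᵗ (suc n) (bd 1ℤ 0ᵛ w (M' ᵗ)) ⟩
      det' (bd 1ℤ 0ᵛ w (M' ᵗ)) ≡⟨ det-bd-0 1ℤ w (M' ᵗ) ⟩
      1ℤ * det (M' ᵗ) ≡⟨ trans (ℤₚ.*-identityˡ (det (M' ᵗ))) (det-ᵗ n M') ⟩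
      det M' ∎
    h : ∀ d b → 1ℤ * d + b ≡ d - - b
    h = solve-∀
    right : det' B ≡ det M - β M w u
    right = begin
      det' B ≡⟨ congruent (λ { zero zero → refl ; zero (suc k) → sym (ℤₚ.+-identityˡ (w k)) ; (suc i) zero → refl ; (suc i) (suc k) → refl }) ⟩
      det' (bd (1ℤ + 0ℤ) (λ k → 0ℤ + w k) u M) ≡⟨ det-bd-row 1ℤ 0ℤ 0ᵛ w u M ⟩
      det' (bd 1ℤ 0ᵛ u M) + det' (bd 0ℤ w u M) ≡⟨ cong (_+ det' (bd 0ℤ w u M)) (det-bd-0 1ℤ u M) ⟩
      1ℤ * det M + det' (bd 0ℤ w u M) ≡⟨ h (det M) (det' (bd 0ℤ w u M)) ⟩
      det M - β M w u ∎

-- Matrices acting on vectors, and inversion by adjugates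

infixr 8 _▹_
_▹_ : ∀ {n m} → Rows n m → Vect m → Vect n
(M ▹ v) i = ∑ (λ j → M i j * v j)

▹-cong : ∀ {n m} (M : Rows n m) {u v} → u ≗ v → M ▹ u ≗ M ▹ v
▹-cong M h i = ∑-cong (λ j → cong (M i j *_) (h j))

▹-congˡ : ∀ {n m} {M N : Rows n m} v → M ≈ N → M ▹ v ≗ N ▹ v
▹-congˡ v h i = ∑-cong (λ j → cong (_* v j) (h i j))

▹-mod : ∀ {n m N} (M : Rows n m) {u v} → (∀ j → u j ≡ v j [mod N ]) → ∀ i → (M ▹ u) i ≡ (M ▹ v) i [mod N ]
▹-mod M h i = ∑-mod (λ j → mod-*ˡ (M i j) (h j))

▹-assoc : ∀ {n} (M N : Mat n) v → (M ⊗ N) ▹ v ≗ M ▹ (N ▹ v)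
▹-assoc M N v i = begin
  ∑ (λ k → ∑ (λ j → M i j * N j k) * v k) ≡⟨ ∑-cong (λ k → sym (∑-*ʳ (v k) (λ j → M i j * N j k))) ⟩
  ∑ (λ k → ∑ (λ j → (M i j * N j k) * v k)) ≡⟨ ∑-swap _ ⟩
  ∑ (λ j → ∑ (λ k → (M i j * N j k) * v k)) ≡⟨ ∑-cong (λ j → trans (∑-cong (λ k → ℤₚ.*-assoc (M i j) (N j k) (v k))) (∑-*ˡ (M i j) (λ k → N j k * v k))) ⟩
  ∑ (λ j → M i j * ∑ (λ k → N j k * v k)) ∎
  where open ≡-Reasoning

adj-▹ : ∀ {n} (M : Mat n) v i → det M * v i ≡ (adjugate M ▹ (M ▹ v)) i
adj-▹ {n} M v i = begin
  det M * v i ≡⟨ cong (det M *_) (sym (∑-δˡ i v)) ⟩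
  det M * ∑ (λ k → δ i k * v k) ≡⟨ sym (∑-*ˡ (det M) _) ⟩
  ∑ (λ k → det M * (δ i k * v k)) ≡⟨ ∑-cong (λ k → trans (sym (ℤₚ.*-assoc (det M) (δ i k) (v k))) (cong (_* v k) (sym (adj-⊗ M i k)))) ⟩
  ((adjugate M ⊗ M) ▹ v) i ≡⟨ ▹-assoc (adjugate M) M v i ⟩
  (adjugate M ▹ (M ▹ v)) i ∎
  where open ≡-Reasoning

*-zero-cases : ∀ a {b} → a ≢ 0ℤ → a * b ≡ 0ℤ → b ≡ 0ℤ
*-zero-cases a {b} a≢0 e with ℤₚ.i*j≡0⇒i≡0∨j≡0 a e
... | inj₁ p = contradiction p a≢0
... | inj₂ p = p

nonsingular⇒injective : ∀ {n} (M : Mat n) → det M ≢ 0ℤ → ∀ v → M ▹ v ≗ 0ᵛ → v ≗ 0ᵛ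
nonsingular⇒injective {n} M d≢0 v h i = *-zero-cases (det M) d≢0
  (trans (adj-▹ M v i) (∑-0 (λ j → trans (cong (adjugate M i j *_) (h j)) (ℤₚ.*-zeroʳ (adjugate M i j)))))

adj-minor : ∀ n (M : Mat (suc n)) j k → adjugate M j k ≡ signPow (toℕ j) * (signPow (toℕ k) * det (minor M k j))
adj-minor n M j k = begin
  - det B ≡⟨ cong -_ (trans (det-laplace (suc n) B) (∑-single (suc j) _ off)) ⟩
  - (- signPow (toℕ j) * (δ j j * det (minor B zero (suc j)))) ≡⟨ cong₂ (λ x y → - (- signPow (toℕ j) * (x * y))) (δ-refl j) inner ⟩
  - (- signPow (toℕ j) * (1ℤ * (signPow (toℕ k) * det (minor M k j)))) ≡⟨ h (signPow (toℕ j)) (signPow (toℕ k) * det (minor M k j)) ⟩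
  signPow (toℕ j) * (signPow (toℕ k) * det (minor M k j)) ∎
  where
  open ≡-Reasoning
  B = bd 0ℤ (δ j) (δ k) M
  h : ∀ s x → - (- s * (1ℤ * x)) ≡ s * x
  h = solve-∀
  g : ∀ s d → s * (0ℤ * d) ≡ 0ℤ
  g = solve-∀
  vanish : ∀ s {x} d → x ≡ 0ℤ → s * (x * d) ≡ 0ℤ
  vanish s d refl = g s d
  off : ∀ l → l ≢ suc j → signPow (toℕ l) * (B zero l * det (minor B zero l)) ≡ 0ℤ
  off zero p = g 1ℤ (det (minor B zero zero))
  off (suc l) p = vanish (signPow (toℕ (suc l))) (det (minor B zero (suc l))) (δ-≢ (λ e → p (cong suc (sym e))))
  C : Mat (suc n)
  C = minor B zero (suc j)
  inner : det C ≡ signPow (toℕ k) * det (minor M k j)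
  inner = begin
    det C ≡⟨ sym (det-ᵗ (suc n) C) ⟩
    det (C ᵗ) ≡⟨ detᵗ-laplace n C ⟩
    ∑ (λ r → signPow (toℕ r) * (δ k r * det ((minor C r zero) ᵗ))) ≡⟨ ∑-single k _ (λ r p → vanish (signPow (toℕ r)) (det ((minor C r zero) ᵗ)) (δ-≢ (λ e → p (sym e)))) ⟩
    signPow (toℕ k) * (δ k k * det ((minor C k zero) ᵗ)) ≡⟨ cong₂ (λ x y → signPow (toℕ k) * (x * y)) (δ-refl k) (det-ᵗ n (minor C k zero)) ⟩
    signPow (toℕ k) * (1ℤ * det (minor C k zero)) ≡⟨ cong (signPow (toℕ k) *_) (trans (ℤₚ.*-identityˡ _) (det-cong n (λ r c → refl))) ⟩
    signPow (toℕ k) * det (minor M k j) ∎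

det-block1 : ∀ n (M : Mat (suc n)) i d → (∀ k → M i k ≡ d * δ i k) → (∀ a → M (punchIn i a) i ≡ 0ℤ) →
             det M ≡ d * det (minor M i i)
det-block1 n M i d hi hc = begin
  det M ≡⟨ unsign (cycle (det-alternating (suc n)) M i) ⟩
  s * det (M i ◂ (M ∘ punchIn i)) ≡⟨ cong (s *_) (congruent (λ { zero k → hi k ; (suc a) k → row a k (view i k) })) ⟩
  s * det ((λ k → d * δ i k) ◂ (λ a → pad i (minor M i i a))) ≡⟨ cong (s *_) (head-scale multilinear d (δ i) _) ⟩
  s * (d * E (minor M i i)) ≡⟨ cong (λ z → s * (d * z)) (det-unique n (precompose (pad-linear i) (fixHead (δ i) (det-alternating (suc n)))) (minor M i i)) ⟩
  s * (d * (det (minor M i i) * E δ)) ≡⟨ cong (λ z → s * (d * (det (minor M i i) * z))) Eδ ⟩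
  s * (d * (det (minor M i i) * s)) ≡⟨ h s d (det (minor M i i)) ⟩
  (s * s) * (d * det (minor M i i)) ≡⟨ trans (cong (_* (d * det (minor M i i))) (signPow-sq (toℕ i))) (ℤₚ.*-identityˡ _) ⟩
  d * det (minor M i i) ∎
  where
  open ≡-Reasoning
  open Alternating (det-alternating (suc n))
  s = signPow (toℕ i)
  E : Mat n → ℤ
  E N = det (δ i ◂ (λ a → pad i (N a)))
  Eδ : E δ ≡ s
  Eδ = trans (congruent (λ { zero k → refl ; (suc a) k → pad-δ i a k })) (trans (cycle (det-alternating (suc n)) δ i)
    (trans (cong (s *_) (det-δ (suc n))) (ℤₚ.*-identityʳ s)))
  h : ∀ s d m → s * (d * (m * s)) ≡ (s * s) * (d * m)
  h = solve-∀
  unsign : ∀ {x y} → x ≡ s * y → y ≡ s * x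
  unsign {x} {y} refl = sym (trans (sym (ℤₚ.*-assoc s s y)) (trans (cong (_* y) (signPow-sq (toℕ i))) (ℤₚ.*-identityˡ y)))
  row : ∀ a k → View i k → M (punchIn i a) k ≡ pad i (minor M i i a) k
  row a _ here = trans (hc a) (sym (pad-at i (minor M i i a)))
  row a _ (there b) = sym (pad-in i (minor M i i a) b)

det-δ≔ : ∀ n i (z : Vect n) → det (δ [ i ≔ z ]) ≡ z i
det-δ≔ n i z = begin
  det (δ [ i ≔ z ]) ≡⟨ cong-≔ multilinear i δ (λ k → sym (∑-δʳ k z)) ⟩
  det (δ [ i ≔ (λ k → ∑ (λ j → z j * δ j k)) ]) ≡⟨ sum-≔ multilinear i z δ δ ⟩
  ∑ (λ j → z j * det (δ [ i ≔ δ j ])) ≡⟨ ∑-single i _ off ⟩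
  z i * det (δ [ i ≔ δ i ]) ≡⟨ cong (z i *_) (trans (congruent (upd-id δ i (λ _ → refl))) (det-δ n)) ⟩
  z i * 1ℤ ≡⟨ ℤₚ.*-identityʳ (z i) ⟩
  z i ∎
  where
  open ≡-Reasoning
  open Alternating (det-alternating n)
  off : ∀ j → j ≢ i → z j * det (δ [ i ≔ δ j ]) ≡ 0ℤ
  off j j≢i = trans (cong (z j *_) (alternate (δ [ i ≔ δ j ]) (λ e → j≢i (sym e))
    (λ k → trans (upd-at δ i (δ j) k) (sym (upd-off δ i (δ j) j j≢i k))))) (ℤₚ.*-zeroʳ (z j))

-- Polynomials and characteristic polynomials

module _ {R S : Set} {opsR : RingOps R} {opsS : RingOps S} (_~_ : R → S → Set) where
  private
    module O = RingOps opsR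
    module P = RingOps opsS

  -- An abstraction theorem for `det`: any relation compatible with the ring operations passes to
  -- determinants. It is applied to congruence of integers, to evaluation of polynomials and to
  -- coefficientwise congruence.
  det-related : O.r0 ~ P.r0 → O.r1 ~ P.r1 →
    (∀ {a b c d} → a ~ b → c ~ d → O.radd a c ~ P.radd b d) →
    (∀ {a b c d} → a ~ b → c ~ d → O.rmul a c ~ P.rmul b d) →
    (∀ {a b} → a ~ b → O.rneg a ~ P.rneg b) →
    ∀ n (M : Fin n → Fin n → R) (N : Fin n → Fin n → S) → (∀ i j → M i j ~ N i j) →
    Det.det opsR n M ~ Det.det opsS n N
  det-related r0 r1 add mul opp = go
    where
    sum : ∀ n {f g} → (∀ i → f i ~ g i) → Det.sumFin opsR n f ~ Det.sumFin opsS n g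
    sum zero    h = r0
    sum (suc n) h = add (h zero) (sum n (λ i → h (suc i)))
    sgn : ∀ k {a b} → a ~ b → Det.sgn opsR k a ~ Det.sgn opsS k b
    sgn zero    h = h
    sgn (suc k) h = opp (sgn k h)
    go : ∀ n M N → (∀ i j → M i j ~ N i j) → Det.det opsR n M ~ Det.det opsS n N
    go zero    M N h = r1
    go (suc n) M N h = sum (suc n) (λ j → sgn (toℕ j) (mul (h zero j) (go n _ _ (λ r c → h (suc r) (punchIn j c)))))

det-mod : ∀ N n {P Q : Mat n} → (∀ i j → P i j ≡ Q i j [mod N ]) → det P ≡ det Q [mod N ]
det-mod N n {P} {Q} h = mod-cong₂ det-detℤ det-detℤ
  (det-related {opsR = ℤops} {opsS = ℤops} (λ a b → a ≡ b [mod N ]) mod-refl mod-refl mod-+ mod-* mod-neg n P Q h)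

eval : Poly → ℤ → ℤ
eval []      y = 0ℤ
eval (a ∷ p) y = a + y * eval p y

module _ (y : ℤ) where
  eval-+p : ∀ p q → eval (p +p q) y ≡ eval p y + eval q y
  eval-+p []      q       = sym (ℤₚ.+-identityˡ (eval q y))
  eval-+p (a ∷ p) []      = sym (ℤₚ.+-identityʳ (a + y * eval p y))
  eval-+p (a ∷ p) (b ∷ q) = trans (cong (λ z → (a + b) + y * z) (eval-+p p q)) (h a b y (eval p y) (eval q y))
    where
    h : ∀ a b y p q → (a + b) + y * (p + q) ≡ (a + y * p) + (b + y * q)
    h = solve-∀

  eval-scale : ∀ c p → eval (scaleP c p) y ≡ c * eval p y
  eval-scale c []      = sym (ℤₚ.*-zeroʳ c)
  eval-scale c (a ∷ p) = trans (cong (λ z → c * a + y * z) (eval-scale c p)) (h c a y (eval p y))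
    where
    h : ∀ c a y p → c * a + y * (c * p) ≡ c * (a + y * p)
    h = solve-∀

  eval-*p : ∀ p q → eval (p *p q) y ≡ eval p y * eval q y
  eval-*p []      q = sym (ℤₚ.*-zeroˡ (eval q y))
  eval-*p (a ∷ p) q = trans (eval-+p (scaleP a q) (0ℤ ∷ (p *p q)))
    (trans (cong₂ (λ u v → u + (0ℤ + y * v)) (eval-scale a q) (eval-*p p q)) (h a y (eval p y) (eval q y)))
    where
    h : ∀ a y p q → a * q + (0ℤ + y * (p * q)) ≡ (a + y * p) * q
    h = solve-∀

  eval-negP : ∀ p → eval (negP p) y ≡ - eval p y
  eval-negP []      = refl
  eval-negP (a ∷ p) = trans (cong (λ z → - a + y * z) (eval-negP p)) (h a y (eval p y))
    where
    h : ∀ a y p → - a + y * - p ≡ - (a + y * p)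
    h = solve-∀

  eval-sum : ∀ n (f : Fin n → Poly) → eval (Det.sumFin Polyops n f) y ≡ ∑ (λ i → eval (f i) y)
  eval-sum zero    f = sym ∑-nil
  eval-sum (suc n) f = trans (eval-+p (f zero) _) (trans (cong (eval (f zero) y +_) (eval-sum n (f ∘ suc))) (sym ∑-suc))

  eval-det : ∀ n (P : Fin n → Fin n → Poly) → eval (Det.det Polyops n P) y ≡ det (λ i j → eval (P i j) y)
  eval-det n P = trans (det-related {opsR = Polyops} {opsS = ℤops} (λ p a → eval p y ≡ a) refl
    (trans (cong (1ℤ +_) (ℤₚ.*-zeroʳ y)) refl)
    (λ {p} {_} {q} e f → trans (eval-+p p q) (cong₂ _+_ e f)) (λ {p} {_} {q} e f → trans (eval-*p p q) (cong₂ _*_ e f))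
    (λ {p} e → trans (eval-negP p) (cong -_ e)) n P _ (λ _ _ → refl)) (sym det-detℤ)

coeff-+p : ∀ p q k → coeff (p +p q) k ≡ coeff p k + coeff q k
coeff-+p []      q       k       = sym (ℤₚ.+-identityˡ (coeff q k))
coeff-+p (a ∷ p) []      k       = sym (ℤₚ.+-identityʳ (coeff (a ∷ p) k))
coeff-+p (a ∷ p) (b ∷ q) zero    = refl
coeff-+p (a ∷ p) (b ∷ q) (suc k) = coeff-+p p q k

coeff-scale : ∀ c p k → coeff (scaleP c p) k ≡ c * coeff p k
coeff-scale c []      k       = sym (ℤₚ.*-zeroʳ c)
coeff-scale c (a ∷ p) zero    = refl
coeff-scale c (a ∷ p) (suc k) = coeff-scale c p k

coeff-negP : ∀ p k → coeff (negP p) k ≡ - coeff p k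
coeff-negP []      k       = refl
coeff-negP (a ∷ p) zero    = refl
coeff-negP (a ∷ p) (suc k) = coeff-negP p k

coeff-sum : ∀ n (f : Fin n → Poly) k → coeff (Det.sumFin Polyops n f) k ≡ ∑ (λ i → coeff (f i) k)
coeff-sum zero    f k = sym ∑-nil
coeff-sum (suc n) f k = trans (coeff-+p (f zero) _ k) (trans (cong (coeff (f zero) k +_) (coeff-sum n (f ∘ suc) k)) (sym ∑-suc))

coeff-sgn : ∀ s p k → coeff (Det.sgn Polyops s p) k ≡ signPow s * coeff p k
coeff-sgn zero    p k = sym (ℤₚ.*-identityˡ (coeff p k))
coeff-sgn (suc s) p k = trans (coeff-negP (Det.sgn Polyops s p) k)
  (trans (cong -_ (coeff-sgn s p k)) (ℤₚ.neg-distribˡ-* (signPow s) (coeff p k)))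

coeff-beyond : ∀ p {k} → length p ℕ.≤ k → coeff p k ≡ 0ℤ
coeff-beyond []      _ = refl
coeff-beyond (a ∷ p) (s≤s h) = coeff-beyond p h

coeff-drop : ∀ m p k → coeff (drop m p) k ≡ coeff p (m ℕ.+ k)
coeff-drop zero    p       k = refl
coeff-drop (suc m) []      k = refl
coeff-drop (suc m) (a ∷ p) k = coeff-drop m p k

-- A constant term divisible by a larger integer vanishes.
eval-zero : ∀ p → (∀ k → eval p (int (suc k)) ≡ 0ℤ) → ∀ m → coeff p m ≡ 0ℤ
eval-zero []      h m = refl
eval-zero (a ∷ p) h = go
  where
  large : ∀ e → a + int (suc ∣ a ∣) * e ≡ 0ℤ → a ≡ 0ℤ
  large e eq = cases ∣ e ∣ refl
    where
    open ≡-Reasoning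
    N = int (suc ∣ a ∣)
    g : ∀ a x → a ≡ (a + x) - x
    g = solve-∀
    size : ∣ a ∣ ≡ suc ∣ a ∣ ℕ.* ∣ e ∣
    size = begin
      ∣ a ∣ ≡⟨ cong ∣_∣ (trans (g a (N * e)) (trans (cong (_- N * e) eq) (ℤₚ.+-identityˡ (- (N * e))))) ⟩
      ∣ - (N * e) ∣ ≡⟨ ℤₚ.∣-i∣≡∣i∣ (N * e) ⟩
      ∣ N * e ∣ ≡⟨ ℤₚ.abs-* N e ⟩
      suc ∣ a ∣ ℕ.* ∣ e ∣ ∎
    cases : ∀ k → ∣ e ∣ ≡ k → a ≡ 0ℤ
    cases zero    ee = ℤₚ.∣i∣≡0⇒i≡0 (trans size (trans (cong (suc ∣ a ∣ ℕ.*_) ee) (ℕₚ.*-zeroʳ ∣ a ∣)))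
    cases (suc k) ee = ⊥-elim (ℕₚ.<-irrefl (trans size (cong (suc ∣ a ∣ ℕ.*_) ee)) (ℕₚ.m≤m*n (suc ∣ a ∣) (suc k)))
  a≡0 : a ≡ 0ℤ
  a≡0 = large (eval p (int (suc ∣ a ∣))) (h ∣ a ∣)
  go : ∀ m → coeff (a ∷ p) m ≡ 0ℤ
  go zero    = a≡0
  go (suc m) = eval-zero p (λ k → *-zero-cases (int (suc k)) (λ ()) (trans (sym (ℤₚ.+-identityˡ (int (suc k) * eval p (int (suc k))))) (trans (cong (_+ int (suc k) * eval p (int (suc k))) (sym a≡0)) (h k)))) m

poly-ext : ∀ p q → (∀ k → eval p (int (suc k)) ≡ eval q (int (suc k))) → p ≈p q
poly-ext p q h m = minus (trans (sym (trans (coeff-+p p (negP q) m) (cong (coeff p m +_) (coeff-negP q m))))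
  (eval-zero (p +p negP q) (λ k → trans (eval-+p _ p (negP q)) (trans (cong₂ _+_ (h k) (eval-negP _ q)) (ℤₚ.+-inverseʳ (eval q (int (suc k)))))) m))
  where
  minus : ∀ {a b} → a + - b ≡ 0ℤ → a ≡ b
  minus {a} {b} e = ℤₚ.i-j≡0⇒i≡j a b e

∑-linear : ∀ {l m n} {L : Vect m → Vect n} → Linear L → ∀ (u : Vect l) (U : Rows l m) →
           L (λ i → ∑ (λ k → u k * U k i)) ≗ (λ i → ∑ (λ k → u k * L (U k) i))
∑-linear {zero} {L = L} lin u U i = begin
  L (λ i → ∑ (λ k → u k * U k i)) i ≡⟨ l-cong (λ j → trans ∑-nil refl) i ⟩
  L (λ j → 0ℤ * 0ℤ + 0ℤ * 0ℤ) i ≡⟨ l-comb 0ℤ 0ℤ 0ᵛ 0ᵛ i ⟩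
  0ℤ * L 0ᵛ i + 0ℤ * L 0ᵛ i ≡⟨ g (L 0ᵛ i) ⟩
  0ℤ ≡⟨ sym ∑-nil ⟩
  ∑ (λ k → u k * L (U k) i) ∎
  where
  open ≡-Reasoning
  open Linear lin
  g : ∀ a → 0ℤ * a + 0ℤ * a ≡ 0ℤ
  g = solve-∀
∑-linear {suc l} {L = L} lin u U i = begin
  L (λ i → ∑ (λ k → u k * U k i)) i ≡⟨ l-cong (λ j → trans ∑-suc (cong (u zero * U zero j +_) (sym (ℤₚ.*-identityˡ (T j))))) i ⟩
  L (λ j → u zero * U zero j + 1ℤ * T j) i ≡⟨ l-comb (u zero) 1ℤ (U zero) T i ⟩
  u zero * L (U zero) i + 1ℤ * L T i ≡⟨ cong (u zero * L (U zero) i +_) (trans (ℤₚ.*-identityˡ (L T i)) (∑-linear lin (u ∘ suc) (U ∘ suc) i)) ⟩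
  u zero * L (U zero) i + ∑ (λ k → u (suc k) * L (U (suc k)) i) ≡⟨ sym ∑-suc ⟩
  ∑ (λ k → u k * L (U k) i) ∎
  where
  open ≡-Reasoning
  open Linear lin
  T : Vect _
  T j = ∑ (λ k → u (suc k) * U (suc k) j)

▹-linear : ∀ {n} (M : Mat n) → Linear (M ▹_)
▹-linear M = record
  { l-cong = ▹-cong M
  ; l-comb = λ x y u v i → trans (∑-cong (λ j → g x y (M i j) (u j) (v j))) (∑-lin x y (λ j → M i j * u j) (λ j → M i j * v j)) }
  where
  g : ∀ x y m u v → m * (x * u + y * v) ≡ x * (m * u) + y * (m * v)
  g = solve-∀

-- Horner's scheme for p(M)v. Polynomials in a matrix appear only through their action on vectors.
act : ∀ {n} → Poly → Mat n → Vect n → Vect n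
act []      M v = 0ᵛ
act (a ∷ p) M v = λ i → a * v i + (M ▹ act p M v) i

act-linear : ∀ {n} p (M : Mat n) → Linear (act p M)
act-linear [] M = record { l-cong = λ h i → refl ; l-comb = λ x y u v i → g x y }
  where
  g : ∀ x y → 0ℤ ≡ x * 0ℤ + y * 0ℤ
  g = solve-∀
act-linear (a ∷ p) M = record
  { l-cong = λ h i → cong₂ (λ x y → a * x + y) (h i) (▹-cong M (P.l-cong h) i)
  ; l-comb = λ x y u v i → trans (cong (a * (x * u i + y * v i) +_) (trans (▹-cong M (P.l-comb x y u v) i) (Linear.l-comb (▹-linear M) x y (act p M u) (act p M v) i)))
      (g a x y (u i) (v i) ((M ▹ act p M u) i) ((M ▹ act p M v) i)) }
  where
  module P = Linear (act-linear p M)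
  g : ∀ a x y u v s t → a * (x * u + y * v) + (x * s + y * t) ≡ x * (a * u + s) + y * (a * v + t)
  g = solve-∀

linear-0 : ∀ {m n} {L : Vect m → Vect n} → Linear L → L 0ᵛ ≗ 0ᵛ
linear-0 {L = L} lin i = trans (Linear.l-comb lin 0ℤ 0ℤ 0ᵛ 0ᵛ i) (g (L 0ᵛ i))
  where
  g : ∀ a → 0ℤ * a + 0ℤ * a ≡ 0ℤ
  g = solve-∀

mod0⇒≡ : ∀ {a b} → a ≡ b [mod 0ℤ ] → a ≡ b
mod0⇒≡ {b = b} (wit k refl) = h b k
  where
  h : ∀ b k → b + k * 0ℤ ≡ b
  h = solve-∀

act-coeffs-mod : ∀ {N n} p q (M : Mat n) v → (∀ k → coeff p k ≡ coeff q k [mod N ]) → ∀ i → act p M v i ≡ act q M v i [mod N ]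
act-coeffs-mod [] [] M v h i = mod-refl
act-coeffs-mod [] (b ∷ q) M v h i = mod-cong₂ (sym (trans (ℤₚ.+-identityʳ _) (ℤₚ.*-zeroˡ (v i)))) refl
  (mod-+ (mod-* (h zero) mod-refl) (subst (λ z → z ≡ (M ▹ act q M v) i [mod _ ]) (linear-0 (▹-linear M) i) (▹-mod M (act-coeffs-mod [] q M v (h ∘ suc)) i)))
act-coeffs-mod (a ∷ p) [] M v h i = mod-cong₂ refl (sym (trans (ℤₚ.+-identityʳ _) (ℤₚ.*-zeroˡ (v i))))
  (mod-+ (mod-* (h zero) mod-refl) (subst (λ z → (M ▹ act p M v) i ≡ z [mod _ ]) (linear-0 (▹-linear M) i) (▹-mod M (act-coeffs-mod p [] M v (h ∘ suc)) i)))
act-coeffs-mod (a ∷ p) (b ∷ q) M v h i = mod-+ (mod-* (h zero) mod-refl) (▹-mod M (act-coeffs-mod p q M v (h ∘ suc)) i)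

act-≈p : ∀ {n} p q (M : Mat n) v → p ≈p q → act p M v ≗ act q M v
act-≈p p q M v h i = mod0⇒≡ (act-coeffs-mod p q M v (λ k → ≡⇒mod (h k)) i)

eval-≈p : ∀ p q y → p ≈p q → eval p y ≡ eval q y
eval-≈p [] [] y h = refl
eval-≈p [] (b ∷ q) y h = sym (trans (cong₂ (λ s t → s + y * t) (sym (h zero)) (sym (eval-≈p [] q y (h ∘ suc)))) (trans (ℤₚ.+-identityˡ _) (ℤₚ.*-zeroʳ y)))
eval-≈p (a ∷ p) [] y h = trans (cong₂ (λ s t → s + y * t) (h zero) (eval-≈p p [] y (h ∘ suc))) (trans (ℤₚ.+-identityˡ _) (ℤₚ.*-zeroʳ y))
eval-≈p (a ∷ p) (b ∷ q) y h = cong₂ (λ s t → s + y * t) (h zero) (eval-≈p p q y (h ∘ suc))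

charEntry : ∀ {n} → Mat n → Fin n → Fin n → Poly
charEntry M i j = if toℕ i ℕ.≡ᵇ toℕ j then (- M i j) ∷ 1ℤ ∷ [] else (- M i j) ∷ []

shift : ∀ {n} → Mat n → ℤ → Mat n
shift M y i j = y * δ i j - M i j

δ-≡ᵇ : ∀ {m n} (i : Fin m) (j : Fin n) → δ i j ≡ (if toℕ i ℕ.≡ᵇ toℕ j then 1ℤ else 0ℤ)
δ-≡ᵇ zero    zero    = refl
δ-≡ᵇ zero    (suc j) = refl
δ-≡ᵇ (suc i) zero    = refl
δ-≡ᵇ (suc i) (suc j) = δ-≡ᵇ i j

eval-charEntry : ∀ {n} (M : Mat n) y i j → eval (charEntry M i j) y ≡ shift M y i j
eval-charEntry M y i j rewrite δ-≡ᵇ i j with toℕ i ℕ.≡ᵇ toℕ j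
... | true  = g (M i j) y
  where
  g : ∀ m y → - m + y * (1ℤ + y * 0ℤ) ≡ y * 1ℤ - m
  g = solve-∀
... | false = g (M i j) y
  where
  g : ∀ m y → - m + y * 0ℤ ≡ y * 0ℤ - m
  g = solve-∀

eval-charPoly : ∀ n (M : Mat n) y → eval (charPoly n M) y ≡ det (shift M y)
eval-charPoly n M y = trans (eval-det y n (charEntry M)) (det-cong n (eval-charEntry M y))

data Affine : Poly → Set where
  const-affine : ∀ a → Affine (a ∷ [])
  affine : ∀ a b → Affine (a ∷ b ∷ [])

charEntry-affine : ∀ {n} (M : Mat n) i j → Affine (charEntry M i j)
charEntry-affine M i j with toℕ i ℕ.≡ᵇ toℕ j
... | true  = affine (- M i j) 1ℤ
... | false = const-affine (- M i j)

coeff-0 : ∀ k → coeff (0ℤ ∷ []) k ≡ 0ℤ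
coeff-0 zero = refl
coeff-0 (suc k) = refl

coeff-affine-* : ∀ {m} → Affine m → ∀ q k → coeff (m *p q) (suc k) ≡ coeff m 0 * coeff q (suc k) + coeff m 1 * coeff q k
coeff-affine-* (const-affine a) q k = trans (coeff-+p (scaleP a q) (0ℤ ∷ []) (suc k))
  (trans (cong (_+ 0ℤ) (coeff-scale a q (suc k))) (g a (coeff q (suc k)) (coeff q k)))
  where
  g : ∀ a x y → a * x + 0ℤ ≡ a * x + 0ℤ * y
  g = solve-∀
coeff-affine-* (affine a b) q k = trans (coeff-+p (scaleP a q) (0ℤ ∷ (scaleP b q +p (0ℤ ∷ []))) (suc k))
  (cong₂ _+_ (coeff-scale a q (suc k)) (trans (coeff-+p (scaleP b q) (0ℤ ∷ []) k) (trans (cong₂ _+_ (coeff-scale b q k) (coeff-0 k)) (ℤₚ.+-identityʳ _))))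

-- Both claims go through one induction: the leading coefficient of the expansion is clean only
-- because the minors have no coefficient beyond their own order.
det-affine : ∀ n (P : Fin n → Fin n → Poly) → (∀ i j → Affine (P i j)) →
             (coeff (Det.det Polyops n P) n ≡ det (λ i j → coeff (P i j) 1)) ×
             (∀ k → n ℕ.< k → coeff (Det.det Polyops n P) k ≡ 0ℤ)
det-affine zero P h = sym det-nil , λ { (suc k) (s≤s _) → refl }
det-affine (suc n) P h = leading , higher
  where
  d : Fin (suc n) → Poly
  d j = Det.det Polyops n (λ r c → P (suc r) (punchIn j c))
  IH : ∀ j → _
  IH j = det-affine n (λ r c → P (suc r) (punchIn j c)) (λ r c → h (suc r) (punchIn j c))
  expand : ∀ k → coeff (Det.det Polyops (suc n) P) (suc k) ≡
           ∑ (λ j → signPow (toℕ j) * (coeff (P zero j) 0 * coeff (d j) (suc k) + coeff (P zero j) 1 * coeff (d j) k))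
  expand k = trans (coeff-sum (suc n) (λ j → Det.sgn Polyops (toℕ j) (P zero j *p d j)) (suc k))
    (∑-cong (λ j → trans (coeff-sgn (toℕ j) (P zero j *p d j) (suc k)) (cong (signPow (toℕ j) *_) (coeff-affine-* (h zero j) (d j) k))))
  g : ∀ a b → a * 0ℤ + b ≡ b
  g = solve-∀
  z : ∀ s a b → s * (a * 0ℤ + b * 0ℤ) ≡ 0ℤ
  z = solve-∀
  leading : coeff (Det.det Polyops (suc n) P) (suc n) ≡ det (λ i j → coeff (P i j) 1)
  leading = trans (expand n) (trans (∑-cong (λ j → cong (signPow (toℕ j) *_)
    (trans (cong₂ (λ x y → coeff (P zero j) 0 * x + coeff (P zero j) 1 * y) (proj₂ (IH j) (suc n) ℕₚ.≤-refl) (proj₁ (IH j)))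
      (g (coeff (P zero j) 0) _)))) (sym (det-laplace n (λ i j → coeff (P i j) 1))))
  higher : ∀ k → suc n ℕ.< k → coeff (Det.det Polyops (suc n) P) k ≡ 0ℤ
  higher (suc k) (s≤s n<k) = trans (expand k) (∑-0 (λ j → trans (cong₂ (λ x y → signPow (toℕ j) * (coeff (P zero j) 0 * x + coeff (P zero j) 1 * y))
    (proj₂ (IH j) (suc k) (ℕₚ.m≤n⇒m≤1+n n<k)) (proj₂ (IH j) k n<k)) (z (signPow (toℕ j)) (coeff (P zero j) 0) (coeff (P zero j) 1))))

charPoly-monic : ∀ n (M : Mat n) → coeff (charPoly n M) n ≡ 1ℤ
charPoly-monic n M = trans (proj₁ (det-affine n (charEntry M) (charEntry-affine M))) (trans (det-cong n eq) (det-δ n))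
  where
  eq : ∀ i j → coeff (charEntry M i j) 1 ≡ δ i j
  eq i j rewrite δ-≡ᵇ i j with toℕ i ℕ.≡ᵇ toℕ j
  ... | true  = refl
  ... | false = refl

charPoly-degree : ∀ n (M : Mat n) k → n ℕ.< k → coeff (charPoly n M) k ≡ 0ℤ
charPoly-degree n M = proj₂ (det-affine n (charEntry M) (charEntry-affine M))

infix 7 _∙_
_∙_ : ∀ {n} → Vect n → Vect n → ℤ
u ∙ v = ∑ (λ i → u i * v i)

∙-comm : ∀ {n} (u v : Vect n) → u ∙ v ≡ v ∙ u
∙-comm u v = ∑-cong (λ i → ℤₚ.*-comm (u i) (v i))

∙-cong : ∀ {n} {u v w z : Vect n} → u ≗ v → w ≗ z → u ∙ w ≡ v ∙ z
∙-cong h g = ∑-cong (λ i → cong₂ _*_ (h i) (g i))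

∙-combʳ : ∀ {n} x y (w u v : Vect n) → w ∙ (λ k → x * u k + y * v k) ≡ x * (w ∙ u) + y * (w ∙ v)
∙-combʳ x y w u v = trans (∑-cong (λ i → g x y (w i) (u i) (v i))) (∑-lin x y (λ i → w i * u i) (λ i → w i * v i))
  where
  g : ∀ x y w u v → w * (x * u + y * v) ≡ x * (w * u) + y * (w * v)
  g = solve-∀

∙-0ʳ : ∀ {n} (w : Vect n) {u} → u ≗ 0ᵛ → w ∙ u ≡ 0ℤ
∙-0ʳ w h = ∑-0 (λ i → trans (cong (w i *_) (h i)) (ℤₚ.*-zeroʳ (w i)))

∙-mod0 : ∀ {n N} (w : Vect n) {u} → (∀ i → u i ≡ 0ℤ [mod N ]) → w ∙ u ≡ 0ℤ [mod N ]
∙-mod0 w h = ∑-mod0 (λ i → mod-*0 (w i) (h i))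

Symmetric : ∀ {n} → Mat n → Set
Symmetric M = ∀ i j → M i j ≡ M j i

adjoint : ∀ {n} (M : Mat n) u v → (M ▹ u) ∙ v ≡ u ∙ ((M ᵗ) ▹ v)
adjoint M u v = begin
  ∑ (λ i → ∑ (λ j → M i j * u j) * v i) ≡⟨ ∑-cong (λ i → sym (∑-*ʳ (v i) (λ j → M i j * u j))) ⟩
  ∑ (λ i → ∑ (λ j → (M i j * u j) * v i)) ≡⟨ ∑-swap (λ i j → (M i j * u j) * v i) ⟩
  ∑ (λ j → ∑ (λ i → (M i j * u j) * v i)) ≡⟨ ∑-cong (λ j → trans (∑-cong (λ i → g (M i j) (u j) (v i))) (∑-*ˡ (u j) (λ i → M i j * v i))) ⟩
  ∑ (λ j → u j * ∑ (λ i → M i j * v i)) ∎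
  where
  open ≡-Reasoning
  g : ∀ m u v → (m * u) * v ≡ u * (m * v)
  g = solve-∀

selfAdjoint : ∀ {n} {M : Mat n} → Symmetric M → ∀ u v → (M ▹ u) ∙ v ≡ u ∙ (M ▹ v)
selfAdjoint {M = M} s u v = trans (adjoint M u v) (∙-cong {u = u} (λ _ → refl) (▹-congˡ v (λ i j → s j i)))

▹-δ : ∀ {n} (M : Mat n) k → M ▹ δ k ≗ (λ i → M i k)
▹-δ M k i = trans (∑-cong (λ j → cong (M i j *_) (δ-sym k j))) (∑-δʳ k (M i))

▹-0 : ∀ {n} (M : Mat n) {v} → v ≗ 0ᵛ → M ▹ v ≗ 0ᵛ
▹-0 M h i = trans (▹-cong M h i) (linear-0 (▹-linear M) i)

-- ρ M p w u lists the numbers wᵀ pₖ(M) u, where pₖ is p with its first k+1 coefficients dropped.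
ρ : ∀ {n} → Mat n → Poly → Vect n → Vect n → Poly
ρ M []      w u = []
ρ M (a ∷ p) w u = w ∙ act p M u ∷ ρ M p w u

coeff-ρ : ∀ {n} (M : Mat n) p w u m → coeff (ρ M p w u) m ≡ w ∙ act (drop (suc m) p) M u
coeff-ρ M []      w u m       = sym (∙-0ʳ w (λ _ → refl))
coeff-ρ M (a ∷ p) w u zero    = refl
coeff-ρ M (a ∷ p) w u (suc m) = coeff-ρ M p w u m

-- Comparing coefficients in (xI - M) adj(xI - M) = χ gives this recursion for the coefficient
-- vectors of a column of the adjugate. They vanish in high degree, so running the recursion
-- downwards identifies them as the Horner tails of χ.
horner-unique : ∀ {n} (M : Mat n) p e (v : ℕ → Vect n) → (∀ m i → v m i ≡ coeff p m * e i + (M ▹ v (suc m)) i) →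
                (B : ℕ) → (∀ m → B ℕ.≤ m → v m ≗ 0ᵛ) → v 0 ≗ act p M e
horner-unique M [] e v h B bound = descend B bound
  where
  descend : ∀ B → (∀ m → B ℕ.≤ m → v m ≗ 0ᵛ) → v 0 ≗ 0ᵛ
  descend zero    b = b 0 z≤n
  descend (suc B) b = descend B next
    where
    next : ∀ m → B ℕ.≤ m → v m ≗ 0ᵛ
    next m le i = trans (h m i) (trans (cong₂ _+_ (ℤₚ.*-zeroˡ (e i)) (▹-0 M (b (suc m) (s≤s le)) i)) refl)
horner-unique M (a ∷ p) e v h B bound i =
  trans (h 0 i) (cong (a * e i +_) (▹-cong M (horner-unique M p e (v ∘ suc) (λ m → h (suc m)) B (λ m le → bound (suc m) (ℕₚ.m≤n⇒m≤1+n le))) i))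

lengths-bounded : ∀ n (f : Fin n → Poly) → Σ ℕ λ B → ∀ i m → B ℕ.≤ m → coeff (f i) m ≡ 0ℤ
lengths-bounded zero    f = 0 , λ ()
lengths-bounded (suc n) f with lengths-bounded n (f ∘ suc)
... | B , h = length (f zero) ℕ.+ B , bounded
  where
  bounded : ∀ i m → length (f zero) ℕ.+ B ℕ.≤ m → coeff (f i) m ≡ 0ℤ
  bounded zero    m le = coeff-beyond (f zero) (ℕₚ.≤-trans (ℕₚ.m≤m+n (length (f zero)) B) le)
  bounded (suc i) m le = h i m (ℕₚ.≤-trans (ℕₚ.m≤n+m B (length (f zero))) le)

module _ {n : ℕ} (M : Mat n) where
  private
    χ' = charPoly n M

    bdP : Fin n → Fin n → Fin (suc n) → Fin (suc n) → Poly
    bdP j k = bd [] (λ c → δ j c ∷ []) (λ r → δ k r ∷ []) (charEntry M)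

    adjPoly : Fin n → Fin n → Poly
    adjPoly j k = negP (Det.det Polyops (suc n) (bdP j k))

    eval-const : ∀ a y → a + y * 0ℤ ≡ a
    eval-const = solve-∀

  eval-adjPoly : ∀ j k y → eval (adjPoly j k) y ≡ adjugate (shift M y) j k
  eval-adjPoly j k y = trans (eval-negP y (Det.det Polyops (suc n) (bdP j k)))
    (cong -_ (trans (eval-det y (suc n) (bdP j k)) (det-cong (suc n) entry)))
    where
    entry : ∀ r c → eval (bdP j k r c) y ≡ bd 0ℤ (δ j) (δ k) (shift M y) r c
    entry zero    zero    = refl
    entry zero    (suc c) = eval-const (δ j c) y
    entry (suc r) zero    = eval-const (δ k r) y
    entry (suc r) (suc c) = eval-charEntry M y r c

  private
    shift-⊗ : ∀ y (N : Mat n) i k → (shift M y ⊗ N) i k ≡ y * N i k - ∑ (λ j → M i j * N j k)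
    shift-⊗ y N i k = begin
      ∑ (λ j → (y * δ i j - M i j) * N j k) ≡⟨ ∑-cong (λ j → g y (δ i j) (M i j) (N j k)) ⟩
      ∑ (λ j → y * (δ i j * N j k) + -1ℤ * (M i j * N j k)) ≡⟨ ∑-lin y -1ℤ (λ j → δ i j * N j k) (λ j → M i j * N j k) ⟩
      y * ∑ (λ j → δ i j * N j k) + -1ℤ * ∑ (λ j → M i j * N j k) ≡⟨ cong₂ (λ a b → y * a + b) (∑-δˡ i (λ j → N j k)) (ℤₚ.-1*i≡-i _) ⟩
      y * N i k - ∑ (λ j → M i j * N j k) ∎
      where
      open ≡-Reasoning
      g : ∀ y d m x → (y * d - m) * x ≡ y * (d * x) + - 1ℤ * (m * x)
      g = solve-∀

    lhs : Fin n → Fin n → Poly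
    lhs i k = (0ℤ ∷ adjPoly i k) +p negP (Det.sumFin Polyops n (λ j → scaleP (M i j) (adjPoly j k)))

    identity : ∀ i k → lhs i k ≈p scaleP (δ k i) χ'
    identity i k = poly-ext (lhs i k) (scaleP (δ k i) χ') pt
      where
      open ≡-Reasoning
      pt : ∀ t → eval (lhs i k) (int (suc t)) ≡ eval (scaleP (δ k i) χ') (int (suc t))
      pt t = begin
        eval (lhs i k) y ≡⟨ eval-+p y (0ℤ ∷ adjPoly i k) (negP (Det.sumFin Polyops n (λ j → scaleP (M i j) (adjPoly j k)))) ⟩
        (0ℤ + y * eval (adjPoly i k) y) + eval (negP (Det.sumFin Polyops n (λ j → scaleP (M i j) (adjPoly j k)))) y
          ≡⟨ cong₂ _+_ (trans (ℤₚ.+-identityˡ _) (cong (y *_) (eval-adjPoly i k y))) (trans (eval-negP y (Det.sumFin Polyops n (λ j → scaleP (M i j) (adjPoly j k))))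
               (cong -_ (trans (eval-sum y n _) (∑-cong (λ j → trans (eval-scale y (M i j) (adjPoly j k)) (cong (M i j *_) (eval-adjPoly j k y))))))) ⟩
        y * adjugate S i k - ∑ (λ j → M i j * adjugate S j k) ≡⟨ sym (shift-⊗ y (adjugate S) i k) ⟩
        (S ⊗ adjugate S) i k ≡⟨ ⊗-adj S i k ⟩
        det S * δ k i ≡⟨ ℤₚ.*-comm (det S) (δ k i) ⟩
        δ k i * det S ≡⟨ cong (δ k i *_) (sym (eval-charPoly n M y)) ⟩
        δ k i * eval χ' y ≡⟨ sym (eval-scale y (δ k i) χ') ⟩
        eval (scaleP (δ k i) χ') y ∎
        where
        y = int (suc t)
        S = shift M y

    -- Column k of adj(xI - M) with its coefficients shifted by one: index m holds the coefficient
    -- of x to the m-1. The zero at index 0 is then exactly the Cayley-Hamilton theorem, by `V-act`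
    -- with m = 0.
    V : Fin n → ℕ → Vect n
    V k zero    = 0ᵛ
    V k (suc m) i = coeff (adjPoly i k) m

    V-step : ∀ k m i → V k m i ≡ coeff χ' m * δ k i + (M ▹ V k (suc m)) i
    V-step k m i = solveFor {c = coeff χ' m} {d = δ k i} (trans (sym (trans (coeff-+p (0ℤ ∷ adjPoly i k) (negP S) m)
        (cong₂ _+_ (first m) (trans (coeff-negP S m) (cong -_ (trans (coeff-sum n (λ j → scaleP (M i j) (adjPoly j k)) m) (∑-cong (λ j → coeff-scale (M i j) (adjPoly j k) m))))))))
      (trans (identity i k m) (coeff-scale (δ k i) χ' m)))
      where
      S = Det.sumFin Polyops n (λ j → scaleP (M i j) (adjPoly j k))
      first : ∀ m → coeff (0ℤ ∷ adjPoly i k) m ≡ V k m i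
      first zero    = refl
      first (suc m) = refl
      solveFor : ∀ {a b c d} → a + - b ≡ d * c → a ≡ c * d + b
      solveFor {a} {b} {c} {d} e = trans (g a b) (trans (cong (_+ b) e) (cong (_+ b) (ℤₚ.*-comm d c)))
        where
        g : ∀ a b → a ≡ (a + - b) + b
        g = solve-∀

    V-bound : ∀ k → Σ ℕ λ B → ∀ m → B ℕ.≤ m → V k m ≗ 0ᵛ
    V-bound k with lengths-bounded n (λ i → adjPoly i k)
    ... | B , h = suc B , λ { (suc m) (s≤s le) i → h i m le }

    V-act : ∀ k m → V k m ≗ act (drop m χ') M (δ k)
    V-act k m = subst (λ z → V k z ≗ act (drop m χ') M (δ k)) (ℕₚ.+-identityʳ m)
      (horner-unique M (drop m χ') (δ k) (λ l → V k (m ℕ.+ l)) step (proj₁ (V-bound k))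
        (λ l le → proj₂ (V-bound k) (m ℕ.+ l) (ℕₚ.≤-trans le (ℕₚ.m≤n+m l m))))
      where
      step : ∀ l i → V k (m ℕ.+ l) i ≡ coeff (drop m χ') l * δ k i + (M ▹ V k (m ℕ.+ suc l)) i
      step l i = trans (V-step k (m ℕ.+ l) i) (cong₂ (λ a b → a * δ k i + (M ▹ V k b) i) (sym (coeff-drop m χ' l)) (sym (ℕₚ.+-suc m l)))

  expand-δ : ∀ p w → act p M w ≗ (λ i → ∑ (λ k → w k * act p M (δ k) i))
  expand-δ p w i = trans (Linear.l-cong (act-linear p M) (λ j → sym (∑-δʳ j w)) i) (∑-linear (act-linear p M) w δ i)

  cayley-hamilton : ∀ w → act (charPoly n M) M w ≗ 0ᵛ
  cayley-hamilton w i = trans (expand-δ χ' w i) (∑-0 (λ k → trans (cong (w k *_) (sym (V-act k 0 i))) (ℤₚ.*-zeroʳ (w k))))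

  -- Since the coefficients of adj(xI - M) are the Horner tails of χ at M, the effect of a rank-one
  -- update on χ becomes a list of numbers wᵀχₖ(M)u. Both the derivative in the direction u uᵀ and
  -- the passage to the complement use this.
  β-shift : ∀ w u y → β (shift M y) w u ≡ eval (ρ M (charPoly n M) w u) y
  β-shift w u y = begin
    β (shift M y) w u ≡⟨ β-adj (shift M y) w u ⟩
    ∑ (λ k → u k * ∑ (λ j → w j * adjugate (shift M y) j k))
      ≡⟨ ∑-cong (λ k → cong (u k *_) (∑-cong (λ j → cong (w j *_) (sym (eval-adjPoly j k y))))) ⟩
    ∑ (λ k → u k * ∑ (λ j → w j * eval (adjPoly j k) y))
      ≡⟨ sym (trans (eval-sum y n (λ k → scaleP (u k) (R k))) (∑-cong (λ k → trans (eval-scale y (u k) (R k)) (cong (u k *_)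
           (trans (eval-sum y n (λ j → scaleP (w j) (adjPoly j k))) (∑-cong (λ j → eval-scale y (w j) (adjPoly j k)))))))) ⟩
    eval Q y ≡⟨ eval-≈p Q (ρ M χ' w u) y coeffs ⟩
    eval (ρ M χ' w u) y ∎
    where
    open ≡-Reasoning
    R : Fin n → Poly
    R k = Det.sumFin Polyops n (λ j → scaleP (w j) (adjPoly j k))
    Q : Poly
    Q = Det.sumFin Polyops n (λ k → scaleP (u k) (R k))
    coeffs : Q ≈p ρ M χ' w u
    coeffs m = begin
      coeff Q m ≡⟨ trans (coeff-sum n (λ k → scaleP (u k) (R k)) m) (∑-cong (λ k → trans (coeff-scale (u k) (R k) m) (cong (u k *_)
                     (trans (coeff-sum n (λ j → scaleP (w j) (adjPoly j k)) m) (∑-cong (λ j → coeff-scale (w j) (adjPoly j k) m)))))) ⟩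
      ∑ (λ k → u k * ∑ (λ j → w j * V k (suc m) j)) ≡⟨ ∑-cong (λ k → sym (∑-*ˡ (u k) (λ j → w j * V k (suc m) j))) ⟩
      ∑ (λ k → ∑ (λ j → u k * (w j * V k (suc m) j))) ≡⟨ ∑-swap (λ k j → u k * (w j * V k (suc m) j)) ⟩
      ∑ (λ j → ∑ (λ k → u k * (w j * V k (suc m) j)))
        ≡⟨ ∑-cong (λ j → trans (∑-cong (λ k → trans (g (u k) (w j) (V k (suc m) j)) (cong (λ z → w j * (u k * z)) (V-act k (suc m) j)))) (trans (∑-*ˡ (w j) (λ k → u k * act (drop (suc m) χ') M (δ k) j)) (cong (w j *_) (sym (expand-δ (drop (suc m) χ') u j))))) ⟩
      w ∙ act (drop (suc m) χ') M u ≡⟨ sym (coeff-ρ M χ' w u m) ⟩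
      coeff (ρ M χ' w u) m ∎
      where
      g : ∀ u w v → u * (w * v) ≡ w * (u * v)
      g = solve-∀

charPoly-rank1 : ∀ {n} (M : Mat n) c u w → charPoly n (λ i j → M i j + c * (u i * w j)) ≈p (charPoly n M +p scaleP (- c) (ρ M (charPoly n M) w u))
charPoly-rank1 {n} M c u w = poly-ext (charPoly n M') (charPoly n M +p scaleP (- c) (ρ M (charPoly n M) w u)) pt
  where
  open ≡-Reasoning
  M' : Mat n
  M' i j = M i j + c * (u i * w j)
  pt : ∀ k → eval (charPoly n M') (int (suc k)) ≡ eval (charPoly n M +p scaleP (- c) (ρ M (charPoly n M) w u)) (int (suc k))
  pt k = begin
    eval (charPoly n M') y ≡⟨ eval-charPoly n M' y ⟩
    det (shift M' y) ≡⟨ det-cong n (λ i j → g (y * δ i j) (M i j) c (u i) (w j)) ⟩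
    det (λ i j → shift M y i j - u i * (c * w j)) ≡⟨ det-rank1 (shift M y) u (λ j → c * w j) ⟩
    det (shift M y) - β (shift M y) (λ j → c * w j) u ≡⟨ cong₂ _-_ (sym (eval-charPoly n M y)) (trans (β-shift M (λ j → c * w j) u y) (scaled (charPoly n M))) ⟩
    eval χ₀ y - c * eval (ρ M χ₀ w u) y ≡⟨ h (eval χ₀ y) c (eval (ρ M χ₀ w u) y) ⟩
    eval χ₀ y + (- c) * eval (ρ M χ₀ w u) y ≡⟨ sym (trans (eval-+p y χ₀ _) (cong (eval χ₀ y +_) (eval-scale y (- c) (ρ M χ₀ w u)))) ⟩
    eval (χ₀ +p scaleP (- c) (ρ M χ₀ w u)) y ∎
    where
    y = int (suc k)
    χ₀ = charPoly n M
    g : ∀ a m c u w → a - (m + c * (u * w)) ≡ (a - m) - u * (c * w)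
    g = solve-∀
    h : ∀ a c r → a - c * r ≡ a + (- c) * r
    h = solve-∀
    scaled : ∀ p → eval (ρ M p (λ j → c * w j) u) y ≡ c * eval (ρ M p w u) y
    scaled [] = sym (ℤₚ.*-zeroʳ c)
    scaled (a ∷ p) = trans (cong₂ (λ s t → s + y * t) (trans (∑-cong (λ i → ℤₚ.*-assoc c (w i) (act p M u i))) (∑-*ˡ c (λ i → w i * act p M u i))) (scaled p))
      (f c (w ∙ act p M u) y (eval (ρ M p w u) y))
      where
      f : ∀ c a y r → c * a + y * (c * r) ≡ c * (a + y * r)
      f = solve-∀

-- Vectors with an isotropic Krylov space

∣⇒mod : ∀ {q a} → q ℕᵈ.∣ ∣ a ∣ → a ≡ 0ℤ [mod int q ]
∣⇒mod {q} {a} d with ℤᵈ.∣ᵤ⇒∣ {int q} {a} d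
... | divides k e = wit k (trans e (sym (ℤₚ.+-identityˡ (k * int q))))

mod⇒∣ : ∀ {q a} → a ≡ 0ℤ [mod int q ] → q ℕᵈ.∣ ∣ a ∣
mod⇒∣ {q} {a} (wit k e) = ℤᵈ.∣⇒∣ᵤ {int q} {a} (divides k (trans e (ℤₚ.+-identityˡ (k * int q))))

mod0? : ∀ q a → Dec (a ≡ 0ℤ [mod int q ])
mod0? q a with q ℕᵈ.∣? ∣ a ∣
... | yes d = yes (∣⇒mod d)
... | no ¬d = no (λ h → ¬d (mod⇒∣ h))

vanishes? : ∀ {n} q (v : Vect n) → (∀ i → v i ≡ 0ℤ [mod int q ]) ⊎ Σ (Fin n) (λ i → ¬ v i ≡ 0ℤ [mod int q ])
vanishes? q v with Finₚ.all? (λ i → mod0? q (v i))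
... | yes h = inj₁ h
... | no ¬h = inj₂ (Finₚ.¬∀⟶∃¬ _ _ (λ i → mod0? q (v i)) ¬h)

mod-cancel : ∀ {N b} c → c ≢ 0ℤ → c * b ≡ 0ℤ [mod c * N ] → b ≡ 0ℤ [mod N ]
mod-cancel {N} {b} c c≢0 (wit k e) = wit k (ℤₚ.i-j≡0⇒i≡j b (0ℤ + k * N) (*-zero-cases c c≢0 (trans (h c b k N) (ℤₚ.i≡j⇒i-j≡0 {c * b} {0ℤ + k * (c * N)} e))))
  where
  h : ∀ c b k N → c * (b - (0ℤ + k * N)) ≡ c * b - (0ℤ + k * (c * N))
  h = solve-∀

mod-scale : ∀ {N b} c → b ≡ 0ℤ [mod N ] → c * b ≡ 0ℤ [mod c * N ]
mod-scale {N} c (wit k refl) = wit k (h c k N)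
  where
  h : ∀ c k N → c * (0ℤ + k * N) ≡ 0ℤ + k * (c * N)
  h = solve-∀

mod-+0ʳ : ∀ {N a b} → b ≡ 0ℤ [mod N ] → a + b ≡ a [mod N ]
mod-+0ʳ {N} {a} {b} h = mod-trans (mod-+ (mod-refl {a = a}) h) (≡⇒mod (ℤₚ.+-identityʳ a))

mod-diff : ∀ {N a b} → a ≡ b [mod N ] → a - b ≡ 0ℤ [mod N ]
mod-diff {N} {a} {b} h = mod-trans (mod-- h (mod-refl {a = b})) (≡⇒mod (ℤₚ.+-inverseʳ b))

mod-undiff : ∀ {N a b} → a - b ≡ 0ℤ [mod N ] → a ≡ b [mod N ]
mod-undiff {N} {a} {b} (wit k e) = wit k (trans (g a b) (trans (cong (_+ b) e) (h k N b)))
  where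
  g : ∀ a b → a ≡ (a - b) + b
  g = solve-∀
  h : ∀ k N b → (0ℤ + k * N) + b ≡ b + k * N
  h = solve-∀

prime≢0 : ∀ {q} → Prime q → int q ≢ 0ℤ
prime≢0 pr e = ℕ.≢-nonZero⁻¹ _ {{prime⇒nonZero pr}} (cong ∣_∣ e)

euclid : ∀ {q} → Prime q → ∀ a {b} → a * b ≡ 0ℤ [mod int q ] → (a ≡ 0ℤ [mod int q ]) ⊎ (b ≡ 0ℤ [mod int q ])
euclid {q} pr a {b} h with euclidsLemma ∣ a ∣ ∣ b ∣ pr (subst (q ℕᵈ.∣_) (ℤₚ.abs-* a b) (mod⇒∣ h))
... | inj₁ d = inj₁ (∣⇒mod d)
... | inj₂ d = inj₂ (∣⇒mod d)

mod-inverse : ∀ {q} → Prime q → ∀ a → ¬ a ≡ 0ℤ [mod int q ] → Σ ℤ λ c → c * a ≡ 1ℤ [mod int q ]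
mod-inverse {q} pr a a≢0 = signed (ℤₚ.+∣i∣≡i⊎+∣i∣≡-i a)
  where
  coprime : Coprime ∣ a ∣ q
  coprime {d} (d∣a , d∣q) with prime⇒irreducible pr d∣q
  ... | inj₁ e = e
  ... | inj₂ refl = contradiction (∣⇒mod d∣a) a≢0
  g₂ : ∀ x a y q → 1ℤ + x * a ≡ y * q → (- x) * a ≡ 1ℤ + (- y) * q
  g₂ x a y q e = trans (f x a) (trans (cong (λ z → 1ℤ - z) e) (h y q))
    where
    f : ∀ x a → (- x) * a ≡ 1ℤ - (1ℤ + x * a)
    f = solve-∀
    h : ∀ y q → 1ℤ - y * q ≡ 1ℤ + (- y) * q
    h = solve-∀
  toℤ : ∀ x m y n → 1 ℕ.+ x ℕ.* m ≡ y ℕ.* n → 1ℤ + int x * int m ≡ int y * int n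
  toℤ x m y n e = trans (cong (1ℤ +_) (sym (ℤₚ.pos-* x m))) (trans (sym (ℤₚ.pos-+ 1 (x ℕ.* m))) (trans (cong int e) (ℤₚ.pos-* y n)))
  inverse : Σ ℤ λ c → c * int ∣ a ∣ ≡ 1ℤ [mod int q ]
  inverse with coprime-Bézout coprime
  ... | Bézout.+- x y eq = int x , wit (int y) (sym (toℤ y q x ∣ a ∣ eq))
  ... | Bézout.-+ x y eq = - int x , wit (- int y) (g₂ (int x) (int ∣ a ∣) (int y) (int q) (toℤ x ∣ a ∣ y q eq))
  signed : (int ∣ a ∣ ≡ a) ⊎ (int ∣ a ∣ ≡ - a) → Σ ℤ λ c → c * a ≡ 1ℤ [mod int q ]
  signed (inj₁ e) = proj₁ inverse , subst (λ z → proj₁ inverse * z ≡ 1ℤ [mod int q ]) e (proj₂ inverse)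
  signed (inj₂ e) = - proj₁ inverse , mod-cong₂ (h (proj₁ inverse) a) refl (subst (λ z → proj₁ inverse * z ≡ 1ℤ [mod int q ]) e (proj₂ inverse))
    where
    h : ∀ c a → (- c) * a ≡ c * - a
    h = solve-∀

pw : ∀ {n} → ℕ → Mat n → Vect n → Vect n
pw zero    M v = v
pw (suc k) M v = M ▹ pw k M v

pw-linear : ∀ {n} k (M : Mat n) → Linear (pw k M)
pw-linear zero    M = record { l-cong = λ h → h ; l-comb = λ x y u v i → refl }
pw-linear (suc k) M = record
  { l-cong = λ h → ▹-cong M (Linear.l-cong (pw-linear k M) h)
  ; l-comb = λ x y u v i → trans (▹-cong M (Linear.l-comb (pw-linear k M) x y u v) i) (Linear.l-comb (▹-linear M) x y (pw k M u) (pw k M v) i) }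

pw-shift : ∀ {n} k (M : Mat n) v → pw k M (M ▹ v) ≗ pw (suc k) M v
pw-shift zero    M v i = refl
pw-shift (suc k) M v = ▹-cong M (pw-shift k M v)

pw-+ : ∀ {n} j k (M : Mat n) v → pw j M (pw k M v) ≗ pw (j ℕ.+ k) M v
pw-+ zero    k M v i = refl
pw-+ (suc j) k M v = ▹-cong M (pw-+ j k M v)

act-shift : ∀ {n} p (M : Mat n) v → act p M (M ▹ v) ≗ M ▹ act p M v
act-shift [] M v i = sym (▹-0 M (λ _ → refl) i)
act-shift (a ∷ p) M v i = sym (trans (trans (▹-cong M (λ j → cong (a * v j +_) (sym (ℤₚ.*-identityˡ ((M ▹ act p M v) j)))) i) (Linear.l-comb (▹-linear M) a 1ℤ v (M ▹ act p M v) i))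
  (cong (a * (M ▹ v) i +_) (trans (ℤₚ.*-identityˡ _) (sym (▹-cong M (act-shift p M v) i)))))

act-pw : ∀ {n} p k (M : Mat n) v → act p M (pw k M v) ≗ pw k M (act p M v)
act-pw p zero    M v i = refl
act-pw p (suc k) M v i = trans (act-shift p M (pw k M v) i) (▹-cong M (act-pw p k M v) i)

linear-mod0 : ∀ {n} q (M : Mat n) p {v} → (∀ i → v i ≡ 0ℤ [mod q ]) → ∀ i → act p M v i ≡ 0ℤ [mod q ]
linear-mod0 q M []      h i = mod-refl
linear-mod0 q M (a ∷ p) h i = mod-+0 (mod-*0 a (h i)) (∑-mod0 (λ j → mod-*0 (M i j) (linear-mod0 q M p h j)))

pw-selfAdjoint : ∀ {n} {M : Mat n} → Symmetric M → ∀ k u v → pw k M u ∙ v ≡ u ∙ pw k M v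
pw-selfAdjoint s zero    u v = refl
pw-selfAdjoint {M = M} s (suc k) u v = trans (selfAdjoint s (pw k M u) v) (trans (pw-selfAdjoint s k u (M ▹ v)) (∙-cong {u = u} (λ _ → refl) (pw-shift k M v)))

∙-act : ∀ {n} (M : Mat n) (w v : Vect n) a p → w ∙ act (a ∷ p) M v ≡ a * (w ∙ v) + w ∙ (M ▹ act p M v)
∙-act M w v a p = trans (∑-cong (λ i → g (w i) a (v i) ((M ▹ act p M v) i)))
  (trans (∑-+ (λ i → a * (w i * v i)) (λ i → w i * (M ▹ act p M v) i)) (cong (_+ w ∙ (M ▹ act p M v)) (∑-*ˡ a (λ i → w i * v i))))
  where
  g : ∀ w a v m → w * (a * v + m) ≡ a * (w * v) + w * m
  g = solve-∀

∙-act-swap : ∀ {n} {M : Mat n} → Symmetric M → ∀ p u v → act p M u ∙ v ≡ u ∙ act p M v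
∙-act-swap s [] u v = trans (∑-0 (λ i → ℤₚ.*-zeroˡ (v i))) (sym (∙-0ʳ u (λ _ → refl)))
∙-act-swap {M = M} s (a ∷ p) u v = trans (∙-comm (act (a ∷ p) M u) v) (trans (∙-act M v u a p)
  (trans (cong₂ (λ x y → a * x + y) (∙-comm v u) (trans (∙-comm v (M ▹ act p M u)) (trans (selfAdjoint s (act p M u) v)
     (trans (∙-act-swap s p u (M ▹ v)) (∙-cong {u = u} (λ _ → refl) (act-shift p M v))))))
    (sym (∙-act M u v a p))))

Isotropic : ∀ {n} → ℤ → Mat n → Vect n → Set
Isotropic N M u = ∀ k → u ∙ pw k M u ≡ 0ℤ [mod N ]

orthogonal-act : ∀ {n} N (M : Mat n) w v → (∀ k → w ∙ pw k M v ≡ 0ℤ [mod N ]) → ∀ p k → w ∙ act p M (pw k M v) ≡ 0ℤ [mod N ]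
orthogonal-act N M w v h []      k = ≡⇒mod (∙-0ʳ w (λ _ → refl))
orthogonal-act N M w v h (a ∷ p) k = mod-cong₂ (∙-act M w (pw k M v) a p) refl
  (mod-+0 (mod-*0 a (h k)) (mod-cong₂ (∙-cong {u = w} (λ _ → refl) (λ i → sym (act-shift p M (pw k M v) i))) refl (orthogonal-act N M w v h p (suc k))))

-- D M u p v is the derivative of p at M in the direction u uᵀ, applied to v.
D : ∀ {n} → Mat n → Vect n → Poly → Vect n → Vect n
D M u []      v = 0ᵛ
D M u (a ∷ p) v = λ i → (u ∙ act p M v) * u i + (M ▹ D M u p v) i

-- p′(M)v in Horner form, from (a + x p)′ = p + x p′.
dact : ∀ {n} → Poly → Mat n → Vect n → Vect n
dact []      M v = 0ᵛ
dact (a ∷ p) M v = λ i → act p M v i + (M ▹ dact p M v) i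

module _ {n : ℕ} (q : ℕ) (M : Mat n) (u : Vect n) where
  private
    Q = int q
    M' : Mat n
    M' i j = M i j + Q * (u i * u j)

  M'-▹ : ∀ v i → (M' ▹ v) i ≡ (M ▹ v) i + Q * ((u ∙ v) * u i)
  M'-▹ v i = trans (∑-cong (λ j → g (M i j) Q (u i) (u j) (v j))) (trans (∑-+ (λ j → M i j * v j) (λ j → (Q * u i) * (u j * v j)))
    (cong ((M ▹ v) i +_) (trans (∑-*ˡ (Q * u i) (λ j → u j * v j)) (h Q (u i) (u ∙ v)))))
    where
    g : ∀ m Q a b v → (m + Q * (a * b)) * v ≡ m * v + (Q * a) * (b * v)
    g = solve-∀
    h : ∀ Q a d → (Q * a) * d ≡ Q * (d * a)
    h = solve-∀

  act-taylor : ∀ p v i → act p M' v i ≡ act p M v i + Q * D M u p v i [mod Q * Q ]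
  act-taylor [] v i = ≡⇒mod (g Q)
    where
    g : ∀ Q → 0ℤ ≡ 0ℤ + Q * 0ℤ
    g = solve-∀
  act-taylor (a ∷ p) v i = mod-trans (mod-+ (mod-refl {a = a * v i}) (▹-mod M' (act-taylor p v) i))
    -- The quotient is the second-order term: q u uᵀ applied to the first-order part q d.
    (wit ((u ∙ d) * u i) (begin
      a * v i + (M' ▹ (λ j → x j + Q * d j)) i ≡⟨ cong (a * v i +_) (trans (M'-▹ _ i) (cong₂ (λ s t → s + Q * (t * u i)) (split i) (dot-split))) ⟩
      a * v i + (((M ▹ x) i + Q * (M ▹ d) i) + Q * ((u ∙ x + Q * (u ∙ d)) * u i)) ≡⟨ g a (v i) ((M ▹ x) i) ((M ▹ d) i) Q (u ∙ x) (u ∙ d) (u i) ⟩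
      (a * v i + (M ▹ x) i) + Q * ((u ∙ x) * u i + (M ▹ d) i) + (u ∙ d) * u i * (Q * Q) ∎))
    where
    open ≡-Reasoning
    x = act p M v
    d = D M u p v
    one : ∀ j → x j + Q * d j ≡ 1ℤ * x j + Q * d j
    one j = cong (_+ Q * d j) (sym (ℤₚ.*-identityˡ (x j)))
    split : ∀ i → (M ▹ (λ j → x j + Q * d j)) i ≡ (M ▹ x) i + Q * (M ▹ d) i
    split i = trans (▹-cong M one i) (trans (Linear.l-comb (▹-linear M) 1ℤ Q x d i) (cong (_+ Q * (M ▹ d) i) (ℤₚ.*-identityˡ ((M ▹ x) i))))
    dot-split : u ∙ (λ j → x j + Q * d j) ≡ u ∙ x + Q * (u ∙ d)
    dot-split = trans (∙-cong {u = u} (λ _ → refl) one) (trans (∙-combʳ 1ℤ Q u x d) (cong (_+ Q * (u ∙ d)) (ℤₚ.*-identityˡ (u ∙ x))))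
    g : ∀ a v mx md Q ux ud ui → a * v + ((mx + Q * md) + Q * ((ux + Q * ud) * ui)) ≡ (a * v + mx) + Q * (ux * ui + md) + ud * ui * (Q * Q)
    g = solve-∀

  -- By Cayley–Hamilton for M + q u uᵀ, whose characteristic polynomial agrees with that of M modulo q².
  derivative-vanishes : Q ≢ 0ℤ → Isotropic Q M u → ∀ p → p ≈p charPoly n M → ∀ v i → D M u p v i ≡ 0ℤ [mod Q ]
  derivative-vanishes Q≢0 iso p p≈ v i = mod-cancel Q Q≢0 (mod-cong₂ (g (act p M v i) (Q * D M u p v i)) refl
    (mod-trans (mod-- (mod-trans (mod-sym (act-taylor p v i)) vanish') (≡⇒mod vanish)) mod-refl))
    where
    g : ∀ a b → b ≡ (a + b) - a
    g = solve-∀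
    vanish : act p M v i ≡ 0ℤ
    vanish = trans (act-≈p p (charPoly n M) M v p≈ i) (cayley-hamilton M v i)
    -- The update by q u uᵀ changes coefficient k by -q uᵀχₖ₊₁(M)u, and isotropy contributes the
    -- second factor q.
    coeffs : ∀ k → coeff p k ≡ coeff (charPoly n M') k [mod Q * Q ]
    coeffs k = mod-cong₂ (p≈ k) (trans (charPoly-rank1 M Q u u k) (trans (coeff-+p (charPoly n M) _ k) (cong (coeff (charPoly n M) k +_) (coeff-scale (- Q) (ρ M (charPoly n M) u u) k))))
      (mod-sym (mod-+0ʳ (mod-cong₂ (h Q _) refl (mod-neg (mod-scale Q (mod-cong₂ (coeff-ρ M (charPoly n M) u u k) refl (orthogonal-act Q M u u iso (drop (suc k) (charPoly n M)) 0)))))))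
      where
      h : ∀ Q r → (- Q) * r ≡ - (Q * r)
      h = solve-∀
    vanish' : act p M' v i ≡ 0ℤ [mod Q * Q ]
    vanish' = mod-trans (act-coeffs-mod p (charPoly n M') M' v coeffs i) (≡⇒mod (cayley-hamilton M' v i))

combination : ∀ {m n} → Rows m n → Rows m n → Vect n → Vect n
combination w v z i = ∑ (λ j → (w j ∙ z) * v j i)

-- Over a field every matrix K has a generalised inverse G with K G K = K; here the columns of K are the
-- vectors v j and the rows of G are the vectors w j.
generalised-inverse : ∀ {n q} → Prime q → ∀ m (v : Rows m n) →
                      Σ (Rows m n) λ w → ∀ l i → combination w v (v l) i ≡ v l i [mod int q ]
generalised-inverse pr zero v = (λ ()) , λ ()
generalised-inverse {n} {q} pr (suc m) v with generalised-inverse pr m (v ∘ suc)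
... | w , H = extend (vanishes? q r)
  where
  V = v ∘ suc
  k = v zero
  P : Vect n → Vect n
  P = combination w V
  r : Vect n
  r i = k i - P k i
  -- Here r is the part of the new vector k that the old combination P misses. If r ≡ 0, then k is
  -- already reproduced and receives the zero functional.
  extend : (∀ i → r i ≡ 0ℤ [mod int q ]) ⊎ Σ (Fin n) (λ i → ¬ r i ≡ 0ℤ [mod int q ]) →
           Σ (Rows (suc m) n) λ w' → ∀ l i → combination w' v (v l) i ≡ v l i [mod int q ]
  extend (inj₁ r≡0) = 0ᵛ ◂ w , λ { zero i → mod-trans (drop0 k i) (mod-sym (mod-undiff (r≡0 i))) ; (suc l) i → mod-trans (drop0 (V l) i) (H l i) }
    where
    drop0 : ∀ z i → combination (0ᵛ ◂ w) v z i ≡ P z i [mod int q ]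
    drop0 z i = ≡⇒mod (trans ∑-suc (trans (cong (λ t → t * k i + P z i) (trans (∙-comm 0ᵛ z) (∙-0ʳ z (λ _ → refl)))) (trans (cong (_+ P z i) (ℤₚ.*-zeroˡ (k i))) (ℤₚ.+-identityˡ (P z i)))))
  extend (inj₂ (i₀ , r≢0)) with mod-inverse pr (r i₀) r≢0
  ... | c , cr≡1 = ω ◂ W′ , reproduce
    where
    -- Otherwise pick a coordinate i₀ where r is invertible. The functional ω(z) = c (z - P z) at i₀
    -- vanishes on the old vectors, which P reproduces, and takes the value 1 on k; the old
    -- functionals are corrected by multiples of ω so that z goes to P z + ω(z) r.
    ω : Vect n
    ω s = c * (1ℤ * δ i₀ s + -1ℤ * ∑ (λ j → V j i₀ * w j s))
    W′ : Rows m n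
    W′ j s = 1ℤ * w j s + (- (w j ∙ k)) * ω s
    ω∙ : ∀ z → ω ∙ z ≡ c * (z i₀ - P z i₀)
    ω∙ z = begin
      ω ∙ z ≡⟨ ∙-comm ω z ⟩
      z ∙ ω ≡⟨ trans (∑-cong (λ s → g (z s) c (e s))) (∑-*ˡ c (λ s → z s * e s)) ⟩
      c * (z ∙ e) ≡⟨ cong (c *_) (∙-combʳ 1ℤ -1ℤ z (δ i₀) b) ⟩
      c * (1ℤ * (z ∙ δ i₀) + -1ℤ * (z ∙ b)) ≡⟨ cong₂ (λ x y → c * (1ℤ * x + -1ℤ * y)) (trans (∙-comm z (δ i₀)) (∑-δˡ i₀ z)) zb ⟩
      c * (1ℤ * z i₀ + -1ℤ * P z i₀) ≡⟨ h c (z i₀) (P z i₀) ⟩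
      c * (z i₀ - P z i₀) ∎
      where
      open ≡-Reasoning
      b e : Vect n
      b s = ∑ (λ j → V j i₀ * w j s)
      e s = 1ℤ * δ i₀ s + -1ℤ * b s
      g : ∀ z c e → z * (c * e) ≡ c * (z * e)
      g = solve-∀
      h : ∀ c x y → c * (1ℤ * x + - 1ℤ * y) ≡ c * (x - y)
      h = solve-∀
      zb : z ∙ b ≡ P z i₀
      zb = begin
        ∑ (λ s → z s * ∑ (λ j → V j i₀ * w j s)) ≡⟨ ∑-cong (λ s → sym (∑-*ˡ (z s) (λ j → V j i₀ * w j s))) ⟩
        ∑ (λ s → ∑ (λ j → z s * (V j i₀ * w j s))) ≡⟨ ∑-swap (λ s j → z s * (V j i₀ * w j s)) ⟩
        ∑ (λ j → ∑ (λ s → z s * (V j i₀ * w j s))) ≡⟨ ∑-cong (λ j → trans (∑-cong (λ s → f (z s) (V j i₀) (w j s))) (∑-*ʳ (V j i₀) (λ s → w j s * z s))) ⟩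
        P z i₀ ∎
        where
        f : ∀ z v w → z * (v * w) ≡ (w * z) * v
        f = solve-∀
    total : ∀ z i → combination (ω ◂ W′) v z i ≡ P z i + (ω ∙ z) * r i
    total z i = begin
      combination (ω ◂ W′) v z i ≡⟨ ∑-suc ⟩
      (ω ∙ z) * k i + ∑ (λ j → (W′ j ∙ z) * V j i) ≡⟨ cong ((ω ∙ z) * k i +_) (∑-cong (λ j → trans (cong (_* V j i) (W′∙ j)) (g (w j ∙ z) (w j ∙ k) (ω ∙ z) (V j i)))) ⟩
      (ω ∙ z) * k i + ∑ (λ j → (w j ∙ z) * V j i + (- (ω ∙ z)) * ((w j ∙ k) * V j i))
        ≡⟨ cong ((ω ∙ z) * k i +_) (trans (∑-+ (λ j → (w j ∙ z) * V j i) (λ j → (- (ω ∙ z)) * ((w j ∙ k) * V j i))) (cong (P z i +_) (∑-*ˡ (- (ω ∙ z)) (λ j → (w j ∙ k) * V j i)))) ⟩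
      (ω ∙ z) * k i + (P z i + (- (ω ∙ z)) * P k i) ≡⟨ h (ω ∙ z) (k i) (P z i) (P k i) ⟩
      P z i + (ω ∙ z) * r i ∎
      where
      open ≡-Reasoning
      W′∙ : ∀ j → W′ j ∙ z ≡ 1ℤ * (w j ∙ z) + (- (w j ∙ k)) * (ω ∙ z)
      W′∙ j = trans (∙-comm (W′ j) z) (trans (∙-combʳ 1ℤ (- (w j ∙ k)) z (w j) ω) (cong₂ (λ x y → 1ℤ * x + (- (w j ∙ k)) * y) (∙-comm z (w j)) (∙-comm z ω)))
      g : ∀ a b o v → (1ℤ * a + (- b) * o) * v ≡ a * v + (- o) * (b * v)
      g = solve-∀
      h : ∀ o k p s → o * k + (p + (- o) * s) ≡ p + o * (k - s)
      h = solve-∀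
    reproduce : ∀ l i → combination (ω ◂ W′) v (v l) i ≡ v l i [mod int q ]
    reproduce zero i = mod-trans (mod-cong₂ (total k i) refl (mod-+ (mod-refl {a = P k i}) (mod-* (mod-cong₂ (ω∙ k) refl cr≡1) (mod-refl {a = r i})))) (≡⇒mod (g (P k i) (k i)))
      where
      g : ∀ p k → p + 1ℤ * (k - p) ≡ k
      g = solve-∀
    reproduce (suc l) i = mod-trans (mod-cong₂ (total (V l) i) refl (mod-+0ʳ (mod-cong₂ (ℤₚ.*-comm (ω ∙ V l) (r i)) refl (mod-*0 (r i)
      (mod-cong₂ (ω∙ (V l)) refl (mod-*0 c (mod-diff (mod-sym (H l i₀))))))))) (H l i)

module _ {n m : ℕ} (q : ℤ) (M : Mat n) (s : Symmetric M) (u : Vect n) (w : Rows m n) where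
  private
    powers : Rows m n
    powers j = pw (toℕ j) M u

  Reproduced : Vect n → Set
  Reproduced z = ∀ i → combination w powers z i ≡ z i [mod q ]

  -- All powers of M occurring in p(M)Mᵏu have exponent below `length p ℕ.+ k`, so the bound places
  -- them among the listed Krylov vectors.
  reproduced-act : (∀ l → Reproduced (powers l)) → ∀ p k → length p ℕ.+ k ℕ.≤ m → Reproduced (act p M (pw k M u))
  reproduced-act h [] k le i = ≡⇒mod (∑-0 (λ j → trans (cong (_* powers j i) (∙-0ʳ (w j) (λ _ → refl))) (ℤₚ.*-zeroˡ (powers j i))))
  reproduced-act h (a ∷ p) k le i = mod-cong₂ split refl (mod-+ (mod-*ˡ a (base i)) (mod-trans (reproduced-act h p (suc k) (subst (ℕ._≤ m) (sym (ℕₚ.+-suc (length p) k)) le) i) (≡⇒mod (act-shift p M (pw k M u) i))))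
    where
    x = pw k M u
    k<m : k ℕ.< m
    k<m = ℕₚ.≤-trans (s≤s (ℕₚ.m≤n+m k (length p))) le
    base : Reproduced x
    base i = subst (λ l → combination w powers (pw l M u) i ≡ pw l M u i [mod q ]) (Finₚ.toℕ-fromℕ< k<m) (h (Fin.fromℕ< k<m) i)
    split : combination w powers (act (a ∷ p) M x) i ≡ a * combination w powers x i + combination w powers (act p M (M ▹ x)) i
    split = trans (∑-cong (λ j → trans (cong (_* powers j i) (trans (∙-act M (w j) x a p) (cong (a * (w j ∙ x) +_) (∙-cong {u = w j} (λ _ → refl) (λ i → sym (act-shift p M x i))))))
        (g a (w j ∙ x) (w j ∙ act p M (M ▹ x)) (powers j i)))) (trans (∑-+ (λ j → a * ((w j ∙ x) * powers j i)) (λ j → (w j ∙ act p M (M ▹ x)) * powers j i)) (cong (_+ combination w powers (act p M (M ▹ x)) i) (∑-*ˡ a (λ j → (w j ∙ x) * powers j i))))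
      where
      g : ∀ a x y v → (a * x + y) * v ≡ a * (x * v) + y * v
      g = solve-∀

  -- The diagonal of the tensor Σ Mᵏu ⊗ pₖ₊₁(M)u is p′(M)u.
  contract : (∀ l → Reproduced (powers l)) → ∀ p → length p ℕ.≤ suc m → ∀ i →
             ∑ (λ j → pw (toℕ j) M (D M u p (w j)) i) ≡ dact p M u i [mod q ]
  contract h [] le i = ≡⇒mod (∑-0 {n = m} (λ j → linear-0 (pw-linear (toℕ j) M) i))
  contract h (a ∷ p) (s≤s le) i = mod-cong₂ split refl (mod-+ (reproduced-act h p 0 (subst (ℕ._≤ m) (sym (ℕₚ.+-identityʳ (length p))) le) i)
    (▹-mod M (contract h p (ℕₚ.m≤n⇒m≤1+n le)) i))
    where
    d : Fin m → Vect n
    d j = D M u p (w j)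
    -- Symmetry turns u · p(M)wⱼ into wⱼ · p(M)u. Summed over j the first summands form the
    -- combination at p(M)u, which is reproduced; this is the first half of the product rule in
    -- `dact`.
    term : ∀ j → pw (toℕ j) M (D M u (a ∷ p) (w j)) i ≡ (w j ∙ act p M u) * powers j i + (M ▹ pw (toℕ j) M (d j)) i
    term j = begin
      pw t M (λ i → (u ∙ act p M (w j)) * u i + (M ▹ d j) i) i ≡⟨ Linear.l-cong (pw-linear t M) (λ i → cong ((u ∙ act p M (w j)) * u i +_) (sym (ℤₚ.*-identityˡ ((M ▹ d j) i)))) i ⟩
      pw t M (λ i → (u ∙ act p M (w j)) * u i + 1ℤ * (M ▹ d j) i) i ≡⟨ Linear.l-comb (pw-linear t M) (u ∙ act p M (w j)) 1ℤ u (M ▹ d j) i ⟩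
      (u ∙ act p M (w j)) * pw t M u i + 1ℤ * pw t M (M ▹ d j) i
        ≡⟨ cong₂ _+_ (cong (_* pw t M u i) (trans (sym (∙-act-swap s p u (w j))) (∙-comm (act p M u) (w j)))) (trans (ℤₚ.*-identityˡ _) (pw-shift t M (d j) i)) ⟩
      (w j ∙ act p M u) * pw t M u i + (M ▹ pw t M (d j)) i ∎
      where
      open ≡-Reasoning
      t = toℕ j
    pull : ∀ {l} (U : Rows l n) i → ∑ (λ j → (M ▹ U j) i) ≡ (M ▹ (λ i → ∑ (λ j → U j i))) i
    pull U i = trans (∑-swap (λ j k → M i k * U j k)) (∑-cong (λ k → ∑-*ˡ (M i k) (λ j → U j k)))
    split : ∑ (λ j → pw (toℕ j) M (D M u (a ∷ p) (w j)) i) ≡ combination w powers (act p M u) i + (M ▹ (λ i → ∑ (λ j → pw (toℕ j) M (d j) i))) i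
    split = trans (∑-cong term) (trans (∑-+ (λ j → (w j ∙ act p M u) * powers j i) (λ j → (M ▹ pw (toℕ j) M (d j)) i)) (cong (combination w powers (act p M u) i +_) (pull (λ j → pw (toℕ j) M (d j)) i)))

pw-mod0 : ∀ {n} N k (M : Mat n) {v} → (∀ i → v i ≡ 0ℤ [mod N ]) → ∀ i → pw k M v i ≡ 0ℤ [mod N ]
pw-mod0 N zero    M h = h
pw-mod0 N (suc k) M h i = ∑-mod0 (λ j → mod-*0 (M i j) (pw-mod0 N k M h j))

tab : ℕ → (ℕ → ℤ) → Poly
tab zero    f = f 0 ∷ []
tab (suc n) f = f 0 ∷ tab n (f ∘ suc)

tab-≈p : ∀ n f → (∀ k → n ℕ.< k → f k ≡ 0ℤ) → ∀ k → coeff (tab n f) k ≡ f k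
tab-≈p zero    f h zero    = refl
tab-≈p zero    f h (suc k) = sym (h (suc k) (s≤s z≤n))
tab-≈p (suc n) f h zero    = refl
tab-≈p (suc n) f h (suc k) = tab-≈p n (f ∘ suc) (λ l le → h (suc l) (s≤s le)) k

isotropic⇒derivative : ∀ {n q} → Prime q → (M : Mat n) → Symmetric M → ∀ u → Isotropic (int q) M u →
                       ∀ p → p ≈p charPoly n M → ∀ i → dact p M u i ≡ 0ℤ [mod int q ]
isotropic⇒derivative {n} {q} pr M s u iso p p≈ i with generalised-inverse pr (length p) (λ j → pw (toℕ j) M u)
... | w , H = mod-trans (mod-sym (contract (int q) M s u w H p (ℕₚ.m≤n⇒m≤1+n ℕₚ.≤-refl) i))
  (∑-mod0 (λ j → pw-mod0 (int q) (toℕ j) M (derivative-vanishes q M u (prime≢0 pr) iso p p≈ (w j)) i))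

Commute : ∀ {n} → Mat n → Mat n → Set
Commute {n} N M = ∀ (v : Vect n) → N ▹ (M ▹ v) ≗ M ▹ (N ▹ v)

▹-comb1 : ∀ {n} (M : Mat n) a u v → M ▹ (λ j → a * u j + v j) ≗ (λ i → a * (M ▹ u) i + (M ▹ v) i)
▹-comb1 M a u v i = trans (▹-cong M (λ j → cong (a * u j +_) (sym (ℤₚ.*-identityˡ (v j)))) i)
  (trans (Linear.l-comb (▹-linear M) a 1ℤ u v i) (cong (a * (M ▹ u) i +_) (ℤₚ.*-identityˡ ((M ▹ v) i))))

▹-+ : ∀ {n} (M : Mat n) u v → M ▹ (λ j → u j + v j) ≗ (λ i → (M ▹ u) i + (M ▹ v) i)
▹-+ M u v i = trans (▹-cong M (λ j → cong (_+ v j) (sym (ℤₚ.*-identityˡ (u j)))) i)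
  (trans (▹-comb1 M 1ℤ u v i) (cong (_+ (M ▹ v) i) (ℤₚ.*-identityˡ ((M ▹ u) i))))

▹-scale : ∀ {n} (M : Mat n) a u → M ▹ (λ j → a * u j) ≗ (λ i → a * (M ▹ u) i)
▹-scale M a u i = trans (▹-cong M (λ j → sym (ℤₚ.+-identityʳ (a * u j))) i)
  (trans (▹-comb1 M a u 0ᵛ i) (trans (cong (a * (M ▹ u) i +_) (▹-0 M (λ _ → refl) i)) (ℤₚ.+-identityʳ (a * (M ▹ u) i))))

commute-act : ∀ {n} (N M : Mat n) → Commute N M → ∀ p v → N ▹ act p M v ≗ act p M (N ▹ v)
commute-act N M c [] v i = ▹-0 N (λ _ → refl) i
commute-act N M c (a ∷ p) v i = trans (▹-comb1 N a v (M ▹ act p M v) i)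
  (cong (a * (N ▹ v) i +_) (trans (c (act p M v) i) (▹-cong M (commute-act N M c p v) i)))

dact-linear : ∀ {n} p (M : Mat n) → Linear (dact p M)
dact-linear [] M = record { l-cong = λ h i → refl ; l-comb = λ x y u v i → g x y }
  where
  g : ∀ x y → 0ℤ ≡ x * 0ℤ + y * 0ℤ
  g = solve-∀
dact-linear (a ∷ p) M = record
  { l-cong = λ h i → cong₂ _+_ (Linear.l-cong (act-linear p M) h i) (▹-cong M (Linear.l-cong (dact-linear p M) h) i)
  ; l-comb = λ x y u v i → trans (cong₂ _+_ (Linear.l-comb (act-linear p M) x y u v i)
      (trans (▹-cong M (Linear.l-comb (dact-linear p M) x y u v) i) (Linear.l-comb (▹-linear M) x y (dact p M u) (dact p M v) i)))
      (g x y (act p M u i) (act p M v i) ((M ▹ dact p M u) i) ((M ▹ dact p M v) i)) }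
  where
  g : ∀ x y u v s t → (x * u + y * v) + (x * s + y * t) ≡ x * (u + s) + y * (v + t)
  g = solve-∀

commute-dact : ∀ {n} (N M : Mat n) → Commute N M → ∀ p v → N ▹ dact p M v ≗ dact p M (N ▹ v)
commute-dact N M c [] v i = ▹-0 N (λ _ → refl) i
commute-dact N M c (a ∷ p) v i = trans (▹-+ N (act p M v) (M ▹ dact p M v) i)
  (cong₂ _+_ (commute-act N M c p v i) (trans (c (dact p M v) i) (▹-cong M (commute-dact N M c p v) i)))

∙-+ʳ : ∀ {n} (w u v : Vect n) → w ∙ (λ i → u i + v i) ≡ w ∙ u + w ∙ v
∙-+ʳ w u v = trans (∑-cong (λ i → ℤₚ.*-distribˡ-+ (w i) (u i) (v i))) (∑-+ (λ i → w i * u i) (λ i → w i * v i))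

∙-+ˡ : ∀ {n} (w u v : Vect n) → (λ i → u i + v i) ∙ w ≡ u ∙ w + v ∙ w
∙-+ˡ w u v = trans (∙-comm _ w) (trans (∙-+ʳ w u v) (cong₂ _+_ (∙-comm w u) (∙-comm w v)))

∙-scaleʳ : ∀ {n} (w : Vect n) a u → w ∙ (λ i → a * u i) ≡ a * (w ∙ u)
∙-scaleʳ w a u = trans (∑-cong (λ i → g (w i) a (u i))) (∑-*ˡ a (λ i → w i * u i))
  where
  g : ∀ w a u → w * (a * u) ≡ a * (w * u)
  g = solve-∀

dact-swap : ∀ {n} {M : Mat n} → Symmetric M → ∀ p u v → dact p M u ∙ v ≡ u ∙ dact p M v
dact-swap s [] u v = trans (∑-0 (λ i → ℤₚ.*-zeroˡ (v i))) (sym (∙-0ʳ u (λ _ → refl)))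
dact-swap {M = M} s (a ∷ p) u v = trans (∙-+ˡ v (act p M u) (M ▹ dact p M u)) (trans (cong₂ _+_ (∙-act-swap s p u v)
  (trans (selfAdjoint s (dact p M u) v) (trans (dact-swap s p u (M ▹ v)) (∙-cong {u = u} (λ _ → refl) (λ i → sym (commute-dact M M (λ _ _ → refl) p v i))))))
  (sym (∙-+ʳ u (act p M v) (M ▹ dact p M v))))

orthogonal-dact : ∀ {n} N (M : Mat n) w v → (∀ k → w ∙ pw k M v ≡ 0ℤ [mod N ]) → ∀ p k → w ∙ dact p M (pw k M v) ≡ 0ℤ [mod N ]
orthogonal-dact N M w v h [] k = ≡⇒mod (∙-0ʳ w (λ _ → refl))
orthogonal-dact N M w v h (a ∷ p) k = mod-cong₂ (∙-+ʳ w (act p M (pw k M v)) _) refl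
  (mod-+0 (orthogonal-act N M w v h p k) (mod-cong₂ (∙-cong {u = w} (λ _ → refl) (commute-dact M M (λ _ _ → refl) p (pw k M v))) refl (orthogonal-dact N M w v h p (suc k))))

-- Powers of a prime dividing a determinant

∙-mod-product : ∀ {n N K} {u v : Vect n} → (∀ i → u i ≡ 0ℤ [mod N ]) → (∀ i → v i ≡ 0ℤ [mod K ]) → u ∙ v ≡ 0ℤ [mod N * K ]
∙-mod-product h g = ∑-mod0 (λ i → product (h i) (g i))
  where
  product : ∀ {N K a b} → a ≡ 0ℤ [mod N ] → b ≡ 0ℤ [mod K ] → a * b ≡ 0ℤ [mod N * K ]
  product {N} {K} (wit k refl) (wit l refl) = wit (k * l) (f k l N K)
    where
    f : ∀ k l N K → (0ℤ + k * N) * (0ℤ + l * K) ≡ 0ℤ + k * l * (N * K)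
    f = solve-∀

det-δ≔≔ : ∀ n {i j : Fin n} → i ≢ j → ∀ y z → z i ≡ 0ℤ → det (δ [ i ≔ y ] [ j ≔ z ]) ≡ y i * z j
det-δ≔≔ n {i} {j} i≢j y z zi≡0 = begin
  det (X [ j ≔ z ]) ≡⟨ cong-≔ multilinear j X (λ k → sym (∑-δʳ k z)) ⟩
  det (X [ j ≔ (λ k → ∑ (λ l → z l * δ l k)) ]) ≡⟨ sum-≔ multilinear j z δ X ⟩
  ∑ (λ l → z l * det (X [ j ≔ δ l ])) ≡⟨ ∑-single j _ off ⟩
  z j * det (X [ j ≔ δ j ]) ≡⟨ cong (z j *_) (trans (congruent (upd-id X j (λ k → upd-off δ i y j (λ e → i≢j (sym e)) k))) (det-δ≔ n i y)) ⟩
  z j * y i ≡⟨ ℤₚ.*-comm (z j) (y i) ⟩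
  y i * z j ∎
  where
  open ≡-Reasoning
  open Alternating (det-alternating n)
  X : Mat n
  X = δ [ i ≔ y ]
  off : ∀ l → l ≢ j → z l * det (X [ j ≔ δ l ]) ≡ 0ℤ
  off l l≢j with l ≟ i
  ... | yes refl = trans (cong (_* det (X [ j ≔ δ l ])) zi≡0) (ℤₚ.*-zeroˡ (det (X [ j ≔ δ l ])))
  ... | no l≢i = trans (cong (z l *_) (alternate (X [ j ≔ δ l ]) (λ e → l≢j (sym e))
    (λ k → trans (upd-at X j (δ l) k) (sym (trans (upd-off X j (δ l) l l≢j k) (upd-off δ i y l l≢i k)))))) (ℤₚ.*-zeroʳ (z l))

coprime-cancel : ∀ {q} → Prime q → ∀ a → ¬ a ≡ 0ℤ [mod int q ] → ∀ k {b} → a * b ≡ 0ℤ [mod int q ℤ.^ k ] → b ≡ 0ℤ [mod int q ℤ.^ k ]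
coprime-cancel pr a a≢0 zero {b} h = wit b (g b)
  where
  g : ∀ b → b ≡ 0ℤ + b * 1ℤ
  g = solve-∀
coprime-cancel {q} pr a a≢0 (suc k) {b} h = divided (reduce (euclid pr a (weaken h)))
  where
  Q = int q
  weaken : ∀ {x} → x ≡ 0ℤ [mod Q * Q ℤ.^ k ] → x ≡ 0ℤ [mod Q ]
  weaken (wit c e) = wit (c * Q ℤ.^ k) (trans e (f c Q (Q ℤ.^ k)))
    where
    f : ∀ c Q R → 0ℤ + c * (Q * R) ≡ 0ℤ + c * R * Q
    f = solve-∀
  reduce : (a ≡ 0ℤ [mod Q ]) ⊎ (b ≡ 0ℤ [mod Q ]) → b ≡ 0ℤ [mod Q ]
  reduce (inj₁ e) = contradiction e a≢0
  reduce (inj₂ e) = e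
  divided : b ≡ 0ℤ [mod Q ] → b ≡ 0ℤ [mod Q * Q ℤ.^ k ]
  divided (wit c e) = mod-cong₂ (trans e (f₂ c Q)) refl (mod-scale Q (coprime-cancel pr a a≢0 k
    (mod-cancel Q (prime≢0 pr) (mod-cong₂ (trans (f₁ Q a c) (cong (a *_) (sym e))) refl h))))
    where
    f₁ : ∀ Q a c → Q * (a * c) ≡ a * (0ℤ + c * Q)
    f₁ = solve-∀
    f₂ : ∀ c Q → 0ℤ + c * Q ≡ Q * c
    f₂ = solve-∀

diag : ∀ {n} → Vect n → Mat n
diag σ r s = σ r * δ r s

diag-⊗ : ∀ {n} (σ : Vect n) (N : Mat n) r s → (diag σ ⊗ N) r s ≡ σ r * N r s
diag-⊗ σ N r s = trans (∑-cong (λ j → ℤₚ.*-assoc (σ r) (δ r j) (N j s))) (trans (∑-*ˡ (σ r) (λ j → δ r j * N j s)) (cong (σ r *_) (∑-δˡ r (λ j → N j s))))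

⊗-diag : ∀ {n} (σ : Vect n) (N : Mat n) r s → (N ⊗ diag σ) r s ≡ N r s * σ s
⊗-diag σ N r s = trans (∑-cong (λ j → sym (ℤₚ.*-assoc (N r j) (σ j) (δ j s)))) (∑-δʳ s (λ j → N r j * σ j))

-- Changing basis so that z true and z false become basis vectors, two rows and two columns of K acquire a factor q.
det-divisible : ∀ {n q} → Prime q → (K : Mat n) → Symmetric K → (idx : Bool → Fin n) → idx true ≢ idx false → (z : Bool → Vect n) →
                z true (idx false) ≡ 0ℤ → z false (idx true) ≡ 0ℤ → (∀ b → ¬ z b (idx b) ≡ 0ℤ [mod int q ]) →
                (∀ b i → (K ▹ z b) i ≡ 0ℤ [mod int q ]) → (∀ a b → z a ∙ (K ▹ z b) ≡ 0ℤ [mod int q * int q ]) →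
                det K ≡ 0ℤ [mod int q ℤ.^ 4 ]
det-divisible {n} {q} pr K s idx i≢j z tf ft nz Kz zKz =
  -- In det(T K Tᵗ) the factor det T = Z occurs twice. It is prime to q, because the vanishing of
  -- each vector at the other's index makes Z a product of two entries prime to q. After cancelling
  -- both copies, the q⁴ comes from the two diagonal factors σ.
  coprime-cancel pr Z Z≢0 4 (coprime-cancel pr Z Z≢0 4 (wit (det L) (trans (sym (trans (det-⊗ n T (K ⊗ (T ᵗ))) (trans (cong₂ _*_ detT (trans (det-⊗ n K (T ᵗ)) (cong (det K *_) (trans (det-ᵗ n T) detT)))) (f₁ Z (det K)))))
    (trans (det-cong n factor) (trans (det-⊗ n (diag σ) (L ⊗ diag σ)) (trans (cong₂ _*_ detσ (trans (det-⊗ n L (diag σ)) (cong (det L *_) detσ))) (f₂ Q (det L))))))))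
  where
  Q = int q
  i = idx true
  j = idx false
  Z = z true i * z false j
  f₁ : ∀ Z k → Z * (k * Z) ≡ Z * (Z * k)
  f₁ = solve-∀
  f₂ : ∀ Q l → (Q * Q) * (l * (Q * Q)) ≡ 0ℤ + l * (Q * (Q * (Q * (Q * 1ℤ))))
  f₂ = solve-∀
  Z≢0 : ¬ Z ≡ 0ℤ [mod Q ]
  Z≢0 h with euclid pr (z true i) h
  ... | inj₁ e = nz true e
  ... | inj₂ e = nz false e
  T : Mat n
  T = δ [ i ≔ z true ] [ j ≔ z false ]
  detT : det T ≡ Z
  detT = det-δ≔≔ n i≢j (z true) (z false) ft
  data Class (r : Fin n) : Set where
    special : ∀ b → idx b ≡ r → Class r
    other   : r ≢ i → r ≢ j → Class r
  class : ∀ r → Class r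
  class r with i ≟ r | j ≟ r
  ... | yes e | _ = special true e
  ... | no _ | yes e = special false e
  ... | no p | no p' = other (λ e → p (sym e)) (λ e → p' (sym e))
  weight : ∀ {r} → Class r → ℤ
  weight (special _ _) = Q
  weight (other _ _) = 1ℤ
  σ : Vect n
  σ r = weight (class r)
  σ-special : ∀ b → σ (idx b) ≡ Q
  σ-special b with class (idx b)
  ... | special _ _ = refl
  σ-special true  | other p p' = contradiction refl p
  σ-special false | other p p' = contradiction refl p'
  σ-other : ∀ r → r ≢ i → r ≢ j → σ r ≡ 1ℤ
  σ-other r p p' with class r
  ... | special true e = contradiction (sym e) p
  ... | special false e = contradiction (sym e) p'
  ... | other _ _ = refl
  T-special : ∀ b → T (idx b) ≗ z b
  T-special true  k = trans (upd-off (δ [ i ≔ z true ]) j (z false) i i≢j k) (upd-at δ i (z true) k)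
  T-special false k = upd-at (δ [ i ≔ z true ]) j (z false) k
  Qδ : Fin n → Vect n
  Qδ r k = Q * δ r k
  detσ : det (diag σ) ≡ Q * Q
  detσ = trans (det-cong n eq) (trans (trans (det-δ≔≔ n i≢j (Qδ i) (Qδ j) (trans (cong (Q *_) (δ-≢ (λ e → i≢j (sym e)))) (ℤₚ.*-zeroʳ Q))) (cong₂ (λ x y → (Q * x) * (Q * y)) (δ-refl i) (δ-refl j))) (g Q))
    where
    g : ∀ Q → (Q * 1ℤ) * (Q * 1ℤ) ≡ Q * Q
    g = solve-∀
    eq' : ∀ r k → Class r → diag σ r k ≡ (δ [ i ≔ Qδ i ] [ j ≔ Qδ j ]) r k
    eq' _ k (special true refl) = trans (cong (_* δ i k) (σ-special true)) (sym (trans (upd-off (δ [ i ≔ Qδ i ]) j (Qδ j) i i≢j k) (upd-at δ i (Qδ i) k)))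
    eq' _ k (special false refl) = trans (cong (_* δ j k) (σ-special false)) (sym (upd-at (δ [ i ≔ Qδ i ]) j (Qδ j) k))
    eq' r k (other p p') = trans (cong (_* δ r k) (σ-other r p p')) (trans (ℤₚ.*-identityˡ (δ r k))
      (sym (trans (upd-off (δ [ i ≔ Qδ i ]) j (Qδ j) r p' k) (upd-off δ i (Qδ i) r p k))))
    eq : diag σ ≈ (δ [ i ≔ Qδ i ] [ j ≔ Qδ j ])
    eq r k = eq' r k (class r)
  N : Mat n
  N = T ⊗ (K ⊗ (T ᵗ))
  divisible : ∀ r t → Class r → Class t → N r t ≡ 0ℤ [mod σ r * σ t ]
  divisible _ _ (special a refl) (special b refl) = subst (λ w → N (idx a) (idx b) ≡ 0ℤ [mod w ]) (sym (cong₂ _*_ (σ-special a) (σ-special b)))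
    (mod-cong₂ (∙-cong (T-special a) (▹-cong K (T-special b))) refl (zKz a b))
  divisible _ t (special a refl) (other p p') = subst (λ w → N (idx a) t ≡ 0ℤ [mod w ]) (sym (trans (cong₂ _*_ (σ-special a) (σ-other t p p')) (ℤₚ.*-identityʳ Q)))
    (mod-cong₂ (trans (sym (selfAdjoint s (T (idx a)) (T t))) (trans (∙-comm (K ▹ T (idx a)) (T t)) (∙-cong {u = T t} (λ _ → refl) (▹-cong K (T-special a))))) refl (∙-mod0 (T t) (Kz a)))
  divisible r _ (other p p') (special b refl) = subst (λ w → N r (idx b) ≡ 0ℤ [mod w ]) (sym (trans (cong₂ _*_ (σ-other r p p') (σ-special b)) (ℤₚ.*-identityˡ Q)))
    (mod-cong₂ (∙-cong {u = T r} (λ _ → refl) (▹-cong K (T-special b))) refl (∙-mod0 (T r) (Kz b)))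
  divisible r t (other p p') (other o o') = subst (λ w → N r t ≡ 0ℤ [mod w ]) (sym (cong₂ _*_ (σ-other r p p') (σ-other t o o'))) (wit (N r t) (g (N r t)))
    where
    g : ∀ x → x ≡ 0ℤ + x * (1ℤ * 1ℤ)
    g = solve-∀
  L : Mat n
  L r t = _≡_[mod_].quot (divisible r t (class r) (class t))
  factor : N ≈ diag σ ⊗ (L ⊗ diag σ)
  factor r t = trans (_≡_[mod_].rel (divisible r t (class r) (class t))) (trans (g (L r t) (σ r) (σ t)) (sym (trans (diag-⊗ σ (L ⊗ diag σ) r t) (cong (σ r *_) (⊗-diag σ L r t)))))
    where
    g : ∀ l x y → 0ℤ + l * (x * y) ≡ x * (l * y)
    g = solve-∀

-- Bipartite matrices

-- The coefficients of p(x²).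
spread : Poly → Poly
spread []      = []
spread (a ∷ p) = a ∷ 0ℤ ∷ spread p

matrixOf : ∀ {n} → (Vect n → Vect n) → Mat n
matrixOf L i j = L (δ j) i

matrixOf-▹ : ∀ {n} {L : Vect n → Vect n} → Linear L → ∀ v → matrixOf L ▹ v ≗ L v
matrixOf-▹ {L = L} lin v i = trans (∑-cong (λ j → ℤₚ.*-comm (L (δ j) i) (v j)))
  (trans (sym (∑-linear lin v δ i)) (Linear.l-cong lin (λ j → ∑-δʳ j v) i))

≢⇒≡not : ∀ {a b : Bool} → a ≢ b → a ≡ not b
≢⇒≡not {true}  {true}  h = contradiction refl h
≢⇒≡not {true}  {false} h = refl
≢⇒≡not {false} {true}  h = refl
≢⇒≡not {false} {false} h = contradiction refl h

not-≢ : ∀ (b : Bool) → not b ≢ b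
not-≢ true ()
not-≢ false ()

Splits : ∀ {n} → (Fin n → Bool) → Mat n → Set
Splits c N = ∀ i j → c i ≡ c j → N i j ≡ 0ℤ

module Parts {n : ℕ} (c : Fin n → Bool) where

  Supp : Bool → Vect n → Set
  Supp b v = ∀ i → c i ≢ b → v i ≡ 0ℤ

  proj : Bool → Vect n → Vect n
  proj b v i with c i Boolₚ.≟ b
  ... | yes _ = v i
  ... | no _  = 0ℤ

  proj-in : ∀ b v i → c i ≡ b → proj b v i ≡ v i
  proj-in b v i e with c i Boolₚ.≟ b
  ... | yes _ = refl
  ... | no p  = contradiction e p

  proj-supp : ∀ b v → Supp b (proj b v)
  proj-supp b v i p with c i Boolₚ.≟ b
  ... | yes e = contradiction e p
  ... | no _  = refl

  proj-split : ∀ v i → v i ≡ proj true v i + proj false v i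
  proj-split v i = cases (c i) refl
    where
    cases : ∀ b → c i ≡ b → v i ≡ proj true v i + proj false v i
    cases true  e = trans (sym (ℤₚ.+-identityʳ (v i))) (sym (cong₂ _+_ (proj-in true v i e) (proj-supp false v i (λ e' → not-≢ false (trans (sym e) e')))))
    cases false e = trans (sym (ℤₚ.+-identityˡ (v i))) (sym (cong₂ _+_ (proj-supp true v i (λ e' → not-≢ true (trans (sym e) e'))) (proj-in false v i e)))

  proj-mod0 : ∀ {N} b {v} → (∀ i → v i ≡ 0ℤ [mod N ]) → ∀ i → proj b v i ≡ 0ℤ [mod N ]
  proj-mod0 b h i with c i Boolₚ.≟ b
  ... | yes _ = h i
  ... | no _  = mod-refl

  supp-▹ : ∀ {N} → Splits c N → ∀ {b v} → Supp b v → Supp (not b) (N ▹ v)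
  supp-▹ {N} bip {b} {v} h i p = ∑-0 term
    where
    ci≡b : c i ≡ b
    ci≡b = trans (≢⇒≡not p) (Boolₚ.not-involutive b)
    term : ∀ j → N i j * v j ≡ 0ℤ
    term j with c j Boolₚ.≟ b
    ... | yes e = trans (cong (_* v j) (bip i j (trans ci≡b (sym e)))) (ℤₚ.*-zeroˡ (v j))
    ... | no e  = trans (cong (N i j *_) (h j e)) (ℤₚ.*-zeroʳ (N i j))

  supp-▹▹ : ∀ {N M} → Splits c N → Splits c M → ∀ {b v} → Supp b v → Supp b (N ▹ (M ▹ v))
  supp-▹▹ p q {b} h = subst (λ z → Supp z _) (Boolₚ.not-involutive b) (supp-▹ p (supp-▹ q h))

  supp-cong : ∀ {b u v} → u ≗ v → Supp b u → Supp b v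
  supp-cong e h i p = trans (sym (e i)) (h i p)

  ▹-proj : ∀ {N} → Splits c N → ∀ b v → N ▹ proj b v ≗ proj (not b) (N ▹ v)
  ▹-proj {N} bip b v i = cases (c i Boolₚ.≟ not b)
    where
    term : c i ≡ not b → ∀ j → N i j * proj b v j ≡ N i j * v j
    term e j with c j Boolₚ.≟ b
    ... | yes _ = refl
    ... | no p  = trans (ℤₚ.*-zeroʳ (N i j)) (sym (trans (cong (_* v j) (bip i j (trans e (sym (≢⇒≡not p))))) (ℤₚ.*-zeroˡ (v j))))
    cases : Dec (c i ≡ not b) → (N ▹ proj b v) i ≡ proj (not b) (N ▹ v) i
    cases (yes e) = trans (∑-cong (term e)) (sym (proj-in (not b) (N ▹ v) i e))
    cases (no p)  = trans (supp-▹ bip (proj-supp b v) i p) (sym (proj-supp (not b) (N ▹ v) i p))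

  opposite : ∀ b {u v} → Supp b u → Supp (not b) v → u ∙ v ≡ 0ℤ
  opposite b {u} {v} h g = ∑-0 term
    where
    term : ∀ i → u i * v i ≡ 0ℤ
    term i with c i Boolₚ.≟ b
    ... | no p  = trans (cong (_* v i) (h i p)) (ℤₚ.*-zeroˡ (v i))
    ... | yes e = trans (cong (u i *_) (g i (λ e' → not-≢ b (trans (sym e') e)))) (ℤₚ.*-zeroʳ (u i))

  supp-act : ∀ {M} → (∀ {b v} → Supp b v → Supp b (M ▹ v)) → ∀ p {b v} → Supp b v → Supp b (act p M v)
  supp-act m [] h i q = refl
  supp-act m (a ∷ p) {v = v} h i q = trans (cong₂ _+_ (trans (cong (a *_) (h i q)) (ℤₚ.*-zeroʳ a)) (m (supp-act m p h) i q)) refl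

  supp-dact : ∀ {M} → (∀ {b v} → Supp b v → Supp b (M ▹ v)) → ∀ p {b v} → Supp b v → Supp b (dact p M v)
  supp-dact m [] h i q = refl
  supp-dact m (a ∷ p) h i q = cong₂ _+_ (supp-act m p h i q) (m (supp-dact m p h) i q)

  δ-supp : ∀ j → Supp (c j) (δ j)
  δ-supp j i p = δ-≢ (λ e → p (cong c (sym e)))

unit-injective : ∀ {n} (M : Mat n) → IsUnit (det M) → ∀ {N v} → (∀ i → (M ▹ v) i ≡ 0ℤ [mod N ]) → ∀ i → v i ≡ 0ℤ [mod N ]
unit-injective M unit {N} {v} h i = cases unit
  where
  zero' : det M * v i ≡ 0ℤ [mod N ]
  zero' = mod-cong₂ (adj-▹ M v i) refl (∑-mod0 (λ j → mod-*0 (adjugate M i j) (h j)))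
  cases : IsUnit (det M) → v i ≡ 0ℤ [mod N ]
  cases (inj₁ e) = mod-cong₂ (sym (trans (cong (_* v i) e) (ℤₚ.*-identityˡ (v i)))) refl zero'
  cases (inj₂ e) = mod-cong₂ (sym (trans (cong (λ d → - (d * v i)) e) (trans (cong -_ (ℤₚ.-1*i≡-i (v i))) (ℤₚ.neg-involutive (v i))))) refl (mod-neg zero')

module Bip {n : ℕ} (B : Mat n) (s : Symmetric B) (c : Fin n → Bool) (bip : Splits c B)
           (unit : IsUnit (det B)) (P : Poly) (P≈ : spread P ≈p charPoly n B) where
  open Parts c

  C : Mat n
  C = B ⊗ B

  C▹ : ∀ v → C ▹ v ≗ B ▹ (B ▹ v)
  C▹ = ▹-assoc B B

  C-sym : Symmetric C
  C-sym i j = ∑-cong (λ k → trans (ℤₚ.*-comm (B i k) (B k j)) (cong₂ _*_ (s k j) (s i k)))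

  BC : Commute B C
  BC v i = trans (▹-cong B (C▹ v) i) (sym (C▹ (B ▹ v) i))

  supp-C : ∀ {b v} → Supp b v → Supp b (C ▹ v)
  supp-C {v = v} h = supp-cong (λ i → sym (C▹ v i)) (supp-▹▹ bip bip h)

  injective : ∀ {N v} → (∀ i → (B ▹ v) i ≡ 0ℤ [mod N ]) → ∀ i → v i ≡ 0ℤ [mod N ]
  injective = unit-injective B unit

  spread-act : ∀ p v → act (spread p) B v ≗ act p C v
  spread-act [] v i = refl
  spread-act (a ∷ p) v i = cong (a * v i +_) (trans (▹-cong B (λ j → trans (cong (_+ (B ▹ act (spread p) B v) j) (ℤₚ.*-zeroˡ (v j))) (ℤₚ.+-identityˡ _)) i)
    (trans (sym (C▹ (act (spread p) B v) i)) (▹-cong C (spread-act p v) i)))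

  -- The chain rule (p(x²))′ = 2x p′(x²), read off from the Horner recursion. This is the source of
  -- the factor 2ⁿ in the discriminant.
  spread-dact : ∀ p v i → dact (spread p) B v i ≡ int 2 * (B ▹ dact p C v) i
  spread-dact [] v i = sym (trans (cong (int 2 *_) (▹-0 B (λ _ → refl) i)) (ℤₚ.*-zeroʳ (int 2)))
  spread-dact (a ∷ p) v i = begin
    (0ℤ * v i + (B ▹ x) i) + (B ▹ (λ j → x j + (B ▹ dact (spread p) B v) j)) i
      ≡⟨ cong₂ _+_ (trans (cong (_+ (B ▹ x) i) (ℤₚ.*-zeroˡ (v i))) (ℤₚ.+-identityˡ ((B ▹ x) i))) (▹-+ B x (B ▹ dact (spread p) B v) i) ⟩
    (B ▹ x) i + ((B ▹ x) i + (B ▹ (B ▹ dact (spread p) B v)) i)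
      ≡⟨ cong₂ (λ a b → a + (a + b)) (▹-cong B (spread-act p v) i) inner ⟩
    (B ▹ y) i + ((B ▹ y) i + int 2 * (B ▹ (C ▹ d)) i) ≡⟨ g ((B ▹ y) i) ((B ▹ (C ▹ d)) i) ⟩
    int 2 * ((B ▹ y) i + (B ▹ (C ▹ d)) i) ≡⟨ cong (int 2 *_) (sym (▹-+ B y (C ▹ d) i)) ⟩
    int 2 * (B ▹ dact (a ∷ p) C v) i ∎
    where
    open ≡-Reasoning
    x = act (spread p) B v
    y = act p C v
    d = dact p C v
    g : ∀ a b → a + (a + (1ℤ + 1ℤ) * b) ≡ (1ℤ + 1ℤ) * (a + b)
    g = solve-∀
    inner : (B ▹ (B ▹ dact (spread p) B v)) i ≡ int 2 * (B ▹ (C ▹ d)) i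
    inner = begin
      (B ▹ (B ▹ dact (spread p) B v)) i ≡⟨ ▹-cong B (▹-cong B (spread-dact p v)) i ⟩
      (B ▹ (B ▹ (λ j → int 2 * (B ▹ d) j))) i ≡⟨ ▹-cong B (▹-scale B (int 2) (B ▹ d)) i ⟩
      (B ▹ (λ j → int 2 * (B ▹ (B ▹ d)) j)) i ≡⟨ ▹-scale B (int 2) (B ▹ (B ▹ d)) i ⟩
      int 2 * (B ▹ (B ▹ (B ▹ d))) i ≡⟨ cong (int 2 *_) (▹-cong B (λ j → sym (C▹ d j)) i) ⟩
      int 2 * (B ▹ (C ▹ d)) i ∎

  -- An odd power of B carries v into the opposite part, where it is orthogonal to x; so every other
  -- term of the derivative drops out and the rest is a derivative with respect to C. It lets
  -- statements about χ at B be used for P at C.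
  spread-D : ∀ b {x v} → Supp b x → Supp b v → ∀ p → D B x (spread p) v ≗ B ▹ D C x p v
  spread-D b hx hv [] i = sym (▹-0 B (λ _ → refl) i)
  spread-D b {x} {v} hx hv (a ∷ p) i = begin
    (x ∙ act (0ℤ ∷ spread p) B v) * x i + (B ▹ D B x (0ℤ ∷ spread p) v) i
      ≡⟨ cong (λ z → z * x i + (B ▹ D B x (0ℤ ∷ spread p) v) i) vanish ⟩
    0ℤ * x i + (B ▹ (λ j → (x ∙ y) * x j + (B ▹ D B x (spread p) v) j)) i
      ≡⟨ trans (cong (_+ (B ▹ (λ j → (x ∙ y) * x j + (B ▹ D B x (spread p) v) j)) i) (ℤₚ.*-zeroˡ (x i))) (ℤₚ.+-identityˡ _) ⟩
    (B ▹ (λ j → (x ∙ y) * x j + (B ▹ D B x (spread p) v) j)) i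
      ≡⟨ ▹-cong B (λ j → cong₂ (λ a b → a * x j + b) (∙-cong {u = x} (λ _ → refl) (spread-act p v)) (trans (▹-cong B (spread-D b hx hv p) j) (sym (C▹ (D C x p v) j)))) i ⟩
    (B ▹ D C x (a ∷ p) v) i ∎
    where
    open ≡-Reasoning
    y = act (spread p) B v
    vanish : x ∙ act (0ℤ ∷ spread p) B v ≡ 0ℤ
    vanish = trans (∙-act B x v 0ℤ (spread p)) (trans (cong₂ _+_ (ℤₚ.*-zeroˡ (x ∙ v))
      (opposite b hx (supp-▹ bip (supp-cong (λ j → sym (spread-act p v j)) (supp-act supp-C p hv))))) refl)

  L : Vect n → Vect n
  L v = B ▹ dact P C v

  L-linear : Linear L
  L-linear = record
    { l-cong = λ h → ▹-cong B (Linear.l-cong (dact-linear P C) h)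
    ; l-comb = λ x y u v i → trans (▹-cong B (Linear.l-comb (dact-linear P C) x y u v) i) (Linear.l-comb (▹-linear B) x y (dact P C u) (dact P C v) i) }

  K : Mat n
  K = matrixOf L

  K▹ : ∀ v → K ▹ v ≗ L v
  K▹ = matrixOf-▹ L-linear

  K-splits : Splits c K
  K-splits i j e = supp-▹ bip (supp-dact supp-C P (δ-supp j)) i (λ e' → not-≢ (c j) (trans (sym e') e))

  K-sym : Symmetric K
  K-sym i j = begin
    L (δ j) i ≡⟨ sym (∑-δˡ i (L (δ j))) ⟩
    δ i ∙ L (δ j) ≡⟨ ∙-cong {u = δ i} (λ _ → refl) (commute-dact B C BC P (δ j)) ⟩
    δ i ∙ dact P C (B ▹ δ j) ≡⟨ sym (dact-swap C-sym P (δ i) (B ▹ δ j)) ⟩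
    dact P C (δ i) ∙ (B ▹ δ j) ≡⟨ sym (selfAdjoint s (dact P C (δ i)) (δ j)) ⟩
    L (δ i) ∙ δ j ≡⟨ ∙-comm (L (δ i)) (δ j) ⟩
    δ j ∙ L (δ i) ≡⟨ ∑-δˡ j (L (δ i)) ⟩
    L (δ i) j ∎
    where open ≡-Reasoning

  derivative : ∀ v i → dact (spread P) B v i ≡ int 2 * (K ▹ v) i
  derivative v i = trans (spread-dact P v i) (cong (int 2 *_) (sym (K▹ v i)))

  -- Vectors in different parts have disjoint supports, which provides the two indices. Since K
  -- exchanges the parts, each vector is exactly orthogonal to its own image, so only the mixed
  -- value needs a congruence modulo q².
  conclude : ∀ {q} → Prime q → (z : Bool → Vect n) → (∀ b → Supp b (z b)) → (∀ b → Σ (Fin n) λ i → ¬ z b i ≡ 0ℤ [mod int q ]) →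
             (∀ b i → (K ▹ z b) i ≡ 0ℤ [mod int q ]) → z true ∙ (K ▹ z false) ≡ 0ℤ [mod int q * int q ] → det K ≡ 0ℤ [mod int q ℤ.^ 4 ]
  conclude {q} pr z supp nz Kz cross = det-divisible pr K K-sym idx distinct z (at true) (at false) (λ b → proj₂ (nz b)) Kz pairs
    where
    idx : Bool → Fin n
    idx b = proj₁ (nz b)
    in-part : ∀ b → c (idx b) ≡ b
    in-part b with c (idx b) Boolₚ.≟ b
    ... | yes e = e
    ... | no p  = contradiction (≡⇒mod (supp b (idx b) p)) (proj₂ (nz b))
    distinct : idx true ≢ idx false
    distinct e = not-≢ true (trans (sym (in-part false)) (trans (cong c (sym e)) (in-part true)))
    at : ∀ b → z b (idx (not b)) ≡ 0ℤ
    at b = supp b (idx (not b)) (λ e → not-≢ b (trans (sym (in-part (not b))) e))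
    same : ∀ b → z b ∙ (K ▹ z b) ≡ 0ℤ [mod int q * int q ]
    same b = ≡⇒mod (opposite b (supp b) (supp-▹ K-splits (supp b)))
    pairs : ∀ a b → z a ∙ (K ▹ z b) ≡ 0ℤ [mod int q * int q ]
    pairs true  true  = same true
    pairs true  false = cross
    pairs false true  = mod-cong₂ (trans (sym (selfAdjoint K-sym (z false) (z true))) (∙-comm (K ▹ z false) (z true))) refl cross
    pairs false false = same false

  isotropic-weaken : ∀ N u → Isotropic (N * N) B u → Isotropic N B u
  isotropic-weaken N u h k = mod-weaken N (h k)

  -- The moments of (1 + B)u are sums of moments of u. The step serves to spread a vector
  -- concentrated in one part over both.
  isotropic-step : ∀ N u → Isotropic N B u → Isotropic N B (λ i → u i + (B ▹ u) i)
  isotropic-step N u h k = mod-cong₂ eq refl (mod-+0 (mod-+0 (h k) (h (suc k))) (mod-+0 (h (suc k)) (h (suc (suc k)))))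
    where
    open ≡-Reasoning
    pw-add : ∀ k → pw k B (λ i → u i + (B ▹ u) i) ≗ (λ i → pw k B u i + pw (suc k) B u i)
    pw-add k i = begin
      pw k B (λ i → u i + (B ▹ u) i) i ≡⟨ Linear.l-cong (pw-linear k B) (λ i → sym (cong₂ _+_ (ℤₚ.*-identityˡ (u i)) (ℤₚ.*-identityˡ ((B ▹ u) i)))) i ⟩
      pw k B (λ i → 1ℤ * u i + 1ℤ * (B ▹ u) i) i ≡⟨ Linear.l-comb (pw-linear k B) 1ℤ 1ℤ u (B ▹ u) i ⟩
      1ℤ * pw k B u i + 1ℤ * pw k B (B ▹ u) i ≡⟨ cong₂ _+_ (ℤₚ.*-identityˡ (pw k B u i)) (trans (ℤₚ.*-identityˡ (pw k B (B ▹ u) i)) (pw-shift k B u i)) ⟩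
      pw k B u i + pw (suc k) B u i ∎
    x = pw k B u
    eq : (λ i → u i + (B ▹ u) i) ∙ pw k B (λ i → u i + (B ▹ u) i) ≡ (u ∙ x + u ∙ (B ▹ x)) + (u ∙ (B ▹ x) + u ∙ (B ▹ (B ▹ x)))
    eq = begin
      (λ i → u i + (B ▹ u) i) ∙ pw k B (λ i → u i + (B ▹ u) i) ≡⟨ ∙-cong {u = λ i → u i + (B ▹ u) i} (λ _ → refl) (pw-add k) ⟩
      (λ i → u i + (B ▹ u) i) ∙ (λ i → x i + (B ▹ x) i) ≡⟨ ∙-+ˡ (λ i → x i + (B ▹ x) i) u (B ▹ u) ⟩
      u ∙ (λ i → x i + (B ▹ x) i) + (B ▹ u) ∙ (λ i → x i + (B ▹ x) i)
        ≡⟨ cong₂ _+_ (∙-+ʳ u x (B ▹ x)) (trans (selfAdjoint s u _) (trans (∙-cong {u = u} (λ _ → refl) (▹-+ B x (B ▹ x))) (∙-+ʳ u (B ▹ x) (B ▹ (B ▹ x))))) ⟩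
      (u ∙ x + u ∙ (B ▹ x)) + (u ∙ (B ▹ x) + u ∙ (B ▹ (B ▹ x))) ∎

  module Odd {q : ℕ} (pr : Prime q) (odd : ¬ int 2 ≡ 0ℤ [mod int q ]) where
    private
      Q = int q

    -- From χ′(B) = 2K comes Ku ≡ 0 modulo q, and since K exchanges the parts it kills both halves.
    -- The mixed value appears in uᵀχ′(B)u = 2uᵀKu = 4 tᵀKf, which vanishes modulo q² by isotropy; q
    -- odd removes the 4.
    both-parts : ∀ u → Isotropic (Q * Q) B u → (∀ b → Σ (Fin n) λ i → ¬ proj b u i ≡ 0ℤ [mod Q ]) → det K ≡ 0ℤ [mod Q ℤ.^ 4 ]
    both-parts u iso nz = conclude pr (λ b → proj b u) (λ b → proj-supp b u) nz Kz (cancel2 (cancel2 four))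
      where
      open ≡-Reasoning
      kill2 : ∀ {x} → int 2 * x ≡ 0ℤ [mod Q ] → x ≡ 0ℤ [mod Q ]
      kill2 {x} h with euclid pr (int 2) h
      ... | inj₁ e = contradiction e odd
      ... | inj₂ e = e
      cancel2 : ∀ {x} → int 2 * x ≡ 0ℤ [mod Q * Q ] → x ≡ 0ℤ [mod Q * Q ]
      cancel2 {x} h = subst (λ N → x ≡ 0ℤ [mod N ]) (cong (Q *_) (ℤₚ.*-identityʳ Q))
        (coprime-cancel pr (int 2) odd 2 (subst (λ N → int 2 * x ≡ 0ℤ [mod N ]) (cong (Q *_) (sym (ℤₚ.*-identityʳ Q))) h))
      Ku : ∀ i → (K ▹ u) i ≡ 0ℤ [mod Q ]
      Ku i = kill2 (mod-cong₂ (sym (derivative u i)) refl (isotropic⇒derivative pr B s u (isotropic-weaken Q u iso) (spread P) P≈ i))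
      Kz : ∀ b i → (K ▹ proj b u) i ≡ 0ℤ [mod Q ]
      Kz b i = mod-cong₂ (▹-proj K-splits b u i) refl (proj-mod0 (not b) Ku i)
      t = proj true u
      f = proj false u
      uKu : u ∙ (K ▹ u) ≡ int 2 * (t ∙ (K ▹ f))
      uKu = begin
        u ∙ (K ▹ u) ≡⟨ ∙-cong (proj-split u) (λ i → trans (▹-cong K (proj-split u) i) (▹-+ K t f i)) ⟩
        (λ i → t i + f i) ∙ (λ i → (K ▹ t) i + (K ▹ f) i) ≡⟨ trans (∙-+ˡ _ t f) (cong₂ _+_ (∙-+ʳ t (K ▹ t) (K ▹ f)) (∙-+ʳ f (K ▹ t) (K ▹ f))) ⟩
        (t ∙ (K ▹ t) + t ∙ (K ▹ f)) + (f ∙ (K ▹ t) + f ∙ (K ▹ f))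
          ≡⟨ cong₂ _+_ (cong (_+ t ∙ (K ▹ f)) (opposite true (proj-supp true u) (supp-▹ K-splits (proj-supp true u))))
                       (cong₂ _+_ (trans (sym (selfAdjoint K-sym f t)) (∙-comm (K ▹ f) t)) (opposite false (proj-supp false u) (supp-▹ K-splits (proj-supp false u)))) ⟩
        (0ℤ + t ∙ (K ▹ f)) + (t ∙ (K ▹ f) + 0ℤ) ≡⟨ g (t ∙ (K ▹ f)) ⟩
        int 2 * (t ∙ (K ▹ f)) ∎
        where
        g : ∀ x → (0ℤ + x) + (x + 0ℤ) ≡ (1ℤ + 1ℤ) * x
        g = solve-∀
      four : int 2 * (int 2 * (t ∙ (K ▹ f))) ≡ 0ℤ [mod Q * Q ]
      four = mod-cong₂ (sym (trans (∙-cong {u = u} (λ _ → refl) (derivative u)) (trans (∙-scaleʳ u (int 2) (K ▹ u)) (cong (int 2 *_) uKu)))) refl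
        (orthogonal-dact (Q * Q) B u u iso (spread P) 0)

    proj-+ : ∀ b u v i → proj b (λ i → u i + v i) i ≡ proj b u i + proj b v i
    proj-+ b u v i with c i Boolₚ.≟ b
    ... | yes _ = refl
    ... | no _  = refl

    odd-prime : ∀ u → Isotropic (Q * Q) B u → Σ (Fin n) (λ i → ¬ u i ≡ 0ℤ [mod Q ]) → det K ≡ 0ℤ [mod Q ℤ.^ 4 ]
    odd-prime u iso (i₀ , u≢0) = decide (vanishes? q (proj true u)) (vanishes? q (proj false u))
      where
      u' : Vect n
      u' i = u i + (B ▹ u) i
      -- When u vanishes in part b, the vector u + Bu has there the image under B of the other half,
      -- nonzero modulo q because det B is a unit, while the other half itself is unchanged modulo
      -- q.
      repair : ∀ b → (∀ i → proj b u i ≡ 0ℤ [mod Q ]) → (Σ (Fin n) λ i → ¬ proj (not b) u i ≡ 0ℤ [mod Q ]) →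
               ∀ a → Σ (Fin n) λ i → ¬ proj a u' i ≡ 0ℤ [mod Q ]
      repair b z (j , nz) a = found (vanishes? q (proj a u'))
        where
        swap : ∀ i → proj b u' i ≡ (B ▹ proj (not b) u) i [mod Q ]
        swap i = mod-cong₂ (proj-+ b u (B ▹ u) i) (trans (▹-proj bip (not b) u i) (cong (λ z → proj z (B ▹ u) i) (Boolₚ.not-involutive b)))
          (mod-trans (mod-+ (z i) (mod-refl {a = proj b (B ▹ u) i})) (≡⇒mod (ℤₚ.+-identityˡ _)))
        stay : ∀ i → proj (not b) u' i ≡ proj (not b) u i [mod Q ]
        stay i = mod-cong₂ (proj-+ (not b) u (B ▹ u) i) refl (mod-+0ʳ (mod-cong₂ (sym (▹-proj bip b u i)) refl (∑-mod0 (λ k → mod-*0 (B i k) (z k)))))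
        impossible : ∀ a → (a ≡ b) ⊎ (a ≡ not b) → (∀ i → proj a u' i ≡ 0ℤ [mod Q ]) → ⊥
        impossible a (inj₁ refl) h = nz (injective (λ i → mod-trans (mod-sym (swap i)) (h i)) j)
        impossible a (inj₂ refl) h = nz (mod-trans (mod-sym (stay j)) (h j))
        which : ∀ a b → (a ≡ b) ⊎ (a ≡ not b)
        which true true = inj₁ refl
        which true false = inj₂ refl
        which false true = inj₂ refl
        which false false = inj₁ refl
        found : (∀ i → proj a u' i ≡ 0ℤ [mod Q ]) ⊎ Σ (Fin n) (λ i → ¬ proj a u' i ≡ 0ℤ [mod Q ]) → Σ (Fin n) λ i → ¬ proj a u' i ≡ 0ℤ [mod Q ]
        found (inj₁ h) = ⊥-elim (impossible a (which a b) h)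
        found (inj₂ r) = r
      decide : (∀ i → proj true u i ≡ 0ℤ [mod Q ]) ⊎ Σ (Fin n) (λ i → ¬ proj true u i ≡ 0ℤ [mod Q ]) →
               (∀ i → proj false u i ≡ 0ℤ [mod Q ]) ⊎ Σ (Fin n) (λ i → ¬ proj false u i ≡ 0ℤ [mod Q ]) → det K ≡ 0ℤ [mod Q ℤ.^ 4 ]
      decide (inj₁ a) (inj₁ b) = contradiction (mod-cong₂ (proj-split u i₀) refl (mod-+0 (a i₀) (b i₀))) u≢0
      decide (inj₁ a) (inj₂ b) = both-parts u' (isotropic-step (Q * Q) u iso) (repair true a b)
      decide (inj₂ a) (inj₁ b) = both-parts u' (isotropic-step (Q * Q) u iso) (repair false b a)
      decide (inj₂ a) (inj₂ b) = both-parts u iso (λ { true → a ; false → b })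

-- The prime 2

2ℤ : ℤ
2ℤ = 1ℤ + 1ℤ

double≡0 : ∀ x → 2ℤ * x ≡ 0ℤ [mod 2ℤ ]
double≡0 x = wit x (h x)
  where
  h : ∀ x → (1ℤ + 1ℤ) * x ≡ 0ℤ + x * (1ℤ + 1ℤ)
  h = solve-∀

square≡ : ∀ a → a * a ≡ a [mod 2ℤ ]
square≡ (int k) = nat k
  where
  f : ∀ k → (1ℤ + k) * (1ℤ + k) ≡ (1ℤ + k * k) + k * (1ℤ + 1ℤ)
  f = solve-∀
  nat : ∀ k → int k * int k ≡ int k [mod 2ℤ ]
  nat zero    = mod-refl
  nat (suc k) = mod-trans (wit (int k) (f (int k))) (mod-+ (mod-refl {a = 1ℤ}) (nat k))
square≡ -[1+ k ] = mod-trans (mod-cong₂ (sym (h (int (suc k)))) refl (square≡ (int (suc k)))) (wit (int (suc k)) (g (int (suc k))))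
  where
  h : ∀ x → x * x ≡ - x * - x
  h = solve-∀
  g : ∀ x → x ≡ - x + x * (1ℤ + 1ℤ)
  g = solve-∀

evens odds : Poly → Poly
evens []      = []
evens (a ∷ F) = a ∷ odds F
odds []      = []
odds (a ∷ F) = evens F

-- The linear functional on polynomials that sends the i-th power of the variable to f i.
moment : Poly → (ℕ → ℤ) → ℤ
moment []      f = 0ℤ
moment (a ∷ p) f = a * f 0 + moment p (f ∘ suc)

-- moment of p(y²), which modulo 2 is also the moment of p(y)²
moment² : Poly → (ℕ → ℤ) → ℤ
moment² []      f = 0ℤ
moment² (a ∷ p) f = a * f 0 + moment² p (λ i → f (suc (suc i)))

moment-split : ∀ F f → moment F f ≡ moment² (evens F) f + moment² (odds F) (f ∘ suc)
moment-split []      f = refl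
moment-split (a ∷ F) f = trans (cong (a * f 0 +_) (moment-split F (f ∘ suc))) (h (a * f 0) (moment² (evens F) (f ∘ suc)) (moment² (odds F) (λ i → f (suc (suc i)))))
  where
  h : ∀ a b c → a + (b + c) ≡ (a + c) + b
  h = solve-∀

moment-mod : ∀ {N} p {f g} → (∀ i → f i ≡ g i [mod N ]) → moment p f ≡ moment p g [mod N ]
moment-mod []      h = mod-refl
moment-mod (a ∷ p) h = mod-+ (mod-*ˡ a (h 0)) (moment-mod p (h ∘ suc))

moment²-mod : ∀ {N} p {f g} → (∀ i → f i ≡ g i [mod N ]) → moment² p f ≡ moment² p g [mod N ]
moment²-mod []      h = mod-refl
moment²-mod (a ∷ p) h = mod-+ (mod-*ˡ a (h 0)) (moment²-mod p (λ i → h (suc (suc i))))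

∙-0ˡ : ∀ {n} (v : Vect n) → 0ᵛ ∙ v ≡ 0ℤ
∙-0ˡ v = ∑-0 (λ i → ℤₚ.*-zeroˡ (v i))

module Quadratic {n : ℕ} (C : Mat n) (sy : Symmetric C) where

  pw-comb1 : ∀ k a u v → pw k C (λ i → a * u i + v i) ≗ (λ i → a * pw k C u i + pw k C v i)
  pw-comb1 k a u v i = trans (Linear.l-cong (pw-linear k C) (λ i → cong (a * u i +_) (sym (ℤₚ.*-identityˡ (v i)))) i)
    (trans (Linear.l-comb (pw-linear k C) a 1ℤ u v i) (cong (a * pw k C u i +_) (ℤₚ.*-identityˡ (pw k C v i))))

  ∙-comb1 : ∀ w a (u v : Vect n) → w ∙ (λ i → a * u i + v i) ≡ a * (w ∙ u) + w ∙ v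
  ∙-comb1 w a u v = trans (∙-+ʳ w (λ i → a * u i) v) (cong (_+ w ∙ v) (∙-scaleʳ w a u))

  pw-sym : ∀ k u v → u ∙ pw k C v ≡ v ∙ pw k C u
  pw-sym k u v = trans (sym (pw-selfAdjoint sy k u v)) (∙-comm (pw k C u) v)

  ∙-pw-act : ∀ w j p v → w ∙ pw j C (act p C v) ≡ moment p (λ i → w ∙ pw (i ℕ.+ j) C v)
  ∙-pw-act w j [] v = ∙-0ʳ w (linear-0 (pw-linear j C))
  ∙-pw-act w j (a ∷ p) v = trans (∙-cong {u = w} (λ _ → refl) (pw-comb1 j a v (C ▹ act p C v)))
    (trans (∙-comb1 w a (pw j C v) _) (cong (a * (w ∙ pw j C v) +_) (trans (∙-cong {u = w} (λ _ → refl) (pw-shift j C (act p C v)))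
      (trans (∙-pw-act w (suc j) p v) (moment-cong p (λ i → cong (λ k → w ∙ pw k C v) (ℕₚ.+-suc i j)))))))
    where
    moment-cong : ∀ p {f g} → (∀ i → f i ≡ g i) → moment p f ≡ moment p g
    moment-cong p h = mod0⇒≡ (moment-mod p (λ i → ≡⇒mod (h i)))

  quadratic : ∀ j b z y → let v = λ i → b * z i + (C ▹ y) i in
              v ∙ pw j C v ≡ (b * b * (z ∙ pw j C z) + 2ℤ * (b * (z ∙ pw (suc j) C y))) + y ∙ pw (suc (suc j)) C y
  quadratic j b z y = begin
    v ∙ pw j C v ≡⟨ ∙-cong {u = v} (λ _ → refl) (pw-comb1 j b z (C ▹ y)) ⟩
    v ∙ (λ i → b * pw j C z i + pw j C (C ▹ y) i) ≡⟨ ∙-comb1 v b (pw j C z) (pw j C (C ▹ y)) ⟩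
    b * (v ∙ pw j C z) + v ∙ pw j C (C ▹ y) ≡⟨ cong₂ (λ x w → b * x + w) (expand (pw j C z)) (trans (expand (pw j C (C ▹ y))) (cong₂ (λ x w → b * x + w) (∙-cong {u = z} (λ _ → refl) (pw-shift j C y)) last)) ⟩
    b * (b * (z ∙ pw j C z) + (C ▹ y) ∙ pw j C z) + (b * (z ∙ pw (suc j) C y) + y ∙ pw (suc (suc j)) C y)
      ≡⟨ cong (λ x → b * (b * (z ∙ pw j C z) + x) + (b * (z ∙ pw (suc j) C y) + y ∙ pw (suc (suc j)) C y)) cross ⟩
    b * (b * (z ∙ pw j C z) + z ∙ pw (suc j) C y) + (b * (z ∙ pw (suc j) C y) + y ∙ pw (suc (suc j)) C y)
      ≡⟨ g b (z ∙ pw j C z) (z ∙ pw (suc j) C y) (y ∙ pw (suc (suc j)) C y) ⟩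
    (b * b * (z ∙ pw j C z) + 2ℤ * (b * (z ∙ pw (suc j) C y))) + y ∙ pw (suc (suc j)) C y ∎
    where
    open ≡-Reasoning
    v : Vect n
    v i = b * z i + (C ▹ y) i
    expand : ∀ w → v ∙ w ≡ b * (z ∙ w) + (C ▹ y) ∙ w
    expand w = trans (∙-comm v w) (trans (∙-comb1 w b z (C ▹ y)) (cong₂ (λ x y → b * x + y) (∙-comm w z) (∙-comm w (C ▹ y))))
    cross : (C ▹ y) ∙ pw j C z ≡ z ∙ pw (suc j) C y
    cross = trans (selfAdjoint sy y (pw j C z)) (pw-sym (suc j) y z)
    last : (C ▹ y) ∙ pw j C (C ▹ y) ≡ y ∙ pw (suc (suc j)) C y
    last = trans (selfAdjoint sy y (pw j C (C ▹ y))) (∙-cong {u = y} (λ _ → refl) (▹-cong C (pw-shift j C y)))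
    g : ∀ b m c e → b * (b * m + c) + (b * c + e) ≡ (b * b * m + (1ℤ + 1ℤ) * (b * c)) + e
    g = solve-∀

  -- Frobenius over the field with two elements: by symmetry of C the mixed terms come in equal
  -- pairs, and each coefficient equals its square.
  square-act : ∀ p j x → act p C x ∙ pw j C (act p C x) ≡ moment² p (λ i → x ∙ pw (i ℕ.+ j) C x) [mod 2ℤ ]
  square-act [] j x = ≡⇒mod (∙-0ˡ (pw j C 0ᵛ))
  square-act (a ∷ p) j x = mod-cong₂ (quadratic j a x (act p C x)) refl
    (mod-+ (mod-trans (mod-+0ʳ (double≡0 _)) (mod-* (square≡ a) mod-refl))
      (mod-trans (square-act p (suc (suc j)) x) (moment²-mod p {λ i → x ∙ pw (i ℕ.+ suc (suc j)) C x} {λ i → x ∙ pw (suc (suc i) ℕ.+ j) C x} (λ i → ≡⇒mod (cong (λ k → x ∙ pw k C x) (trans (ℕₚ.+-suc i (suc j)) (cong suc (ℕₚ.+-suc i j))))))))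

  -- Modulo 2 the derivative of Σ aᵢxⁱ keeps only the odd i and becomes a polynomial in x², hence
  -- the square of the polynomial whose coefficients are the odd-indexed aᵢ.
  root : Poly → Poly
  root []          = []
  root (a ∷ [])    = []
  root (a ∷ b ∷ p) = b ∷ root p

  dact-2 : ∀ a b p x i → dact (a ∷ b ∷ p) C x i ≡ (b * x i + 2ℤ * (C ▹ act p C x) i) + (C ▹ (C ▹ dact p C x)) i
  dact-2 a b p x i = trans (cong ((b * x i + (C ▹ act p C x) i) +_) (▹-+ C (act p C x) (C ▹ dact p C x) i))
    (g (b * x i) ((C ▹ act p C x) i) ((C ▹ (C ▹ dact p C x)) i))
    where
    g : ∀ b y d → (b + y) + (y + d) ≡ (b + (1ℤ + 1ℤ) * y) + d
    g = solve-∀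

  dact-1 : ∀ a x i → dact (a ∷ []) C x i ≡ 0ℤ
  dact-1 a x i = trans (ℤₚ.+-identityˡ _) (▹-0 C (λ _ → refl) i)

  -- p′ is a square modulo 2.
  dact-square : ∀ p x i → dact p C x i ≡ act (root p) C (act (root p) C x) i [mod 2ℤ ]
  dact-square [] x i = mod-refl
  dact-square (a ∷ []) x i = ≡⇒mod (dact-1 a x i)
  dact-square (a ∷ b ∷ p) x i = mod-cong₂ (dact-2 a b p x i) eq
    (mod-+ (mod-trans (mod-+0ʳ (double≡0 _)) (mod-trans (mod-* (mod-sym (square≡ b)) mod-refl) (mod-sym (mod-+0ʳ (double≡0 (b * (C ▹ y) i))))))
      (▹-mod C (▹-mod C (dact-square p x)) i))
    where
    y = act (root p) C x
    eq : act (root (a ∷ b ∷ p)) C (act (root (a ∷ b ∷ p)) C x) i ≡ (b * b * x i + 2ℤ * (b * (C ▹ y) i)) + (C ▹ (C ▹ act (root p) C y)) i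
    eq = begin
      b * (b * x i + (C ▹ y) i) + (C ▹ act (root p) C (λ k → b * x k + (C ▹ y) k)) i ≡⟨ cong (b * (b * x i + (C ▹ y) i) +_) (▹-cong C inner i) ⟩
      b * (b * x i + (C ▹ y) i) + (C ▹ (λ k → b * y k + (C ▹ act (root p) C y) k)) i ≡⟨ cong (b * (b * x i + (C ▹ y) i) +_) (▹-comb1 C b y (C ▹ act (root p) C y) i) ⟩
      b * (b * x i + (C ▹ y) i) + (b * (C ▹ y) i + (C ▹ (C ▹ act (root p) C y)) i) ≡⟨ g b (x i) ((C ▹ y) i) _ ⟩
      (b * b * x i + 2ℤ * (b * (C ▹ y) i)) + (C ▹ (C ▹ act (root p) C y)) i ∎
      where
      open ≡-Reasoning
      g : ∀ b x y d → b * (b * x + y) + (b * y + d) ≡ (b * b * x + (1ℤ + 1ℤ) * (b * y)) + d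
      g = solve-∀
      inner : act (root p) C (λ k → b * x k + (C ▹ y) k) ≗ (λ k → b * y k + (C ▹ act (root p) C y) k)
      inner k = trans (Linear.l-cong (act-linear (root p) C) (λ k → cong (b * x k +_) (sym (ℤₚ.*-identityˡ ((C ▹ y) k)))) k)
        (trans (Linear.l-comb (act-linear (root p) C) b 1ℤ x (C ▹ y) k) (cong (b * y k +_) (trans (ℤₚ.*-identityˡ _) (act-shift (root p) C y k))))

  -- Congruence of p′ with a square holds only modulo 2, but the quadratic form of the two sides
  -- agrees modulo 4: each discrepancy is doubled or carries an even factor b² - b, and isotropy of
  -- z makes the value multiplied with it even. This gives the q² that `conclude` asks of the mixed
  -- value.
  dact-square-form : ∀ p z → Isotropic 2ℤ C z → ∀ j → z ∙ pw j C (dact p C z) ≡ act (root p) C z ∙ pw j C (act (root p) C z) [mod 2ℤ * 2ℤ ]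
  dact-square-form [] z iso j = ≡⇒mod (trans (∙-0ʳ z (linear-0 (pw-linear j C))) (sym (∙-0ˡ (pw j C 0ᵛ))))
  dact-square-form (a ∷ []) z iso j = ≡⇒mod (trans (∙-0ʳ z (λ i → trans (Linear.l-cong (pw-linear j C) (dact-1 a z) i) (linear-0 (pw-linear j C) i))) (sym (∙-0ˡ (pw j C 0ᵛ))))
  dact-square-form (a ∷ b ∷ p) z iso j = mod-cong₂ left (quadratic j b z (act (root p) C z))
    (mod-+ (mod-trans (mod-+0ʳ (mod-scale 2ℤ even₁)) (mod-trans bm (mod-sym (mod-+0ʳ (mod-scale 2ℤ (mod-*0 b even₂))))))
      (mod-trans (dact-square-form p z iso (suc (suc j))) mod-refl))
    where
    y = act p C z
    d = dact p C z
    even : ∀ p → z ∙ pw (suc j) C (act p C z) ≡ 0ℤ [mod 2ℤ ]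
    even p = mod-cong₂ (∙-cong {u = z} (λ _ → refl) (λ i → sym (act-pw p (suc j) C z i))) refl (orthogonal-act 2ℤ C z z iso p (suc j))
    even₁ = even p
    even₂ = even (root p)
    -- Both b² - b and the moment of z are even, so their product is a multiple of 4.
    bm : b * (z ∙ pw j C z) ≡ b * b * (z ∙ pw j C z) [mod 2ℤ * 2ℤ ]
    bm = evenDiff (square≡ b) (iso j)
      where
      evenDiff : ∀ {m} → b * b ≡ b [mod 2ℤ ] → m ≡ 0ℤ [mod 2ℤ ] → b * m ≡ b * b * m [mod 2ℤ * 2ℤ ]
      evenDiff (wit k e) (wit l refl) = mod-sym (wit (k * l) (trans (cong (_* (0ℤ + l * 2ℤ)) e) (g b k l)))
        where
        g : ∀ b k l → (b + k * (1ℤ + 1ℤ)) * (0ℤ + l * (1ℤ + 1ℤ)) ≡ b * (0ℤ + l * (1ℤ + 1ℤ)) + k * l * ((1ℤ + 1ℤ) * (1ℤ + 1ℤ))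
        g = solve-∀
    left : z ∙ pw j C (dact (a ∷ b ∷ p) C z) ≡ (b * (z ∙ pw j C z) + 2ℤ * (z ∙ pw (suc j) C y)) + z ∙ pw (suc (suc j)) C d
    left = begin
      z ∙ pw j C (dact (a ∷ b ∷ p) C z)
        ≡⟨ ∙-cong {u = z} (λ _ → refl) (λ i → Linear.l-cong (pw-linear j C) (λ i → trans (dact-2 a b p z i) (ℤₚ.+-assoc (b * z i) (2ℤ * (C ▹ y) i) ((C ▹ (C ▹ d)) i))) i) ⟩
      z ∙ pw j C (λ i → b * z i + (2ℤ * (C ▹ y) i + (C ▹ (C ▹ d)) i)) ≡⟨ ∙-cong {u = z} (λ _ → refl) (pw-comb1 j b z _) ⟩
      z ∙ (λ i → b * pw j C z i + pw j C (λ i → 2ℤ * (C ▹ y) i + (C ▹ (C ▹ d)) i) i) ≡⟨ ∙-comb1 z b (pw j C z) _ ⟩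
      b * (z ∙ pw j C z) + z ∙ pw j C (λ i → 2ℤ * (C ▹ y) i + (C ▹ (C ▹ d)) i)
        ≡⟨ cong (b * (z ∙ pw j C z) +_) (trans (∙-cong {u = z} (λ _ → refl) (pw-comb1 j 2ℤ (C ▹ y) (C ▹ (C ▹ d)))) (∙-comb1 z 2ℤ (pw j C (C ▹ y)) (pw j C (C ▹ (C ▹ d))))) ⟩
      b * (z ∙ pw j C z) + (2ℤ * (z ∙ pw j C (C ▹ y)) + z ∙ pw j C (C ▹ (C ▹ d)))
        ≡⟨ cong (b * (z ∙ pw j C z) +_) (cong₂ (λ x w → 2ℤ * x + w) (∙-cong {u = z} (λ _ → refl) (pw-shift j C y)) (∙-cong {u = z} (λ _ → refl) (λ i → trans (pw-shift j C (C ▹ d) i) (▹-cong C (pw-shift j C d) i)))) ⟩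
      b * (z ∙ pw j C z) + (2ℤ * (z ∙ pw (suc j) C y) + z ∙ pw (suc (suc j)) C d) ≡⟨ sym (ℤₚ.+-assoc (b * (z ∙ pw j C z)) _ _) ⟩
      (b * (z ∙ pw j C z) + 2ℤ * (z ∙ pw (suc j) C y)) + z ∙ pw (suc (suc j)) C d ∎
      where open ≡-Reasoning

evens-odds-length : ∀ F → (length (evens F) ℕ.≤ length F) × (length (odds F) ℕ.≤ length F)
evens-odds-length []      = z≤n , z≤n
evens-odds-length (a ∷ F) = s≤s (proj₂ (evens-odds-length F)) , ℕₚ.m≤n⇒m≤1+n (proj₁ (evens-odds-length F))

OddCoeff : Poly → Set
OddCoeff F = Σ ℕ λ k → ¬ coeff F k ≡ 0ℤ [mod 2ℤ ]

odd-coeff-split : ∀ F → OddCoeff F → OddCoeff (evens F) ⊎ OddCoeff (odds F)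
odd-coeff-split []      (k , h)     = inj₁ (k , h)
odd-coeff-split (a ∷ F) (zero , h)  = inj₁ (zero , h)
odd-coeff-split (a ∷ F) (suc k , h) with odd-coeff-split F (k , h)
... | inj₁ r = inj₂ r
... | inj₂ (l , g) = inj₁ (suc l , g)

-- Over 𝔽₂ every polynomial is F = p² + y r² with p, r its even and odd parts.  If F annihilates the form
-- h(j) = tᵀCʲt, then x = p(C)t + r(C)s is isotropic; and if x = 0 then p and y r annihilate h as well.
module Descent {n : ℕ} (C : Mat n) (sy : Symmetric C) (t s : Vect n)
  (ts : ∀ j → t ∙ pw j C s ≡ 0ℤ [mod 2ℤ ]) (ss : ∀ j → s ∙ pw j C s ≡ t ∙ pw (suc j) C t [mod 2ℤ ])
  (inj : ∀ v → (∀ i → (C ▹ v) i ≡ 0ℤ [mod 2ℤ ]) → ∀ i → v i ≡ 0ℤ [mod 2ℤ ])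
  (nz : ¬ ((∀ i → t i ≡ 0ℤ [mod 2ℤ ]) × (∀ i → s i ≡ 0ℤ [mod 2ℤ ]))) where
  open Quadratic C sy

  h : ℕ → ℤ
  h j = t ∙ pw j C t

  X : Poly → Poly → Vect n
  X p r i = act p C t i + act r C s i

  Found : Set
  Found = Σ Poly λ p → Σ Poly λ r → (Σ (Fin n) λ i → ¬ X p r i ≡ 0ℤ [mod 2ℤ ]) × Isotropic 2ℤ C (X p r)

  Annihilates : Poly → Set
  Annihilates F = ∀ j → moment F (λ i → h (i ℕ.+ j)) ≡ 0ℤ [mod 2ℤ ]

  pw-X : ∀ j p r → pw j C (X p r) ≗ (λ i → pw j C (act p C t) i + pw j C (act r C s) i)
  pw-X j p r i = trans (Linear.l-cong (pw-linear j C) (λ i → cong (_+ act r C s i) (sym (ℤₚ.*-identityˡ (act p C t i)))) i)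
    (trans (pw-comb1 j 1ℤ (act p C t) (act r C s) i) (cong (_+ pw j C (act r C s) i) (ℤₚ.*-identityˡ (pw j C (act p C t) i))))

  ∙-X : ∀ w j p r → w ∙ pw j C (X p r) ≡ moment p (λ i → w ∙ pw (i ℕ.+ j) C t) + moment r (λ i → w ∙ pw (i ℕ.+ j) C s)
  ∙-X w j p r = trans (∙-cong {u = w} (λ _ → refl) (pw-X j p r)) (trans (∙-+ʳ w _ _) (cong₂ _+_ (∙-pw-act w j p t) (∙-pw-act w j r s)))

  moment-0 : ∀ p {f} → (∀ i → f i ≡ 0ℤ [mod 2ℤ ]) → moment p f ≡ 0ℤ [mod 2ℤ ]
  moment-0 []      e = mod-refl
  moment-0 (a ∷ p) e = mod-+0 (mod-*0 a (e 0)) (moment-0 p (λ i → e (suc i)))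

  cross : ∀ p j r → act p C t ∙ pw j C (act r C s) ≡ 0ℤ [mod 2ℤ ]
  cross p j r = mod-cong₂ (∙-pw-act (act p C t) j r s) refl (moment-0 r (λ i → mod-cong₂
    (trans (pw-sym (i ℕ.+ j) (act p C t) s) (∙-pw-act s (i ℕ.+ j) p t)) refl (moment-0 p (λ l → mod-cong₂ (pw-sym (l ℕ.+ (i ℕ.+ j)) s t) refl (ts (l ℕ.+ (i ℕ.+ j)))))))

  X-isotropic : ∀ F → Annihilates F → Isotropic 2ℤ C (X (evens F) (odds F))
  X-isotropic F ann j = mod-cong₂ expand refl (mod-trans (mod-+ (mod-+ (square-act p j t) (cross p j r)) (mod-+ (mod-cong₂ (pw-sym j b a) refl (cross p j r)) (square-act r j s)))
    (mod-cong₂ (f Mp (moment² r (λ i → s ∙ pw (i ℕ.+ j) C s))) refl (mod-trans (mod-+ (mod-refl {a = Mp}) (moment²-mod r (λ i → ss (i ℕ.+ j))))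
      (mod-cong₂ (sym (moment-split F (λ i → h (i ℕ.+ j)))) refl (ann j)))))
    where
    p = evens F
    r = odds F
    a = act p C t
    b = act r C s
    f : ∀ x y → (x + 0ℤ) + (0ℤ + y) ≡ x + y
    f = solve-∀
    Mp = moment² p (λ i → h (i ℕ.+ j))
    expand : X p r ∙ pw j C (X p r) ≡ (a ∙ pw j C a + a ∙ pw j C b) + (b ∙ pw j C a + b ∙ pw j C b)
    expand = trans (∙-cong {u = X p r} (λ _ → refl) (pw-X j p r)) (trans (∙-+ˡ _ a b) (cong₂ _+_ (∙-+ʳ a _ _) (∙-+ʳ b _ _)))

  -- Pair x ≡ 0 with t and with s. By `ts` the first pairing sees only p(C)t and gives p on h; the
  -- second sees only r(C)s and, by `ss`, gives r on the shifted form.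
  X-zero : ∀ p r → (∀ i → X p r i ≡ 0ℤ [mod 2ℤ ]) → Annihilates p × Annihilates (0ℤ ∷ r)
  X-zero p r z = first , second
    where
    first : Annihilates p
    first j = mod-trans (mod-sym (mod-+0ʳ (moment-0 r (λ i → ts (i ℕ.+ j))))) (mod-cong₂ (sym (∙-X t j p r)) refl (∙-mod0 t (pw-mod0 2ℤ j C z)))
    second : Annihilates (0ℤ ∷ r)
    second j = mod-cong₂ (g (h j) (moment r (λ i → h (suc i ℕ.+ j)))) refl (mod-trans (mod-+
      (mod-sym (moment-0 p {λ i → s ∙ pw (i ℕ.+ j) C t} (λ i → mod-cong₂ (pw-sym (i ℕ.+ j) s t) refl (ts (i ℕ.+ j)))))
      (moment-mod r (λ i → mod-sym (ss (i ℕ.+ j)))))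
      (mod-cong₂ (sym (∙-X s j p r)) refl (∙-mod0 s (pw-mod0 2ℤ j C z))))
      where
      g : ∀ x y → 0ℤ * x + y ≡ 0ℤ + y
      g = solve-∀

  X-t : X (1ℤ ∷ []) [] ≗ t
  X-t i = trans (cong (λ z → (1ℤ * t i + z) + 0ℤ) (▹-0 C (λ _ → refl) i)) (g (t i))
    where
    g : ∀ x → (1ℤ * x + 0ℤ) + 0ℤ ≡ x
    g = solve-∀

  X-s : X [] (1ℤ ∷ []) ≗ s
  X-s i = trans (cong (λ z → 0ℤ + (1ℤ * s i + z)) (▹-0 C (λ _ → refl) i)) (g (s i))
    where
    g : ∀ x → 0ℤ + (1ℤ * x + 0ℤ) ≡ x
    g = solve-∀

  X-Ct : X (0ℤ ∷ 1ℤ ∷ []) [] ≗ C ▹ t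
  X-Ct i = trans (cong (λ z → (0ℤ * t i + z) + 0ℤ) (▹-cong C (λ j → trans (cong (1ℤ * t j +_) (▹-0 C (λ _ → refl) j)) (trans (ℤₚ.+-identityʳ _) (ℤₚ.*-identityˡ (t j)))) i)) (g (t i) ((C ▹ t) i))
    where
    g : ∀ x y → (0ℤ * x + y) + 0ℤ ≡ y
    g = solve-∀

  found : ∀ p r x → X p r ≗ x → ¬ (∀ i → x i ≡ 0ℤ [mod 2ℤ ]) → Isotropic 2ℤ C x → Found
  found p r x e nzx iso = p , r , index (vanishes? 2 (X p r)) , λ k → mod-cong₂ (∙-cong e (Linear.l-cong (pw-linear k C) e)) refl (iso k)
    where
    index : (∀ i → X p r i ≡ 0ℤ [mod 2ℤ ]) ⊎ Σ (Fin n) (λ i → ¬ X p r i ≡ 0ℤ [mod 2ℤ ]) → Σ (Fin n) λ i → ¬ X p r i ≡ 0ℤ [mod 2ℤ ]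
    index (inj₁ z) = contradiction (λ i → mod-cong₂ (sym (e i)) refl (z i)) nzx
    index (inj₂ w) = w

  odd-cancel : ∀ {a b} → ¬ a ≡ 0ℤ [mod 2ℤ ] → a * b ≡ 0ℤ [mod 2ℤ ] → b ≡ 0ℤ [mod 2ℤ ]
  odd-cancel {a} a≢0 e with euclid prime[2] a e
  ... | inj₁ z = contradiction z a≢0
  ... | inj₂ z = z

  final₁ : ∀ a → ¬ a ≡ 0ℤ [mod 2ℤ ] → Annihilates (a ∷ []) → Found
  final₁ a odd ann = choose (vanishes? 2 t)
    where
    h≡0 : ∀ j → h j ≡ 0ℤ [mod 2ℤ ]
    h≡0 j = odd-cancel odd (mod-cong₂ (sym (ℤₚ.+-identityʳ (a * h j))) refl (ann j))
    choose : (∀ i → t i ≡ 0ℤ [mod 2ℤ ]) ⊎ Σ (Fin n) (λ i → ¬ t i ≡ 0ℤ [mod 2ℤ ]) → Found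
    choose (inj₁ z) = found [] (1ℤ ∷ []) s X-s (λ z' → nz (z , z')) (λ k → mod-trans (ss k) (h≡0 (suc k)))
    choose (inj₂ (i , w)) = found (1ℤ ∷ []) [] t X-t (λ z → w (z i)) h≡0

  -- Only h(j+1) is known to vanish, so t itself may fail to be isotropic. But the moments of s are
  -- h(j+1), and if s ≡ 0 then C t serves: its moments are h(j+2), and it is nonzero since C is
  -- injective modulo 2.
  final₂ : ∀ b → ¬ b ≡ 0ℤ [mod 2ℤ ] → Annihilates (0ℤ ∷ b ∷ []) → Found
  final₂ b odd ann = choose (vanishes? 2 s)
    where
    h≡0 : ∀ j → h (suc j) ≡ 0ℤ [mod 2ℤ ]
    h≡0 j = odd-cancel odd (mod-cong₂ (g (h j) (b * h (suc j))) refl (ann j))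
      where
      g : ∀ x y → y ≡ 0ℤ * x + (y + 0ℤ)
      g = solve-∀
    choose : (∀ i → s i ≡ 0ℤ [mod 2ℤ ]) ⊎ Σ (Fin n) (λ i → ¬ s i ≡ 0ℤ [mod 2ℤ ]) → Found
    choose (inj₁ z) = found (0ℤ ∷ 1ℤ ∷ []) [] (C ▹ t) X-Ct (λ z' → nz (inj t z' , z))
      (λ k → mod-cong₂ (trans (selfAdjoint sy t (pw k C (C ▹ t))) (∙-cong {u = t} (λ _ → refl) (▹-cong C (pw-shift k C t)))) refl (h≡0 (suc k)))
    choose (inj₂ (i , w)) = found [] (1ℤ ∷ []) s X-s (λ z → w (z i)) (λ k → mod-trans (ss k) (h≡0 k))

  -- N is fuel bounding the length. With at least three coefficients both `evens F` and
  -- `0ℤ ∷ odds F` are strictly shorter, and one of them keeps an odd coefficient. With two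
  -- coefficients the second list no longer shrinks, so lengths one and two are settled by `final₁`
  -- and `final₂`.
  descend : ∀ N F → length F ℕ.≤ N → Annihilates F → OddCoeff F → Found
  descend N [] le ann (k , odd) = contradiction mod-refl odd
  descend N (a ∷ []) le ann (zero , odd) = final₁ a odd ann
  descend N (a ∷ []) le ann (suc k , odd) = contradiction mod-refl odd
  descend N F@(a ∷ b ∷ []) le ann (k , odd) = step (vanishes? 2 (X (a ∷ []) (b ∷ [])))
    where
    step : (∀ i → X (a ∷ []) (b ∷ []) i ≡ 0ℤ [mod 2ℤ ]) ⊎ Σ (Fin n) (λ i → ¬ X (a ∷ []) (b ∷ []) i ≡ 0ℤ [mod 2ℤ ]) → Found
    step (inj₂ w) = a ∷ [] , b ∷ [] , w , X-isotropic F ann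
    step (inj₁ z) = cases k odd
      where
      cases : ∀ k → ¬ coeff F k ≡ 0ℤ [mod 2ℤ ] → Found
      cases zero          o = final₁ a o (proj₁ (X-zero (a ∷ []) (b ∷ []) z))
      cases (suc zero)    o = final₂ b o (proj₂ (X-zero (a ∷ []) (b ∷ []) z))
      cases (suc (suc k)) o = contradiction mod-refl o
  descend (suc N) F@(a ∷ b ∷ c ∷ G) (s≤s le) ann odd = step (vanishes? 2 (X (evens F) (odds F)))
    where
    step : (∀ i → X (evens F) (odds F) i ≡ 0ℤ [mod 2ℤ ]) ⊎ Σ (Fin n) (λ i → ¬ X (evens F) (odds F) i ≡ 0ℤ [mod 2ℤ ]) → Found
    step (inj₂ w) = evens F , odds F , w , X-isotropic F ann
    step (inj₁ z) with odd-coeff-split F odd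
    ... | inj₁ o = descend N (evens F) (ℕₚ.≤-trans (s≤s (s≤s (proj₂ (evens-odds-length G)))) le) (proj₁ (X-zero (evens F) (odds F) z)) o
    ... | inj₂ (k , o) = descend N (0ℤ ∷ odds F) (ℕₚ.≤-trans (s≤s (s≤s (proj₁ (evens-odds-length G)))) le) (proj₂ (X-zero (evens F) (odds F) z)) (suc k , o)

halve : ∀ k → Σ ℕ λ j → (k ≡ j ℕ.+ j) ⊎ (k ≡ suc (j ℕ.+ j))
halve zero = 0 , inj₁ refl
halve (suc k) with halve k
... | j , inj₁ refl = j , inj₂ refl
... | j , inj₂ refl = suc j , inj₁ (cong suc (sym (ℕₚ.+-suc j j)))

module Main {n : ℕ} (B : Mat n) (s : Symmetric B) (c : Fin n → Bool) (bip : Splits c B)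
            (unit : IsUnit (det B)) (P : Poly) (P≈ : spread P ≈p charPoly n B) where
  open Parts c
  open Bip B s c bip unit P P≈
  open Quadratic C C-sym using (root; dact-square; dact-square-form)

  double-▹ : ∀ j v → pw j C v ≗ pw (j ℕ.+ j) B v
  double-▹ zero    v i = refl
  double-▹ (suc j) v i = trans (▹-cong C (double-▹ j v) i) (trans (C▹ (pw (j ℕ.+ j) B v) i)
    (cong (λ k → pw k B v i) (cong suc (sym (ℕₚ.+-suc j j)))))

  supp-pw : ∀ j {b v} → Supp b v → Supp b (pw j C v)
  supp-pw zero    h = h
  supp-pw (suc j) h = supp-C (supp-pw j h)

  -- For u = t + f along the two parts and s = Bf, the odd moments of u are 2 t·Cʲs, the even ones s·Cʲs + t·Cʲ⁺¹t.
  module Halves (u : Vect n) (iso : Isotropic (2ℤ * 2ℤ) B u) where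
    open ≡-Reasoning
    t f r : Vect n
    t = proj true u
    f = proj false u
    r = B ▹ f

    t-supp : Supp true t
    t-supp = proj-supp true u
    f-supp : Supp false f
    f-supp = proj-supp false u
    r-supp : Supp true r
    r-supp = supp-▹ bip f-supp

    bilinear : ∀ (M : Mat n) → Symmetric M → u ∙ (M ▹ u) ≡ (t ∙ (M ▹ t) + t ∙ (M ▹ f)) + (t ∙ (M ▹ f) + f ∙ (M ▹ f))
    bilinear M sy = begin
      u ∙ (M ▹ u) ≡⟨ ∙-cong (proj-split u) (λ i → trans (▹-cong M (proj-split u) i) (▹-+ M t f i)) ⟩
      (λ i → t i + f i) ∙ (λ i → (M ▹ t) i + (M ▹ f) i) ≡⟨ trans (∙-+ˡ _ t f) (cong₂ _+_ (∙-+ʳ t (M ▹ t) (M ▹ f)) (∙-+ʳ f (M ▹ t) (M ▹ f))) ⟩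
      (t ∙ (M ▹ t) + t ∙ (M ▹ f)) + (f ∙ (M ▹ t) + f ∙ (M ▹ f))
        ≡⟨ cong (λ z → (t ∙ (M ▹ t) + t ∙ (M ▹ f)) + (z + f ∙ (M ▹ f))) (trans (sym (selfAdjoint sy f t)) (∙-comm (M ▹ f) t)) ⟩
      (t ∙ (M ▹ t) + t ∙ (M ▹ f)) + (t ∙ (M ▹ f) + f ∙ (M ▹ f)) ∎

    powMat : ℕ → Mat n
    powMat k = matrixOf (pw k B)

    powMat-▹ : ∀ k v → powMat k ▹ v ≗ pw k B v
    powMat-▹ k = matrixOf-▹ (pw-linear k B)

    powMat-sym : ∀ k → Symmetric (powMat k)
    powMat-sym k i j = trans (sym (∑-δˡ i (pw k B (δ j)))) (trans (sym (pw-selfAdjoint s k (δ i) (δ j))) (trans (∙-comm (pw k B (δ i)) (δ j)) (∑-δˡ j (pw k B (δ i)))))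

    moments : ∀ k → u ∙ pw k B u ≡ (t ∙ pw k B t + t ∙ pw k B f) + (t ∙ pw k B f + f ∙ pw k B f)
    moments k = trans (∙-cong {u = u} (λ _ → refl) (λ i → sym (powMat-▹ k u i))) (trans (bilinear (powMat k) (powMat-sym k))
      (cong₂ _+_ (cong₂ _+_ (e t t) (e t f)) (cong₂ _+_ (e t f) (e f f))))
      where
      e : ∀ v w → v ∙ (powMat k ▹ w) ≡ v ∙ pw k B w
      e v w = ∙-cong {u = v} (λ _ → refl) (powMat-▹ k w)

    odd-pw : ∀ j v → pw (suc (j ℕ.+ j)) B v ≗ B ▹ pw j C v
    odd-pw j v = ▹-cong B (λ i → sym (double-▹ j v i))

    odd-pw' : ∀ j v → pw (suc (j ℕ.+ j)) B v ≗ pw j C (B ▹ v)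
    odd-pw' j v i = trans (sym (pw-shift (j ℕ.+ j) B v i)) (sym (double-▹ j (B ▹ v) i))

    -- Here isotropy modulo 4 is spent: the odd moment of u is twice this number, and cancelling the
    -- 2 leaves a congruence modulo 2.
    tr : ∀ j → t ∙ pw j C r ≡ 0ℤ [mod 2ℤ ]
    tr j = mod-cancel 2ℤ (λ ()) (mod-cong₂ (sym eq) refl (iso (suc (j ℕ.+ j))))
      where
      k = suc (j ℕ.+ j)
      eq : u ∙ pw k B u ≡ 2ℤ * (t ∙ pw j C r)
      eq = begin
        u ∙ pw k B u ≡⟨ moments k ⟩
        (t ∙ pw k B t + t ∙ pw k B f) + (t ∙ pw k B f + f ∙ pw k B f)
          ≡⟨ cong₂ _+_ (cong₂ _+_ (trans (∙-cong {u = t} (λ _ → refl) (odd-pw j t)) (opposite true t-supp (supp-▹ bip (supp-pw j t-supp)))) x)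
                       (cong₂ _+_ x (trans (∙-cong {u = f} (λ _ → refl) (odd-pw j f)) (opposite false f-supp (supp-▹ bip (supp-pw j f-supp))))) ⟩
        (0ℤ + t ∙ pw j C r) + (t ∙ pw j C r + 0ℤ) ≡⟨ g (t ∙ pw j C r) ⟩
        2ℤ * (t ∙ pw j C r) ∎
        where
        g : ∀ x → (0ℤ + x) + (x + 0ℤ) ≡ (1ℤ + 1ℤ) * x
        g = solve-∀
        x : t ∙ pw k B f ≡ t ∙ pw j C r
        x = ∙-cong {u = t} (λ _ → refl) (odd-pw' j f)

    rr : ∀ j → r ∙ pw j C r ≡ t ∙ pw (suc j) C t [mod 2ℤ ]
    rr j = mod-trans (mod-sym (mod-+0ʳ (double≡0 (t ∙ pw (suc j) C t)))) (mod-trans (≡⇒mod (g (r ∙ pw j C r) (t ∙ pw (suc j) C t)))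
      (mod-trans (mod-+ (mod-trans (mod-cong₂ (sym eq) refl (mod-weaken 2ℤ (iso k))) mod-refl) (mod-refl {a = t ∙ pw (suc j) C t})) (≡⇒mod (ℤₚ.+-identityˡ (t ∙ pw (suc j) C t)))))
      where
      k = suc j ℕ.+ suc j
      g : ∀ x y → x + (1ℤ + 1ℤ) * y ≡ (y + x) + y
      g = solve-∀
      even : ∀ v w → v ∙ pw k B w ≡ v ∙ pw (suc j) C w
      even v w = ∙-cong {u = v} (λ _ → refl) (λ i → sym (double-▹ (suc j) w i))
      fr : f ∙ pw (suc j) C f ≡ r ∙ pw j C r
      fr = begin
        f ∙ pw (suc j) C f ≡⟨ ∙-cong {u = f} (λ _ → refl) (λ i → trans (sym (pw-shift j C f i)) (trans (Linear.l-cong (pw-linear j C) (C▹ f) i) refl)) ⟩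
        f ∙ pw j C (B ▹ r) ≡⟨ ∙-cong {u = f} (λ _ → refl) (λ i → trans (sym (odd-pw' j r i)) (odd-pw j r i)) ⟩
        f ∙ (B ▹ pw j C r) ≡⟨ sym (selfAdjoint s f (pw j C r)) ⟩
        r ∙ pw j C r ∎
      eq : u ∙ pw k B u ≡ t ∙ pw (suc j) C t + r ∙ pw j C r
      eq = begin
        u ∙ pw k B u ≡⟨ moments k ⟩
        (t ∙ pw k B t + t ∙ pw k B f) + (t ∙ pw k B f + f ∙ pw k B f)
          ≡⟨ cong₂ _+_ (cong₂ _+_ (even t t) x) (cong₂ _+_ x (trans (even f f) fr)) ⟩
        (t ∙ pw (suc j) C t + 0ℤ) + (0ℤ + r ∙ pw j C r) ≡⟨ cong₂ _+_ (ℤₚ.+-identityʳ (t ∙ pw (suc j) C t)) (ℤₚ.+-identityˡ (r ∙ pw j C r)) ⟩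
        t ∙ pw (suc j) C t + r ∙ pw j C r ∎
        where
        x : t ∙ pw k B f ≡ 0ℤ
        x = trans (even t f) (opposite true t-supp (supp-pw (suc j) f-supp))

    vanishing : (∀ i → t i ≡ 0ℤ [mod 2ℤ ]) × (∀ i → r i ≡ 0ℤ [mod 2ℤ ]) → ∀ i → u i ≡ 0ℤ [mod 2ℤ ]
    vanishing (ht , hr) i = mod-cong₂ (proj-split u i) refl (mod-+0 (ht i) (injective hr i))

    C-injective : ∀ v → (∀ i → (C ▹ v) i ≡ 0ℤ [mod 2ℤ ]) → ∀ i → v i ≡ 0ℤ [mod 2ℤ ]
    C-injective v h = injective (injective (λ i → mod-cong₂ (sym (C▹ v i)) refl (h i)))

  module Two (u : Vect n) (iso : Isotropic (2ℤ * 2ℤ) B u) (u≢0 : Σ (Fin n) λ i → ¬ u i ≡ 0ℤ [mod 2ℤ ])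
             (P-odd : OddCoeff P) where
    open Halves u iso
    open Descent C C-sym t r tr rr C-injective (λ z → proj₂ u≢0 (vanishing z (proj₁ u≢0)))

    annihilates : Annihilates P
    annihilates j = ≡⇒mod (trans (sym (Quadratic.∙-pw-act C C-sym t j P t)) (∙-0ʳ t (λ i → trans (Linear.l-cong (pw-linear j C)
      (λ i → trans (sym (spread-act P t i)) (trans (act-≈p (spread P) (charPoly n B) B t P≈ i) (cayley-hamilton B t i))) i) (linear-0 (pw-linear j C) i))))

    isotropic-B : ∀ {x} → Supp true x → Isotropic 2ℤ C x → Isotropic 2ℤ B x
    isotropic-B {x} hx hi k = byParity k (halve k)
      where
      byParity : ∀ k → (Σ ℕ λ j → (k ≡ j ℕ.+ j) ⊎ (k ≡ suc (j ℕ.+ j))) → x ∙ pw k B x ≡ 0ℤ [mod 2ℤ ]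
      byParity _ (j , inj₁ refl) = mod-cong₂ (∙-cong {u = x} (λ _ → refl) (λ i → sym (double-▹ j x i))) refl (hi j)
      byParity _ (j , inj₂ refl) = ≡⇒mod (trans (∙-cong {u = x} (λ _ → refl) (odd-pw j x)) (opposite true hx (supp-▹ bip (supp-pw j hx))))

    -- For B itself the conclusion χ′(B)x ≡ 0 is empty modulo 2. Instead the directional derivative
    -- of χ at B is rewritten by `spread-D` as B times that of P at C, and B is cancelled before
    -- contracting. For this the functionals wⱼ must live in the same part as x, so they are
    -- projected to it, which does not change their values on the Krylov vectors of x.
    derivative-C : ∀ {x} → Supp true x → Isotropic 2ℤ C x → ∀ i → dact P C x i ≡ 0ℤ [mod 2ℤ ]
    derivative-C {x} hx hi i with generalised-inverse prime[2] (length P) (λ j → pw (toℕ j) C x)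
    ... | w , H = mod-trans (mod-sym (contract 2ℤ C C-sym x w' H' P (ℕₚ.m≤n⇒m≤1+n ℕₚ.≤-refl) i))
      (∑-mod0 (λ j → pw-mod0 2ℤ (toℕ j) C (D-vanishes (proj-supp true (w j))) i))
      where
      w' : Rows (length P) n
      w' j = proj true (w j)
      same : ∀ {z} → Supp true z → ∀ v → proj true v ∙ z ≡ v ∙ z
      same {z} hz v = sym (trans (∙-cong (proj-split v) (λ _ → refl)) (trans (∙-+ˡ z (proj true v) (proj false v))
        (trans (cong (proj true v ∙ z +_) (opposite false (proj-supp false v) hz)) (ℤₚ.+-identityʳ _))))
      H' : ∀ l i → combination w' (λ j → pw (toℕ j) C x) (pw (toℕ l) C x) i ≡ pw (toℕ l) C x i [mod 2ℤ ]
      H' l i = mod-cong₂ (∑-cong (λ j → cong (_* pw (toℕ j) C x i) (same (supp-pw (toℕ l) hx) (w j)))) refl (H l i)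
      D-vanishes : ∀ {v} → Supp true v → ∀ i → D C x P v i ≡ 0ℤ [mod 2ℤ ]
      D-vanishes {v} hv = injective (λ i → mod-cong₂ (sym (spread-D true hx hv P i)) refl
        (derivative-vanishes 2 B x (λ ()) (isotropic-B hx hi) (spread P) P≈ v i))

    -- The two vectors are z and Bz. As P′ is the square of its root modulo 2, P′(C)z ≡ 0 and K
    -- kills both. Their mixed value is zᵀC P′(C)z, congruent modulo 4 to yᵀC y with y the root
    -- applied to z; since y ≡ 0 modulo 2 it vanishes modulo 4.
    conclude-with : ∀ z → Supp true z → (Σ (Fin n) λ i → ¬ z i ≡ 0ℤ [mod 2ℤ ]) → Isotropic 2ℤ C z →
                    (∀ i → act (root P) C z i ≡ 0ℤ [mod 2ℤ ]) → det K ≡ 0ℤ [mod 2ℤ ℤ.^ 4 ]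
    conclude-with z hz nzz hi gz = conclude prime[2] zs supps nonzero Kzs
        (mod-cong₂ crossEq refl (mod-trans (dact-square-form P z hi 1) (∙-mod-product gz (∑-mod0 ∘ λ i j → mod-*0 (C i j) (gz j)))))
      where
      zs : Bool → Vect n
      zs true  = z
      zs false = B ▹ z
      supps : ∀ b → Supp b (zs b)
      supps true  = hz
      supps false = supp-▹ bip hz
      nonzero : ∀ b → Σ (Fin n) λ i → ¬ zs b i ≡ 0ℤ [mod 2ℤ ]
      nonzero true = nzz
      nonzero false with vanishes? 2 (B ▹ z)
      ... | inj₁ h = contradiction (injective h (proj₁ nzz)) (proj₂ nzz)
      ... | inj₂ w = w
      dz : ∀ i → dact P C z i ≡ 0ℤ [mod 2ℤ ]
      dz i = mod-trans (dact-square P z i) (linear-mod0 2ℤ C (root P) gz i)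
      Kzs : ∀ b i → (K ▹ zs b) i ≡ 0ℤ [mod 2ℤ ]
      Kzs true  i = mod-cong₂ (K▹ z i) refl (∑-mod0 (λ j → mod-*0 (B i j) (dz j)))
      Kzs false i = mod-cong₂ (trans (K▹ (B ▹ z) i) (▹-cong B (λ j → sym (commute-dact B C BC P z j)) i)) refl
        (∑-mod0 (λ j → mod-*0 (B i j) (∑-mod0 (λ k → mod-*0 (B j k) (dz k)))))
      crossEq : z ∙ (K ▹ (B ▹ z)) ≡ z ∙ pw 1 C (dact P C z)
      crossEq = ∙-cong {u = z} (λ _ → refl) (λ i → trans (K▹ (B ▹ z) i) (trans (▹-cong B (λ j → sym (commute-dact B C BC P z j)) i) (sym (C▹ (dact P C z) i))))

    -- An isotropic x satisfies P′(C)x ≡ 0, so the root of P′ applied twice kills it. Either one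
    -- application y already vanishes and x is the wanted vector, or y is: the root kills y, and
    -- yᵀCᵏy = xᵀCᵏP′(C)x ≡ 0 modulo 2.
    two : det K ≡ 0ℤ [mod 2ℤ ℤ.^ 4 ]
    two = finish (descend (length P) P ℕₚ.≤-refl annihilates P-odd)
      where
      finish : Found → det K ≡ 0ℤ [mod 2ℤ ℤ.^ 4 ]
      finish (p , r' , nzx , hi) = choose (vanishes? 2 y)
        where
        x = X p r'
        y = act (root P) C x
        hx : Supp true x
        hx i q = cong₂ _+_ (supp-act supp-C p t-supp i q) (supp-act supp-C r' r-supp i q)
        gy : ∀ i → act (root P) C y i ≡ 0ℤ [mod 2ℤ ]
        gy i = mod-trans (mod-sym (dact-square P x i)) (derivative-C hx hi i)
        y-isotropic : Isotropic 2ℤ C y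
        y-isotropic k = mod-cong₂ (trans (∙-act-swap C-sym (root P) x (pw k C y)) (∙-cong {u = x} (λ _ → refl) (act-pw (root P) k C y)))
          refl (∙-mod0 x (pw-mod0 2ℤ k C gy))
        choose : (∀ i → y i ≡ 0ℤ [mod 2ℤ ]) ⊎ Σ (Fin n) (λ i → ¬ y i ≡ 0ℤ [mod 2ℤ ]) → det K ≡ 0ℤ [mod 2ℤ ℤ.^ 4 ]
        choose (inj₁ h) = conclude-with x hx nzx hi h
        choose (inj₂ w) = conclude-with y (supp-act supp-C (root P) hx) w y-isotropic gy

  prime-divides : ∀ {q} → Prime q → OddCoeff P → ∀ u → Isotropic (int q * int q) B u → (Σ (Fin n) λ i → ¬ u i ≡ 0ℤ [mod int q ]) → det K ≡ 0ℤ [mod int q ℤ.^ 4 ]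
  prime-divides {q} pr po u iso nz with q ℕ.≟ 2
  ... | yes refl = Two.two u iso nz po
  ... | no q≢2 = Odd.odd-prime pr odd u iso nz
    where
    odd : ¬ int 2 ≡ 0ℤ [mod int q ]
    odd h with prime⇒irreducible prime[2] (mod⇒∣ {q} {int 2} h)
    ... | inj₁ refl = ℕ.nonTrivial⇒≢1 {{prime⇒nonTrivial pr}} refl
    ... | inj₂ e = q≢2 e

-- Parity of the characteristic polynomial of a bipartite matrix

signPow-^ : ∀ n → signPow n ≡ -1ℤ ℤ.^ n
signPow-^ zero    = refl
signPow-^ (suc n) = trans (cong -_ (signPow-^ n)) (sym (ℤₚ.-1*i≡-i (-1ℤ ℤ.^ n)))

det-diag-const : ∀ n k → det {n} (diag (λ _ → k)) ≡ k ℤ.^ n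
det-diag-const zero    k = det-nil
det-diag-const (suc n) k = trans (det-block1 n (diag (λ _ → k)) zero k (λ _ → refl) (λ _ → ℤₚ.*-zeroʳ k)) (cong (k *_) (det-diag-const n k))

det-scale : ∀ n k (M : Mat n) → det (λ i j → k * M i j) ≡ k ℤ.^ n * det M
det-scale n k M = trans (det-cong n (λ i j → sym (diag-⊗ (λ _ → k) M i j))) (trans (det-⊗ n (diag (λ _ → k)) M) (cong (_* det M) (det-diag-const n k)))

det-neg : ∀ n (M : Mat n) → det (λ i j → - M i j) ≡ signPow n * det M
det-neg n M = trans (det-cong n (λ i j → sym (ℤₚ.-1*i≡-i (M i j)))) (trans (det-scale n -1ℤ M) (cong (_* det M) (sym (signPow-^ n))))

signPow-cases : ∀ n → (signPow n ≡ 1ℤ) ⊎ (signPow n ≡ -1ℤ)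
signPow-cases zero = inj₁ refl
signPow-cases (suc n) with signPow-cases n
... | inj₁ e = inj₂ (cong -_ e)
... | inj₂ e = inj₁ (cong -_ e)

flip : Poly → Poly
flip []      = []
flip (a ∷ p) = a ∷ negP (flip p)

coeff-flip : ∀ p k → coeff (flip p) k ≡ signPow k * coeff p k
coeff-flip []      k       = sym (ℤₚ.*-zeroʳ (signPow k))
coeff-flip (a ∷ p) zero    = sym (ℤₚ.*-identityˡ a)
coeff-flip (a ∷ p) (suc k) = trans (coeff-negP (flip p) k) (trans (cong -_ (coeff-flip p k)) (ℤₚ.neg-distribˡ-* (signPow k) (coeff p k)))

eval-flip : ∀ p y → eval (flip p) y ≡ eval p (- y)
eval-flip []      y = refl
eval-flip (a ∷ p) y = trans (cong (λ z → a + y * z) (trans (eval-negP y (flip p)) (cong -_ (eval-flip p y)))) (g a y (eval p (- y)))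
  where
  g : ∀ a y e → a + y * - e ≡ a + - y * e
  g = solve-∀

coeff-0-det : ∀ n (M : Mat n) → coeff (charPoly n M) 0 ≡ signPow n * det M
coeff-0-det n M = trans (sym (eval-0 (charPoly n M))) (trans (eval-charPoly n M 0ℤ) (trans (det-cong n (λ i j → g (δ i j) (M i j))) (det-neg n M)))
  where
  eval-0 : ∀ p → eval p 0ℤ ≡ coeff p 0
  eval-0 [] = refl
  eval-0 (a ∷ p) = trans (cong (a +_) (ℤₚ.*-zeroˡ (eval p 0ℤ))) (ℤₚ.+-identityʳ a)
  g : ∀ d b → 0ℤ * d - b ≡ - b
  g = solve-∀

-- Conjugation by the diagonal matrix of signs of the two parts sends M to -M. Hence χ(-x) =
-- (-1)ⁿχ(x), and coefficients of the wrong parity vanish.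
module Parity {n : ℕ} (c : Fin n → Bool) (M : Mat n) (bip : Splits c M) where
  private
    sg : Vect n
    sg i = if c i then 1ℤ else -1ℤ

    sg² : ∀ i → sg i * sg i ≡ 1ℤ
    sg² i with c i
    ... | true  = refl
    ... | false = refl

    sgδ : ∀ i j → sg i * (δ i j * sg j) ≡ δ i j
    sgδ i j with i ≟ j
    ... | yes refl rewrite δ-refl i = trans (cong (sg i *_) (ℤₚ.*-identityˡ (sg i))) (sg² i)
    ... | no i≢j rewrite δ-≢ i≢j = trans (cong (sg i *_) (ℤₚ.*-zeroˡ (sg j))) (ℤₚ.*-zeroʳ (sg i))

    sgM : ∀ i j → sg i * (M i j * sg j) ≡ - M i j
    sgM i j with c i Boolₚ.≟ c j
    ... | yes e = trans (cong (λ z → sg i * (z * sg j)) (bip i j e)) (trans (cong (sg i *_) (ℤₚ.*-zeroˡ (sg j))) (trans (ℤₚ.*-zeroʳ (sg i)) (cong -_ (sym (bip i j e)))))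
    ... | no ne with c i | c j
    ...   | true  | true  = contradiction refl ne
    ...   | true  | false = h (M i j)
      where
      h : ∀ m → 1ℤ * (m * - 1ℤ) ≡ - m
      h = solve-∀
    ...   | false | true  = h (M i j)
      where
      h : ∀ m → - 1ℤ * (m * 1ℤ) ≡ - m
      h = solve-∀
    ...   | false | false = contradiction refl ne

    conjugate : ∀ (X : Mat n) → det (λ i j → sg i * (X i j * sg j)) ≡ det X
    conjugate X = begin
      det (λ i j → sg i * (X i j * sg j)) ≡⟨ det-cong n (λ i j → sym (trans (diag-⊗ sg (X ⊗ diag sg) i j) (cong (sg i *_) (⊗-diag sg X i j)))) ⟩
      det (diag sg ⊗ (X ⊗ diag sg)) ≡⟨ trans (det-⊗ n (diag sg) (X ⊗ diag sg)) (cong (det (diag sg) *_) (det-⊗ n X (diag sg))) ⟩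
      d * (det X * d) ≡⟨ g d (det X) ⟩
      (d * d) * det X ≡⟨ cong (_* det X) (trans (sym (det-⊗ n (diag sg) (diag sg))) (trans (det-cong n (λ i j → trans (diag-⊗ sg (diag sg) i j) (square i j))) (det-δ n))) ⟩
      1ℤ * det X ≡⟨ ℤₚ.*-identityˡ (det X) ⟩
      det X ∎
      where
      open ≡-Reasoning
      d = det (diag sg)
      g : ∀ d x → d * (x * d) ≡ (d * d) * x
      g = solve-∀
      square : ∀ i j → sg i * (sg i * δ i j) ≡ δ i j
      square i j = trans (sym (ℤₚ.*-assoc (sg i) (sg i) (δ i j))) (trans (cong (_* δ i j) (sg² i)) (ℤₚ.*-identityˡ (δ i j)))

  shift-neg : ∀ y → det (shift M (- y)) ≡ signPow n * det (shift M y)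
  shift-neg y = trans (sym (conjugate (shift M (- y)))) (trans (det-cong n eq) (det-neg n (shift M y)))
    where
    eq : ∀ i j → sg i * ((- y * δ i j - M i j) * sg j) ≡ - (y * δ i j - M i j)
    eq i j = trans (g (sg i) y (δ i j) (M i j) (sg j)) (trans (cong₂ (λ a b → - y * a + - b) (sgδ i j) (sgM i j)) (h y (δ i j) (M i j)))
      where
      g : ∀ s y d m t → s * ((- y * d - m) * t) ≡ - y * (s * (d * t)) + - (s * (m * t))
      g = solve-∀
      h : ∀ y d m → - y * d + - (- m) ≡ - (y * d - m)
      h = solve-∀

  parity : ∀ k → signPow k * coeff (charPoly n M) k ≡ signPow n * coeff (charPoly n M) k
  parity k = trans (sym (coeff-flip χ' k)) (trans (poly-ext (flip χ') (scaleP (signPow n) χ') eq k) (coeff-scale (signPow n) χ' k))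
    where
    χ' = charPoly n M
    eq : ∀ t → eval (flip χ') (int (suc t)) ≡ eval (scaleP (signPow n) χ') (int (suc t))
    eq t = trans (eval-flip χ' y) (trans (eval-charPoly n M (- y)) (trans (shift-neg y)
      (trans (cong (signPow n *_) (sym (eval-charPoly n M y))) (sym (eval-scale y (signPow n) χ')))))
      where y = int (suc t)

  wrong-parity : ∀ k → signPow k ≡ - signPow n → coeff (charPoly n M) k ≡ 0ℤ
  wrong-parity k e = *-zero-cases (int 2) (λ ()) (trans (h (signPow-cases n) (trans (cong (_* coeff (charPoly n M) k) (sym e)) (parity k))) refl)
    where
    h : ∀ {s x} → (s ≡ 1ℤ) ⊎ (s ≡ -1ℤ) → - s * x ≡ s * x → int 2 * x ≡ 0ℤ
    h {x = x} (inj₁ refl) e = trans (g₁ x) (trans (cong (λ z → 1ℤ * x - z) e) (ℤₚ.+-inverseʳ (1ℤ * x)))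
      where
      g₁ : ∀ x → (1ℤ + 1ℤ) * x ≡ 1ℤ * x - - 1ℤ * x
      g₁ = solve-∀
    h {x = x} (inj₂ refl) e = trans (g₂ x) (trans (cong (λ z → z - - 1ℤ * x) e) (ℤₚ.+-inverseʳ (- 1ℤ * x)))
      where
      g₂ : ∀ x → (1ℤ + 1ℤ) * x ≡ 1ℤ * x - - 1ℤ * x
      g₂ = solve-∀

coeff-spread-even : ∀ p k → coeff (spread p) (k ℕ.+ k) ≡ coeff p k
coeff-spread-even []      k       = refl
coeff-spread-even (a ∷ p) zero    = refl
coeff-spread-even (a ∷ p) (suc k) rewrite ℕₚ.+-suc k k = coeff-spread-even p k

coeff-spread-odd : ∀ p k → coeff (spread p) (suc (k ℕ.+ k)) ≡ 0ℤ
coeff-spread-odd []      k       = refl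
coeff-spread-odd (a ∷ p) zero    = refl
coeff-spread-odd (a ∷ p) (suc k) rewrite ℕₚ.+-suc k k = coeff-spread-odd p k

signPow-double : ∀ j → signPow (j ℕ.+ j) ≡ 1ℤ
signPow-double j = trans (signPow-+ j j) (signPow-sq j)

unit-* : ∀ {a b} → IsUnit a → IsUnit b → IsUnit (a * b)
unit-* (inj₁ refl) (inj₁ refl) = inj₁ refl
unit-* (inj₁ refl) (inj₂ refl) = inj₂ refl
unit-* (inj₂ refl) (inj₁ refl) = inj₂ refl
unit-* (inj₂ refl) (inj₂ refl) = inj₁ refl

unit-abs : ∀ {a} → IsUnit a → ∣ a ∣ ≡ 1
unit-abs (inj₁ refl) = refl
unit-abs (inj₂ refl) = refl

unit≢0 : ∀ {a} → IsUnit a → a ≢ 0ℤ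
unit≢0 (inj₁ refl) ()
unit≢0 (inj₂ refl) ()

unit-odd : ∀ {a} → IsUnit a → ¬ a ≡ 0ℤ [mod 2ℤ ]
unit-odd u h = 2∤1 (subst (2 ℕᵈ.∣_) (unit-abs u) (mod⇒∣ {2} h))
  where
  2∤1 : ¬ 2 ℕᵈ.∣ 1
  2∤1 d = ℕₚ.<⇒≱ (ℕₚ.n<1+n 1) (ℕᵈ.∣⇒≤ d)

module Unimodular {n : ℕ} (c : Fin n → Bool) (B : Mat n) (bip : Splits c B) (unit : IsUnit (coeff (charPoly n B) 0)) where
  open Parity c B bip

  det-unit : IsUnit (det B)
  det-unit = subst IsUnit eq (unit-* (signPow-cases n) unit)
    where
    eq : signPow n * coeff (charPoly n B) 0 ≡ det B
    eq = trans (cong (signPow n *_) (coeff-0-det n B)) (trans (sym (ℤₚ.*-assoc (signPow n) (signPow n) (det B))) (trans (cong (_* det B) (signPow-sq n)) (ℤₚ.*-identityˡ (det B))))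

  even-order : signPow n ≡ 1ℤ
  even-order with signPow-cases n
  ... | inj₁ e = e
  ... | inj₂ e = contradiction (wrong-parity 0 (cong -_ (sym e))) (unit≢0 unit)

  half : Poly
  half = tab n (λ k → coeff (charPoly n B) (k ℕ.+ k))

  half-coeff : ∀ k → coeff half k ≡ coeff (charPoly n B) (k ℕ.+ k)
  half-coeff = tab-≈p n _ (λ k n<k → charPoly-degree n B (k ℕ.+ k) (ℕₚ.≤-trans n<k (ℕₚ.m≤m+n k k)))

  half-≈p : spread half ≈p charPoly n B
  half-≈p m with halve m
  ... | j , inj₁ refl = trans (coeff-spread-even half j) (half-coeff j)
  ... | j , inj₂ refl = trans (coeff-spread-odd half j) (sym (wrong-parity (suc (j ℕ.+ j)) (cong -_ (trans (signPow-double j) (sym even-order)))))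

  half-odd : OddCoeff half
  half-odd = 0 , λ h → unit-odd unit (mod-cong₂ (sym (half-coeff 0)) refl h)

-- The discriminant as det χ′(A)

record ScaledCoeffs (k : ℕ) (q r : Poly) : Set where
  constructor scaled
  field law : ∀ j → coeff r j ≡ int (k ℕ.+ j) * coeff q j

scaled-coeffs : (g : ℕ → Poly → Poly) → (∀ k → g k [] ≡ []) → (∀ k a q → g k (a ∷ q) ≡ (int k * a) ∷ g (suc k) q) →
                ∀ k q → ScaledCoeffs k q (g k q)
scaled-coeffs g e₀ e₁ k q = scaled (go k q)
  where
  go : ∀ k q j → coeff (g k q) j ≡ int (k ℕ.+ j) * coeff q j
  go k []      j       rewrite e₀ k     = sym (ℤₚ.*-zeroʳ (int (k ℕ.+ j)))
  go k (a ∷ q) zero    rewrite e₁ k a q = cong (λ z → int z * a) (sym (ℕₚ.+-identityʳ k))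
  go k (a ∷ q) (suc j) rewrite e₁ k a q = trans (go (suc k) q j) (cong (λ z → int z * coeff q j) (sym (ℕₚ.+-suc k j)))

-- The recursion inside `derivP` is a local function, so `derivP-loop` is left as a hole.
-- Abstracting `a ∷ q` and 1 in `derivP-scaled` turns the goal into that function applied to
-- distinct variables, and unification with `derivP-loop-scaled` fills the hole; the record
-- `ScaledCoeffs` keeps the function visible as a parameter for this purpose.
mutual
  derivP-loop : Poly → ℕ → Poly → Poly
  derivP-loop = _

  derivP-scaled : ∀ a q → ScaledCoeffs 1 q (derivP (a ∷ q))
  derivP-scaled a q with a ∷ q | 1
  ... | p | k = derivP-loop-scaled p k q

  derivP-loop-scaled : ∀ p k q → ScaledCoeffs k q (derivP-loop p k q)
  derivP-loop-scaled p = scaled-coeffs (derivP-loop p) (λ k → refl) (λ k a q → refl)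

coeff-derivP : ∀ p j → coeff (derivP p) j ≡ int (suc j) * coeff p (suc j)
coeff-derivP []      j = sym (ℤₚ.*-zeroʳ (int (suc j)))
coeff-derivP (a ∷ q) j = ScaledCoeffs.law (derivP-scaled a q) j

act-derivP : ∀ {n} p (M : Mat n) v → act (derivP p) M v ≗ dact p M v
act-derivP []      M v i = refl
act-derivP (a ∷ q) M v i = trans (act-≈p (derivP (a ∷ q)) (q +p (0ℤ ∷ derivP q)) M v coeffs i)
  (trans (act-+p q (0ℤ ∷ derivP q) i) (cong (act q M v i +_) (trans (cong (_+ (M ▹ act (derivP q) M v) i) (ℤₚ.*-zeroˡ (v i)))
    (trans (ℤₚ.+-identityˡ ((M ▹ act (derivP q) M v) i)) (▹-cong M (act-derivP q M v) i)))))
  where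
  act-+p : ∀ p r i → act (p +p r) M v i ≡ act p M v i + act r M v i
  act-+p []      r       i = sym (ℤₚ.+-identityˡ (act r M v i))
  act-+p (a ∷ p) []      i = sym (ℤₚ.+-identityʳ (act (a ∷ p) M v i))
  act-+p (a ∷ p) (b ∷ r) i = trans (cong ((a + b) * v i +_) (trans (▹-cong M (act-+p p r) i) (▹-+ M (act p M v) (act r M v) i)))
    (g a b (v i) ((M ▹ act p M v) i) ((M ▹ act r M v) i))
    where
    g : ∀ a b v x y → (a + b) * v + (x + y) ≡ (a * v + x) + (b * v + y)
    g = solve-∀
  coeffs : derivP (a ∷ q) ≈p (q +p (0ℤ ∷ derivP q))
  coeffs zero    = trans (coeff-derivP (a ∷ q) 0) (trans (ℤₚ.*-identityˡ (coeff q 0)) (sym (trans (coeff-+p q (0ℤ ∷ derivP q) 0) (ℤₚ.+-identityʳ (coeff q 0)))))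
  coeffs (suc j) = trans (coeff-derivP (a ∷ q) (suc j)) (sym (trans (coeff-+p q (0ℤ ∷ derivP q) (suc j)) (trans (cong (coeff q (suc j) +_) (coeff-derivP q j))
    (trans (g (int (suc j)) (coeff q (suc j))) (cong (_* coeff q (suc j)) (sym (ℤₚ.pos-+ 1 (suc j))))))))
    where
    g : ∀ k c → c + k * c ≡ (1ℤ + k) * c
    g = solve-∀

-- Block triangular determinants and the Sylvester matrix

module _ {m n : ℕ} where
  blockEntry : Mat m → (Fin n → Fin m → ℤ) → Mat n → Fin m ⊎ Fin n → Fin m ⊎ Fin n → ℤ
  blockEntry X Y Z (inj₁ i) (inj₁ j) = X i j
  blockEntry X Y Z (inj₁ i) (inj₂ j) = 0ℤ
  blockEntry X Y Z (inj₂ i) (inj₁ j) = Y i j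
  blockEntry X Y Z (inj₂ i) (inj₂ j) = Z i j

  block : Mat m → (Fin n → Fin m → ℤ) → Mat n → Mat (m ℕ.+ n)
  block X Y Z r c = blockEntry X Y Z (splitAt m r) (splitAt m c)

  block-alternating : ∀ Y Z → Alternating (λ X → det (block X Y Z))
  block-alternating Y Z = record
    { multilinear = record
      { congruent = λ {M} {N} h → det-cong (m ℕ.+ n) (λ r c → entry {M} {N} (splitAt m r) (splitAt m c) (λ i _ → h i))
      ; linear = λ i x y {M} {N} {P} p q h → linear (i ↑ˡ n) x y (off i {M} {N} p) (off i {M} {P} q) (at i x y {M} {N} {P} h) }
    ; alternate = λ {i} {j} M i≢j h → alternate {i ↑ˡ n} {j ↑ˡ n} (block M Y Z) (λ e → i≢j (Finₚ.↑ˡ-injective n i j e)) (same i j M h) }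
    where
    open Alternating (det-alternating (m ℕ.+ n))
    entry : ∀ {M N : Mat m} s t → (∀ i → s ≡ inj₁ i → M i ≗ N i) → blockEntry M Y Z s t ≡ blockEntry N Y Z s t
    entry (inj₁ i) (inj₁ j) h = h i refl j
    entry (inj₁ i) (inj₂ j) h = refl
    entry (inj₂ i) (inj₁ j) h = refl
    entry (inj₂ i) (inj₂ j) h = refl
    off : ∀ i {M N : Mat m} → N ≈[ i ] M → block N Y Z ≈[ i ↑ˡ n ] block M Y Z
    off i {M} {N} p a a≢ k = entry {N} {M} (splitAt m a) (splitAt m k)
      (λ a' e → p a' (λ e' → a≢ (trans (sym (Finₚ.splitAt⁻¹-↑ˡ e)) (cong (_↑ˡ n) e'))))
    at : ∀ i x y {M N P : Mat m} → (∀ k → M i k ≡ x * N i k + y * P i k) →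
         ∀ k → block M Y Z (i ↑ˡ n) k ≡ x * block N Y Z (i ↑ˡ n) k + y * block P Y Z (i ↑ˡ n) k
    at i x y h k rewrite Finₚ.splitAt-↑ˡ m i n with splitAt m k
    ... | inj₁ k' = h k'
    ... | inj₂ _  = g x y
      where
      g : ∀ x y → 0ℤ ≡ x * 0ℤ + y * 0ℤ
      g = solve-∀
    same : ∀ i j M → M i ≗ M j → block M Y Z (i ↑ˡ n) ≗ block M Y Z (j ↑ˡ n)
    same i j M h k rewrite Finₚ.splitAt-↑ˡ m i n | Finₚ.splitAt-↑ˡ m j n with splitAt m k
    ... | inj₁ k' = h k'
    ... | inj₂ _  = refl

det-block-δ : ∀ m {n} (Y : Fin n → Fin m → ℤ) (Z : Mat n) → det (block δ Y Z) ≡ det Z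
det-block-δ zero    {n} Y Z = det-cong n (λ i j → refl)
det-block-δ (suc m) {n} Y Z = trans (det-laplace (m ℕ.+ n) B) (trans (∑-single zero _ off)
  (trans (g (det (minor B zero zero))) (trans (det-cong (m ℕ.+ n) inner) (det-block-δ m (λ i j → Y i (suc j)) Z))))
  where
  B = block δ Y Z
  g : ∀ d → 1ℤ * (1ℤ * d) ≡ d
  g = solve-∀
  first : ∀ j → B zero (suc j) ≡ 0ℤ
  first j with splitAt m j
  ... | inj₁ _ = refl
  ... | inj₂ _ = refl
  off : ∀ j → j ≢ zero → signPow (toℕ j) * (B zero j * det (minor B zero j)) ≡ 0ℤ
  off zero    p = contradiction refl p
  off (suc j) p = trans (cong (λ z → signPow (suc (toℕ j)) * (z * det (minor B zero (suc j)))) (first j)) (f (signPow (suc (toℕ j))) (det (minor B zero (suc j))))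
    where
    f : ∀ s d → s * (0ℤ * d) ≡ 0ℤ
    f = solve-∀
  inner : minor B zero zero ≈ block δ (λ i j → Y i (suc j)) Z
  inner r c with splitAt m r | splitAt m c
  ... | inj₁ _ | inj₁ _ = refl
  ... | inj₁ _ | inj₂ _ = refl
  ... | inj₂ _ | inj₁ _ = refl
  ... | inj₂ _ | inj₂ _ = refl

det-block : ∀ m n X Y Z → det (block {m} {n} X Y Z) ≡ det X * det Z
det-block m n X Y Z = trans (det-unique m (block-alternating Y Z) X) (cong (det X *_) (det-block-δ m Y Z))

det-unitriangular : ∀ n (U : Mat n) → (∀ i j → toℕ j ℕ.< toℕ i → U i j ≡ 0ℤ) → (∀ i → U i i ≡ 1ℤ) → det U ≡ 1ℤ
det-unitriangular zero    U lower diagonal = det-nil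
det-unitriangular (suc n) U lower diagonal = trans (sym (det-ᵗ (suc n) U)) (trans (detᵗ-laplace n U) (trans (∑-single zero _ off)
  (trans (cong (λ z → 1ℤ * (z * det ((minor U zero zero) ᵗ))) (diagonal zero)) (trans (g (det ((minor U zero zero) ᵗ)))
    (trans (det-ᵗ n (minor U zero zero)) (det-unitriangular n (minor U zero zero) (λ i j lt → lower (suc i) (suc j) (s≤s lt)) (λ i → diagonal (suc i))))))))
  where
  g : ∀ d → 1ℤ * (1ℤ * d) ≡ d
  g = solve-∀
  off : ∀ j → j ≢ zero → signPow (toℕ j) * (U j zero * det ((minor U j zero) ᵗ)) ≡ 0ℤ
  off zero    p = contradiction refl p
  off (suc j) p = trans (cong (λ z → signPow (suc (toℕ j)) * (z * det ((minor U (suc j) zero) ᵗ))) (lower (suc j) zero (s≤s z≤n))) (f (signPow (suc (toℕ j))) (det ((minor U (suc j) zero) ᵗ)))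
    where
    f : ∀ s d → s * (0ℤ * d) ≡ 0ℤ
    f = solve-∀

-- A named copy of the local `band` of `sylvester`, with which it agrees definitionally.
bandEntry : Poly → ℕ → ℕ → ℕ → ℤ
bandEntry p d i j = if (i ℕ.≤ᵇ j) ∧ (j ℕ.≤ᵇ i ℕ.+ d) then coeff p (d ℕ.∸ (j ℕ.∸ i)) else 0ℤ

suc≤ᵇsuc : ∀ a b → (suc a ℕ.≤ᵇ suc b) ≡ (a ℕ.≤ᵇ b)
suc≤ᵇsuc zero    b = refl
suc≤ᵇsuc (suc a) b = refl

bandEntry-suc : ∀ p d i j → bandEntry p d (suc i) (suc j) ≡ bandEntry p d i j
bandEntry-suc p d i j = cong₂ (λ a b → if a ∧ b then coeff p (d ℕ.∸ (j ℕ.∸ i)) else 0ℤ) (suc≤ᵇsuc i j) (suc≤ᵇsuc j (i ℕ.+ d))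

bandEntry-step : ∀ p d j → bandEntry p (suc d) 0 (suc j) ≡ bandEntry p d 0 j
bandEntry-step p d j = cong (λ b → if b then coeff p (d ℕ.∸ j) else 0ℤ) (suc≤ᵇsuc j d)

bandEntry-lower : ∀ p d i j → j ℕ.< i → bandEntry p d i j ≡ 0ℤ
bandEntry-lower p d (suc i) zero    lt = refl
bandEntry-lower p d (suc i) (suc j) (s≤s lt) = trans (bandEntry-suc p d i j) (bandEntry-lower p d i j lt)

bandEntry-diagonal : ∀ p d i → bandEntry p d i i ≡ coeff p d
bandEntry-diagonal p d zero    = refl
bandEntry-diagonal p d (suc i) = trans (bandEntry-suc p d i i) (bandEntry-diagonal p d i)

-- The sum of f k F k for k ≤ d, taken from the top because the rows of a Sylvester matrix list
-- coefficients from the leading one downwards.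
topMoment : (ℕ → ℤ) → (ℕ → ℤ) → ℕ → ℤ
topMoment f F zero    = f 0 * F 0
topMoment f F (suc d) = f (suc d) * F (suc d) + topMoment f F d

topMoment-shift : ∀ d f F → topMoment f F (suc d) ≡ f 0 * F 0 + topMoment (f ∘ suc) (F ∘ suc) d
topMoment-shift zero    f F = ℤₚ.+-comm (f 1 * F 1) (f 0 * F 0)
topMoment-shift (suc d) f F = trans (cong (f (suc (suc d)) * F (suc (suc d)) +_) (topMoment-shift d f F))
  (g (f (suc (suc d)) * F (suc (suc d))) (f 0 * F 0) (topMoment (f ∘ suc) (F ∘ suc) d))
  where
  g : ∀ a b c → a + (b + c) ≡ b + (a + c)
  g = solve-∀

topMoment-moment : ∀ d p F → (∀ k → d ℕ.< k → coeff p k ≡ 0ℤ) → topMoment (coeff p) F d ≡ moment p F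
topMoment-moment d p F h = trans (tabbed d (coeff p) F) (moment-≈ (tab d (coeff p)) p F (tab-≈p d (coeff p) h))
  where
  tabbed : ∀ d f F → topMoment f F d ≡ moment (tab d f) F
  tabbed zero    f F = sym (ℤₚ.+-identityʳ (f 0 * F 0))
  tabbed (suc d) f F = trans (topMoment-shift d f F) (cong (f 0 * F 0 +_) (tabbed d (f ∘ suc) (F ∘ suc)))
  moment-≈ : ∀ p q F → p ≈p q → moment p F ≡ moment q F
  moment-≈ []      []      F h = refl
  moment-≈ []      (b ∷ q) F h = trans (moment-≈ [] q (F ∘ suc) (h ∘ suc)) (sym (trans (cong (λ z → z * F 0 + moment q (F ∘ suc)) (sym (h 0))) (trans (cong (_+ moment q (F ∘ suc)) (ℤₚ.*-zeroˡ (F 0))) (ℤₚ.+-identityˡ (moment q (F ∘ suc))))))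
  moment-≈ (a ∷ p) []      F h = trans (cong₂ (λ x y → x * F 0 + y) (h 0) (moment-≈ p [] (F ∘ suc) (h ∘ suc))) (trans (ℤₚ.+-identityʳ (0ℤ * F 0)) (ℤₚ.*-zeroˡ (F 0)))
  moment-≈ (a ∷ p) (b ∷ q) F h = cong₂ (λ x y → x * F 0 + y) (h 0) (moment-≈ p q (F ∘ suc) (h ∘ suc))

band-top : ∀ p d e (F : ℕ → ℤ) → ∑ {suc (d ℕ.+ e)} (λ c → bandEntry p d 0 (toℕ c) * F ((d ℕ.+ e) ℕ.∸ toℕ c)) ≡ topMoment (coeff p) (λ k → F (k ℕ.+ e)) d
band-top p zero e F = trans ∑-suc (trans (cong (coeff p 0 * F e +_) (∑-0 (λ c → trans (cong (_* F (e ℕ.∸ suc (toℕ c))) (vanish (toℕ c))) (ℤₚ.*-zeroˡ (F (e ℕ.∸ suc (toℕ c))))))) (ℤₚ.+-identityʳ (coeff p 0 * F e)))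
  where
  vanish : ∀ c → bandEntry p 0 0 (suc c) ≡ 0ℤ
  vanish c = refl
band-top p (suc d) e F = trans ∑-suc (cong (coeff p (suc d) * F (suc d ℕ.+ e) +_)
  (trans (∑-cong (λ c → cong (_* F ((d ℕ.+ e) ℕ.∸ toℕ c)) (bandEntry-step p d (toℕ c)))) (band-top p d e F)))

band-row : ∀ p d i e (F : ℕ → ℤ) → ∑ {i ℕ.+ suc (d ℕ.+ e)} (λ c → bandEntry p d i (toℕ c) * F ((i ℕ.+ suc (d ℕ.+ e)) ℕ.∸ 1 ℕ.∸ toℕ c)) ≡ topMoment (coeff p) (λ k → F (k ℕ.+ e)) d
band-row p d zero    e F = band-top p d e F
band-row p d (suc i) e F = trans ∑-suc (trans (cong (_+ rest) (ℤₚ.*-zeroˡ (F N))) (trans (ℤₚ.+-identityˡ rest)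
  (trans (∑-cong (λ c → cong₂ _*_ (bandEntry-suc p d i (toℕ c)) (cong F (sym (ℕₚ.∸-+-assoc N 1 (toℕ c)))))) (band-row p d i e F))))
  where
  N = i ℕ.+ suc (d ℕ.+ e)
  rest = ∑ {N} (λ c → bandEntry p d (suc i) (suc (toℕ c)) * F (N ℕ.∸ suc (toℕ c)))

moment-pw : ∀ {n} (M : Mat n) v p e k → moment p (λ l → pw (l ℕ.+ e) M v k) ≡ pw e M (act p M v) k
moment-pw M v p e k = trans (go p e k) (act-pw p e M v k)
  where
  go : ∀ p e k → moment p (λ l → pw (l ℕ.+ e) M v k) ≡ act p M (pw e M v) k
  go []      e k = refl
  go (a ∷ p) e k = cong (a * pw e M v k +_) (trans (moment-cong p (λ i → cong (λ l → pw l M v k) (sym (ℕₚ.+-suc i e)))) (trans (go p (suc e) k) (act-shift p M (pw e M v) k)))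
    where
    moment-cong : ∀ p {f g} → (∀ i → f i ≡ g i) → moment p f ≡ moment p g
    moment-cong p h = mod0⇒≡ (moment-mod p (λ i → ≡⇒mod (h i)))

δ-toℕ : ∀ {l m n} (i : Fin l) (i' : Fin m) (j : Fin n) → toℕ i ≡ toℕ i' → δ i j ≡ δ i' j
δ-toℕ zero    zero     zero    e = refl
δ-toℕ zero    zero     (suc j) e = refl
δ-toℕ (suc i) (suc i') zero    e = refl
δ-toℕ (suc i) (suc i') (suc j) e = δ-toℕ i i' j (ℕₚ.suc-injective e)

δ-toℕ-≢ : ∀ {m n} (i : Fin m) (j : Fin n) → toℕ i ≢ toℕ j → δ i j ≡ 0ℤ
δ-toℕ-≢ zero    zero    h = contradiction refl h
δ-toℕ-≢ zero    (suc j) h = refl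
δ-toℕ-≢ (suc i) zero    h = refl
δ-toℕ-≢ (suc i) (suc j) h = δ-toℕ-≢ i j (h ∘ cong suc)

<ᵇ-true : ∀ {a b} → a ℕ.< b → (a ℕ.<ᵇ b) ≡ true
<ᵇ-true {zero}  (s≤s _) = refl
<ᵇ-true {suc a} (s≤s h) = <ᵇ-true h

+≮ᵇ : ∀ a b → (a ℕ.+ b ℕ.<ᵇ a) ≡ false
+≮ᵇ zero    b = refl
+≮ᵇ (suc a) b = +≮ᵇ a b

-- Multiplying the Sylvester matrix by the Krylov rows A^(N-1-c)v kills the rows of f, since f(A)v = 0, and turns
-- those of g into the Krylov matrix times g(A).
module Resultant (m n : ℕ) (A′ : Mat n) (v : Vect n) (f g : Poly) (monic : coeff f n ≡ 1ℤ)
  (f-degree : ∀ k → n ℕ.< k → coeff f k ≡ 0ℤ) (g-degree : ∀ k → m ℕ.< k → coeff g k ≡ 0ℤ) (annihilated : act f A′ v ≗ 0ᵛ) where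
  S : Mat (m ℕ.+ n)
  S = sylvester f n g m

  S-top : ∀ r c → toℕ r ℕ.< m → S r c ≡ bandEntry f n (toℕ r) (toℕ c)
  S-top r c lt rewrite <ᵇ-true lt = refl

  S-bottom : ∀ j c → S (m ↑ʳ j) c ≡ bandEntry g m (toℕ j) (toℕ c)
  S-bottom j c rewrite Finₚ.toℕ-↑ʳ m j | +≮ᵇ m (toℕ j) | ℕₚ.m+n∸m≡n m (toℕ j) = refl

  krylov : Mat n
  krylov j = pw (n ℕ.∸ suc (toℕ j)) A′ v

  power : Fin (m ℕ.+ n) → Vect n
  power c = pw ((m ℕ.+ n) ℕ.∸ 1 ℕ.∸ toℕ c) A′ v

  power-bottom : ∀ j → power (m ↑ʳ j) ≗ krylov j
  power-bottom j k = cong (λ l → pw l A′ v k) (trans (cong (λ t → (m ℕ.+ n) ℕ.∸ 1 ℕ.∸ t) (Finₚ.toℕ-↑ʳ m j))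
    (trans (ℕₚ.∸-+-assoc (m ℕ.+ n) 1 (m ℕ.+ toℕ j)) (trans (cong ((m ℕ.+ n) ℕ.∸_) (sym (ℕₚ.+-suc m (toℕ j)))) (ℕₚ.[m+n]∸[m+o]≡n∸o m n (suc (toℕ j))))))

  row : ∀ p d i e → i ℕ.+ suc (d ℕ.+ e) ≡ m ℕ.+ n → (∀ k → d ℕ.< k → coeff p k ≡ 0ℤ) → ∀ k →
        ∑ (λ c → bandEntry p d i (toℕ c) * power c k) ≡ pw e A′ (act p A′ v) k
  row p d i e eq deg k = trans (go eq) (trans (band-row p d i e F) (trans (topMoment-moment d p (λ l → F (l ℕ.+ e)) deg) (moment-pw A′ v p e k)))
    where
    F : ℕ → ℤ
    F l = pw l A′ v k
    go : ∀ {N N'} → N' ≡ N → ∑ {N} (λ c → bandEntry p d i (toℕ c) * F (N ℕ.∸ 1 ℕ.∸ toℕ c)) ≡ ∑ {N'} (λ c → bandEntry p d i (toℕ c) * F (N' ℕ.∸ 1 ℕ.∸ toℕ c))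
    go refl = refl

  -- The first m unit columns complete the Krylov rows to a square matrix with determinant
  -- `det krylov`. They leave the first m columns of S in place, whose upper block is unitriangular
  -- because f is monic.
  Ē : Mat (m ℕ.+ n)
  Ē c k with splitAt m k
  ... | inj₁ k' = δ c k'
  ... | inj₂ k' = power c k'

  gA : Mat n
  gA = matrixOf (act g A′)

  det-Ē : det Ē ≡ det krylov
  det-Ē = trans (sym (det-ᵗ (m ℕ.+ n) Ē)) (trans (det-cong (m ℕ.+ n) eq) (trans (det-block m n δ (λ k c → power (c ↑ˡ n) k) (krylov ᵗ))
    (trans (cong₂ _*_ (det-δ m) (det-ᵗ n krylov)) (ℤₚ.*-identityˡ (det krylov)))))
    where
    eq : Ē ᵗ ≈ block δ (λ k c → power (c ↑ˡ n) k) (krylov ᵗ)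
    eq k c with splitAt m k | splitAt m c in e
    ... | inj₁ k' | inj₁ c' = trans (δ-toℕ c c' k' (trans (cong toℕ (sym (Finₚ.splitAt⁻¹-↑ˡ e))) (Finₚ.toℕ-↑ˡ c' n))) (δ-sym c' k')
    ... | inj₁ k' | inj₂ c' = δ-toℕ-≢ c k' (λ e' → ℕₚ.<⇒≱ (Finₚ.toℕ<n k') (subst (m ℕ.≤_) (trans (sym (Finₚ.toℕ-↑ʳ m c')) (trans (cong toℕ (Finₚ.splitAt⁻¹-↑ʳ e)) e')) (ℕₚ.m≤m+n m (toℕ c'))))
    ... | inj₂ k' | inj₁ c' = cong (λ z → power z k') (sym (Finₚ.splitAt⁻¹-↑ˡ e))
    ... | inj₂ k' | inj₂ c' = trans (cong (λ z → power z k') (sym (Finₚ.splitAt⁻¹-↑ʳ e))) (power-bottom c' k')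

  U : Mat m
  U r k = S (r ↑ˡ n) (k ↑ˡ n)

  det-U : det U ≡ 1ℤ
  det-U = det-unitriangular m U lower diagonal
    where
    entry : ∀ r k → U r k ≡ bandEntry f n (toℕ r) (toℕ k)
    entry r k = trans (S-top (r ↑ˡ n) (k ↑ˡ n) (subst (ℕ._< m) (sym (Finₚ.toℕ-↑ˡ r n)) (Finₚ.toℕ<n r)))
      (cong₂ (bandEntry f n) (Finₚ.toℕ-↑ˡ r n) (Finₚ.toℕ-↑ˡ k n))
    lower : ∀ i j → toℕ j ℕ.< toℕ i → U i j ≡ 0ℤ
    lower i j lt = trans (entry i j) (bandEntry-lower f n (toℕ i) (toℕ j) lt)
    diagonal : ∀ i → U i i ≡ 1ℤ
    diagonal i = trans (entry i i) (trans (bandEntry-diagonal f n (toℕ i)) monic)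

  product : S ⊗ Ē ≈ block U (λ j k → S (m ↑ʳ j) (k ↑ˡ n)) (krylov ⊗ (gA ᵗ))
  product r k with splitAt m k in ek | splitAt m r in er
  ... | inj₁ k' | inj₁ r' = trans left (cong (λ z → S z (k' ↑ˡ n)) (sym (Finₚ.splitAt⁻¹-↑ˡ er)))
    where
    left : ∑ (λ c → S r c * δ c k') ≡ S r (k' ↑ˡ n)
    left = trans (∑-cong (λ c → cong (S r c *_) (trans (δ-sym c k') (trans (δ-toℕ k' (k' ↑ˡ n) c (sym (Finₚ.toℕ-↑ˡ k' n))) (δ-sym (k' ↑ˡ n) c))))) (∑-δʳ (k' ↑ˡ n) (S r))
  ... | inj₁ k' | inj₂ r' = trans left (cong (λ z → S z (k' ↑ˡ n)) (sym (Finₚ.splitAt⁻¹-↑ʳ er)))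
    where
    left : ∑ (λ c → S r c * δ c k') ≡ S r (k' ↑ˡ n)
    left = trans (∑-cong (λ c → cong (S r c *_) (trans (δ-sym c k') (trans (δ-toℕ k' (k' ↑ˡ n) c (sym (Finₚ.toℕ-↑ˡ k' n))) (δ-sym (k' ↑ˡ n) c))))) (∑-δʳ (k' ↑ˡ n) (S r))
  ... | inj₂ k' | inj₁ r' = trans (∑-cong (λ c → cong (_* power c k') (S-top r c r<m))) (trans (row f n (toℕ r) e eq f-degree k')
      (trans (Linear.l-cong (pw-linear e A′) annihilated k') (linear-0 (pw-linear e A′) k')))
    where
    r<m : toℕ r ℕ.< m
    r<m = subst (ℕ._< m) (trans (sym (Finₚ.toℕ-↑ˡ r' n)) (cong toℕ (Finₚ.splitAt⁻¹-↑ˡ er))) (Finₚ.toℕ<n r')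
    e = m ℕ.∸ suc (toℕ r)
    eq : toℕ r ℕ.+ suc (n ℕ.+ e) ≡ m ℕ.+ n
    eq = trans (ℕₚ.+-suc (toℕ r) (n ℕ.+ e)) (trans (cong (suc (toℕ r) ℕ.+_) (ℕₚ.+-comm n e)) (trans (sym (ℕₚ.+-assoc (suc (toℕ r)) e n)) (cong (ℕ._+ n) (ℕₚ.m+[n∸m]≡n r<m))))
  ... | inj₂ k' | inj₂ j = trans (∑-cong (λ c → cong (_* power c k') (trans (cong (λ z → S z c) (sym (Finₚ.splitAt⁻¹-↑ʳ er))) (S-bottom j c)))) (trans (row g m (toℕ j) e eq g-degree k')
      (trans (sym (act-pw g e A′ v k')) (trans (sym (matrixOf-▹ (act-linear g A′) (pw e A′ v) k')) (∑-cong (λ l → ℤₚ.*-comm (gA k' l) (pw e A′ v l))))))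
    where
    e = n ℕ.∸ suc (toℕ j)
    eq : toℕ j ℕ.+ suc (m ℕ.+ e) ≡ m ℕ.+ n
    eq = trans (ℕₚ.+-suc (toℕ j) (m ℕ.+ e)) (trans (cong suc (trans (sym (ℕₚ.+-assoc (toℕ j) m e)) (trans (cong (ℕ._+ e) (ℕₚ.+-comm (toℕ j) m)) (ℕₚ.+-assoc m (toℕ j) e))))
      (trans (sym (ℕₚ.+-suc m (toℕ j ℕ.+ e))) (cong (m ℕ.+_) (ℕₚ.m+[n∸m]≡n (Finₚ.toℕ<n j)))))

  resultant : det krylov ≢ 0ℤ → det S ≡ det gA
  resultant k≢0 = ℤₚ.i-j≡0⇒i≡j (det S) (det gA) (*-zero-cases (det krylov) k≢0 (trans (h (det krylov) (det S) (det gA)) (ℤₚ.i≡j⇒i-j≡0 {det S * det krylov} {det krylov * det gA} main)))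
    where
    h : ∀ k s g → k * (s - g) ≡ s * k - k * g
    h = solve-∀
    main : det S * det krylov ≡ det krylov * det gA
    main = trans (cong (det S *_) (sym det-Ē)) (trans (sym (det-⊗ (m ℕ.+ n) S Ē)) (trans (det-cong (m ℕ.+ n) product) (trans (det-block m n U _ (krylov ⊗ (gA ᵗ)))
      (trans (cong₂ _*_ det-U (trans (det-⊗ n krylov (gA ᵗ)) (cong (det krylov *_) (det-ᵗ n gA)))) (ℤₚ.*-identityˡ (det krylov * det gA))))))

-- Congruent matrices and perturbation to a generic one

data PolyMod (N : ℤ) : Poly → Poly → Set where
  []  : PolyMod N [] []
  _∷_ : ∀ {a b p q} → a ≡ b [mod N ] → PolyMod N p q → PolyMod N (a ∷ p) (b ∷ q)

module _ {N : ℤ} where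
  mod-+p : ∀ {p q r t} → PolyMod N p q → PolyMod N r t → PolyMod N (p +p r) (q +p t)
  mod-+p []      g       = g
  mod-+p (e ∷ h) []      = e ∷ h
  mod-+p (e ∷ h) (f ∷ g) = mod-+ e f ∷ mod-+p h g

  mod-scaleP : ∀ {a b p q} → a ≡ b [mod N ] → PolyMod N p q → PolyMod N (scaleP a p) (scaleP b q)
  mod-scaleP e []      = []
  mod-scaleP e (f ∷ h) = mod-* e f ∷ mod-scaleP e h

  mod-*p : ∀ {p q r t} → PolyMod N p q → PolyMod N r t → PolyMod N (p *p r) (q *p t)
  mod-*p []      g = []
  mod-*p (e ∷ h) g = mod-+p (mod-scaleP e g) (mod-refl ∷ mod-*p h g)

  mod-negP : ∀ {p q} → PolyMod N p q → PolyMod N (negP p) (negP q)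
  mod-negP []      = []
  mod-negP (e ∷ h) = mod-neg e ∷ mod-negP h

  mod-coeff : ∀ {p q} → PolyMod N p q → ∀ k → coeff p k ≡ coeff q k [mod N ]
  mod-coeff []      k       = mod-refl
  mod-coeff (e ∷ h) zero    = e
  mod-coeff (e ∷ h) (suc k) = mod-coeff h k

  module _ {n : ℕ} {M M' : Mat n} (h : ∀ i j → M i j ≡ M' i j [mod N ]) where
    charPoly-mod : ∀ k → coeff (charPoly n M) k ≡ coeff (charPoly n M') k [mod N ]
    charPoly-mod = mod-coeff (det-related {opsR = Polyops} {opsS = Polyops} (PolyMod N) [] (mod-refl ∷ []) mod-+p mod-*p mod-negP n (charEntry M) (charEntry M') entry)
      where
      entry : ∀ i j → PolyMod N (charEntry M i j) (charEntry M' i j)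
      entry i j with toℕ i ℕ.≡ᵇ toℕ j
      ... | true  = mod-neg (h i j) ∷ (mod-refl ∷ [])
      ... | false = mod-neg (h i j) ∷ []

    ▹-mod₂ : ∀ {u v} → (∀ j → u j ≡ v j [mod N ]) → ∀ i → (M ▹ u) i ≡ (M' ▹ v) i [mod N ]
    ▹-mod₂ g i = ∑-mod (λ j → mod-* (h i j) (g j))

    act-mod₂ : ∀ p v i → act p M v i ≡ act p M' v i [mod N ]
    act-mod₂ []      v i = mod-refl
    act-mod₂ (a ∷ p) v i = mod-+ (mod-refl {a = a * v i}) (▹-mod₂ (act-mod₂ p v) i)

    pw-mod₂ : ∀ k v i → pw k M v i ≡ pw k M' v i [mod N ]
    pw-mod₂ zero    v i = mod-refl
    pw-mod₂ (suc k) v i = ▹-mod₂ (pw-mod₂ k v) i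

bandEntry-mod : ∀ {N} p q d i j → (∀ k → coeff p k ≡ coeff q k [mod N ]) → bandEntry p d i j ≡ bandEntry q d i j [mod N ]
bandEntry-mod p q d i j h with (i ℕ.≤ᵇ j) ∧ (j ℕ.≤ᵇ i ℕ.+ d)
... | true  = h _
... | false = mod-refl

sylvester-mod : ∀ {N} f f' d g g' m r c → (∀ k → coeff f k ≡ coeff f' k [mod N ]) → (∀ k → coeff g k ≡ coeff g' k [mod N ]) →
                sylvester f d g m r c ≡ sylvester f' d g' m r c [mod N ]
sylvester-mod f f' d g g' m r c hf hg with toℕ r ℕ.<ᵇ m
... | true  = bandEntry-mod f f' d (toℕ r) (toℕ c) hf
... | false = bandEntry-mod g g' m (toℕ r ℕ.∸ m) (toℕ c) hg

mod-all⇒0 : ∀ a → (∀ k → a ≡ 0ℤ [mod int (suc k) ]) → a ≡ 0ℤ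
mod-all⇒0 a h = ℤₚ.∣i∣≡0⇒i≡0 (small ∣ a ∣ (mod⇒∣ {suc ∣ a ∣} (h ∣ a ∣)))
  where
  small : ∀ k → suc k ℕᵈ.∣ k → k ≡ 0
  small zero    d = refl
  small (suc k) d = contradiction (ℕᵈ.∣⇒≤ d) (ℕₚ.<⇒≱ (ℕₚ.n<1+n (suc k)))

1≢0-mod : ∀ k {a} → a ≡ 1ℤ [mod int (suc (suc k)) ] → a ≢ 0ℤ
1≢0-mod k h refl = ℕₚ.<⇒≱ (s≤s (s≤s z≤n)) (ℕᵈ.∣⇒≤ (mod⇒∣ {suc (suc k)} {1ℤ} (mod-sym h)))

-- X and X + k(X − Y) agree modulo k, while the latter agrees with Y modulo k + 1; with k = suc l this
-- transfers integer polynomial identities from matrices resembling Y to arbitrary ones.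
perturb : ∀ {n} → ℕ → Mat n → Mat n → Mat n
perturb l Y X i j = X i j + int (suc l) * (X i j - Y i j)

perturb-≡X : ∀ {n} l (Y X : Mat n) i j → X i j ≡ perturb l Y X i j [mod int (suc l) ]
perturb-≡X l Y X i j = mod-sym (wit (X i j - Y i j) (cong (X i j +_) (ℤₚ.*-comm (int (suc l)) (X i j - Y i j))))

perturb-≡Y : ∀ {n} l (Y X : Mat n) i j → perturb l Y X i j ≡ Y i j [mod int (suc (suc l)) ]
perturb-≡Y l Y X i j = wit (X i j - Y i j) (trans (g (X i j) (Y i j) (int (suc l))) (cong (λ z → Y i j + (X i j - Y i j) * z) (sym (ℤₚ.pos-+ 1 (suc l)))))
  where
  g : ∀ x y k → x + k * (x - y) ≡ y + (x - y) * (1ℤ + k)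
  g = solve-∀

module _ {n' : ℕ} where
  private
    n = suc n'

  -- The model matrix for having a cyclic vector: it shifts each unit vector to the preceding one,
  -- so the Krylov matrix of the last unit vector is the identity.
  lowering : Mat n
  lowering i j = δ (Fin.suc i) j

  lowering-step : ∀ i → lowering ▹ δ (Fin.suc i) ≗ δ (inject₁ i)
  lowering-step i r = trans (▹-δ lowering (Fin.suc i) r) (trans (δ-sym r i) (δ-toℕ i (inject₁ i) r (sym (Finₚ.toℕ-inject₁ i))))

  lowering-power : ∀ k (i : Fin n) → toℕ i ℕ.+ k ≡ n' → pw k lowering (δ (fromℕ n')) ≗ δ i
  lowering-power zero i e r = δ-toℕ (fromℕ n') i r (trans (Finₚ.toℕ-fromℕ n') (trans (sym e) (ℕₚ.+-identityʳ (toℕ i))))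
  lowering-power (suc k) i e r = trans (▹-cong lowering (lowering-power k (Fin.suc i') e') r) (trans (lowering-step i' r)
    (δ-toℕ (inject₁ i') i r (trans (Finₚ.toℕ-inject₁ i') (Finₚ.toℕ-fromℕ< i<n'))))
    where
    i<n' : toℕ i ℕ.< n'
    i<n' = subst (toℕ i ℕ.<_) e (ℕₚ.m<m+n (toℕ i) (s≤s z≤n))
    i' = Fin.fromℕ< i<n'
    e' : suc (toℕ i') ℕ.+ k ≡ n'
    e' = trans (cong (λ z → suc z ℕ.+ k) (Finₚ.toℕ-fromℕ< i<n')) (trans (sym (ℕₚ.+-suc (toℕ i) k)) e)

  -- `Resultant` needs a vector with nonzero Krylov determinant, which M may lack. Its perturbation
  -- towards `lowering` has a Krylov determinant congruent to 1 modulo l + 2, hence nonzero, so the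
  -- identity holds there and therefore for M modulo l + 1, for every l.
  sylvester-det-suc : ∀ (M : Mat n) → det (sylvester (charPoly n M) n (derivP (charPoly n M)) n') ≡ det (matrixOf (act (derivP (charPoly n M)) M))
  sylvester-det-suc M = ℤₚ.i-j≡0⇒i≡j _ _ (mod-all⇒0 (E M) (λ l → mod-trans (E-mod l) (≡⇒mod (E-vanishes l))))
    where
    f g : Mat n → Poly
    f X = charPoly n X
    g X = derivP (f X)
    E : Mat n → ℤ
    E X = det (sylvester (f X) n (g X) n') - det (matrixOf (act (g X) X))
    M' : ℕ → Mat n
    M' l = perturb l lowering M
    E-mod : ∀ l → E M ≡ E (M' l) [mod int (suc l) ]
    E-mod l = mod-- (det-mod N (n' ℕ.+ n) (λ r c → sylvester-mod (f M) (f (M' l)) n (g M) (g (M' l)) n' r c f-mod g-mod))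
      (det-mod N n (λ i j → mod-trans (act-coeffs-mod (g M) (g (M' l)) M (δ j) g-mod i) (act-mod₂ h (g (M' l)) (δ j) i)))
      where
      N = int (suc l)
      h = perturb-≡X l lowering M
      f-mod = charPoly-mod h
      g-mod : ∀ k → coeff (g M) k ≡ coeff (g (M' l)) k [mod N ]
      g-mod k = mod-cong₂ (coeff-derivP (f M) k) (coeff-derivP (f (M' l)) k) (mod-*ˡ (int (suc k)) (f-mod (suc k)))
    E-vanishes : ∀ l → E (M' l) ≡ 0ℤ
    E-vanishes l = ℤₚ.i≡j⇒i-j≡0 {det (sylvester (f X) n (g X) n')} {det (matrixOf (act (g X) X))} (R.resultant (1≢0-mod l (mod-trans
        (det-mod (int (suc (suc l))) n (λ j k → mod-trans (pw-mod₂ (perturb-≡Y l lowering M) (n' ℕ.∸ toℕ j) (δ (fromℕ n')) k)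
          (≡⇒mod (lowering-power (n' ℕ.∸ toℕ j) j (ℕₚ.m+[n∸m]≡n (ℕₚ.≤-pred (Finₚ.toℕ<n j))) k)))) (≡⇒mod (det-δ n)))))
      where
      X = M' l
      module R = Resultant n' n X (δ (fromℕ n')) (f X) (g X) (charPoly-monic n X) (charPoly-degree n X)
        (λ k lt → trans (coeff-derivP (f X) k) (trans (cong (int (suc k) *_) (charPoly-degree n X (suc k) (s≤s lt))) (ℤₚ.*-zeroʳ (int (suc k)))))
        (cayley-hamilton X (δ (fromℕ n')))

sylvester-det : ∀ n (M : Mat n) → det (sylvester (charPoly n M) n (derivP (charPoly n M)) (n ℕ.∸ 1)) ≡ det (matrixOf (dact (charPoly n M) M))
sylvester-det zero    M = trans det-nil (sym det-nil)
sylvester-det (suc n) M = trans (sylvester-det-suc M) (det-cong (suc n) (λ i j → act-derivP (charPoly (suc n) M) M (δ j) i))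

abs-signPow-* : ∀ k x → ∣ signPow k * x ∣ ≡ ∣ x ∣
abs-signPow-* k x with signPow-cases k
... | inj₁ e = cong ∣_∣ (trans (cong (_* x) e) (ℤₚ.*-identityˡ x))
... | inj₂ e = trans (cong ∣_∣ (trans (cong (_* x) e) (ℤₚ.-1*i≡-i x))) (ℤₚ.∣-i∣≡∣i∣ x)

abs-Δ : ∀ {n} (Σ' : SignedGraph n) → ∣ Δ Σ' ∣ ≡ ∣ det (matrixOf (dact (χ Σ') (A Σ'))) ∣
abs-Δ {n} Σ' = trans (abs-signPow-* ((n ℕ.* (n ℕ.∸ 1)) ℕ./ 2) _) (cong ∣_∣ (trans (sym det-detℤ) (sylvester-det n (A Σ'))))

-- Isolated vertices

∑ℕ : ∀ {n} → (Fin n → ℕ) → ℕ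
∑ℕ {zero}  g = 0
∑ℕ {suc n} g = g zero ℕ.+ ∑ℕ (g ∘ suc)

∑-int : ∀ {n} (g : Fin n → ℕ) → ∑ (λ i → int (g i)) ≡ int (∑ℕ g)
∑-int {zero}  g = ∑-nil
∑-int {suc n} g = trans ∑-suc (trans (cong (int (g zero) +_) (∑-int (g ∘ suc))) (sym (ℤₚ.pos-+ (g zero) (∑ℕ (g ∘ suc)))))

≤∑ℕ : ∀ {n} (g : Fin n → ℕ) i → g i ℕ.≤ ∑ℕ g
≤∑ℕ g zero    = ℕₚ.m≤m+n (g zero) (∑ℕ (g ∘ suc))
≤∑ℕ g (suc i) = ℕₚ.≤-trans (≤∑ℕ (g ∘ suc) i) (ℕₚ.m≤n+m (∑ℕ (g ∘ suc)) (g zero))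

two≤∑ℕ : ∀ {n} (g : Fin n → ℕ) i j → i ≢ j → g i ℕ.+ g j ℕ.≤ ∑ℕ g
two≤∑ℕ g zero    zero    i≢j = contradiction refl i≢j
two≤∑ℕ g zero    (suc j) i≢j = ℕₚ.+-monoʳ-≤ (g zero) (≤∑ℕ (g ∘ suc) j)
two≤∑ℕ g (suc i) zero    i≢j = subst (ℕ._≤ ∑ℕ g) (ℕₚ.+-comm (g zero) (g (suc i))) (ℕₚ.+-monoʳ-≤ (g zero) (≤∑ℕ (g ∘ suc) i))
two≤∑ℕ g (suc i) (suc j) i≢j = ℕₚ.≤-trans (two≤∑ℕ (g ∘ suc) i j (i≢j ∘ cong suc)) (ℕₚ.m≤n+m (∑ℕ (g ∘ suc)) (g zero))

∣_∣² : ℤ → ℕ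
∣ x ∣² = ∣ x ∣ ℕ.* ∣ x ∣

square-abs : ∀ x → x * x ≡ int ∣ x ∣²
square-abs (int k)  = sym (ℤₚ.pos-* k k)
square-abs -[1+ k ] = refl

norm : ∀ {n} → Vect n → ℕ
norm v = ∑ℕ (λ i → ∣ v i ∣²)

∙-norm : ∀ {n} (v : Vect n) → v ∙ v ≡ int (norm v)
∙-norm v = trans (∑-cong (λ i → square-abs (v i))) (∑-int (λ i → ∣ v i ∣²))

∣∣²≡0 : ∀ x → ∣ x ∣² ≡ 0 → x ≡ 0ℤ
∣∣²≡0 x e with ℕₚ.m*n≡0⇒m≡0∨n≡0 ∣ x ∣ e
... | inj₁ p = ℤₚ.∣i∣≡0⇒i≡0 p
... | inj₂ p = ℤₚ.∣i∣≡0⇒i≡0 p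

∣∣≤∣∣² : ∀ x → ∣ x ∣ ℕ.≤ ∣ x ∣²
∣∣≤∣∣² x = k≤k² ∣ x ∣
  where
  k≤k² : ∀ k → k ℕ.≤ k ℕ.* k
  k≤k² zero    = z≤n
  k≤k² (suc k) = ℕₚ.m≤m*n (suc k) (suc k)

norm≡0 : ∀ {n} (v : Vect n) → norm v ≡ 0 → v ≗ 0ᵛ
norm≡0 v e i = ∣∣²≡0 (v i) (ℕₚ.n≤0⇒n≡0 (subst (∣ v i ∣² ℕ.≤_) e (≤∑ℕ (λ i → ∣ v i ∣²) i)))

act-head : ∀ {n} p (M : Mat n) v i → act p M v i ≡ coeff p 0 * v i + (M ▹ act (drop 1 p) M v) i
act-head []      M v i = sym (trans (cong₂ _+_ (ℤₚ.*-zeroˡ (v i)) (▹-0 M (λ _ → refl) i)) refl)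
act-head (a ∷ p) M v i = refl

act-kernel : ∀ {n} p (M : Mat n) w → M ▹ w ≗ 0ᵛ → act p M w ≗ (λ i → coeff p 0 * w i)
act-kernel p M w h i = trans (act-head p M w i) (trans (cong (coeff p 0 * w i +_)
  (trans (sym (act-shift (drop 1 p) M w i)) (trans (Linear.l-cong (act-linear (drop 1 p) M) h i) (linear-0 (act-linear (drop 1 p) M) i)))) (ℤₚ.+-identityʳ (coeff p 0 * w i)))

-- With p = χ/x, the matrix p(M) annihilates M and satisfies p(M)² = ±p(M); a nonzero diagonal entry of
-- such a symmetric integer matrix leaves no room for other entries in its column.
module Isolated {n : ℕ} (M : Mat n) (s : Symmetric M) (χ₀ : coeff (charPoly n M) 0 ≡ 0ℤ) (χ₁ : IsUnit (coeff (charPoly n M) 1)) where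
  private
    T : Poly
    T = drop 1 (charPoly n M)

    a₁ = coeff (charPoly n M) 1

    T₀ : coeff T 0 ≡ a₁
    T₀ = coeff-drop 1 (charPoly n M) 0

    Π : Vect n → Vect n
    Π = act T M

    kernel : ∀ v → M ▹ Π v ≗ 0ᵛ
    kernel v i = trans (sym (ℤₚ.+-identityˡ ((M ▹ Π v) i))) (trans (cong (_+ (M ▹ Π v) i) (sym (trans (cong (_* v i) χ₀) (ℤₚ.*-zeroˡ (v i)))))
      (trans (sym (act-head (charPoly n M) M v i)) (cayley-hamilton M v i)))

    diagonal : Fin n → ℤ
    diagonal i = Π (δ i) i

    -- By symmetry the norm of column i is the diagonal entry of Π². The image of Π lies in the
    -- kernel of M, where Π acts as its constant term ±1.
    norm-column : ∀ i → norm (Π (δ i)) ≡ ∣ diagonal i ∣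
    norm-column i = begin
      norm x ≡⟨ sym (cong ∣_∣ (∙-norm x)) ⟩
      ∣ x ∙ x ∣ ≡⟨ cong ∣_∣ (trans (∙-act-swap s T (δ i) x) (∑-δˡ i (Π x))) ⟩
      ∣ Π x i ∣ ≡⟨ cong ∣_∣ (act-kernel T M x (kernel (δ i)) i) ⟩
      ∣ coeff T 0 * x i ∣ ≡⟨ trans (ℤₚ.abs-* (coeff T 0) (x i)) (cong (ℕ._* ∣ x i ∣) (trans (cong ∣_∣ T₀) (unit-abs χ₁))) ⟩
      1 ℕ.* ∣ x i ∣ ≡⟨ ℕₚ.*-identityˡ ∣ x i ∣ ⟩
      ∣ diagonal i ∣ ∎
      where
      open ≡-Reasoning
      x = Π (δ i)

    det≡0 : det M ≡ 0ℤ
    det≡0 = *-zero-cases (signPow n) (λ e → 1≢0 (trans (sym (signPow-sq n)) (trans (cong (_* signPow n) e) (ℤₚ.*-zeroˡ (signPow n))))) (trans (sym (coeff-0-det n M)) χ₀)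
      where
      1≢0 : 1ℤ ≢ 0ℤ
      1≢0 ()

    -- Otherwise every column of T(M) has norm 0, so T(M) = 0. As T has constant term a₁ = ±1, this
    -- exhibits -a₁ times the identity as a multiple of M, against det M = 0.
    not-all-zero : ¬ (∀ i → diagonal i ≡ 0ℤ)
    not-all-zero h = -a₁≢0 (ℤₚ.i^n≡0⇒i≡0 (- a₁) n (trans (sym (trans (det-scale n (- a₁) δ) (trans (cong ((- a₁) ℤ.^ n *_) (det-δ n)) (ℤₚ.*-identityʳ ((- a₁) ℤ.^ n)))))
        (trans (det-cong n inverse) (trans (det-⊗ n M N) (trans (cong (_* det N) det≡0) (ℤₚ.*-zeroˡ (det N)))))))
      where
      -a₁≢0 : - a₁ ≢ 0ℤ
      -a₁≢0 e = unit≢0 χ₁ (trans (sym (ℤₚ.neg-involutive a₁)) (cong -_ e))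
      N : Mat n
      N = matrixOf (act (drop 1 T) M)
      column-zero : ∀ i → Π (δ i) ≗ 0ᵛ
      column-zero i = norm≡0 (Π (δ i)) (trans (norm-column i) (cong ∣_∣ (h i)))
      inverse : ∀ i j → - a₁ * δ i j ≡ (M ⊗ N) i j
      inverse i j = trans (cong (- a₁ *_) (δ-sym i j)) (solveFor {a₁} {δ j i} (trans (sym (cong (λ z → z * δ j i + (M ▹ act (drop 1 T) M (δ j)) i) T₀)) (trans (sym (act-head T M (δ j) i)) (column-zero j i))))
        where
        solveFor : ∀ {a d x} → a * d + x ≡ 0ℤ → - a * d ≡ x
        solveFor {a} {d} {x} e = trans (g a d x) (trans (cong (λ z → x - z) e) (ℤₚ.+-identityʳ x))
          where
          g : ∀ a d x → - a * d ≡ x - (a * d + x)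
          g = solve-∀

  isolated : Σ (Fin n) λ i → ∀ j → M j i ≡ 0ℤ
  isolated with Finₚ.all? (λ i → diagonal i ℤ.≟ 0ℤ)
  ... | yes h = contradiction h not-all-zero
  ... | no ¬h with Finₚ.¬∀⟶∃¬ n _ (λ i → diagonal i ℤ.≟ 0ℤ) ¬h
  ...   | i , d≢0 = i , λ j → *-zero-cases (diagonal i) d≢0 (trans (cong (diagonal i *_) (sym (▹-δ M i j)))
            (trans (sym (▹-scale M (diagonal i) (δ i) j)) (trans (▹-cong M (λ k → sym (column k)) j) (kernel (δ i) j))))
    where
    -- The column has squared norm |d|, and the diagonal entry alone contributes d² ≥ |d|, so every
    -- other entry is zero. Then d times column i of M is M Π δᵢ = 0.
    column : ∀ k → Π (δ i) k ≡ diagonal i * δ i k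
    column k with k ≟ i
    ... | yes refl = sym (trans (cong (diagonal i *_) (δ-refl i)) (ℤₚ.*-identityʳ (diagonal i)))
    ... | no k≢i = trans (∣∣²≡0 (Π (δ i) k) (ℕₚ.n≤0⇒n≡0 (ℕₚ.+-cancelˡ-≤ ∣ diagonal i ∣ _ 0 (ℕₚ.≤-trans (ℕₚ.+-monoˡ-≤ ∣ Π (δ i) k ∣² (∣∣≤∣∣² (diagonal i)))
        (ℕₚ.≤-trans (two≤∑ℕ (λ l → ∣ Π (δ i) l ∣²) i k (λ e → k≢i (sym e))) (ℕₚ.≤-reflexive (trans (norm-column i) (sym (ℕₚ.+-identityʳ ∣ diagonal i ∣)))))))))
        (sym (trans (cong (diagonal i *_) (δ-≢ (λ e → k≢i (sym e)))) (ℤₚ.*-zeroʳ (diagonal i))))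

∑-punchIn : ∀ {n} (i : Fin (suc n)) (f : Vect (suc n)) → ∑ f ≡ f i + ∑ (f ∘ punchIn i)
∑-punchIn zero f = ∑-suc
∑-punchIn {suc n} (suc i) f = trans ∑-suc (trans (cong (f zero +_) (∑-punchIn i (f ∘ suc))) (trans (h (f zero) (f (suc i)) _) (cong (f (suc i) +_) (sym ∑-suc))))
  where
  h : ∀ a b c → a + (b + c) ≡ b + (a + c)
  h = solve-∀

module Deletion {n : ℕ} (M : Mat (suc n)) (s : Symmetric M) (i : Fin (suc n)) (iso : ∀ j → M j i ≡ 0ℤ) where
  B : Mat n
  B = minor M i i

  iso' : ∀ j → M i j ≡ 0ℤ
  iso' j = trans (s i j) (iso j)

  restrict : Vect (suc n) → Vect n
  restrict v = v ∘ punchIn i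

  ▹-at : ∀ v → (M ▹ v) i ≡ 0ℤ
  ▹-at v = ∑-0 (λ j → trans (cong (_* v j) (iso' j)) (ℤₚ.*-zeroˡ (v j)))

  ▹-restrict : ∀ v → restrict (M ▹ v) ≗ B ▹ restrict v
  ▹-restrict v a = trans (∑-punchIn i (λ j → M (punchIn i a) j * v j)) (trans (cong (_+ (B ▹ restrict v) a) (trans (cong (_* v i) (iso (punchIn i a))) (ℤₚ.*-zeroˡ (v i)))) (ℤₚ.+-identityˡ ((B ▹ restrict v) a)))

  pw-restrict : ∀ k v → restrict (pw k M v) ≗ pw k B (restrict v)
  pw-restrict zero    v a = refl
  pw-restrict (suc k) v a = trans (▹-restrict (pw k M v) a) (▹-cong B (pw-restrict k v) a)

  act-restrict : ∀ p v → restrict (act p M v) ≗ act p B (restrict v)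
  act-restrict []      v a = refl
  act-restrict (c ∷ p) v a = cong (c * restrict v a +_) (trans (▹-restrict (act p M v) a) (▹-cong B (act-restrict p v) a))

  dact-restrict : ∀ p v → restrict (dact p M v) ≗ dact p B (restrict v)
  dact-restrict []      v a = refl
  dact-restrict (c ∷ p) v a = cong₂ _+_ (act-restrict p v a) (trans (▹-restrict (dact p M v) a) (▹-cong B (dact-restrict p v) a))

  charPoly-deletion : charPoly (suc n) M ≈p (0ℤ ∷ charPoly n B)
  charPoly-deletion = poly-ext (charPoly (suc n) M) (0ℤ ∷ charPoly n B) (λ t → pt (int (suc t)))
    where
    pt : ∀ y → eval (charPoly (suc n) M) y ≡ eval (0ℤ ∷ charPoly n B) y
    pt y = trans (eval-charPoly (suc n) M y) (trans (det-block1 n (shift M y) i y (λ k → trans (cong (λ z → y * δ i k - z) (iso' k)) (g (y * δ i k)))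
        (λ a → trans (cong₂ (λ x z → y * x - z) (δ-≢ (Finₚ.punchInᵢ≢i i a)) (iso (punchIn i a))) (h y)))
      (trans (cong (y *_) (trans (det-cong n (λ a b → cong (λ z → y * z - B a b) (δ-punchIn i a b))) (sym (eval-charPoly n B y)))) (sym (ℤₚ.+-identityˡ (y * eval (charPoly n B) y)))))
      where
      g : ∀ x → x - 0ℤ ≡ x
      g = solve-∀
      h : ∀ y → y * 0ℤ - 0ℤ ≡ 0ℤ
      h = solve-∀

  -- (xχ_B)′ = χ_B + xχ_B′. On the isolated coordinate M acts as 0 and only χ_B(0) remains; on the
  -- others χ_B(B) = 0 by Cayley-Hamilton and B χ_B′(B) remains.
  derivative-det : det (matrixOf (dact (0ℤ ∷ charPoly n B) M)) ≡ coeff (charPoly n B) 0 * (det B * det (matrixOf (dact (charPoly n B) B)))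
  derivative-det = trans (det-block1 n X i (coeff χ' 0) at-i column) (cong (coeff χ' 0 *_) (trans (det-cong n inner) (det-⊗ n B (matrixOf (dact χ' B)))))
    where
    χ' = charPoly n B
    X = matrixOf (dact (0ℤ ∷ χ') M)
    at-i : ∀ k → X i k ≡ coeff χ' 0 * δ i k
    at-i k = trans (cong (act χ' M (δ k) i +_) (▹-at (dact χ' M (δ k)))) (trans (ℤₚ.+-identityʳ (act χ' M (δ k) i)) (trans (act-head χ' M (δ k) i)
      (trans (cong (coeff χ' 0 * δ k i +_) (▹-at (act (drop 1 χ') M (δ k)))) (trans (ℤₚ.+-identityʳ (coeff χ' 0 * δ k i)) (cong (coeff χ' 0 *_) (δ-sym k i))))))
    column : ∀ a → X (punchIn i a) i ≡ 0ℤ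
    column a = trans (dact-restrict (0ℤ ∷ χ') (δ i) a) (trans (Linear.l-cong (dact-linear (0ℤ ∷ χ') B) (λ b → δ-≢ (λ e → Finₚ.punchInᵢ≢i i b (sym e))) a) (linear-0 (dact-linear (0ℤ ∷ χ') B) a))
    inner : ∀ a b → X (punchIn i a) (punchIn i b) ≡ (B ⊗ matrixOf (dact χ' B)) a b
    inner a b = trans (dact-restrict (0ℤ ∷ χ') (δ (punchIn i b)) a) (trans (Linear.l-cong (dact-linear (0ℤ ∷ χ') B) (δ-punchIn i b) a)
      (trans (cong (_+ (B ▹ dact χ' B (δ b)) a) (cayley-hamilton B (δ b) a)) (ℤₚ.+-identityˡ ((B ▹ dact χ' B (δ b)) a))))

-- Contradiction with squarefreeness, for even and odd order

abs-^ : ∀ a n → ∣ a ℤ.^ n ∣ ≡ ∣ a ∣ ℕ.^ n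
abs-^ a zero    = refl
abs-^ a (suc n) = trans (ℤₚ.abs-* a (a ℤ.^ n)) (cong (∣ a ∣ ℕ.*_) (abs-^ a n))

dact-≈p : ∀ {n} p r (M : Mat n) v → p ≈p r → dact p M v ≗ dact r M v
dact-≈p p r M v h i = trans (sym (act-derivP p M v i)) (trans (act-≈p (derivP p) (derivP r) M v
  (λ k → trans (coeff-derivP p k) (trans (cong (int (suc k) *_) (h (suc k))) (sym (coeff-derivP r k)))) i) (act-derivP r M v i))

A-sym : ∀ {n} (Σ' : SignedGraph n) → Symmetric (A Σ')
A-sym Σ' i j = cong adjℤ (SignedGraph.sym Σ' i j)

A-splits : ∀ {n} (Σ' : SignedGraph n) (c : Fin n → Bool) → (∀ i j → ¬ (adj Σ' i j ≡ none) → ¬ (c i ≡ c j)) → Splits c (A Σ')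
A-splits Σ' c h i j e with adj Σ' i j | h i j
... | none | _ = refl
... | pos  | f = contradiction e (f (λ ()))
... | neg  | f = contradiction e (f (λ ()))

euclid-square : ∀ {q} → Prime q → ∀ a → a * a ≡ 0ℤ [mod int q ] → a ≡ 0ℤ [mod int q ]
euclid-square pr a h with euclid pr a h
... | inj₁ e = e
... | inj₂ e = e

-- From q ∣ M write M = t q; cancelling q² leaves q² ∣ t², so q ∣ t and q² ∣ M.
fourth-power : ∀ {q M} → Prime q → Squarefree M → ¬ q ℕ.^ 4 ℕᵈ.∣ M ℕ.* M
fourth-power {q} {M} pr sf d = ℕ.nonTrivial⇒≢1 {{prime⇒nonTrivial pr}} (sf q (twice (both (ℕᵈ.∣-trans q∣q⁴ d))))
  where
  instance _ = prime⇒nonZero pr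
  instance _ = ℕₚ.m*n≢0 q q
  q∣q⁴ : q ℕᵈ.∣ q ℕ.^ 4
  q∣q⁴ = ℕᵈ.m∣m*n (q ℕ.^ 3)
  both : ∀ {k} → q ℕᵈ.∣ k ℕ.* k → q ℕᵈ.∣ k
  both {k} e with euclidsLemma k k pr e
  ... | inj₁ x = x
  ... | inj₂ x = x
  regroup : ∀ t → (t ℕ.* q) ℕ.* (t ℕ.* q) ≡ (t ℕ.* t) ℕ.* (q ℕ.* q)
  regroup t = ℕₚ.[m*n]*[o*p]≡[m*o]*[n*p] t q t q
  q⁴ : q ℕ.^ 4 ≡ (q ℕ.* q) ℕ.* (q ℕ.* q)
  q⁴ = trans (cong (λ z → q ℕ.* (q ℕ.* (q ℕ.* z))) (ℕₚ.*-identityʳ q)) (sym (ℕₚ.*-assoc q q (q ℕ.* q)))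
  twice : q ℕᵈ.∣ M → q ℕ.* q ℕᵈ.∣ M
  twice (divides t refl) = ℕᵈ.*-monoˡ-∣ q (both {t} (ℕᵈ.∣-trans (ℕᵈ.m∣m*n q) (ℕᵈ.*-cancelʳ-∣ (q ℕ.* q) (subst₂ ℕᵈ._∣_ q⁴ (regroup t) d))))

module _ {n : ℕ} (B : Mat n) (s : Symmetric B) (c : Fin n → Bool) (bip : Splits c B) (unit : IsUnit (coeff (charPoly n B) 0)) where
  private
    module Uni = Unimodular c B bip unit
    module Main′ = Main B s c bip Uni.det-unit Uni.half Uni.half-≈p
    module Bip′ = Bip B s c bip Uni.det-unit Uni.half Uni.half-≈p

  derivative-half : Σ ℕ λ k → (∣ det (matrixOf (dact (charPoly n B) B)) ∣ ≡ 2 ℕ.^ n ℕ.* k) ×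
    (∀ {q} → Prime q → ∀ u → Isotropic (int q * int q) B u → (Σ (Fin n) λ i → ¬ u i ≡ 0ℤ [mod int q ]) → q ℕ.^ 4 ℕᵈ.∣ k)
  derivative-half = ∣ det Bip′.K ∣ , size , λ {q} pr u iso nz → fourth q (Main′.prime-divides pr Uni.half-odd u iso nz)
    where
    size : ∣ det (matrixOf (dact (charPoly n B) B)) ∣ ≡ 2 ℕ.^ n ℕ.* ∣ det Bip′.K ∣
    size = trans (cong ∣_∣ (trans (det-cong n (λ i j → trans (dact-≈p (charPoly n B) (spread Uni.half) B (δ j) (λ k → sym (Uni.half-≈p k)) i)
      (trans (Bip′.derivative (δ j) i) (cong (int 2 *_) (▹-δ Bip′.K j i))))) (det-scale n (int 2) Bip′.K)))
      (trans (ℤₚ.abs-* (int 2 ℤ.^ n) (det Bip′.K)) (cong (ℕ._* ∣ det Bip′.K ∣) (abs-^ (int 2) n)))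
    fourth : ∀ q → det Bip′.K ≡ 0ℤ [mod int q ℤ.^ 4 ] → q ℕ.^ 4 ℕᵈ.∣ ∣ det Bip′.K ∣
    fourth q (wit k e) = divides ∣ k ∣ (trans (cong ∣_∣ (trans e (ℤₚ.+-identityˡ (k * int q ℤ.^ 4)))) (trans (ℤₚ.abs-* k (int q ℤ.^ 4)) (cong (∣ k ∣ ℕ.*_) (abs-^ (int q) 4))))

twice : ∀ h → h ℕ.* 2 ≡ h ℕ.+ h
twice h = trans (ℕₚ.*-comm h 2) (cong (h ℕ.+_) (ℕₚ.+-identityʳ h))

square-split : ∀ h M → (2 ℕ.^ h ℕ.* M) ℕ.^ 2 ≡ 2 ℕ.^ (h ℕ.* 2) ℕ.* (M ℕ.* M)
square-split h M = trans (cong ((2 ℕ.^ h ℕ.* M) ℕ.*_) (ℕₚ.*-identityʳ (2 ℕ.^ h ℕ.* M))) (trans (ℕₚ.[m*n]*[o*p]≡[m*o]*[n*p] (2 ℕ.^ h) M (2 ℕ.^ h) M)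
  (cong (ℕ._* (M ℕ.* M)) (trans (sym (ℕₚ.^-distribˡ-+-* 2 h h)) (cong (2 ℕ.^_) (sym (twice h))))))

cancel-power : ∀ h {k} M → 2 ℕ.^ (h ℕ.* 2) ℕ.* k ≡ (2 ℕ.^ h ℕ.* M) ℕ.^ 2 → k ≡ M ℕ.* M
cancel-power h {k} M e = ℕₚ.*-cancelˡ-≡ k (M ℕ.* M) (2 ℕ.^ (h ℕ.* 2)) {{ℕₚ.m^n≢0 2 (h ℕ.* 2)}} (trans e (square-split h M))

module Core {n : ℕ} (Σ' : SignedGraph n) (bipartite : Bipartite Σ') (unit : IsUnit (lowCoeff Σ')) (disc : ScaledSqrtDiscSquarefree Σ')
            {q : ℕ} (pr : Prime q) where
  private
    c = proj₁ bipartite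
    M = proj₁ disc
    Q = int q

    Δ-size : ∣ det (matrixOf (dact (χ Σ') (A Σ'))) ∣ ≡ (2 ℕ.^ (n ℕ./ 2) ℕ.* M) ℕ.^ 2
    Δ-size = trans (sym (abs-Δ Σ')) (cong ∣_∣ (proj₂ (proj₂ disc)))

    order : n ≡ n ℕ.% 2 ℕ.+ n ℕ./ 2 ℕ.* 2
    order = m≡m%n+[m/n]*n n 2

  even-case : n ℕ.% 2 ≡ 0 → ∀ u → Isotropic (Q * Q) (A Σ') u → ∀ i → u i ≡ 0ℤ [mod Q ]
  even-case e u iso i = decide (mod0? q (u i))
    where
    half = derivative-half (A Σ') (A-sym Σ') c (A-splits Σ' c (proj₂ bipartite)) (subst (λ k → IsUnit (coeff (χ Σ') k)) e unit)
    n≡ : n ≡ n ℕ./ 2 ℕ.* 2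
    n≡ = trans order (cong (ℕ._+ n ℕ./ 2 ℕ.* 2) e)
    k≡ : proj₁ half ≡ M ℕ.* M
    k≡ = cancel-power (n ℕ./ 2) M (trans (cong (λ z → 2 ℕ.^ z ℕ.* proj₁ half) (sym n≡)) (trans (sym (proj₁ (proj₂ half))) Δ-size))
    decide : Dec (u i ≡ 0ℤ [mod Q ]) → u i ≡ 0ℤ [mod Q ]
    decide (yes z) = z
    decide (no z)  = ⊥-elim (fourth-power pr (proj₁ (proj₂ disc)) (subst (q ℕ.^ 4 ℕᵈ.∣_) k≡ (proj₂ (proj₂ half) pr u iso (i , z))))

module OddCore {n : ℕ} (Σ' : SignedGraph (suc n)) (bipartite : Bipartite Σ') (unit : IsUnit (lowCoeff Σ')) (disc : ScaledSqrtDiscSquarefree Σ')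
               (odd : suc n ℕ.% 2 ≡ 1) (v : Fin (suc n)) (iso-v : ∀ j → A Σ' j v ≡ 0ℤ) {q : ℕ} (pr : Prime q) where
  private
    c = proj₁ bipartite
    M = proj₁ disc
    Q = int q
    h = suc n ℕ./ 2
    bip = A-splits Σ' c (proj₂ bipartite)

    n≡ : n ≡ h ℕ.* 2
    n≡ = ℕₚ.suc-injective (trans (m≡m%n+[m/n]*n (suc n) 2) (cong (ℕ._+ h ℕ.* 2) odd))

    χ₁ : IsUnit (coeff (χ Σ') 1)
    χ₁ = subst (λ k → IsUnit (coeff (χ Σ') k)) odd unit

    open module Del = Deletion (A Σ') (A-sym Σ') v iso-v

    B-sym : Symmetric B
    B-sym i j = A-sym Σ' (punchIn v i) (punchIn v j)

    B-bip : Splits (c ∘ punchIn v) B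
    B-bip i j e = bip (punchIn v i) (punchIn v j) e

    B-unit : IsUnit (coeff (charPoly n B) 0)
    B-unit = subst IsUnit (charPoly-deletion 1) χ₁

    half = derivative-half B B-sym (c ∘ punchIn v) B-bip B-unit

    det-B-unit : IsUnit (det B)
    det-B-unit = Unimodular.det-unit (c ∘ punchIn v) B B-bip B-unit

    k≡ : proj₁ half ≡ M ℕ.* M
    k≡ = cancel-power h M (trans (cong (λ z → 2 ℕ.^ z ℕ.* proj₁ half) (sym n≡)) (trans (sym (proj₁ (proj₂ half))) (trans (sym size)
      (trans (sym (abs-Δ Σ')) (cong ∣_∣ (proj₂ (proj₂ disc)))))))
      where
      X = det (matrixOf (dact (charPoly n B) B))
      size : ∣ det (matrixOf (dact (χ Σ') (A Σ'))) ∣ ≡ ∣ X ∣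
      size = trans (cong ∣_∣ (trans (det-cong (suc n) (λ i j → dact-≈p (χ Σ') (0ℤ ∷ charPoly n B) (A Σ') (δ j) charPoly-deletion i)) derivative-det))
        (trans (ℤₚ.abs-* (coeff (charPoly n B) 0) (det B * X)) (trans (cong₂ ℕ._*_ (unit-abs B-unit) (trans (ℤₚ.abs-* (det B) X) (trans (cong (ℕ._* ∣ X ∣) (unit-abs det-B-unit)) (ℕₚ.*-identityˡ ∣ X ∣))))
          (ℕₚ.*-identityˡ ∣ X ∣)))

  -- The coordinate of u at the isolated vertex enters the zeroth moment, so the restriction r need
  -- not be isotropic. B r is: its moments are those of u from the second on. If B r ≡ 0 then r ≡ 0
  -- by unimodularity, and the zeroth moment leaves the square of the isolated coordinate.
  odd-case : ∀ u → Isotropic (Q * Q) (A Σ') u → ∀ i → u i ≡ 0ℤ [mod Q ]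
  odd-case u iso = decide (vanishes? q (B ▹ restrict u))
    where
    r = restrict u
    isoB : Isotropic (Q * Q) B (B ▹ r)
    isoB k = mod-cong₂ eq refl (iso (suc (suc k)))
      where
      open ≡-Reasoning
      eq : (B ▹ r) ∙ pw k B (B ▹ r) ≡ u ∙ pw (suc (suc k)) (A Σ') u
      eq = begin
        (B ▹ r) ∙ pw k B (B ▹ r) ≡⟨ selfAdjoint B-sym r (pw k B (B ▹ r)) ⟩
        r ∙ (B ▹ pw k B (B ▹ r)) ≡⟨ ∙-cong {u = r} (λ _ → refl) (▹-cong B (pw-shift k B r)) ⟩
        r ∙ pw (suc (suc k)) B r ≡⟨ ∙-cong {u = r} (λ _ → refl) (λ a → sym (pw-restrict (suc (suc k)) u a)) ⟩
        r ∙ restrict x ≡⟨ sym (trans (cong (_+ r ∙ restrict x) (trans (cong (u v *_) (▹-at (pw (suc k) (A Σ') u))) (ℤₚ.*-zeroʳ (u v)))) (ℤₚ.+-identityˡ (r ∙ restrict x))) ⟩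
        u v * x v + r ∙ restrict x ≡⟨ sym (∑-punchIn v (λ j → u j * x j)) ⟩
        u ∙ x ∎
        where x = pw (suc (suc k)) (A Σ') u
    decide : (∀ a → (B ▹ r) a ≡ 0ℤ [mod Q ]) ⊎ Σ (Fin n) (λ a → ¬ (B ▹ r) a ≡ 0ℤ [mod Q ]) → ∀ i → u i ≡ 0ℤ [mod Q ]
    decide (inj₂ nz) = ⊥-elim (fourth-power pr (proj₁ (proj₂ disc)) (subst (q ℕ.^ 4 ℕᵈ.∣_) k≡ (proj₂ (proj₂ half) pr (B ▹ r) isoB nz)))
    decide (inj₁ z) i = cases i (view v i)
      where
      r≡0 : ∀ a → r a ≡ 0ℤ [mod Q ]
      r≡0 = unit-injective B det-B-unit z
      square : u v * u v ≡ 0ℤ [mod Q ]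
      square = mod-trans (mod-sym (mod-+0ʳ (∙-mod0 r r≡0))) (mod-cong₂ (sym (∑-punchIn v (λ j → u j * u j))) refl (mod-weaken Q (iso 0)))
      cases : ∀ i → View v i → u i ≡ 0ℤ [mod Q ]
      cases _ here      = euclid-square pr (u v) square
      cases _ (there a) = r≡0 a

isolated-vertex : ∀ {n} (Σ' : SignedGraph (suc n)) → Bipartite Σ' → IsUnit (lowCoeff Σ') → suc n ℕ.% 2 ≡ 1 →
                  Σ (Fin (suc n)) λ v → ∀ j → A Σ' j v ≡ 0ℤ
isolated-vertex {n} Σ' (c , bip) unit odd = Isolated.isolated (A Σ') (A-sym Σ') χ₀ (subst (λ k → IsUnit (coeff (χ Σ') k)) odd unit)
  where
  h = suc n ℕ./ 2
  χ₀ : coeff (χ Σ') 0 ≡ 0ℤ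
  χ₀ = Parity.wrong-parity c (A Σ') (A-splits Σ' c bip) 0 (sym (trans (ℤₚ.neg-involutive (signPow n))
    (trans (cong signPow (trans (ℕₚ.suc-injective (trans (m≡m%n+[m/n]*n (suc n) 2) (cong (ℕ._+ h ℕ.* 2) odd))) (twice h))) (signPow-double h))))

isotropic-vanishes : ∀ {n} (Σ' : SignedGraph n) → Bipartite Σ' → IsUnit (lowCoeff Σ') → ScaledSqrtDiscSquarefree Σ' →
                     ∀ {q} → Prime q → ∀ u → Isotropic (int q * int q) (A Σ') u → ∀ i → u i ≡ 0ℤ [mod int q ]
isotropic-vanishes {zero}  Σ' b l d pr u iso ()
isotropic-vanishes {suc n} Σ' b l d {q} pr = remainder (suc n ℕ.% 2) refl (m%n<n (suc n) 2)
  where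
  remainder : ∀ k → suc n ℕ.% 2 ≡ k → k ℕ.< 2 → ∀ u → Isotropic (int q * int q) (A Σ') u → ∀ i → u i ≡ 0ℤ [mod int q ]
  remainder 0 e _ = Core.even-case Σ' b l d pr e
  remainder 1 e _ = let v , iso-v = isolated-vertex Σ' b l e in OddCore.odd-case Σ' b l d e v iso-v pr
  remainder (suc (suc k)) e (s≤s (s≤s ()))

-- Generalized cospectrality

𝟙 : ∀ {n} → Vect n
𝟙 _ = 1ℤ

-𝟙 : ∀ {n} → Vect n
-𝟙 _ = -1ℤ

walks : ∀ {n} → Mat n → ℕ → ℤ
walks M j = ∑ (pw j M 𝟙)

Acomp≡ : ∀ {n} (Σ' : SignedGraph n) i j → Acomp Σ' i j ≡ (1ℤ - δ i j) - A Σ' i j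
Acomp≡ Σ' i j with toℕ i ℕ.≟ toℕ j
... | yes e rewrite Finₚ.toℕ-injective e | SignedGraph.irref Σ' j | δ-refl j = refl
... | no ne rewrite δ-toℕ-≢ i j ne = refl

topMoment-cong : ∀ d {f g F G} → (∀ k → f k ≡ g k) → (∀ k → k ℕ.≤ d → F k ≡ G k) → topMoment f F d ≡ topMoment g G d
topMoment-cong zero    hf hF = cong₂ _*_ (hf 0) (hF 0 z≤n)
topMoment-cong (suc d) hf hF = cong₂ _+_ (cong₂ _*_ (hf (suc d)) (hF (suc d) ℕₚ.≤-refl)) (topMoment-cong d hf (λ k le → hF k (ℕₚ.m≤n⇒m≤1+n le)))

+-cancelʳ : ∀ c x y → x + c ≡ y + c → x ≡ y
+-cancelʳ c x y e = trans (g x c) (trans (cong (_- c) e) (sym (g y c)))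
  where
  g : ∀ x c → x ≡ (x + c) - c
  g = solve-∀

top-determines : ∀ j {f F G} → f j ≡ 1ℤ → (∀ k → k ℕ.< j → F k ≡ G k) → topMoment f F j ≡ topMoment f G j → F j ≡ G j
top-determines zero {f} {F} {G} f≡1 h e = trans (sym (scale F)) (trans e (scale G))
  where
  scale : ∀ H → f 0 * H 0 ≡ H 0
  scale H = trans (cong (_* H 0) f≡1) (ℤₚ.*-identityˡ (H 0))
top-determines (suc j) {f} {F} {G} f≡1 h e = trans (sym (scale F)) (trans (+-cancelʳ (topMoment f F j) (f (suc j) * F (suc j)) (f (suc j) * G (suc j))
    (trans e (cong (f (suc j) * G (suc j) +_) (sym (topMoment-cong j (λ _ → refl) (λ k le → h k (s≤s le))))))) (scale G))
  where
  scale : ∀ H → f (suc j) * H (suc j) ≡ H (suc j)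
  scale H = trans (cong (_* H (suc j)) f≡1) (ℤₚ.*-identityˡ (H (suc j)))

module WalkCounts {n : ℕ} (Σ₁ Σ₂ : SignedGraph n) (cospectral : GenCospectral Σ₁ Σ₂) where
  private
    A₁ = A Σ₁
    A₂ = A Σ₂
    χ₁ = χ Σ₁
    χ₂ = χ Σ₂
    χ≈ = proj₁ cospectral

  -- For y = −z − 1, the matrix yI − (J − I − A) is −(zI − A + J), a rank-one update of zI − A up to sign.
  complement : ∀ (Σ' : SignedGraph n) z → eval (charPoly n (Acomp Σ')) (- z - 1ℤ) ≡ signPow n * (eval (χ Σ') z - eval (ρ (A Σ') (χ Σ') -𝟙 𝟙) z)
  complement Σ' z = begin
    eval (charPoly n (Acomp Σ')) (- z - 1ℤ) ≡⟨ eval-charPoly n (Acomp Σ') (- z - 1ℤ) ⟩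
    det (shift (Acomp Σ') (- z - 1ℤ)) ≡⟨ det-cong n (λ i j → trans (cong (λ a → (- z - 1ℤ) * δ i j - a) (Acomp≡ Σ' i j)) (g z (δ i j) (A Σ' i j))) ⟩
    det (λ i j → - (shift (A Σ') z i j - 1ℤ * -1ℤ)) ≡⟨ det-neg n (λ i j → shift (A Σ') z i j - 1ℤ * -1ℤ) ⟩
    signPow n * det (λ i j → shift (A Σ') z i j - 1ℤ * -1ℤ) ≡⟨ cong (signPow n *_) (det-rank1 (shift (A Σ') z) 𝟙 -𝟙) ⟩
    signPow n * (det (shift (A Σ') z) - β (shift (A Σ') z) -𝟙 𝟙) ≡⟨ cong (signPow n *_) (cong₂ _-_ (sym (eval-charPoly n (A Σ') z)) (β-shift (A Σ') -𝟙 𝟙 z)) ⟩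
    signPow n * (eval (χ Σ') z - eval (ρ (A Σ') (χ Σ') -𝟙 𝟙) z) ∎
    where
    open ≡-Reasoning
    g : ∀ z d a → (- z - 1ℤ) * d - ((1ℤ - d) - a) ≡ - ((z * d - a) - 1ℤ * - 1ℤ)
    g = solve-∀

  ρ≈ : ρ A₁ χ₁ -𝟙 𝟙 ≈p ρ A₂ χ₂ -𝟙 𝟙
  ρ≈ = poly-ext (ρ A₁ χ₁ -𝟙 𝟙) (ρ A₂ χ₂ -𝟙 𝟙) (λ k → at (int (suc k)))
    where
    unsign : ∀ {x y} → signPow n * x ≡ signPow n * y → x ≡ y
    unsign {x} {y} e = trans (sym (twice' x)) (trans (cong (signPow n *_) e) (twice' y))
      where
      twice' : ∀ x → signPow n * (signPow n * x) ≡ x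
      twice' x = trans (sym (ℤₚ.*-assoc (signPow n) (signPow n) x)) (trans (cong (_* x) (signPow-sq n)) (ℤₚ.*-identityˡ x))
    at : ∀ z → eval (ρ A₁ χ₁ -𝟙 𝟙) z ≡ eval (ρ A₂ χ₂ -𝟙 𝟙) z
    at z = cancel {eval χ₁ z} (trans (unsign (trans (sym (complement Σ₁ z)) (trans (eval-≈p (charPoly n (Acomp Σ₁)) (charPoly n (Acomp Σ₂)) (- z - 1ℤ) (proj₂ cospectral)) (complement Σ₂ z))))
      (cong (_- eval (ρ A₂ χ₂ -𝟙 𝟙) z) (sym (eval-≈p χ₁ χ₂ z χ≈))))
      where
      cancel : ∀ {a x y} → a - x ≡ a - y → x ≡ y
      cancel {a} {x} {y} e = ℤₚ.neg-injective (+-cancelʳ a (- x) (- y) (trans (ℤₚ.+-comm (- x) a) (trans e (ℤₚ.+-comm a (- y)))))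

  signed : Mat n → ℕ → ℤ
  signed M j = -𝟙 ∙ pw j M 𝟙

  moments : ∀ (Σ' : SignedGraph n) p s → -𝟙 ∙ pw s (A Σ') (act p (A Σ') 𝟙) ≡ moment p (λ i → signed (A Σ') (i ℕ.+ s))
  moments Σ' p s = Quadratic.∙-pw-act (A Σ') (A-sym Σ') -𝟙 s p 𝟙

  -- The coefficient of ρ in degree n - 1 - j is the value of a monic polynomial of degree j in A,
  -- with coefficients taken from χ, so it yields the j-th walk count from the earlier ones.
  low : ∀ j → j ℕ.< n → (∀ k → k ℕ.< j → signed A₁ k ≡ signed A₂ k) → signed A₁ j ≡ signed A₂ j
  low j j<n h = top-determines j {coeff p₁} top h
    (trans (sym (side Σ₁ p₁ deg₁)) (trans (trans (sym (coeff-ρ A₁ χ₁ -𝟙 𝟙 m)) (trans (ρ≈ m) (coeff-ρ A₂ χ₂ -𝟙 𝟙 m))) (trans (side Σ₂ p₂ deg₂) (topMoment-cong j (λ k → sym (p≈ k)) (λ _ _ → refl)))))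
    where
    m = n ℕ.∸ suc j
    p₁ = drop (suc m) χ₁
    p₂ = drop (suc m) χ₂
    sm : suc m ℕ.+ j ≡ n
    sm = trans (sym (ℕₚ.+-suc m j)) (ℕₚ.m∸n+n≡m j<n)
    p≈ : ∀ k → coeff p₁ k ≡ coeff p₂ k
    p≈ k = trans (coeff-drop (suc m) χ₁ k) (trans (χ≈ (suc m ℕ.+ k)) (sym (coeff-drop (suc m) χ₂ k)))
    top : coeff p₁ j ≡ 1ℤ
    top = trans (coeff-drop (suc m) χ₁ j) (trans (cong (coeff χ₁) sm) (charPoly-monic n A₁))
    deg₁ : ∀ k → j ℕ.< k → coeff p₁ k ≡ 0ℤ
    deg₁ k lt = trans (coeff-drop (suc m) χ₁ k) (charPoly-degree n A₁ (suc m ℕ.+ k) (subst (ℕ._< suc m ℕ.+ k) sm (ℕₚ.+-monoʳ-< (suc m) lt)))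
    deg₂ : ∀ k → j ℕ.< k → coeff p₂ k ≡ 0ℤ
    deg₂ k lt = trans (sym (p≈ k)) (deg₁ k lt)
    side : ∀ (Σ' : SignedGraph n) p → (∀ k → j ℕ.< k → coeff p k ≡ 0ℤ) → -𝟙 ∙ act p (A Σ') 𝟙 ≡ topMoment (coeff p) (signed (A Σ')) j
    side Σ' p deg = trans (moments Σ' p 0) (trans (sym (topMoment-moment j p (λ i → signed (A Σ') (i ℕ.+ 0)) deg)) (topMoment-cong j (λ _ → refl) (λ k _ → cong (signed (A Σ')) (ℕₚ.+-identityʳ k))))

  -- From n on, Cayley-Hamilton gives both sequences the same linear recurrence.
  high : ∀ j → n ℕ.≤ j → (∀ k → k ℕ.< j → signed A₁ k ≡ signed A₂ k) → signed A₁ j ≡ signed A₂ j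
  high j n≤j h = subst (λ k → signed A₁ k ≡ signed A₂ k) n+s (top-determines n {coeff χ₁} {λ i → signed A₁ (i ℕ.+ s)} {λ i → signed A₂ (i ℕ.+ s)} (charPoly-monic n A₁)
    (λ k k<n → h (k ℕ.+ s) (subst (k ℕ.+ s ℕ.<_) n+s (ℕₚ.+-monoˡ-< s k<n)))
    (trans (side Σ₁) (sym (trans (topMoment-cong n χ≈ (λ _ _ → refl)) (side Σ₂)))))
    where
    s = j ℕ.∸ n
    n+s : n ℕ.+ s ≡ j
    n+s = ℕₚ.m+[n∸m]≡n n≤j
    side : ∀ (Σ' : SignedGraph n) → topMoment (coeff (χ Σ')) (λ i → signed (A Σ') (i ℕ.+ s)) n ≡ 0ℤ
    side Σ' = trans (topMoment-moment n (χ Σ') _ (charPoly-degree n (A Σ'))) (trans (sym (moments Σ' (χ Σ') s))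
      (∙-0ʳ -𝟙 (λ i → trans (Linear.l-cong (pw-linear s (A Σ')) (cayley-hamilton (A Σ') 𝟙) i) (linear-0 (pw-linear s (A Σ')) i))))

  signed-equal : ∀ N j → j ℕ.< N → signed A₁ j ≡ signed A₂ j
  signed-equal (suc N) j (s≤s j≤N) = split (j ℕ.<? n)
    where
    below : ∀ k → k ℕ.< j → signed A₁ k ≡ signed A₂ k
    below k k<j = signed-equal N k (ℕₚ.<-≤-trans k<j j≤N)
    split : Dec (j ℕ.< n) → signed A₁ j ≡ signed A₂ j
    split (yes lt) = low j lt below
    split (no ge)  = high j (ℕₚ.≮⇒≥ ge) below

  walks-equal : ∀ j → 𝟙 ∙ pw j A₁ 𝟙 ≡ 𝟙 ∙ pw j A₂ 𝟙
  walks-equal j = trans (relate A₁) (trans (cong -_ (signed-equal (suc j) j ℕₚ.≤-refl)) (sym (relate A₂)))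
    where
    relate : ∀ M → 𝟙 ∙ pw j M 𝟙 ≡ - signed M j
    relate M = trans (trans (∑-cong (λ i → ℤₚ.*-identityˡ (pw j M 𝟙 i))) (sym (ℤₚ.neg-involutive (walks M j)))) (cong -_ (sym (trans (∑-*ˡ -1ℤ (pw j M 𝟙)) (ℤₚ.-1*i≡-i (walks M j)))))

  gram : ∀ i j → pw i A₁ 𝟙 ∙ pw j A₁ 𝟙 ≡ pw i A₂ 𝟙 ∙ pw j A₂ 𝟙
  gram i j = trans (side Σ₁) (trans (walks-equal (i ℕ.+ j)) (sym (side Σ₂)))
    where
    side : ∀ (Σ' : SignedGraph n) → pw i (A Σ') 𝟙 ∙ pw j (A Σ') 𝟙 ≡ 𝟙 ∙ pw (i ℕ.+ j) (A Σ') 𝟙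
    side Σ' = trans (pw-selfAdjoint (A-sym Σ') i 𝟙 (pw j (A Σ') 𝟙)) (∙-cong {u = 𝟙} (λ _ → refl) (pw-+ i j (A Σ') 𝟙))

-- Intertwiners from equal Gram matrices

▹-adj : ∀ {n} (M : Mat n) v i → (M ▹ (adjugate M ▹ v)) i ≡ det M * v i
▹-adj {n} M v i = begin
  (M ▹ (adjugate M ▹ v)) i ≡⟨ sym (▹-assoc M (adjugate M) v i) ⟩
  ∑ (λ k → (M ⊗ adjugate M) i k * v k) ≡⟨ ∑-cong (λ k → trans (cong (_* v k) (trans (⊗-adj M i k) (cong (det M *_) (δ-sym k i)))) (ℤₚ.*-assoc (det M) (δ i k) (v k))) ⟩
  ∑ (λ k → det M * (δ i k * v k)) ≡⟨ trans (∑-*ˡ (det M) (λ k → δ i k * v k)) (cong (det M *_) (∑-δˡ i v)) ⟩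
  det M * v i ∎
  where open ≡-Reasoning

col : ∀ {n} → Mat n → Fin n → Vect n
col X k i = X i k

columns-∙ : ∀ {n} (X : Mat n) x z → (X ▹ x) ∙ z ≡ ∑ (λ k → x k * (col X k ∙ z))
columns-∙ X x z = adjoint X x z

columns-bilinear : ∀ {n} (X N : Mat n) x y → (X ▹ x) ∙ (N ▹ (X ▹ y)) ≡ ∑ (λ k → x k * ∑ (λ l → y l * (col X k ∙ (N ▹ col X l))))
columns-bilinear X N x y = trans (columns-∙ X x (N ▹ (X ▹ y))) (∑-cong (λ k → cong (x k *_) (begin
  col X k ∙ (N ▹ (X ▹ y)) ≡⟨ ∙-cong {u = col X k} (λ _ → refl) (λ i → sym (▹-assoc N X y i)) ⟩
  col X k ∙ ((N ⊗ X) ▹ y) ≡⟨ ∙-comm (col X k) ((N ⊗ X) ▹ y) ⟩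
  ((N ⊗ X) ▹ y) ∙ col X k ≡⟨ columns-∙ (N ⊗ X) y (col X k) ⟩
  ∑ (λ l → y l * ((N ▹ col X l) ∙ col X k)) ≡⟨ ∑-cong (λ l → cong (y l *_) (∙-comm (N ▹ col X l) (col X k))) ⟩
  ∑ (λ l → y l * (col X k ∙ (N ▹ col X l))) ∎)))
  where open ≡-Reasoning

δ-▹ : ∀ {n} (v : Vect n) → δ ▹ v ≗ v
δ-▹ v i = ∑-δˡ i v

columns-∙∙ : ∀ {n} (X : Mat n) x y → (X ▹ x) ∙ (X ▹ y) ≡ ∑ (λ k → x k * ∑ (λ l → y l * (col X k ∙ col X l)))
columns-∙∙ X x y = trans (∙-cong {u = X ▹ x} (λ _ → refl) (λ i → sym (δ-▹ (X ▹ y) i))) (trans (columns-bilinear X δ x y)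
  (∑-cong (λ k → cong (x k *_) (∑-cong (λ l → cong (y l *_) (∙-cong {u = col X k} (λ _ → refl) (δ-▹ (col X l))))))))

record Intertwiner {n} (A₁ A₂ : Mat n) (ℓ : ℤ) : Set where
  field
    Q : Mat n
    isometry : ∀ x y → (Q ▹ x) ∙ (Q ▹ y) ≡ ℓ * ℓ * (x ∙ y)
    conjugates : ∀ x y → (Q ▹ x) ∙ (A₁ ▹ (Q ▹ y)) ≡ ℓ * ℓ * (x ∙ (A₂ ▹ y))
    fixes-𝟙 : ∀ i → (Q ▹ 𝟙) i ≡ ℓ

module Orthogonal {n : ℕ} (Q : Mat n) (ℓ : ℤ) (ℓ≢0 : ℓ ≢ 0ℤ) (isometry : ∀ x y → (Q ▹ x) ∙ (Q ▹ y) ≡ ℓ * ℓ * (x ∙ y)) where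
  left : ∀ x → (Q ᵗ) ▹ (Q ▹ x) ≗ (λ k → ℓ * ℓ * x k)
  left x k = begin
    ((Q ᵗ) ▹ (Q ▹ x)) k ≡⟨ sym (∑-δˡ k ((Q ᵗ) ▹ (Q ▹ x))) ⟩
    δ k ∙ ((Q ᵗ) ▹ (Q ▹ x)) ≡⟨ sym (adjoint Q (δ k) (Q ▹ x)) ⟩
    (Q ▹ δ k) ∙ (Q ▹ x) ≡⟨ isometry (δ k) x ⟩
    ℓ * ℓ * (δ k ∙ x) ≡⟨ cong (ℓ * ℓ *_) (∑-δˡ k x) ⟩
    ℓ * ℓ * x k ∎
    where open ≡-Reasoning

  ℓℓ≢0 : ℓ * ℓ ≢ 0ℤ
  ℓℓ≢0 e = ℓ≢0 (*-zero-cases ℓ ℓ≢0 e)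

  det≢0 : det (Q ᵗ) ≢ 0ℤ
  det≢0 e = ℓℓ≢0 (ℤₚ.i^n≡0⇒i≡0 (ℓ * ℓ) n (trans (sym (trans (det-scale n (ℓ * ℓ) δ) (trans (cong ((ℓ * ℓ) ℤ.^ n *_) (det-δ n)) (ℤₚ.*-identityʳ _))))
    (trans (det-cong n entry) (trans (det-⊗ n (Q ᵗ) Q) (trans (cong (_* det Q) e) (ℤₚ.*-zeroˡ (det Q)))))))
    where
    entry : ∀ i j → ℓ * ℓ * δ i j ≡ ((Q ᵗ) ⊗ Q) i j
    entry i j = trans (cong (ℓ * ℓ *_) (δ-sym i j)) (trans (sym (left (δ j) i)) (▹-cong (Q ᵗ) (▹-δ Q j) i))

  right : ∀ x → Q ▹ ((Q ᵗ) ▹ x) ≗ (λ k → ℓ * ℓ * x k)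
  right x k = ℤₚ.i-j≡0⇒i≡j _ _ (trans (h (z k) (ℓ * ℓ) (x k)) (nonsingular⇒injective (Q ᵗ) det≢0 y Qy k))
    where
    z = Q ▹ ((Q ᵗ) ▹ x)
    y : Vect n
    y k = 1ℤ * z k + (- (ℓ * ℓ)) * x k
    h : ∀ z l x → z - l * x ≡ 1ℤ * z + (- l) * x
    h = solve-∀
    g : ∀ l x → 1ℤ * (l * x) + (- l) * x ≡ 0ℤ
    g = solve-∀
    Qy : (Q ᵗ) ▹ y ≗ 0ᵛ
    Qy k = trans (Linear.l-comb (▹-linear (Q ᵗ)) 1ℤ (- (ℓ * ℓ)) z x k) (trans (cong (λ w → 1ℤ * w + (- (ℓ * ℓ)) * ((Q ᵗ) ▹ x) k) (left ((Q ᵗ) ▹ x) k)) (g (ℓ * ℓ) (((Q ᵗ) ▹ x) k)))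

  rows : ∀ i j → ∑ (λ k → Q i k * Q j k) ≡ ℓ * ℓ * δ i j
  rows i j = trans (∑-cong (λ k → cong (Q i k *_) (sym (▹-δ (Q ᵗ) j k)))) (trans (right (δ j) i) (cong (ℓ * ℓ *_) (δ-sym j i)))

-- The rational orthogonal matrix X₁X₂⁻¹ carries the columns of X₂ to those of X₁. Replacing the
-- inverse by the adjugate clears the denominators, so the level starts as det X₂. A column of ones
-- shared by X₁ and X₂ makes the all-ones vector an eigenvector.
module Intertwine {n : ℕ} (A₁ A₂ X₁ X₂ : Mat n) (d≢0 : det X₂ ≢ 0ℤ) (gram : ∀ k l → col X₁ k ∙ col X₁ l ≡ col X₂ k ∙ col X₂ l) where
  d = det X₂

  Y : Vect n → Vect n
  Y x = adjugate X₂ ▹ x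

  Q : Mat n
  Q = X₁ ⊗ adjugate X₂

  Q▹ : ∀ x → Q ▹ x ≗ X₁ ▹ Y x
  Q▹ = ▹-assoc X₁ (adjugate X₂)

  form-equal : ∀ x y → (X₁ ▹ x) ∙ (X₁ ▹ y) ≡ (X₂ ▹ x) ∙ (X₂ ▹ y)
  form-equal x y = trans (columns-∙∙ X₁ x y) (trans (∑-cong (λ k → cong (x k *_) (∑-cong (λ l → cong (y l *_) (gram k l))))) (sym (columns-∙∙ X₂ x y)))

  scale-form : ∀ x (M : Mat n) y → (X₂ ▹ Y x) ∙ (M ▹ (X₂ ▹ Y y)) ≡ d * d * (x ∙ (M ▹ y))
  scale-form x M y = begin
    (X₂ ▹ Y x) ∙ (M ▹ (X₂ ▹ Y y)) ≡⟨ ∙-cong (▹-adj X₂ x) (λ i → trans (▹-cong M (▹-adj X₂ y) i) (▹-scale M d y i)) ⟩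
    (λ i → d * x i) ∙ (λ i → d * (M ▹ y) i) ≡⟨ ∙-scaleʳ (λ i → d * x i) d (M ▹ y) ⟩
    d * ((λ i → d * x i) ∙ (M ▹ y)) ≡⟨ cong (d *_) (trans (∙-comm (λ i → d * x i) (M ▹ y)) (trans (∙-scaleʳ (M ▹ y) d x) (cong (d *_) (∙-comm (M ▹ y) x)))) ⟩
    d * (d * (x ∙ (M ▹ y))) ≡⟨ sym (ℤₚ.*-assoc d d (x ∙ (M ▹ y))) ⟩
    d * d * (x ∙ (M ▹ y)) ∎
    where open ≡-Reasoning

  isometry : ∀ x y → (Q ▹ x) ∙ (Q ▹ y) ≡ d * d * (x ∙ y)
  isometry x y = begin
    (Q ▹ x) ∙ (Q ▹ y) ≡⟨ ∙-cong (Q▹ x) (Q▹ y) ⟩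
    (X₁ ▹ Y x) ∙ (X₁ ▹ Y y) ≡⟨ form-equal (Y x) (Y y) ⟩
    (X₂ ▹ Y x) ∙ (X₂ ▹ Y y) ≡⟨ ∙-cong {u = X₂ ▹ Y x} (λ _ → refl) (λ i → sym (δ-▹ (X₂ ▹ Y y) i)) ⟩
    (X₂ ▹ Y x) ∙ (δ ▹ (X₂ ▹ Y y)) ≡⟨ scale-form x δ y ⟩
    d * d * (x ∙ (δ ▹ y)) ≡⟨ cong (d * d *_) (∙-cong {u = x} (λ _ → refl) (δ-▹ y)) ⟩
    d * d * (x ∙ y) ∎
    where open ≡-Reasoning

  intertwiner : (∀ k l → col X₁ k ∙ (A₁ ▹ col X₁ l) ≡ col X₂ k ∙ (A₂ ▹ col X₂ l)) →
                ∀ c → (∀ i → X₁ i c ≡ 1ℤ) → (∀ i → X₂ i c ≡ 1ℤ) → Intertwiner A₁ A₂ d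
  intertwiner gramA c h₁ h₂ = record { Q = Q ; isometry = isometry ; conjugates = conjugates ; fixes-𝟙 = fixes }
    where
    conjugates : ∀ x y → (Q ▹ x) ∙ (A₁ ▹ (Q ▹ y)) ≡ d * d * (x ∙ (A₂ ▹ y))
    conjugates x y = trans (∙-cong (Q▹ x) (▹-cong A₁ (Q▹ y))) (trans (columns-bilinear X₁ A₁ (Y x) (Y y))
      (trans (∑-cong (λ k → cong (Y x k *_) (∑-cong (λ l → cong (Y y l *_) (gramA k l))))) (trans (sym (columns-bilinear X₂ A₂ (Y x) (Y y))) (scale-form x A₂ y))))
    fixes : ∀ i → (Q ▹ 𝟙) i ≡ d
    fixes i = begin
      (Q ▹ 𝟙) i ≡⟨ Q▹ 𝟙 i ⟩
      (X₁ ▹ Y 𝟙) i ≡⟨ ▹-cong X₁ (λ j → trans (▹-cong (adjugate X₂) (λ k → sym (trans (▹-δ X₂ c k) (h₂ k))) j) (sym (adj-▹ X₂ (δ c) j))) i ⟩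
      (X₁ ▹ (λ j → d * δ c j)) i ≡⟨ ▹-scale X₁ d (δ c) i ⟩
      d * (X₁ ▹ δ c) i ≡⟨ cong (d *_) (trans (▹-δ X₁ c i) (h₁ i)) ⟩
      d * 1ℤ ≡⟨ ℤₚ.*-identityʳ d ⟩
      d ∎
      where open ≡-Reasoning

  -- Comparing the traces of QᵀA₁Q and d²A₂ determines a single unknown entry.
  missing-entry : (∀ i → A₁ i i ≡ 0ℤ) → (∀ i → A₂ i i ≡ 0ℤ) → ∀ e →
    (∀ k l → ¬ (k ≡ e × l ≡ e) → col X₁ k ∙ (A₁ ▹ col X₁ l) ≡ col X₂ k ∙ (A₂ ▹ col X₂ l)) →
    ∀ k l → col X₁ k ∙ (A₁ ▹ col X₁ l) ≡ col X₂ k ∙ (A₂ ▹ col X₂ l)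
  missing-entry tr₁ tr₂ e h k l with k ≟ e | l ≟ e
  ... | no p | _ = h k l (λ q → p (proj₁ q))
  ... | yes _ | no p = h k l (λ q → p (proj₂ q))
  ... | yes refl | yes refl = ℤₚ.i-j≡0⇒i≡j (G₁ e e) (G₂ e e) (*-zero-cases (int (norm row)) norm≢0 (trans (ℤₚ.*-comm (int (norm row)) θ) (trans (sym total) total0)))
    where
    open ≡-Reasoning
    G₁ G₂ : Fin n → Fin n → ℤ
    G₁ k l = col X₁ k ∙ (A₁ ▹ col X₁ l)
    G₂ k l = col X₂ k ∙ (A₂ ▹ col X₂ l)
    -- Each diagonal value of QᵀA₁Q equals θ times the square of an entry of row e of adj X₂, since
    -- A₂ has zero diagonal. The trace of QᵀA₁Q is d² tr A₁ = 0 because the rows of Q are orthogonal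
    -- too. Row e is nonzero, as its product with column e of X₂ is d; hence θ = 0.
    θ = G₁ e e - G₂ e e
    row : Vect n
    row k = adjugate X₂ e k
    norm≢0 : int (norm row) ≢ 0ℤ
    norm≢0 z = d≢0 (trans (sym (trans (adj-⊗ X₂ e e) (trans (cong (d *_) (δ-refl e)) (ℤₚ.*-identityʳ d))))
      (∑-0 (λ j → trans (cong (_* X₂ j e) (norm≡0 row (ℤₚ.+-injective z) j)) (ℤₚ.*-zeroˡ (X₂ j e)))))
    difference : ∀ x → (X₁ ▹ x) ∙ (A₁ ▹ (X₁ ▹ x)) ≡ (X₂ ▹ x) ∙ (A₂ ▹ (X₂ ▹ x)) + θ * (x e * x e)
    difference x = begin
      (X₁ ▹ x) ∙ (A₁ ▹ (X₁ ▹ x)) ≡⟨ columns-bilinear X₁ A₁ x x ⟩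
      ∑ (λ k → x k * ∑ (λ l → x l * G₁ k l)) ≡⟨ ∑-cong (λ k → cong (x k *_) (∑-cong (λ l → cong (x l *_) (split k l)))) ⟩
      ∑ (λ k → x k * ∑ (λ l → x l * (G₂ k l + θ * (δ e k * δ e l)))) ≡⟨ ∑-cong (λ k → cong (x k *_) (inner k)) ⟩
      ∑ (λ k → x k * (∑ (λ l → x l * G₂ k l) + (θ * x e) * δ e k)) ≡⟨ trans (∑-cong (λ k → g₂ (x k) (∑ (λ l → x l * G₂ k l)) (θ * x e) (δ e k))) (∑-+ (λ k → x k * ∑ (λ l → x l * G₂ k l)) (λ k → (θ * x e) * (δ e k * x k))) ⟩
      ∑ (λ k → x k * ∑ (λ l → x l * G₂ k l)) + ∑ (λ k → (θ * x e) * (δ e k * x k))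
        ≡⟨ cong₂ _+_ (sym (columns-bilinear X₂ A₂ x x)) (trans (∑-*ˡ (θ * x e) (λ k → δ e k * x k)) (trans (cong ((θ * x e) *_) (∑-δˡ e x)) (ℤₚ.*-assoc θ (x e) (x e)))) ⟩
      (X₂ ▹ x) ∙ (A₂ ▹ (X₂ ▹ x)) + θ * (x e * x e) ∎
      where
      g₂ : ∀ x s t d → x * (s + t * d) ≡ x * s + t * (d * x)
      g₂ = solve-∀
      g₃ : ∀ x s t a b → x * (s + t * (a * b)) ≡ x * s + (t * a) * (b * x)
      g₃ = solve-∀
      g₄ : ∀ t a x → (t * a) * x ≡ (t * x) * a
      g₄ = solve-∀
      inner : ∀ k → ∑ (λ l → x l * (G₂ k l + θ * (δ e k * δ e l))) ≡ ∑ (λ l → x l * G₂ k l) + (θ * x e) * δ e k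
      inner k = trans (∑-cong (λ l → g₃ (x l) (G₂ k l) θ (δ e k) (δ e l))) (trans (∑-+ (λ l → x l * G₂ k l) (λ l → (θ * δ e k) * (δ e l * x l)))
        (cong (∑ (λ l → x l * G₂ k l) +_) (trans (∑-*ˡ (θ * δ e k) (λ l → δ e l * x l)) (trans (cong ((θ * δ e k) *_) (∑-δˡ e x)) (g₄ θ (δ e k) (x e))))))
      split : ∀ k l → G₁ k l ≡ G₂ k l + θ * (δ e k * δ e l)
      split k l with k ≟ e | l ≟ e
      ... | yes refl | yes refl rewrite δ-refl e = f (G₁ e e) (G₂ e e)
        where
        f : ∀ a b → a ≡ b + (a - b) * (1ℤ * 1ℤ)
        f = solve-∀
      ... | yes refl | no p = trans (h k l (λ q → p (proj₂ q))) (sym (trans (cong (λ z → G₂ k l + θ * (δ e k * z)) (δ-≢ (λ q → p (sym q)))) (f (G₂ k l) θ (δ e k))))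
        where
        f : ∀ a t d → a + t * (d * 0ℤ) ≡ a
        f = solve-∀
      ... | no p | _ = trans (h k l (λ q → p (proj₁ q))) (sym (trans (cong (λ z → G₂ k l + θ * (z * δ e l)) (δ-≢ (λ q → p (sym q)))) (f (G₂ k l) θ (δ e l))))
        where
        f : ∀ a t d → a + t * (0ℤ * d) ≡ a
        f = solve-∀
    module O = Orthogonal Q d d≢0 isometry
    trace : ∑ (λ k → (Q ▹ δ k) ∙ (A₁ ▹ (Q ▹ δ k))) ≡ 0ℤ
    trace = begin
      ∑ (λ k → (Q ▹ δ k) ∙ (A₁ ▹ (Q ▹ δ k))) ≡⟨ ∑-cong (λ k → ∙-cong (▹-δ Q k) (▹-cong A₁ (▹-δ Q k))) ⟩
      ∑ (λ k → ∑ (λ i → Q i k * ∑ (λ j → A₁ i j * Q j k))) ≡⟨ ∑-swap (λ k i → Q i k * ∑ (λ j → A₁ i j * Q j k)) ⟩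
      ∑ (λ i → ∑ (λ k → Q i k * ∑ (λ j → A₁ i j * Q j k))) ≡⟨ ∑-0 term ⟩
      0ℤ ∎
      where
      g : ∀ q a r → q * (a * r) ≡ a * (q * r)
      g = solve-∀
      term : ∀ i → ∑ (λ k → Q i k * ∑ (λ j → A₁ i j * Q j k)) ≡ 0ℤ
      term i = begin
        ∑ (λ k → Q i k * ∑ (λ j → A₁ i j * Q j k)) ≡⟨ ∑-cong (λ k → trans (sym (∑-*ˡ (Q i k) (λ j → A₁ i j * Q j k))) (∑-cong (λ j → g (Q i k) (A₁ i j) (Q j k)))) ⟩
        ∑ (λ k → ∑ (λ j → A₁ i j * (Q i k * Q j k))) ≡⟨ ∑-swap (λ k j → A₁ i j * (Q i k * Q j k)) ⟩
        ∑ (λ j → ∑ (λ k → A₁ i j * (Q i k * Q j k))) ≡⟨ ∑-cong (λ j → trans (∑-*ˡ (A₁ i j) (λ k → Q i k * Q j k)) (trans (cong (A₁ i j *_) (trans (O.rows i j) (ℤₚ.*-comm (d * d) (δ i j)))) (sym (ℤₚ.*-assoc (A₁ i j) (δ i j) (d * d))))) ⟩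
        ∑ (λ j → (A₁ i j * δ i j) * (d * d)) ≡⟨ trans (∑-*ʳ (d * d) (λ j → A₁ i j * δ i j)) (cong (_* (d * d)) (trans (∑-cong (λ j → cong (A₁ i j *_) (δ-sym i j))) (trans (∑-δʳ i (A₁ i)) (tr₁ i)))) ⟩
        0ℤ * (d * d) ≡⟨ ℤₚ.*-zeroˡ (d * d) ⟩
        0ℤ ∎
    term₂ : ∀ k → (Q ▹ δ k) ∙ (A₁ ▹ (Q ▹ δ k)) ≡ θ * (row k * row k)
    term₂ k = begin
      (Q ▹ δ k) ∙ (A₁ ▹ (Q ▹ δ k)) ≡⟨ ∙-cong (Q▹ (δ k)) (▹-cong A₁ (Q▹ (δ k))) ⟩
      (X₁ ▹ Y (δ k)) ∙ (A₁ ▹ (X₁ ▹ Y (δ k))) ≡⟨ difference (Y (δ k)) ⟩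
      (X₂ ▹ Y (δ k)) ∙ (A₂ ▹ (X₂ ▹ Y (δ k))) + θ * (Y (δ k) e * Y (δ k) e)
        ≡⟨ cong₂ _+_ (trans (scale-form (δ k) A₂ (δ k)) (trans (cong (d * d *_) (trans (∑-δˡ k (A₂ ▹ δ k)) (trans (▹-δ A₂ k k) (tr₂ k)))) (ℤₚ.*-zeroʳ (d * d))))
             (cong (λ z → θ * (z * z)) (▹-δ (adjugate X₂) k e)) ⟩
      0ℤ + θ * (row k * row k) ≡⟨ ℤₚ.+-identityˡ (θ * (row k * row k)) ⟩
      θ * (row k * row k) ∎
    total : ∑ (λ k → (Q ▹ δ k) ∙ (A₁ ▹ (Q ▹ δ k))) ≡ θ * int (norm row)
    total = trans (∑-cong term₂) (trans (∑-*ˡ θ (λ k → row k * row k)) (cong (θ *_) (∙-norm row)))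
    total0 = trace

-- Walk matrices and their completion

powApply≗pw : ∀ {n} k (M : Mat n) v → powApply k M v ≗ pw k M v
powApply≗pw zero    M v i = refl
powApply≗pw (suc k) M v i = trans (sym ∑-sumFin) (▹-cong M (powApply≗pw k M v) i)

walkMat : ∀ {n} → SignedGraph n → Mat n
walkMat Σ' i k = pw (toℕ k) (A Σ') 𝟙 i

W≈walkMat : ∀ {n} (Σ' : SignedGraph n) → W Σ' ≈ walkMat Σ'
W≈walkMat Σ' i k = powApply≗pw (toℕ k) (A Σ') 𝟙 i

det-square : ∀ {n} (X Y : Mat n) → (∀ k l → col X k ∙ col X l ≡ col Y k ∙ col Y l) → det X * det X ≡ det Y * det Y
det-square {n} X Y h = trans (sym (side X)) (trans (det-cong n h) (side Y))
  where
  side : ∀ X → det ((X ᵗ) ⊗ X) ≡ det X * det X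
  side X = trans (det-⊗ n (X ᵗ) X) (cong (_* det X) (det-ᵗ n X))

square-zero : ∀ {a b} → a * a ≡ b * b → b ≡ 0ℤ → a ≡ 0ℤ
square-zero {a} e refl with ℤₚ.i*j≡0⇒i≡0∨j≡0 a e
... | inj₁ p = p
... | inj₂ p = p

diagonal-A : ∀ {n} (Σ' : SignedGraph n) i → A Σ' i i ≡ 0ℤ
diagonal-A Σ' i = cong adjℤ (SignedGraph.irref Σ' i)

∑-inject₁ : ∀ {n} (f : Vect (suc n)) → ∑ f ≡ ∑ (f ∘ inject₁) + f (fromℕ n)
∑-inject₁ {zero}  f = trans ∑-suc (trans (cong (f zero +_) ∑-nil) (trans (ℤₚ.+-identityʳ (f zero)) (sym (trans (cong (_+ f zero) ∑-nil) (ℤₚ.+-identityˡ (f zero))))))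
∑-inject₁ {suc n} f = trans ∑-suc (trans (cong (f zero +_) (∑-inject₁ (f ∘ suc))) (trans (sym (ℤₚ.+-assoc (f zero) (∑ (f ∘ suc ∘ inject₁)) (f (fromℕ (suc n))))) (cong (_+ f (fromℕ (suc n))) (sym ∑-suc))))

adjugate-mod : ∀ {N n} {M M' : Mat n} → (∀ i j → M i j ≡ M' i j [mod N ]) → ∀ j k → adjugate M j k ≡ adjugate M' j k [mod N ]
adjugate-mod {N} {n} h j k = mod-neg (det-mod N (suc n) entry)
  where
  entry : ∀ r c → bd 0ℤ (δ j) (δ k) _ r c ≡ bd 0ℤ (δ j) (δ k) _ r c [mod N ]
  entry zero    zero    = mod-refl
  entry zero    (suc c) = mod-refl
  entry (suc r) zero    = mod-refl
  entry (suc r) (suc c) = h r c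

-- A diagonal entry of adj(MᵀM) = adj(M) adj(M)ᵀ; for nonsingular M one cancels MᵀM, and perturbation does the rest.
adjugate-gram : ∀ {n} (M : Mat n) l → ∑ (λ j → adjugate M l j * adjugate M l j) ≡ adjugate ((M ᵗ) ⊗ M) l l
adjugate-gram {n} M l = ℤₚ.i-j≡0⇒i≡j _ _ (mod-all⇒0 (E M) (λ k → mod-trans (E-mod k) (≡⇒mod (E-vanishes k))))
  where
  E : Mat n → ℤ
  E M = ∑ (λ j → adjugate M l j * adjugate M l j) - adjugate ((M ᵗ) ⊗ M) l l
  E-mod : ∀ k → E M ≡ E (perturb k δ M) [mod int (suc k) ]
  E-mod k = mod-- (∑-mod (λ j → mod-* (adjugate-mod h l j) (adjugate-mod h l j))) (adjugate-mod (λ a b → ∑-mod (λ j → mod-* (h j a) (h j b))) l l)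
    where h = perturb-≡X k δ M
  nonsingular : ∀ X → det X ≢ 0ℤ → ∀ l → ∑ (λ j → adjugate X l j * adjugate X l j) ≡ adjugate ((X ᵗ) ⊗ X) l l
  nonsingular X d≢0 l = ℤₚ.i-j≡0⇒i≡j (h l) (g l) (trans (f (h l) (g l)) (nonsingular⇒injective G detG≢0 (λ i → 1ℤ * h i + -1ℤ * g i) kernel l))
    where
    open ≡-Reasoning
    D' = det X
    G = (X ᵗ) ⊗ X
    detG : det G ≡ D' * D'
    detG = trans (det-⊗ n (X ᵗ) X) (cong (_* D') (det-ᵗ n X))
    detG≢0 : det G ≢ 0ℤ
    detG≢0 e = d≢0 (*-zero-cases D' d≢0 (trans (sym detG) e))
    h g : Vect n
    h i = (adjugate X ▹ (λ j → adjugate X l j)) i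
    g i = adjugate G i l
    f : ∀ a b → a - b ≡ 1ℤ * a + - 1ℤ * b
    f = solve-∀
    Gh : ∀ i → (G ▹ h) i ≡ D' * D' * δ l i
    Gh i = begin
      (G ▹ h) i ≡⟨ ▹-assoc (X ᵗ) X h i ⟩
      ((X ᵗ) ▹ (X ▹ h)) i ≡⟨ ▹-cong (X ᵗ) (▹-adj X (λ j → adjugate X l j)) i ⟩
      ((X ᵗ) ▹ (λ j → D' * adjugate X l j)) i ≡⟨ ▹-scale (X ᵗ) D' (λ j → adjugate X l j) i ⟩
      D' * ∑ (λ j → X j i * adjugate X l j) ≡⟨ cong (D' *_) (trans (∑-cong (λ j → ℤₚ.*-comm (X j i) (adjugate X l j))) (adj-⊗ X l i)) ⟩
      D' * (D' * δ l i) ≡⟨ sym (ℤₚ.*-assoc D' D' (δ l i)) ⟩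
      D' * D' * δ l i ∎
    kernel : G ▹ (λ i → 1ℤ * h i + -1ℤ * g i) ≗ 0ᵛ
    kernel i = trans (Linear.l-comb (▹-linear G) 1ℤ -1ℤ h g i) (trans (cong₂ (λ a b → 1ℤ * a + -1ℤ * b) (Gh i) (trans (⊗-adj G i l) (cong (_* δ l i) detG))) (z (D' * D' * δ l i)))
      where
      z : ∀ x → 1ℤ * x + - 1ℤ * x ≡ 0ℤ
      z = solve-∀
  E-vanishes : ∀ k → E (perturb k δ M) ≡ 0ℤ
  E-vanishes k = ℤₚ.i≡j⇒i-j≡0 {∑ (λ j → adjugate X l j * adjugate X l j)} {adjugate ((X ᵗ) ⊗ X) l l}
    (nonsingular X (1≢0-mod k (mod-trans (det-mod (int (suc (suc k))) n (perturb-≡Y k δ M)) (≡⇒mod (det-δ n)))) l)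
    where X = perturb k δ M

module Krylov {n' : ℕ} (Σ' : SignedGraph (suc n')) where
  private
    n = suc n'
    M = A Σ'
    w = walkMat Σ'
    last = fromℕ n'

  -- The cofactors of the last column, hence orthogonal to all columns once the walk matrix is
  -- singular. The last column is the one to give up because A maps every other column to a column,
  -- which makes `normal` orthogonal also to their images under A.
  normal : Vect n
  normal i = adjugate w last i

  completed : Mat n
  completed = ((w ᵗ) [ last ≔ normal ]) ᵗ

  completed-last : ∀ i → completed i last ≡ normal i
  completed-last i = upd-at (w ᵗ) last normal i

  completed-other : ∀ k → k ≢ last → ∀ i → completed i k ≡ w i k
  completed-other k p i = upd-off (w ᵗ) last normal k p i

  module _ (singular : det w ≡ 0ℤ) where
    normal-⊥ : ∀ k → normal ∙ col w k ≡ 0ℤ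
    normal-⊥ k = trans (adj-⊗ w last k) (trans (cong (_* δ last k) singular) (ℤₚ.*-zeroˡ (δ last k)))

    not-last : ∀ k → k ≢ last → toℕ k ℕ.< n'
    not-last k p = ℕₚ.≤∧≢⇒< (ℕₚ.≤-pred (Finₚ.toℕ<n k)) (λ e → p (Finₚ.toℕ-injective (trans e (sym (Finₚ.toℕ-fromℕ n')))))

    normal-⊥-A : ∀ k → k ≢ last → normal ∙ (M ▹ col w k) ≡ 0ℤ
    normal-⊥-A k p = trans (∙-cong {u = normal} (λ _ → refl) (λ i → cong (λ t → pw t M 𝟙 i) (sym (Finₚ.toℕ-fromℕ< k<n)))) (normal-⊥ (Fin.fromℕ< k<n))
      where
      k<n : suc (toℕ k) ℕ.< n
      k<n = s≤s (not-last k p)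

    -- If normal = 0, the dependency c among the columns of w supplied by the minor does not involve the last
    -- column; its shift under A is a second one, whence c = 0.
    normal≢0 : ∀ i j → ¬ det (minor w i j) ≡ 0ℤ → ¬ normal ≗ 0ᵛ
    normal≢0 i j minor≢0 zero-normal = cj≢0 (all-zero (n' ℕ.∸ toℕ j) j (ℕₚ.m+[n∸m]≡n (ℕₚ.≤-pred (Finₚ.toℕ<n j))))
      where
      open ≡-Reasoning
      c c₂ : Vect n
      c l = adjugate w l i
      c₂ zero    = 0ℤ
      c₂ (suc l) = c (inject₁ l)
      c-last : c last ≡ 0ℤ
      c-last = zero-normal i
      cj≢0 : c j ≢ 0ℤ
      cj≢0 e = minor≢0 (unsign (toℕ i) (unsign (toℕ j) (trans (sym (adj-minor n' w j i)) e)))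
        where
        unsign : ∀ k {x} → signPow k * x ≡ 0ℤ → x ≡ 0ℤ
        unsign k {x} e = trans (sym (trans (sym (ℤₚ.*-assoc (signPow k) (signPow k) x)) (trans (cong (_* x) (signPow-sq k)) (ℤₚ.*-identityˡ x)))) (trans (cong (signPow k *_) e) (ℤₚ.*-zeroʳ (signPow k)))
      wc : w ▹ c ≗ 0ᵛ
      wc r = trans (⊗-adj w r i) (trans (cong (_* δ i r) singular) (ℤₚ.*-zeroˡ (δ i r)))
      wc₂ : w ▹ c₂ ≗ 0ᵛ
      wc₂ r = begin
        ∑ (λ k → w r k * c₂ k) ≡⟨ ∑-suc ⟩
        w r zero * 0ℤ + ∑ (λ l → (M ▹ pw (toℕ l) M 𝟙) r * c (inject₁ l)) ≡⟨ trans (cong (_+ ∑ (λ l → (M ▹ pw (toℕ l) M 𝟙) r * c (inject₁ l))) (ℤₚ.*-zeroʳ (w r zero))) (ℤₚ.+-identityˡ _) ⟩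
        ∑ (λ l → (M ▹ pw (toℕ l) M 𝟙) r * c (inject₁ l)) ≡⟨ ∑-cong (λ l → cong (λ t → (M ▹ pw t M 𝟙) r * c (inject₁ l)) (sym (Finₚ.toℕ-inject₁ l))) ⟩
        ∑ (f ∘ inject₁) ≡⟨ sym (trans (∑-inject₁ f) (trans (cong (∑ (f ∘ inject₁) +_) (trans (cong ((M ⊗ w) r last *_) c-last) (ℤₚ.*-zeroʳ ((M ⊗ w) r last)))) (ℤₚ.+-identityʳ _))) ⟩
        ((M ⊗ w) ▹ c) r ≡⟨ ▹-assoc M w c r ⟩
        (M ▹ (w ▹ c)) r ≡⟨ ▹-0 M wc r ⟩
        0ℤ ∎
        where
        f : Vect n
        f k = (M ⊗ w) r k * c k
      -- The combination of the two dependencies that vanishes at j. The nonzero minor omits column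
      -- j, so c₃ vanishes everywhere and c₂ is proportional to c.
      c₃ : Vect n
      c₃ l = c₂ j * c l + (- c j) * c₂ l
      wc₃ : w ▹ c₃ ≗ 0ᵛ
      wc₃ r = trans (Linear.l-comb (▹-linear w) (c₂ j) (- c j) c c₂ r) (trans (cong₂ (λ a b → c₂ j * a + (- c j) * b) (wc r) (wc₂ r)) (g (c₂ j) (c j)))
        where
        g : ∀ a b → a * 0ℤ + (- b) * 0ℤ ≡ 0ℤ
        g = solve-∀
      c₃-j : c₃ j ≡ 0ℤ
      c₃-j = g (c₂ j) (c j)
        where
        g : ∀ a b → a * b + (- b) * a ≡ 0ℤ
        g = solve-∀
      restricted : (c₃ ∘ punchIn j) ≗ 0ᵛ
      restricted = nonsingular⇒injective (minor w i j) minor≢0 (c₃ ∘ punchIn j) (λ a → trans (sym (trans (∑-punchIn j (λ k → w (punchIn i a) k * c₃ k))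
        (trans (cong (_+ (minor w i j ▹ (c₃ ∘ punchIn j)) a) (trans (cong (w (punchIn i a) j *_) c₃-j) (ℤₚ.*-zeroʳ (w (punchIn i a) j)))) (ℤₚ.+-identityˡ _)))) (wc₃ (punchIn i a)))
      c₃≡0 : c₃ ≗ 0ᵛ
      c₃≡0 l = go (view j l)
        where
        go : ∀ {l} → View j l → c₃ l ≡ 0ℤ
        go here      = c₃-j
        go (there a) = restricted a
      step : ∀ l → c l ≡ 0ℤ → c₂ l ≡ 0ℤ
      step l e = *-zero-cases (c j) cj≢0 (solveFor (c₂ j) (c l) (c j) (c₂ l) e (c₃≡0 l))
        where
        solveFor : ∀ a b c d → b ≡ 0ℤ → a * b + (- c) * d ≡ 0ℤ → c * d ≡ 0ℤ
        solveFor a _ c d refl e = trans (g a c d) (cong -_ e)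
          where
          g : ∀ a c d → c * d ≡ - (a * 0ℤ + (- c) * d)
          g = solve-∀
      -- Descent from the last index: proportionality carries a zero of c at l + 1 to c₂, whose
      -- value there is c at l.
      all-zero : ∀ k l → toℕ l ℕ.+ k ≡ n' → c l ≡ 0ℤ
      all-zero zero    l e = subst (λ z → c z ≡ 0ℤ) (Finₚ.toℕ-injective (trans (Finₚ.toℕ-fromℕ n') (trans (sym e) (ℕₚ.+-identityʳ (toℕ l))))) c-last
      all-zero (suc k) l e = subst (λ z → c z ≡ 0ℤ) (Finₚ.toℕ-injective (trans (Finₚ.toℕ-inject₁ l') (Finₚ.toℕ-fromℕ< l<n')))
        (step (suc l') (all-zero k (suc l') (trans (cong (λ z → suc z ℕ.+ k) (Finₚ.toℕ-fromℕ< l<n')) (trans (sym (ℕₚ.+-suc (toℕ l) k)) e))))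
        where
        l<n' : toℕ l ℕ.< n'
        l<n' = subst (toℕ l ℕ.<_) e (ℕₚ.m<m+n (toℕ l) (s≤s z≤n))
        l' = Fin.fromℕ< l<n'

  -- Replacing a column does not change its own cofactors, so expansion along the last column pairs
  -- `normal` with itself; nonsingularity thus amounts to `normal` being nonzero.
  det-completed : det completed ≡ normal ∙ normal
  det-completed = begin
    det completed ≡⟨ sym (trans (adj-⊗ completed last last) (trans (cong (det completed *_) (δ-refl last)) (ℤₚ.*-identityʳ (det completed)))) ⟩
    ∑ (λ j → adjugate completed last j * completed j last) ≡⟨ ∑-cong (λ j → cong₂ _*_ (same j) (completed-last j)) ⟩
    normal ∙ normal ∎
    where
    open ≡-Reasoning
    same : ∀ j → adjugate completed last j ≡ normal j
    same j = trans (adj-minor n' completed last j) (trans (cong (λ z → signPow (toℕ last) * (signPow (toℕ j) * z))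
      (det-cong n' (λ r c → completed-other (punchIn last c) (Finₚ.punchInᵢ≢i last c) (punchIn j r)))) (sym (adj-minor n' w last j)))

-- In order one the walk matrix is the single entry 1. So when it is singular, the column of ones is
-- not the column replaced in the completion.
singular⇒zero≢last : ∀ m (Σ' : SignedGraph (suc m)) → det (walkMat Σ') ≡ 0ℤ → zero ≢ fromℕ m
singular⇒zero≢last zero    Σ' e _ = 1≢0 (trans (sym (trans (det-cong 1 (λ { zero zero → refl })) (det-δ 1))) e)
  where
  1≢0 : 1ℤ ≢ 0ℤ
  1≢0 ()
singular⇒zero≢last (suc m) Σ' e ()

module _ {n' : ℕ} (Σ₁ Σ₂ : SignedGraph (suc n')) (cospectral : GenCospectral Σ₁ Σ₂) where
  private
    n = suc n'
    w₁ = walkMat Σ₁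
    w₂ = walkMat Σ₂
    last = fromℕ n'

    walk-gram : ∀ k l → col w₁ k ∙ col w₁ l ≡ col w₂ k ∙ col w₂ l
    walk-gram k l = WalkCounts.gram Σ₁ Σ₂ cospectral (toℕ k) (toℕ l)

    walk-gram-A : ∀ k l → col w₁ k ∙ (A Σ₁ ▹ col w₁ l) ≡ col w₂ k ∙ (A Σ₂ ▹ col w₂ l)
    walk-gram-A k l = WalkCounts.gram Σ₁ Σ₂ cospectral (toℕ k) (suc (toℕ l))

  controllable-intertwiner : Controllable Σ₁ → Σ ℤ λ ℓ → (ℓ ≢ 0ℤ) × Intertwiner (A Σ₁) (A Σ₂) ℓ
  controllable-intertwiner ctrl = det w₂ , d≢0 , Intertwine.intertwiner (A Σ₁) (A Σ₂) w₁ w₂ d≢0 walk-gram walk-gram-A zero (λ _ → refl) (λ _ → refl)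
    where
    d≢0 : det w₂ ≢ 0ℤ
    d≢0 e = ctrl (trans (sym det-detℤ) (trans (det-cong n (W≈walkMat Σ₁)) (square-zero (det-square w₁ w₂ walk-gram) e)))

  almost-intertwiner : AlmostControllable Σ₁ → Σ ℤ λ ℓ → (ℓ ≢ 0ℤ) × Intertwiner (A Σ₁) (A Σ₂) ℓ
  almost-intertwiner (detW≡0 , i , j , minor≢0) = det X₂ , d≢0 , I.intertwiner gram-A zero (first Σ₁ 0≢last) (first Σ₂ 0≢last)
    where
    module K₁ = Krylov Σ₁
    module K₂ = Krylov Σ₂
    X₁ = K₁.completed
    X₂ = K₂.completed
    s₁ : det w₁ ≡ 0ℤ
    s₁ = trans (det-cong n (λ a b → sym (W≈walkMat Σ₁ a b))) (trans det-detℤ detW≡0)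
    s₂ : det w₂ ≡ 0ℤ
    s₂ = square-zero (sym (det-square w₁ w₂ walk-gram)) s₁
    -- The squared length of `normal` is a diagonal entry of adj(wᵀw), so it depends only on the
    -- Gram matrix of the walk vectors.
    norms : K₁.normal ∙ K₁.normal ≡ K₂.normal ∙ K₂.normal
    norms = trans (adjugate-gram w₁ last) (trans (β-cong {w = δ last} {u = δ last} walk-gram (λ _ → refl) (λ _ → refl)) (sym (adjugate-gram w₂ last)))
    normal₁≢0 : ¬ K₁.normal ≗ 0ᵛ
    normal₁≢0 = K₁.normal≢0 s₁ i j (λ e → minor≢0 (trans (sym det-detℤ) (trans (det-cong n' (λ r c → W≈walkMat Σ₁ (punchIn i r) (punchIn j c))) e)))
    d≢0 : det X₂ ≢ 0ℤ
    d≢0 e = normal₁≢0 (norm≡0 K₁.normal (ℤₚ.+-injective (trans (sym (∙-norm K₁.normal)) (trans norms (trans (sym K₂.det-completed) e)))))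
    0≢last : zero ≢ last
    0≢last = singular⇒zero≢last n' Σ₁ s₁
    first : ∀ (Σ' : SignedGraph n) → zero ≢ last → ∀ i → Krylov.completed Σ' i zero ≡ 1ℤ
    first Σ' p i = Krylov.completed-other Σ' zero p i
    gram : ∀ k l → col X₁ k ∙ col X₁ l ≡ col X₂ k ∙ col X₂ l
    gram k l = cases (k ≟ last) (l ≟ last)
      where
      cases : Dec (k ≡ last) → Dec (l ≡ last) → col X₁ k ∙ col X₁ l ≡ col X₂ k ∙ col X₂ l
      cases (yes refl) (yes refl) = trans (∙-cong K₁.completed-last K₁.completed-last) (trans norms (sym (∙-cong K₂.completed-last K₂.completed-last)))
      cases (yes refl) (no p) = trans (side Σ₁ s₁) (sym (side Σ₂ s₂))
        where
        side : ∀ (Σ' : SignedGraph n) → det (walkMat Σ') ≡ 0ℤ → col (Krylov.completed Σ') last ∙ col (Krylov.completed Σ') l ≡ 0ℤ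
        side Σ' s = trans (∙-cong (Krylov.completed-last Σ') (Krylov.completed-other Σ' l p)) (Krylov.normal-⊥ Σ' s l)
      cases (no p) (yes refl) = trans (side Σ₁ s₁) (sym (side Σ₂ s₂))
        where
        side : ∀ (Σ' : SignedGraph n) → det (walkMat Σ') ≡ 0ℤ → col (Krylov.completed Σ') k ∙ col (Krylov.completed Σ') last ≡ 0ℤ
        side Σ' s = trans (∙-cong (Krylov.completed-other Σ' k p) (Krylov.completed-last Σ')) (trans (∙-comm (col (walkMat Σ') k) (Krylov.normal Σ')) (Krylov.normal-⊥ Σ' s k))
      cases (no p) (no p') = trans (∙-cong (K₁.completed-other k p) (K₁.completed-other l p')) (trans (walk-gram k l) (sym (∙-cong (K₂.completed-other k p) (K₂.completed-other l p'))))
    module I = Intertwine (A Σ₁) (A Σ₂) X₁ X₂ d≢0 gram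
    gram-A : ∀ k l → col X₁ k ∙ (A Σ₁ ▹ col X₁ l) ≡ col X₂ k ∙ (A Σ₂ ▹ col X₂ l)
    gram-A = I.missing-entry (diagonal-A Σ₁) (diagonal-A Σ₂) last known
      where
      known : ∀ k l → ¬ (k ≡ last × l ≡ last) → col X₁ k ∙ (A Σ₁ ▹ col X₁ l) ≡ col X₂ k ∙ (A Σ₂ ▹ col X₂ l)
      known k l h = cases (k ≟ last) (l ≟ last)
        where
        cases : Dec (k ≡ last) → Dec (l ≡ last) → col X₁ k ∙ (A Σ₁ ▹ col X₁ l) ≡ col X₂ k ∙ (A Σ₂ ▹ col X₂ l)
        cases (yes p) (yes q) = contradiction (p , q) h
        cases (yes refl) (no p) = trans (side Σ₁ s₁) (sym (side Σ₂ s₂))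
          where
          side : ∀ (Σ' : SignedGraph n) → det (walkMat Σ') ≡ 0ℤ → col (Krylov.completed Σ') last ∙ (A Σ' ▹ col (Krylov.completed Σ') l) ≡ 0ℤ
          side Σ' s = trans (∙-cong (Krylov.completed-last Σ') (▹-cong (A Σ') (Krylov.completed-other Σ' l p))) (Krylov.normal-⊥-A Σ' s l p)
        cases (no p) (yes refl) = trans (side Σ₁ s₁) (sym (side Σ₂ s₂))
          where
          side : ∀ (Σ' : SignedGraph n) → det (walkMat Σ') ≡ 0ℤ → col (Krylov.completed Σ') k ∙ (A Σ' ▹ col (Krylov.completed Σ') last) ≡ 0ℤ
          side Σ' s = trans (∙-cong (Krylov.completed-other Σ' k p) (▹-cong (A Σ') (Krylov.completed-last Σ'))) (trans (sym (selfAdjoint (A-sym Σ') (col (walkMat Σ') k) (Krylov.normal Σ')))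
            (trans (∙-comm (A Σ' ▹ col (walkMat Σ') k) (Krylov.normal Σ')) (Krylov.normal-⊥-A Σ' s k p)))
        cases (no p) (no p') = trans (∙-cong (K₁.completed-other k p) (▹-cong (A Σ₁) (K₁.completed-other l p')))
          (trans (walk-gram-A k l) (sym (∙-cong (K₂.completed-other k p) (▹-cong (A Σ₂) (K₂.completed-other l p')))))

-- Descent on the level

rescale : ∀ {n} {A₁ A₂ : Mat n} c ℓ → c ≢ 0ℤ → (I : Intertwiner A₁ A₂ (c * ℓ)) (Q' : Mat n) → (∀ i j → Intertwiner.Q I i j ≡ c * Q' i j) → Intertwiner A₁ A₂ ℓ
rescale {n} {A₁} {A₂} c ℓ c≢0 I Q' h = record
  { Q = Q'
  ; isometry = λ x y → cancel (trans (sym (trans (∙-cong (Q▹ x) (Q▹ y)) (forms (Q' ▹ x) (Q' ▹ y)))) (trans (I.isometry x y) (g c ℓ (x ∙ y))))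
  ; conjugates = λ x y → cancel (trans (sym (trans (∙-cong (Q▹ x) (λ i → trans (▹-cong A₁ (Q▹ y) i) (▹-scale A₁ c (Q' ▹ y) i))) (forms (Q' ▹ x) (A₁ ▹ (Q' ▹ y))))) (trans (I.conjugates x y) (g c ℓ (x ∙ (A₂ ▹ y)))))
  ; fixes-𝟙 = λ i → cancel₁ (trans (sym (Q▹ 𝟙 i)) (I.fixes-𝟙 i)) }
  where
  module I = Intertwiner I
  Q▹ : ∀ x → I.Q ▹ x ≗ (λ i → c * (Q' ▹ x) i)
  Q▹ x i = trans (∑-cong (λ j → trans (cong (_* x j) (h i j)) (ℤₚ.*-assoc c (Q' i j) (x j)))) (∑-*ˡ c (λ j → Q' i j * x j))
  g : ∀ c l x → (c * l) * (c * l) * x ≡ c * (c * (l * l * x))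
  g = solve-∀
  forms : ∀ u v → (λ i → c * u i) ∙ (λ i → c * v i) ≡ c * (c * (u ∙ v))
  forms u v = trans (∙-scaleʳ (λ i → c * u i) c v) (cong (c *_) (trans (∙-comm (λ i → c * u i) v) (trans (∙-scaleʳ v c u) (cong (c *_) (∙-comm v u)))))
  cancel₁ : ∀ {x y} → c * x ≡ c * y → x ≡ y
  cancel₁ {x} {y} e = ℤₚ.i-j≡0⇒i≡j x y (*-zero-cases c c≢0 (trans (f c x y) (ℤₚ.i≡j⇒i-j≡0 {c * x} {c * y} e)))
    where
    f : ∀ c x y → c * (x - y) ≡ c * x - c * y
    f = solve-∀
  cancel : ∀ {x y} → c * (c * x) ≡ c * (c * y) → x ≡ y
  cancel e = cancel₁ (cancel₁ e)

positive-level : ∀ {n} {A₁ A₂ : Mat n} ℓ → ℓ ≢ 0ℤ → Intertwiner A₁ A₂ ℓ → Σ ℕ λ k → Intertwiner A₁ A₂ (int (suc k))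
positive-level (int zero)    h I = contradiction refl h
positive-level (int (suc k)) h I = k , I
positive-level -[1+ k ]      h I = k , rescale -1ℤ (int (suc k)) (λ ()) (subst (Intertwiner _ _) (sym (ℤₚ.-1*i≡-i (int (suc k)))) I) (λ i j → - Intertwiner.Q I i j)
  (λ i j → trans (at (ℤₚ.-1*i≡-i (int (suc k))) i j) (f (Intertwiner.Q I i j)))
  where
  f : ∀ x → x ≡ - 1ℤ * - x
  f = solve-∀
  at : ∀ {ℓ} (e : ℓ ≡ -[1+ k ]) i j → Intertwiner.Q (subst (Intertwiner _ _) (sym e) I) i j ≡ Intertwiner.Q I i j
  at refl i j = refl

module Level {n : ℕ} {A₁ A₂ : Mat n} {ℓ : ℤ} (ℓ≢0 : ℓ ≢ 0ℤ) (I : Intertwiner A₁ A₂ ℓ) where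
  open Intertwiner I
  module O = Orthogonal Q ℓ ℓ≢0 isometry

  -- Both sides have the same products with every column of Q, by `conjugates` and `isometry`, and
  -- the transpose of Q is nonsingular.
  intertwines : ∀ y → A₁ ▹ (Q ▹ y) ≗ Q ▹ (A₂ ▹ y)
  intertwines y i = ℤₚ.i-j≡0⇒i≡j (u i) (v i) (trans (f (u i) (v i)) (nonsingular⇒injective (Q ᵗ) O.det≢0 (λ i → 1ℤ * u i + -1ℤ * v i) kernel i))
    where
    u v : Vect n
    u = A₁ ▹ (Q ▹ y)
    v = Q ▹ (A₂ ▹ y)
    f : ∀ a b → a - b ≡ 1ℤ * a + - 1ℤ * b
    f = solve-∀
    pair : ∀ k z → ((Q ᵗ) ▹ z) k ≡ (Q ▹ δ k) ∙ z
    pair k z = trans (sym (∑-δˡ k ((Q ᵗ) ▹ z))) (sym (adjoint Q (δ k) z))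
    kernel : (Q ᵗ) ▹ (λ i → 1ℤ * u i + -1ℤ * v i) ≗ 0ᵛ
    kernel k = trans (Linear.l-comb (▹-linear (Q ᵗ)) 1ℤ -1ℤ u v k)
      (trans (cong₂ (λ a b → 1ℤ * a + -1ℤ * b) (trans (pair k u) (conjugates (δ k) y)) (trans (pair k v) (isometry (δ k) (A₂ ▹ y)))) (g (ℓ * ℓ * (δ k ∙ (A₂ ▹ y)))))
      where
      g : ∀ x → 1ℤ * x + - 1ℤ * x ≡ 0ℤ
      g = solve-∀

  intertwines-pw : ∀ k y → pw k A₁ (Q ▹ y) ≗ Q ▹ pw k A₂ y
  intertwines-pw zero    y i = refl
  intertwines-pw (suc k) y i = trans (▹-cong A₁ (intertwines-pw k y) i) (intertwines (pw k A₂ y) i)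

  -- The moments of Qx under A₁ are ℓ² times those of x under A₂. This is how the level produces
  -- isotropy modulo q².
  isotropic-image : ∀ {q} → ℓ ≡ 0ℤ [mod q ] → ∀ x → Isotropic (q * q) A₁ (Q ▹ x)
  isotropic-image {q} (wit t e) x k = wit (t * t * (x ∙ pw k A₂ x)) (trans (∙-cong {u = Q ▹ x} (λ _ → refl) (intertwines-pw k x)) (trans (isometry x (pw k A₂ x))
    (trans (cong (λ l → l * l * (x ∙ pw k A₂ x)) e) (g t q (x ∙ pw k A₂ x)))))
    where
    g : ∀ t q d → (0ℤ + t * q) * (0ℤ + t * q) * d ≡ 0ℤ + t * t * d * (q * q)
    g = solve-∀

  divide : ∀ {q} → Prime q → ∀ t → ℓ ≡ int q * t → (∀ u → Isotropic (int q * int q) A₁ u → ∀ i → u i ≡ 0ℤ [mod int q ]) → Intertwiner A₁ A₂ t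
  divide {q} pr t e vanish = rescale (int q) t (prime≢0 pr) (subst (Intertwiner A₁ A₂) e I) Q' (λ i j → trans (at e i j) (trans (_≡_[mod_].rel (divisible i j)) (g (Q' i j) (int q))))
    where
    divisible : ∀ i j → Q i j ≡ 0ℤ [mod int q ]
    divisible i j = mod-cong₂ (sym (▹-δ Q j i)) refl (vanish (Q ▹ δ j) (isotropic-image (wit t (trans e (h (int q) t))) (δ j)) i)
      where
      h : ∀ q t → q * t ≡ 0ℤ + t * q
      h = solve-∀
    Q' : Mat n
    Q' i j = _≡_[mod_].quot (divisible i j)
    g : ∀ x q → 0ℤ + x * q ≡ q * x
    g = solve-∀
    at : ∀ {ℓ'} (e : ℓ ≡ ℓ') i j → Intertwiner.Q (subst (Intertwiner A₁ A₂) e I) i j ≡ Q i j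
    at refl i j = refl

prime-factor : ∀ k → Σ ℕ λ q → Σ ℕ λ t → Prime q × (suc (suc k) ≡ q ℕ.* t)
prime-factor k = extract (PrimeFactorisation.factors F) (PrimeFactorisation.isFactorisation F) (PrimeFactorisation.factorsPrime F)
  where
  F = factorise (suc (suc k))
  extract : ∀ ps → suc (suc k) ≡ productℕ ps → All Prime ps → Σ ℕ λ q → Σ ℕ λ t → Prime q × (suc (suc k) ≡ q ℕ.* t)
  extract []       () _
  extract (q ∷ ps) e (pr ∷ _) = q , productℕ ps , pr , e

level-one : ∀ {n} {A₁ A₂ : Mat n} → (∀ {q} → Prime q → ∀ u → Isotropic (int q * int q) A₁ u → ∀ i → u i ≡ 0ℤ [mod int q ]) →
            ∀ N k → k ℕ.< N → Intertwiner A₁ A₂ (int (suc k)) → Intertwiner A₁ A₂ 1ℤ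
level-one vanish (suc N) zero    _ I = I
level-one {A₁ = A₁} {A₂} vanish (suc N) (suc k) (s≤s k<N) I = step (prime-factor k)
  where
  step : (Σ ℕ λ q → Σ ℕ λ t → Prime q × (suc (suc k) ≡ q ℕ.* t)) → Intertwiner A₁ A₂ 1ℤ
  step (q , zero , pr , e) = contradiction (trans e (ℕₚ.*-zeroʳ q)) λ ()
  step (q , suc t , pr , e) = level-one vanish N t (ℕₚ.≤-trans (ℕₚ.≤-pred smaller) k<N)
    (Level.divide (λ ()) I pr (int (suc t)) (trans (cong int e) (ℤₚ.pos-* q (suc t))) (vanish pr))
    where
    smaller : suc t ℕ.< suc (suc k)
    smaller = subst (suc t ℕ.<_) (trans (ℕₚ.*-comm (suc t) q) (sym e)) (ℕₚ.m<m*n (suc t) q (ℕ.nonTrivial⇒n>1 q {{prime⇒nonTrivial pr}}))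

-- Intertwiners of level one are permutation matrices

OneEntry : ∀ {n} → Vect n → Set
OneEntry {n} v = Σ (Fin n) λ i → (v i ≢ 0ℤ) × (∀ k → k ≢ i → v k ≡ 0ℤ)

unit-vector : ∀ {n} (v : Vect n) → norm v ≡ 1 → OneEntry v
unit-vector {n} v e = search (Finₚ.all? (λ i → v i ℤ.≟ 0ℤ))
  where
  norm-0 : ∀ {n} (v : Vect n) → v ≗ 0ᵛ → norm v ≡ 0
  norm-0 {zero}  v h = refl
  norm-0 {suc n} v h = cong₂ ℕ._+_ (cong ∣_∣² (h zero)) (norm-0 (v ∘ suc) (h ∘ suc))
  search : Dec (∀ i → v i ≡ 0ℤ) → OneEntry v
  search (yes h) = contradiction (trans (sym e) (norm-0 v h)) λ ()
  search (no ¬h) = let i , v≢0 = Finₚ.¬∀⟶∃¬ n _ (λ i → v i ℤ.≟ 0ℤ) ¬h in i , v≢0 , λ k k≢i → others i v≢0 k k≢i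
    where
    others : ∀ i → v i ≢ 0ℤ → ∀ k → k ≢ i → v k ≡ 0ℤ
    others i v≢0 k k≢i = ∣∣²≡0 (v k) (ℕₚ.n≤0⇒n≡0 (ℕₚ.+-cancelˡ-≤ 1 _ 0 (ℕₚ.≤-trans (ℕₚ.+-monoˡ-≤ ∣ v k ∣² positive) (ℕₚ.≤-trans (two≤∑ℕ (λ l → ∣ v l ∣²) i k (λ q → k≢i (sym q))) (ℕₚ.≤-reflexive e)))))
      where
      positive : 1 ℕ.≤ ∣ v i ∣²
      positive = ℕₚ.≤-trans (ℕₚ.n≢0⇒n>0 (λ z → v≢0 (ℤₚ.∣i∣≡0⇒i≡0 z))) (∣∣≤∣∣² (v i))

adjℤ-injective : ∀ a b → adjℤ a ≡ adjℤ b → a ≡ b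
adjℤ-injective none none _ = refl
adjℤ-injective pos  pos  _ = refl
adjℤ-injective neg  neg  _ = refl
adjℤ-injective none pos ()
adjℤ-injective none neg ()
adjℤ-injective pos none ()
adjℤ-injective pos neg ()
adjℤ-injective neg none ()
adjℤ-injective neg pos ()

module PermutationMatrix {n : ℕ} (Q : Mat n) (row : ∀ i → OneEntry (Q i)) (column : ∀ j → OneEntry (col Q j)) (fixes : ∀ i → (Q ▹ 𝟙) i ≡ 1ℤ) where
  π σ : Fin n → Fin n
  π i = proj₁ (row i)
  σ j = proj₁ (column j)

  off-row : ∀ i k → k ≢ π i → Q i k ≡ 0ℤ
  off-row i = proj₂ (proj₂ (row i))

  -- Norm one leaves the sign open; the row sum, fixed by the all-ones vector, makes it positive.
  -- Otherwise one would only obtain a signed permutation.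
  on-row : ∀ i → Q i (π i) ≡ 1ℤ
  on-row i = trans (sym (∑-single (π i) (Q i) (off-row i))) (trans (∑-cong (λ k → sym (ℤₚ.*-identityʳ (Q i k)))) (fixes i))

  σπ : ∀ i → σ (π i) ≡ i
  σπ i with σ (π i) ≟ i
  ... | yes e = e
  ... | no ne = contradiction (proj₂ (proj₂ (column (π i))) i (λ e → ne (sym e))) (proj₁ (proj₂ (row i)))

  πσ : ∀ j → π (σ j) ≡ j
  πσ j with π (σ j) ≟ j
  ... | yes e = e
  ... | no ne = contradiction (off-row (σ j) j (λ e → ne (sym e))) (proj₁ (proj₂ (column j)))

  entry : ∀ i k → Q i k ≡ δ (π i) k
  entry i k with k ≟ π i
  ... | yes refl = trans (on-row i) (sym (δ-refl (π i)))
  ... | no ne    = trans (off-row i k ne) (sym (δ-≢ (λ e → ne (sym e))))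

  image : ∀ j → Q ▹ δ (π j) ≗ δ j
  image j i = trans (▹-δ Q (π j) i) (trans (entry i (π j)) (same (i ≟ j)))
    where
    same : Dec (i ≡ j) → δ (π i) (π j) ≡ δ j i
    same (yes refl) = trans (δ-refl (π i)) (sym (δ-refl i))
    same (no ne)    = trans (δ-≢ (λ e → ne (trans (sym (σπ i)) (trans (cong σ e) (σπ j))))) (sym (δ-≢ (λ e → ne (sym e))))

module Permutation {n : ℕ} (Σ₁ Σ₂ : SignedGraph n) (I : Intertwiner (A Σ₁) (A Σ₂) 1ℤ) where
  open Intertwiner I
  private
    module L = Level {ℓ = 1ℤ} (λ ()) I

    row-norm : ∀ i → norm (Q i) ≡ 1
    row-norm i = ℤₚ.+-injective (trans (sym (∙-norm (Q i))) (trans (L.O.rows i i) (cong (1ℤ * 1ℤ *_) (δ-refl i))))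

    column-norm : ∀ j → norm (col Q j) ≡ 1
    column-norm j = ℤₚ.+-injective (trans (sym (∙-norm (col Q j))) (trans (∙-cong (λ i → sym (▹-δ Q j i)) (λ i → sym (▹-δ Q j i)))
      (trans (isometry (δ j) (δ j)) (cong (1ℤ * 1ℤ *_) (trans (∑-δˡ j (δ j)) (δ-refl j))))))

  open PermutationMatrix Q (λ i → unit-vector (Q i) (row-norm i)) (λ j → unit-vector (col Q j) (column-norm j)) fixes-𝟙

  A-image : ∀ i j → A Σ₂ (π i) (π j) ≡ A Σ₁ i j
  A-image i j = begin
    A Σ₂ (π i) (π j) ≡⟨ sym (▹-δ (A Σ₂) (π j) (π i)) ⟩
    (A Σ₂ ▹ δ (π j)) (π i) ≡⟨ sym (∑-δˡ (π i) (A Σ₂ ▹ δ (π j))) ⟩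
    δ (π i) ∙ (A Σ₂ ▹ δ (π j)) ≡⟨ ∑-cong (λ k → cong (_* (A Σ₂ ▹ δ (π j)) k) (sym (entry i k))) ⟩
    (Q ▹ (A Σ₂ ▹ δ (π j))) i ≡⟨ sym (L.intertwines (δ (π j)) i) ⟩
    (A Σ₁ ▹ (Q ▹ δ (π j))) i ≡⟨ ▹-cong (A Σ₁) (image j) i ⟩
    (A Σ₁ ▹ δ j) i ≡⟨ ▹-δ (A Σ₁) j i ⟩
    A Σ₁ i j ∎
    where open ≡-Reasoning

  isomorphic : Isomorphic Σ₁ Σ₂
  isomorphic = mk↔ₛ′ π σ πσ σπ , λ i j → adjℤ-injective (adj Σ₂ (π i) (π j)) (adj Σ₁ i j) (A-image i j)

theorem2 : (n : ℕ) (Σ' : SignedGraph n) → Bipartite Σ' →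
    (Controllable Σ' ⊎ AlmostControllable Σ') →
    IsUnit (lowCoeff Σ') →
    ScaledSqrtDiscSquarefree Σ' →
    DGS Σ'
theorem2 zero    Σ' bipartite ctrl unit disc Σ₂ cospectral = mk↔ₛ′ id id (λ _ → refl) (λ _ → refl) , λ ()
theorem2 (suc n) Σ' bipartite ctrl unit disc Σ₂ cospectral = Permutation.isomorphic Σ' Σ₂ (finish (intertwiner ctrl))
  where
  intertwiner : Controllable Σ' ⊎ AlmostControllable Σ' → Σ ℤ λ ℓ → (ℓ ≢ 0ℤ) × Intertwiner (A Σ') (A Σ₂) ℓ
  intertwiner (inj₁ c) = controllable-intertwiner Σ' Σ₂ cospectral c
  intertwiner (inj₂ a) = almost-intertwiner Σ' Σ₂ cospectral a
  finish : (Σ ℤ λ ℓ → (ℓ ≢ 0ℤ) × Intertwiner (A Σ') (A Σ₂) ℓ) → Intertwiner (A Σ') (A Σ₂) 1ℤ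
  finish (ℓ , ℓ≢0 , I) = let k , J = positive-level ℓ ℓ≢0 I in level-one (isotropic-vanishes Σ' bipartite unit disc) (suc k) k ℕₚ.≤-refl J
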